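{- $\rho(3,6)=\frac{1}{2}\left(1-\frac{1}{r(3,3)}\right)=\frac{1}{2}\left(1-\frac16\right)=\frac{5}{12}$; equivalently, $RT(n,3,6,o(n))=\frac{5}{12}n^2+o(n^2)$. Moreover, the weak stability property holds for $RT(n,3,6,o(n))$: if $\{S_n\}$ and $\{Z_n\}$ are any two asymptotically extremal sequences for $RT(n,3,6,o(n))$, then $\Delta(S_n,Z_n)=o(n^2)$.
   Context: For integers $p,q\ge 2$, a graph $G$ is $(K_p,K_q)$-free if there is a red/blue coloring of its edges with no red $K_p$ and no blue $K_q$. For integers $n,m$, $RT(n,p,q,m)$ is the maximum number of edges of an $n$-vertex $(K_p,K_q)$-free graph $G$ with independence number $\alpha(G)<m$. For $0<\delta<1$ let $\rho(p,q,\delta)=\lim_{n\to\infty}RT(n,p,q,\delta n)/n^2$, and $\rho(p,q)=\lim_{\delta\to0}\rho(p,q,\delta)$ (the Ramsey–Turán density). $r(3,3)=6$ is the classical Ramsey number. A sequence of graphs $\{G_n\}$ ($G_n$ on $n$ vertices) is asymptotically extremal for $RT(n,3,6,o(n))$ if each $G_n$ is $(K_3,K_6)$-free, $\alpha(G_n)=o(n)$, and $e(G_n)=RT(n,3,6,o(n))+o(n^2)$ (i.e. $e(G_n)=\rho(3,6)n^2+o(n^2)$). For two graphs $S,Z$ on the same number of vertices, $\Delta(S,Z)$ is the minimum number of edges one has to delete from and add to $S$ to obtain a graph isomorphic to $Z$. -}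

module Defs where

open import Data.Nat using (ℕ; zero; suc; _+_; _*_; _≤_; _<_; _≥_; _<ᵇ_)
open import Data.Bool using (Bool; true; false; _∧_; if_then_else_; _xor_)
open import Data.Fin using (Fin; toℕ)
open import Data.List using (List; map; allFin)
open import Data.Nat.ListAction using (sum)
open import Data.Product using (Σ; _×_; ∃; ∃-syntax)
open import Data.Fin.Permutation using (Permutation′; _⟨$⟩ʳ_)
open import Function.Definitions using (Injective)
open import Relation.Binary.PropositionalEquality using (_≡_; _≢_)
open import Relation.Nullary using (¬_)

record Graph (n : ℕ) : Set where
  field
    adj    : Fin n → Fin n → Bool
    sym    : ∀ i j → adj i j ≡ adj j i
    irrefl : ∀ i → adj i i ≡ false
open Graph public

countPairs : {n : ℕ} → (Fin n → Fin n → Bool) → ℕ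
countPairs {n} P =
  sum (map (λ i → sum (map (λ j → if (toℕ i <ᵇ toℕ j) ∧ P i j then 1 else 0) (allFin n))) (allFin n))

edges : {n : ℕ} → Graph n → ℕ
edges G = countPairs (adj G)

-- red/blue colouring of the edges (true = red, false = blue), symmetric
record Colouring {n : ℕ} (G : Graph n) : Set where
  field
    col    : Fin n → Fin n → Bool
    colSym : ∀ i j → col i j ≡ col j i
open Colouring public

MonoClique : {n : ℕ} (G : Graph n) → Colouring G → Bool → ℕ → Set
MonoClique {n} G χ c p =
  Σ (Fin p → Fin n) λ f → Injective _≡_ _≡_ f ×
    (∀ a b → a ≢ b → (adj G (f a) (f b) ≡ true) × (col χ (f a) (f b) ≡ c))

KFree : {n : ℕ} → ℕ → ℕ → Graph n → Set
KFree p q G = Σ (Colouring G) λ χ → ¬ MonoClique G χ true p × ¬ MonoClique G χ false q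

IndepSet : {n : ℕ} → Graph n → ℕ → Set
IndepSet {n} G s =
  Σ (Fin s → Fin n) λ f → Injective _≡_ _≡_ f × (∀ a b → a ≢ b → adj G (f a) (f b) ≡ false)

-- α(G) < δ n with δ = 1/(d+1), i.e. every independent set of size s has s(d+1) < n
AlphaSmall : {n : ℕ} → Graph n → ℕ → Set
AlphaSmall {n} G d = ∀ s → IndepSet G s → s * suc d < n

editCount : {n : ℕ} → Graph n → Graph n → Permutation′ n → ℕ
editCount S Z σ = countPairs (λ i j → adj S i j xor adj Z (σ ⟨$⟩ʳ i) (σ ⟨$⟩ʳ j))

-- Δ(S,Z) ≤ n²/(k+1) : some vertex bijection σ realises at most n²/(k+1) edits
DeltaSmall : {n : ℕ} → Graph n → Graph n → ℕ → Set
DeltaSmall {n} S Z k = ∃[ σ ] editCount S Z σ * suc k ≤ n * n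

GraphSeq : Set
GraphSeq = (n : ℕ) → Graph n

-- asymptotically extremal for RT(n,3,6,o(n)) (with ρ(3,6)n² = 5/12 n²):
--  each G_n is (K3,K6)-free, α(G_n) = o(n), e(G_n) = 5/12 n² + o(n²).
-- ε is written 1/(k+1), δ is written 1/(d+1).
AsympExtremal : GraphSeq → Set
AsympExtremal G =
  (∀ n → KFree 3 6 (G n)) ×
  (∀ d → ∃[ N ] ∀ n → n ≥ N → AlphaSmall (G n) d) ×
  (∀ k → ∃[ N ] ∀ n → n ≥ N →
     (12 * suc k * edges (G n) ≤ (5 * suc k + 12) * (n * n)) ×
     (5 * suc k * (n * n) ≤ 12 * suc k * edges (G n) + 12 * (n * n)))

{-# OPTIONS --safe #-}
module Submission where

-- Upper bound and stability avoid the regularity lemma.  Say that two clusters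
-- (linear sized sets of vertices) are joined in a colour if all their large
-- subsets span a positive density of edges of that colour.  Such pairs are found
-- by deleting sparse blocks, and clusters can be embedded like vertices; if the
-- vertices of a cluster span blue edges everywhere, two vertices are taken from it,
-- provided the blue densities to the other such clusters exceed 1/2.  In a graph
-- of minimum degree about 5n/6, any configuration of clusters with weights can be
-- extended by a cluster that sees it with weighted density 5/6.  A finite search
-- shows that this always leads to five clusters forming a red and a blue 5-cycle
-- together with an apex cluster spanning red edges.  Every vertex then misses
-- almost all of one of these six clusters, which yields the bound on the degree
-- and, if it is attained, the six almost independent classes.
--
-- For the lower bound, six copies of a triangle-free graph of small independence
-- ratio (a weighted Mycielski construction) are joined completely.

-- Why the search is finite and exact: the density of a vertex to a cluster is rounded to one of
-- four labels, so a weighted density becomes an integer score over a fixed denominator. Rounding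
-- costs an error of order 1/p per unit of weight. Total weights are at most 100 and 38 * 100 ≤ p,
-- so the error stays below the gap between integers, and the sharp test against 5/6 applies
-- although degrees are only nearly 5/6. The label `half` between two clusters of blue kind stands
-- for density at most about 1/2 and counts half; every other nonzero label may stand for density up
-- to 1.
--
-- Why this target: the heaviest cliques available in the pentagon with apex have red weight 2 and
-- blue weight 5, one below the forbidden 3 and 6. A vertex joined to all six clusters would
-- complete one of them.
--
-- The parameters run in opposite directions. The depth `g` to which densities are inherited is
-- prescribed at the end of the search and computed backwards; the share 1/s of the clusters is
-- computed forwards. Only then is the scale `M` chosen, which the small independence number makes
-- possible.

module FiniteSets where
  open import Data.Bool using (Bool; true; false; _∧_; _∨_; not; T)
  open import Data.Empty using (⊥; ⊥-elim)
  open import Data.Fin using (Fin; zero; suc) renaming (_≟_ to _≟ᶠ_)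
  open import Data.Nat
  open import Data.Nat.Properties
  open import Data.Nat.Tactic.RingSolver using (solve-∀)
  open import Data.Product using (_,_; ∃-syntax)
  open import Data.Sum using (_⊎_; inj₁; inj₂)
  open import Function using (_∘_)
  open import Relation.Binary.PropositionalEquality
  open import Relation.Nullary using (Dec; yes; contradiction; does)
  open import Algebra.Properties.CommutativeMonoid.Sum +-0-commutativeMonoid using (sum; ∑-distrib-+; sum-cong-≗)
  open import Algebra.Properties.Semiring.Sum +-*-semiring using (*-distribˡ-sum)

  -- Boolean subsets of `Fin n`, their cardinalities, and sums over them.

  Subset : ℕ → Set
  Subset n = Fin n → Bool

  infix 4 _∈_ _⊑_
  _∈_ : ∀ {n} → Fin n → Subset n → Set
  i ∈ X = X i ≡ true

  _⊑_ : ∀ {n} → Subset n → Subset n → Set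
  X ⊑ Y = ∀ i → i ∈ X → i ∈ Y

  dec-sound : ∀ {P : Set} (d : Dec P) → does d ≡ true → P
  dec-sound (yes p) _ = p

  does-sound : ∀ {k} {i j : Fin k} → does (i ≟ᶠ j) ≡ true → i ≡ j
  does-sound {i = i} {j} = dec-sound (i ≟ᶠ j)

  ⊑-refl : ∀ {n} {X : Subset n} → X ⊑ X
  ⊑-refl i p = p

  ⊑-trans : ∀ {n} {X Y Z : Subset n} → X ⊑ Y → Y ⊑ Z → X ⊑ Z
  ⊑-trans f g i p = g i (f i p)

  infixr 7 _∩_
  infixr 6 _∪_
  _∩_ _∪_ _∖_ : ∀ {n} → Subset n → Subset n → Subset n
  (X ∩ Y) i = X i ∧ Y i
  (X ∪ Y) i = X i ∨ Y i
  (X ∖ Y) i = X i ∧ not (Y i)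

  ⟦_⟧ : Bool → ℕ
  ⟦ true ⟧ = 1
  ⟦ false ⟧ = 0

  card : ∀ {n} → Subset n → ℕ
  card X = sum λ i → ⟦ X i ⟧

  ∧-intro : ∀ {a b} → a ≡ true → b ≡ true → a ∧ b ≡ true
  ∧-intro refl refl = refl

  ∧-fst : ∀ {a b} → a ∧ b ≡ true → a ≡ true
  ∧-fst {true} p = refl

  ∧-snd : ∀ {a b} → a ∧ b ≡ true → b ≡ true
  ∧-snd {true} p = p

  ∩-⊑ˡ : ∀ {n} (X Y : Subset n) → (X ∩ Y) ⊑ X
  ∩-⊑ˡ X Y i = ∧-fst

  ∩-⊑ʳ : ∀ {n} (X Y : Subset n) → (X ∩ Y) ⊑ Y
  ∩-⊑ʳ X Y i = ∧-snd {X i}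

  ∖-⊑ : ∀ {n} (X Y : Subset n) → (X ∖ Y) ⊑ X
  ∖-⊑ X Y i = ∧-fst

  not-true : ∀ {a} → not a ≡ true → a ≡ false
  not-true {false} p = refl

  not-false : ∀ {a} → a ≡ false → not a ≡ true
  not-false refl = refl

  true≢false : ∀ {a : Bool} → a ≡ true → a ≡ false → ⊥
  true≢false refl ()

  bool-cases : ∀ (a : Bool) → (a ≡ true) ⊎ (a ≡ false)
  bool-cases true = inj₁ refl
  bool-cases false = inj₂ refl

  ∪-elim : ∀ a {b} → a ∨ b ≡ true → (a ≡ true) ⊎ (b ≡ true)
  ∪-elim true p = inj₁ refl
  ∪-elim false p = inj₂ p

  ∪-left : ∀ {a b} → a ≡ true → a ∨ b ≡ true
  ∪-left refl = refl

  ∪-right : ∀ {a b} → b ≡ true → a ∨ b ≡ true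
  ∪-right {true} p = refl
  ∪-right {false} p = p

  ≤ᵇ-true : ∀ {a b} → (a ≤ᵇ b) ≡ true → a ≤ b
  ≤ᵇ-true {a} {b} p = ≤ᵇ⇒≤ a b (subst T (sym p) _)

  ≤ᵇ-false : ∀ {a b} → (a ≤ᵇ b) ≡ false → b < a
  ≤ᵇ-false {a} {b} p = ≰⇒> λ q → subst T p (≤⇒≤ᵇ q)

  ≤ᵇ-intro : ∀ {a b} → a ≤ b → (a ≤ᵇ b) ≡ true
  ≤ᵇ-intro {a} {b} p with a ≤ᵇ b in eq
  ... | true = refl
  ... | false = contradiction p (<⇒≱ (≤ᵇ-false eq))

  -- A linear inequality follows from another one L ≤ R by a polynomial identity.
  by-identity : ∀ {a b L R} → L ≤ R → ∀ c → a + R + c ≡ b + L → a ≤ b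
  by-identity {a} {b} {L} {R} h c eq = +-cancelʳ-≤ L a b (begin
    a + L     ≤⟨ +-monoʳ-≤ a h ⟩
    a + R     ≤⟨ m≤m+n (a + R) c ⟩
    a + R + c ≡⟨ eq ⟩
    b + L ∎)
    where open ≤-Reasoning

  positive : ∀ {a b} c → 1 ≤ a → a ≤ c * b → 1 ≤ b
  positive {b = zero} c h h′ = ⊥-elim (<⇒≱ h (≤-trans h′ (≤-reflexive (*-zeroʳ c))))
  positive {b = suc b} c h h′ = s≤s z≤n

  sum-mono : ∀ {n} {f g : Fin n → ℕ} → (∀ i → f i ≤ g i) → sum f ≤ sum g
  sum-mono {zero} h = z≤n
  sum-mono {suc n} h = +-mono-≤ (h zero) (sum-mono (h ∘ suc))

  sum-const : ∀ n c → sum {n} (λ _ → c) ≡ n * c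
  sum-const zero c = refl
  sum-const (suc n) c = cong (c +_) (sum-const n c)

  sum-positive : ∀ {n} (f : Fin n → ℕ) → 1 ≤ sum f → ∃[ i ] 1 ≤ f i
  sum-positive {suc n} f p with f zero in eq
  ... | suc k = zero , ≤-trans (s≤s z≤n) (≤-reflexive (sym eq))
  ... | zero = let (i , q) = sum-positive (f ∘ suc) p in suc i , q

  ⟦⟧≤1 : ∀ b → ⟦ b ⟧ ≤ 1
  ⟦⟧≤1 true = ≤-refl
  ⟦⟧≤1 false = z≤n

  ⟦⟧-mono : ∀ {a b} → (a ≡ true → b ≡ true) → ⟦ a ⟧ ≤ ⟦ b ⟧
  ⟦⟧-mono {false} h = z≤n
  ⟦⟧-mono {true} h rewrite h refl = ≤-refl

  ⟦∧⟧ : ∀ a b → ⟦ a ∧ b ⟧ ≡ ⟦ a ⟧ * ⟦ b ⟧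
  ⟦∧⟧ true b = sym (+-identityʳ _)
  ⟦∧⟧ false b = refl

  card-mono : ∀ {n} {X Y : Subset n} → X ⊑ Y → card X ≤ card Y
  card-mono h = sum-mono λ i → ⟦⟧-mono (h i)

  card≤n : ∀ {n} (X : Subset n) → card X ≤ n
  card≤n {n} X = ≤-trans (sum-mono (λ i → ⟦⟧≤1 (X i)))
    (≤-reflexive (trans (sum-const n 1) (*-identityʳ n)))

  card-full : ∀ n → card {n} (λ _ → true) ≡ n
  card-full n = trans (sum-const n 1) (*-identityʳ n)

  card-cover : ∀ {n} {X Y Z : Subset n} → (∀ i → i ∈ X → (i ∈ Y) ⊎ (i ∈ Z)) →
    card X ≤ card Y + card Z
  card-cover {X = X} {Y} {Z} h = begin
    card X                              ≤⟨ sum-mono (λ i → pointwise (X i) (Y i) (Z i) (h i)) ⟩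
    sum (λ i → ⟦ Y i ⟧ + ⟦ Z i ⟧)       ≡⟨ ∑-distrib-+ (λ i → ⟦ Y i ⟧) (λ i → ⟦ Z i ⟧) ⟩
    card Y + card Z ∎
    where
    open ≤-Reasoning
    pointwise : ∀ x y z → (x ≡ true → (y ≡ true) ⊎ (z ≡ true)) → ⟦ x ⟧ ≤ ⟦ y ⟧ + ⟦ z ⟧
    pointwise false y z h = z≤n
    pointwise true y z h with h refl
    ... | inj₁ refl = s≤s z≤n
    ... | inj₂ refl = m≤n+m 1 ⟦ y ⟧

  card-split : ∀ {n} (X Y : Subset n) → card X ≡ card (X ∩ Y) + card (X ∖ Y)
  card-split X Y = trans (sum-cong-≗ λ i → pointwise (X i) (Y i))
    (∑-distrib-+ (λ i → ⟦ X i ∧ Y i ⟧) (λ i → ⟦ X i ∧ not (Y i) ⟧))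
    where
    pointwise : ∀ x y → ⟦ x ⟧ ≡ ⟦ x ∧ y ⟧ + ⟦ x ∧ not y ⟧
    pointwise false y = refl
    pointwise true true = refl
    pointwise true false = refl

  card-∩ : ∀ {n} {X Y Z : Subset n} → X ⊑ Z → Y ⊑ Z → card X + card Y ≤ card Z + card (X ∩ Y)
  card-∩ {X = X} {Y} {Z} hX hY = begin
    card X + card Y                           ≡⟨ sym (∑-distrib-+ (λ i → ⟦ X i ⟧) (λ i → ⟦ Y i ⟧)) ⟩
    sum (λ i → ⟦ X i ⟧ + ⟦ Y i ⟧)             ≤⟨ sum-mono (λ i → pointwise (X i) (Y i) (Z i) (hX i) (hY i)) ⟩
    sum (λ i → ⟦ Z i ⟧ + ⟦ X i ∧ Y i ⟧)       ≡⟨ ∑-distrib-+ (λ i → ⟦ Z i ⟧) (λ i → ⟦ X i ∧ Y i ⟧) ⟩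
    card Z + card (X ∩ Y) ∎
    where
    open ≤-Reasoning
    pointwise : ∀ x y z → (x ≡ true → z ≡ true) → (y ≡ true → z ≡ true) →
      ⟦ x ⟧ + ⟦ y ⟧ ≤ ⟦ z ⟧ + ⟦ x ∧ y ⟧
    pointwise true y z f g rewrite f refl = ≤-refl
    pointwise false true z f g rewrite g refl = ≤-refl
    pointwise false false z f g = z≤n

  card-positive : ∀ {n} (X : Subset n) → 1 ≤ card X → ∃[ i ] i ∈ X
  card-positive X p with sum-positive (λ i → ⟦ X i ⟧) p
  ... | i , q with X i in eq
  ...   | true = i , eq

  sumOver : ∀ {n} → Subset n → (Fin n → ℕ) → ℕ
  sumOver X f = sum λ i → ⟦ X i ⟧ * f i

  sumOver-≤ : ∀ {n} (X : Subset n) {f : Fin n → ℕ} {c} → (∀ i → i ∈ X → f i ≤ c) → sumOver X f ≤ card X * c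
  sumOver-≤ X {f} {c} h = begin
    sumOver X f                ≤⟨ sum-mono (λ i → pointwise (X i) (h i)) ⟩
    sum (λ i → c * ⟦ X i ⟧)    ≡⟨ sym (*-distribˡ-sum c (λ i → ⟦ X i ⟧)) ⟩
    c * card X                 ≡⟨ *-comm c _ ⟩
    card X * c ∎
    where
    open ≤-Reasoning
    pointwise : ∀ x {k} → (x ≡ true → k ≤ c) → ⟦ x ⟧ * k ≤ c * ⟦ x ⟧
    pointwise false h = z≤n
    pointwise true {k} h = ≤-trans (≤-reflexive (+-identityʳ k)) (≤-trans (h refl) (≤-reflexive (sym (*-identityʳ c))))

  sumOver-≥ : ∀ {n} (X : Subset n) {f : Fin n → ℕ} {c} → (∀ i → i ∈ X → c ≤ f i) → card X * c ≤ sumOver X f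
  sumOver-≥ X {f} {c} h = begin
    card X * c                 ≡⟨ *-comm _ c ⟩
    c * card X                 ≡⟨ *-distribˡ-sum c (λ i → ⟦ X i ⟧) ⟩
    sum (λ i → c * ⟦ X i ⟧)    ≤⟨ sum-mono (λ i → pointwise (X i) (h i)) ⟩
    sumOver X f ∎
    where
    open ≤-Reasoning
    pointwise : ∀ x {k} → (x ≡ true → c ≤ k) → c * ⟦ x ⟧ ≤ ⟦ x ⟧ * k
    pointwise false h = ≤-reflexive (*-zeroʳ c)
    pointwise true {k} h = ≤-trans (≤-reflexive (*-identityʳ c)) (≤-trans (h refl) (≤-reflexive (sym (+-identityʳ k))))

  sumOver-mono : ∀ {n} (X : Subset n) {f g : Fin n → ℕ} → (∀ i → i ∈ X → f i ≤ g i) → sumOver X f ≤ sumOver X g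
  sumOver-mono X {f} {g} h = sum-mono λ i → pointwise (X i) (h i)
    where
    pointwise : ∀ x {j k} → (x ≡ true → j ≤ k) → ⟦ x ⟧ * j ≤ ⟦ x ⟧ * k
    pointwise false h = z≤n
    pointwise true h = +-monoˡ-≤ 0 (h refl)

  sumOver-⊑ : ∀ {n} {X Y : Subset n} (f : Fin n → ℕ) → X ⊑ Y → sumOver X f ≤ sumOver Y f
  sumOver-⊑ f h = sum-mono λ i → *-monoˡ-≤ (f i) (⟦⟧-mono (h i))

  sumOver-* : ∀ {n} (X : Subset n) c (f : Fin n → ℕ) → sumOver X (λ i → c * f i) ≡ c * sumOver X f
  sumOver-* X c f = trans (sum-cong-≗ λ i → lemma ⟦ X i ⟧ c (f i)) (sym (*-distribˡ-sum c (λ i → ⟦ X i ⟧ * f i)))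
    where
    lemma : ∀ a b d → a * (b * d) ≡ b * (a * d)
    lemma = solve-∀

  sumOver-+ : ∀ {n} (X : Subset n) (f g : Fin n → ℕ) → sumOver X (λ i → f i + g i) ≡ sumOver X f + sumOver X g
  sumOver-+ X f g = trans (sum-cong-≗ λ i → *-distribˡ-+ ⟦ X i ⟧ (f i) (g i))
    (∑-distrib-+ (λ i → ⟦ X i ⟧ * f i) (λ i → ⟦ X i ⟧ * g i))

  sumOver-split : ∀ {n} (X Y : Subset n) (f : Fin n → ℕ) →
    sumOver X f ≡ sumOver (X ∩ Y) f + sumOver (X ∖ Y) f
  sumOver-split X Y f = trans (sum-cong-≗ λ i → pointwise (X i) (Y i) (f i))
    (∑-distrib-+ (λ i → ⟦ X i ∧ Y i ⟧ * f i) (λ i → ⟦ X i ∧ not (Y i) ⟧ * f i))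
    where
    pointwise : ∀ x y k → ⟦ x ⟧ * k ≡ ⟦ x ∧ y ⟧ * k + ⟦ x ∧ not y ⟧ * k
    pointwise false y k = refl
    pointwise true true k = sym (+-identityʳ _)
    pointwise true false k = refl


open FiniteSets

-- Pairs of sets with hereditarily positive edge density.

module DensePairs where
  open import Data.Bool using (Bool; true; false; _∧_; _∨_; not)
  open import Data.Bool.Properties using (_≟_; ∧-comm)
  open import Data.Empty using (⊥; ⊥-elim)
  open import Data.Fin using (Fin; zero; suc)
  open import Data.Fin.Properties using (all?)
  open import Data.Nat hiding (_≟_)
  open import Data.Nat.Properties hiding (_≟_)
  open import Data.Nat.Tactic.RingSolver using (solve-∀)
  open import Data.Product using (_×_; _,_; ∃; ∃-syntax)
  open import Data.Sum using (_⊎_; inj₁; inj₂; [_,_]′)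
  open import Data.Vec.Functional using (_∷_)
  open import Function using (_∘_; case_of_)
  open import Relation.Binary.PropositionalEquality
  open import Relation.Nullary using (Dec; yes; no; _×-dec_; _→-dec_)
  open import Algebra.Properties.CommutativeMonoid.Sum +-0-commutativeMonoid using (sum; ∑-comm; sum-cong-≗)
  open import Algebra.Properties.Semiring.Sum +-*-semiring using (*-distribˡ-sum)

  -- Subsets are functions, and pointwise equal ones need not be propositionally equal. An
  -- exhaustive search over subsets is therefore confined to predicates that respect pointwise
  -- equality.
  Extensional : ∀ {n} → (Subset n → Set) → Set
  Extensional P = ∀ {X Y} → (∀ i → X i ≡ Y i) → P X → P Y

  search : ∀ {n} {P : Subset n → Set} → Extensional P → (∀ X → Dec (P X)) → Dec (∃ P)
  search {zero} ext P? with P? (λ ())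
  ... | yes p = yes (_ , p)
  ... | no ¬p = no λ (X , p) → ¬p (ext (λ ()) p)
  search {suc n} {P} ext P? with search (extend true) (λ X → P? (true ∷ X)) | search (extend false) (λ X → P? (false ∷ X))
    where
    extend : ∀ b → Extensional (λ X → P (b ∷ X))
    extend b h = ext λ { zero → refl ; (suc i) → h i }
  ... | yes (X , p) | _ = yes (_ , p)
  ... | no _ | yes (X , p) = yes (_ , p)
  ... | no ¬t | no ¬f = no λ (X , p) → split X (X zero) refl p
    where
    split : ∀ X b → X zero ≡ b → P X → ⊥
    split X true eq p = ¬t (X ∘ suc , ext (λ { zero → eq ; (suc i) → refl }) p)
    split X false eq p = ¬f (X ∘ suc , ext (λ { zero → eq ; (suc i) → refl }) p)

  _⊑?_ : ∀ {n} (X Y : Subset n) → Dec (X ⊑ Y)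
  X ⊑? Y = all? λ i → (X i ≟ true) →-dec (Y i ≟ true)

  card-cong : ∀ {n} {X Y : Subset n} → (∀ i → X i ≡ Y i) → card X ≡ card Y
  card-cong h = sum-cong-≗ (cong ⟦_⟧ ∘ h)

  ⊑-congˡ : ∀ {n} {X Y Z : Subset n} → (∀ i → X i ≡ Y i) → X ⊑ Z → Y ⊑ Z
  ⊑-congˡ h p i q = p i (trans (h i) q)

  Colours : ℕ → Set
  Colours n = Bool → Fin n → Fin n → Bool

  Symmetric : ∀ {n} → Colours n → Set
  Symmetric E = ∀ c x y → E c x y ≡ E c y x

  module Degrees {n : ℕ} (E : Colours n) (E-sym : Symmetric E) where

    deg : Bool → Fin n → Subset n → ℕ
    deg c v X = card (E c v ∩ X)

    edgesBetween : Bool → Subset n → Subset n → ℕ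
    edgesBetween c X Y = sumOver X λ x → deg c x Y

    deg-mono : ∀ {c v X Y} → X ⊑ Y → deg c v X ≤ deg c v Y
    deg-mono h = card-mono λ i p → ∧-intro (∧-fst p) (h i (∧-snd p))

    deg≤card : ∀ c v X → deg c v X ≤ card X
    deg≤card c v X = card-mono (∩-⊑ʳ (E c v) X)

    deg-cover : ∀ {c v X Y Z} → (∀ i → i ∈ X → (i ∈ Y) ⊎ (i ∈ Z)) → deg c v X ≤ deg c v Y + deg c v Z
    deg-cover h = card-cover λ i p → case h i (∧-snd p) of λ
      { (inj₁ q) → inj₁ (∧-intro (∧-fst p) q) ; (inj₂ q) → inj₂ (∧-intro (∧-fst p) q) }

    edgesBetween-sym : ∀ c X Y → edgesBetween c X Y ≡ edgesBetween c Y X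
    edgesBetween-sym c X Y = begin
      sum (λ x → ⟦ X x ⟧ * sum (λ y → ⟦ E c x y ∧ Y y ⟧))       ≡⟨ sum-cong-≗ (λ x → *-distribˡ-sum ⟦ X x ⟧ (λ y → ⟦ E c x y ∧ Y y ⟧)) ⟩
      sum (λ x → sum (λ y → ⟦ X x ⟧ * ⟦ E c x y ∧ Y y ⟧))       ≡⟨ ∑-comm (λ x y → ⟦ X x ⟧ * ⟦ E c x y ∧ Y y ⟧) ⟩
      sum (λ y → sum (λ x → ⟦ X x ⟧ * ⟦ E c x y ∧ Y y ⟧))       ≡⟨ sum-cong-≗ (λ y → sum-cong-≗ (λ x → flip x y)) ⟩
      sum (λ y → sum (λ x → ⟦ Y y ⟧ * ⟦ E c y x ∧ X x ⟧))       ≡⟨ sum-cong-≗ (λ y → sym (*-distribˡ-sum ⟦ Y y ⟧ (λ x → ⟦ E c y x ∧ X x ⟧))) ⟩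
      sum (λ y → ⟦ Y y ⟧ * sum (λ x → ⟦ E c y x ∧ X x ⟧)) ∎
      where
      open ≡-Reasoning
      rearrange : ∀ a b d → a * (b * d) ≡ d * (b * a)
      rearrange = solve-∀
      flip : ∀ x y → ⟦ X x ⟧ * ⟦ E c x y ∧ Y y ⟧ ≡ ⟦ Y y ⟧ * ⟦ E c y x ∧ X x ⟧
      flip x y = begin
        ⟦ X x ⟧ * ⟦ E c x y ∧ Y y ⟧     ≡⟨ cong (⟦ X x ⟧ *_) (⟦∧⟧ (E c x y) (Y y)) ⟩
        ⟦ X x ⟧ * (⟦ E c x y ⟧ * ⟦ Y y ⟧) ≡⟨ cong (λ e → ⟦ X x ⟧ * (⟦ e ⟧ * ⟦ Y y ⟧)) (E-sym c x y) ⟩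
        ⟦ X x ⟧ * (⟦ E c y x ⟧ * ⟦ Y y ⟧) ≡⟨ rearrange ⟦ X x ⟧ ⟦ E c y x ⟧ ⟦ Y y ⟧ ⟩
        ⟦ Y y ⟧ * (⟦ E c y x ⟧ * ⟦ X x ⟧) ≡⟨ cong (⟦ Y y ⟧ *_) (sym (⟦∧⟧ (E c y x) (X x))) ⟩
        ⟦ Y y ⟧ * ⟦ E c y x ∧ X x ⟧ ∎

    -- A one-sided form of regularity: density at least a/q between all pieces of share at least
    -- 1/g. Passing to large subsets keeps the density and only uses up `g`.
    record Dense (q g a : ℕ) (c : Bool) (X Y : Subset n) : Set where
      constructor dense
      field
        spans : ∀ X′ Y′ → X′ ⊑ X → Y′ ⊑ Y → card X ≤ g * card X′ → card Y ≤ g * card Y′ →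
          a * (card X′ * card Y′) ≤ q * edgesBetween c X′ Y′
    open Dense public

    Dense-sym : ∀ {q g a c X Y} → Dense q g a c X Y → Dense q g a c Y X
    Dense-sym {q} {g} {a} {c} (dense D) = dense λ Y′ X′ hY hX cY cX → subst₂ _≤_ (cong (a *_) (*-comm (card X′) (card Y′))) (cong (q *_) (edgesBetween-sym c X′ Y′))
        (D X′ Y′ hX hY cX cY)

    Dense-⊑ : ∀ {q g h k a c X Y X₁ Y₁} → X₁ ⊑ X → Y₁ ⊑ Y → card X ≤ k * card X₁ → card Y ≤ k * card Y₁ →
      k * h ≤ g → Dense q g a c X Y → Dense q h a c X₁ Y₁
    Dense-⊑ {g = g} {h} {k} {X = X} {Y} {X₁} {Y₁} X₁⊑X Y₁⊑Y cX cY kh≤g (dense D) = dense λ X′ Y′ hX hY dX dY → D X′ Y′ (⊑-trans {X = X′} hX X₁⊑X) (⊑-trans {X = Y′} hY Y₁⊑Y) (chain cX dX) (chain cY dY)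
      where
      chain : ∀ {x y z} → x ≤ k * y → y ≤ h * z → x ≤ g * z
      chain {x} {y} {z} p r = begin
        x           ≤⟨ p ⟩
        k * y       ≤⟨ *-monoʳ-≤ k r ⟩
        k * (h * z) ≡⟨ sym (*-assoc k h z) ⟩
        k * h * z   ≤⟨ *-monoˡ-≤ z kh≤g ⟩
        g * z ∎
        where open ≤-Reasoning

    edgesBetween-congˡ : ∀ {c X X′} Y → (∀ i → X i ≡ X′ i) → edgesBetween c X Y ≡ edgesBetween c X′ Y
    edgesBetween-congˡ {c} Y h = sum-cong-≗ λ i → cong (λ b → ⟦ b ⟧ * deg c i Y) (h i)

    edgesBetween-congʳ : ∀ {c Y Y′} X → (∀ i → Y i ≡ Y′ i) → edgesBetween c X Y ≡ edgesBetween c X Y′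
    edgesBetween-congʳ {c} X h = sum-cong-≗ λ i → cong (⟦ X i ⟧ *_) (card-cong λ j → cong (E c i j ∧_) (h j))

    Violation : (q g a : ℕ) → Bool → Subset n → Subset n → Subset n → Subset n → Set
    Violation q g a c X Y X′ Y′ = X′ ⊑ X × Y′ ⊑ Y × card X ≤ g * card X′ × card Y ≤ g * card Y′ ×
      q * edgesBetween c X′ Y′ < a * (card X′ * card Y′)

    -- Exhaustive search over all pairs of subsets supplies the case distinction constructively.
    dense-or-violation : ∀ q g a c X Y → Dense q g a c X Y ⊎ ∃[ X′ ] ∃[ Y′ ] Violation q g a c X Y X′ Y′
    dense-or-violation q g a c X Y with search {P = λ X′ → ∃[ Y′ ] Violation q g a c X Y X′ Y′} extX
        (λ X′ → search (extY {X′}) (λ Y′ → (X′ ⊑? X) ×-dec (Y′ ⊑? Y) ×-dec (_ ≤? _) ×-dec (_ ≤? _) ×-dec (_ <? _)))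
      where
      extY : ∀ {X′} → Extensional (Violation q g a c X Y X′)
      extY {X′} h (p , r , s , t , v) rewrite card-cong h | edgesBetween-congʳ {c} X′ h =
        p , ⊑-congˡ {Z = Y} h r , s , t , v
      extX : Extensional (λ X′ → ∃[ Y′ ] Violation q g a c X Y X′ Y′)
      extX h (Y′ , p , r , s , t , v) rewrite card-cong h | edgesBetween-congˡ {c} Y′ h =
        Y′ , ⊑-congˡ {Z = X} h p , r , s , t , v
    ... | yes v = inj₂ v
    ... | no ¬v = inj₁ (dense λ X′ Y′ h₁ h₂ h₃ h₄ → ≮⇒≥ λ h₅ → ¬v (X′ , Y′ , h₁ , h₂ , h₃ , h₄ , h₅))

    -- The vertices of Y sending few edges into a sparse block X′ form a positive
    -- share of Y; deleting X′ from X makes them denser to the rest, so this stops.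
    module _ (q g a : ℕ) (c : Bool) (X : Subset n) (a<q : suc a ≤ q) (g≥1 : 1 ≤ g) (X≥1 : 1 ≤ card X) where

      private
        Result : ℕ → Subset n → Set
        Result s Y = ∃[ X′ ] ∃[ Y′ ] X′ ⊑ X × Y′ ⊑ Y × card X ≤ q * card X′ × card Y ≤ s * card Y′ ×
          Dense q g a c X′ Y′

        low : Subset n → Subset n
        low X′ y = q * deg c y X′ ≤ᵇ suc a * card X′

        -- Markov's inequality: in a block of density below a/q, the vertices of `Y′` with density
        -- above (a + 1)/q to `X′` number at most `a` times the others, so the others have a share
        -- of at least 1/(a + 1), hence at least 1/q.
        violation-share : ∀ X′ Y′ → q * edgesBetween c X′ Y′ < a * (card X′ * card Y′) → card Y′ ≤ q * card (Y′ ∩ low X′)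
        violation-share X′ Y′ v = ≤-trans (≤-trans (≤-reflexive (card-split Y′ (low X′))) bound) (*-monoˡ-≤ _ a<q)
          where
          l h m : ℕ
          l = card (Y′ ∩ low X′)
          h = card (Y′ ∖ low X′)
          m = card X′
          many : h * (suc a * m) ≤ q * edgesBetween c X′ Y′
          many = begin
            h * (suc a * m)                              ≤⟨ sumOver-≥ (Y′ ∖ low X′) (λ y p → <⇒≤ (≤ᵇ-false (not-true (∧-snd {Y′ y} p)))) ⟩
            sumOver (Y′ ∖ low X′) (λ y → q * deg c y X′) ≤⟨ sumOver-⊑ (λ y → q * deg c y X′) (∖-⊑ Y′ (low X′)) ⟩
            sumOver Y′ (λ y → q * deg c y X′)            ≡⟨ sumOver-* Y′ q (λ y → deg c y X′) ⟩
            q * edgesBetween c Y′ X′                     ≡⟨ cong (q *_) (edgesBetween-sym c Y′ X′) ⟩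
            q * edgesBetween c X′ Y′ ∎
            where open ≤-Reasoning
          strict : m * (suc a * h) < m * (a * (l + h))
          strict = begin-strict
            m * (suc a * h)      ≡⟨ rearrange m (suc a) h ⟩
            h * (suc a * m)      ≤⟨ many ⟩
            _                    <⟨ v ⟩
            a * (m * card Y′)    ≡⟨ cong (λ z → a * (m * z)) (card-split Y′ (low X′)) ⟩
            a * (m * (l + h))    ≡⟨ swap a m (l + h) ⟩
            m * (a * (l + h)) ∎
            where
            open ≤-Reasoning
            rearrange : ∀ x y z → x * (y * z) ≡ z * (y * x)
            rearrange = solve-∀
            swap : ∀ x y z → x * (y * z) ≡ y * (x * z)
            swap = solve-∀
          bound : l + h ≤ suc a * l
          bound = by-identity (<⇒≤ (*-cancelˡ-< m _ _ strict)) 0 (id₁ a l h)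
            where
            id₁ : ∀ a l h → (l + h) + a * (l + h) + 0 ≡ suc a * l + suc a * h
            id₁ = solve-∀

        -- `R` is the part of `X` deleted so far. Every `y` has density at least (a + 2)/q to `X`
        -- but at most (a + 1)/q to `R`, so at least a 1/q share of `X` is always left. Each
        -- violation deletes a 1/g share of that rest, that is 1/(q * g) of `X`; after q * g rounds
        -- nothing could be left. `k` counts the remaining rounds, and each of them costs `Y` a
        -- factor of at most q * g.
        loop : ∀ k R Y → R ⊑ X → 1 ≤ card Y → (∀ y → y ∈ Y → suc (suc a) * card X ≤ q * deg c y X) →
          (∀ y → y ∈ Y → q * deg c y R ≤ suc a * card R) →
          q * g * card X ≤ q * g * card R + k * card X → Result ((q * g) ^ k) Y
        loop k R Y R⊑X Y≥1 rich lowR fuel = continue k fuel (dense-or-violation q g a c X₁ Y)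
          where
          X₁ : Subset n
          X₁ = X ∖ R
          X₁⊑X : X₁ ⊑ X
          X₁⊑X i = ∧-fst
          sizes : card X ≡ card R + card X₁
          sizes = trans (card-split X R) (cong (_+ card X₁) (≤-antisym
            (card-mono λ i p → ∧-snd {X i} p) (card-mono λ i p → ∧-intro (R⊑X i p) p)))
          X₁-large : card X ≤ q * card X₁
          X₁-large with card-positive Y Y≥1
          ... | y , y∈Y = by-identity step 0 (id₂ (card X) a (q * card X₁))
            where
            open ≤-Reasoning
            id₂ : ∀ x a z → x + (suc a * x + z) + 0 ≡ z + suc (suc a) * x
            id₂ = solve-∀
            step : suc (suc a) * card X ≤ suc a * card X + q * card X₁
            step = begin
              suc (suc a) * card X                  ≤⟨ rich y y∈Y ⟩
              q * deg c y X                         ≤⟨ *-monoʳ-≤ q (deg-cover {c} {y} {X} {R} {X₁} λ i p →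
                                                         case bool-cases (R i) of λ
                                                           { (inj₁ r) → inj₁ r ; (inj₂ r) → inj₂ (∧-intro p (not-false r)) }) ⟩
              q * (deg c y R + deg c y X₁)          ≡⟨ *-distribˡ-+ q (deg c y R) _ ⟩
              q * deg c y R + q * deg c y X₁        ≤⟨ +-mono-≤ (≤-trans (lowR y y∈Y) (*-monoʳ-≤ (suc a) (card-mono R⊑X)))
                                                                (*-monoʳ-≤ q (deg≤card c y X₁)) ⟩
              suc a * card X + q * card X₁ ∎
          continue : ∀ k → q * g * card X ≤ q * g * card R + k * card X →
            Dense q g a c X₁ Y ⊎ (∃[ X′ ] ∃[ Y′ ] Violation q g a c X₁ Y X′ Y′) → Result ((q * g) ^ k) Y
          continue k fuel (inj₁ D) = X₁ , Y , X₁⊑X , ⊑-refl {X = Y} , X₁-large , grow , D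
            where
            open ≤-Reasoning
            1≤qg : 1 ≤ q * g
            1≤qg = *-mono-≤ (≤-trans (s≤s z≤n) a<q) g≥1
            grow : card Y ≤ (q * g) ^ k * card Y
            grow = begin
              card Y                 ≡⟨ sym (*-identityˡ _) ⟩
              1 * card Y             ≡⟨ cong (_* card Y) (sym (^-zeroˡ k)) ⟩
              1 ^ k * card Y         ≤⟨ *-monoˡ-≤ (card Y) (^-monoˡ-≤ k 1≤qg) ⟩
              (q * g) ^ k * card Y ∎
          continue zero fuel (inj₂ _) = ⊥-elim (<-irrefl refl (≤-trans X₁≥1 X₁≤0))
            where
            X₁≥1 : 1 ≤ card X₁
            X₁≥1 = positive q X≥1 X₁-large
            X₁≤0 : card X₁ ≤ 0
            X₁≤0 = *-cancelˡ-≤ (q * g) {{>-nonZero (*-mono-≤ (≤-trans (s≤s z≤n) a<q) g≥1)}}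
              (by-identity (subst (λ z → q * g * z ≤ q * g * card R + 0) sizes fuel) 0 (id₃ (q * g) (card R) (card X₁)))
              where
              id₃ : ∀ w r x → w * x + (w * r + 0) + 0 ≡ w * 0 + w * (r + x)
              id₃ = solve-∀
          continue (suc k) fuel (inj₂ (X′ , Y′ , X′⊑ , Y′⊑ , cX , cY , v)) =
            enlarge (loop k (R ∪ X′) (Y′ ∩ low X′) R′⊑X Y″≥1 (λ y p → rich y (Y′⊑ y (∧-fst p))) lowR′ fuel′)
            where
            open ≤-Reasoning
            R′⊑X : (R ∪ X′) ⊑ X
            R′⊑X i p = [ R⊑X i , (λ r → ∧-fst (X′⊑ i r)) ]′ (∪-elim (R i) p)
            Y≤ : card Y ≤ g * (q * card (Y′ ∩ low X′))
            Y≤ = ≤-trans cY (*-monoʳ-≤ g (violation-share X′ Y′ v))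
            Y″≥1 : 1 ≤ card (Y′ ∩ low X′)
            Y″≥1 = positive q (positive g Y≥1 Y≤) ≤-refl
            sizeR′ : card (R ∪ X′) ≡ card R + card X′
            sizeR′ = trans (card-split (R ∪ X′) R) (cong₂ _+_
              (card-cong λ i → pick (R i) (X′ i)) (card-cong λ i → drop (R i) (X′ i) λ p → not-true (∧-snd {X i} (X′⊑ i p))))
              where
              pick : ∀ r x → (r ∨ x) ∧ r ≡ r
              pick true x = refl
              pick false true = refl
              pick false false = refl
              drop : ∀ r x → (x ≡ true → r ≡ false) → (r ∨ x) ∧ not r ≡ x
              drop true true h = sym (h refl)
              drop true false h = refl
              drop false true h = refl
              drop false false h = refl
            lowR′ : ∀ y → y ∈ (Y′ ∩ low X′) → q * deg c y (R ∪ X′) ≤ suc a * card (R ∪ X′)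
            lowR′ y p = begin
              q * deg c y (R ∪ X′)                  ≤⟨ *-monoʳ-≤ q (deg-cover {c} {y} {R ∪ X′} {R} {X′} λ i → ∪-elim (R i)) ⟩
              q * (deg c y R + deg c y X′)          ≡⟨ *-distribˡ-+ q (deg c y R) _ ⟩
              q * deg c y R + q * deg c y X′        ≤⟨ +-mono-≤ (lowR y (Y′⊑ y (∧-fst p))) (≤ᵇ-true (∧-snd {Y′ y} p)) ⟩
              suc a * card R + suc a * card X′      ≡⟨ sym (*-distribˡ-+ (suc a) (card R) _) ⟩
              suc a * (card R + card X′)            ≡⟨ cong (suc a *_) (sym sizeR′) ⟩
              suc a * card (R ∪ X′) ∎
            fuel′ : q * g * card X ≤ q * g * card (R ∪ X′) + k * card X
            fuel′ = begin
              q * g * card X                                   ≤⟨ fuel ⟩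
              q * g * card R + (card X + k * card X)           ≤⟨ +-monoʳ-≤ (q * g * card R) (+-monoˡ-≤ (k * card X)
                                                                    (≤-trans X₁-large (*-monoʳ-≤ q cX))) ⟩
              q * g * card R + (q * (g * card X′) + k * card X) ≡⟨ id₄ q g (card R) (card X′) (k * card X) ⟩
              q * g * (card R + card X′) + k * card X          ≡⟨ cong (λ z → q * g * z + k * card X) (sym sizeR′) ⟩
              q * g * card (R ∪ X′) + k * card X ∎
              where
              id₄ : ∀ q g r x k → q * g * r + (q * (g * x) + k) ≡ q * g * (r + x) + k
              id₄ = solve-∀
            enlarge : Result ((q * g) ^ k) (Y′ ∩ low X′) → Result ((q * g) ^ suc k) Y
            enlarge (X‴ , Y‴ , hX , hY , sX , sY , D) = X‴ , Y‴ , hX , (λ i p → Y′⊑ i (∧-fst (hY i p))) , sX , grow , D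
              where
              grow : card Y ≤ (q * g) ^ suc k * card Y‴
              grow = begin
                card Y                                    ≤⟨ ≤-trans cY (*-monoʳ-≤ g (violation-share X′ Y′ v)) ⟩
                g * (q * card (Y′ ∩ low X′))              ≤⟨ *-monoʳ-≤ g (*-monoʳ-≤ q sY) ⟩
                g * (q * ((q * g) ^ k * card Y‴))         ≡⟨ id₅ g q ((q * g) ^ k) (card Y‴) ⟩
                (q * g) ^ suc k * card Y‴ ∎
                where
                id₅ : ∀ g q e y → g * (q * (e * y)) ≡ q * g * e * y
                id₅ = solve-∀

      densify : ∀ Y → 1 ≤ card Y → (∀ y → y ∈ Y → suc (suc a) * card X ≤ q * deg c y X) → Result ((q * g) ^ (q * g)) Y
      densify Y Y≥1 rich = loop (q * g) (λ _ → false) Y (λ _ ()) Y≥1 rich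
        (λ y _ → ≤-trans (≤-reflexive (trans (cong (q *_) (card-none y)) (*-zeroʳ q))) z≤n) (m≤n+m _ _)
        where
        card-none : ∀ y → deg c y (λ _ → false) ≡ 0
        card-none y = trans (sum-cong-≗ λ i → cong ⟦_⟧ (∧-comm (E c y i) false)) (trans (sum-const n 0) (*-zeroʳ n))

open DensePairs

-- Embedding a monochromatic clique into pairwise dense clusters.

module CliqueEmbedding where
  open import Data.Bool using (Bool; true; false; if_then_else_)
  open import Data.Empty using (⊥; ⊥-elim)
  open import Data.Fin using (Fin; zero; suc)
  open import Data.List using (List; []; _∷_; length; map)
  open import Data.List.Properties using (length-map)
  open import Data.List.Relation.Unary.All as All using (All; []; _∷_)
  import Data.List.Relation.Unary.All.Properties as All
  open import Data.List.Relation.Unary.AllPairs as AllPairs using (AllPairs; []; _∷_)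
  import Data.List.Relation.Unary.AllPairs.Properties as AllPairs
  open import Data.Nat hiding (_≟_)
  open import Data.Nat.Properties hiding (_≟_)
  open import Data.Nat.Tactic.RingSolver using (solve-∀)
  open import Data.Product using (_×_; _,_; proj₁; proj₂; ∃-syntax; ∃₂)
  open import Data.Sum using ([_,_]′)
  open import Function using (_∘_)
  open import Relation.Binary.PropositionalEquality
  open import Algebra.Properties.CommutativeMonoid.Sum +-0-commutativeMonoid using (sum-cong-≗)

  cliqueLimit : Bool → ℕ
  cliqueLimit true = 3
  cliqueLimit false = 6

  -- A red/blue coloured graph without red triangle and blue K₆.  Its vertices are
  -- of two kinds: many vertices of kind c always span an edge of colour c.
  record Setting (n : ℕ) : Set where
    field
      E         : Colours n
      E-sym     : Symmetric E
      disjoint  : ∀ x y → E true x y ≡ true → E false x y ≡ false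
      no-clique : ∀ c xs → AllPairs (λ x y → E c x y ≡ true) xs → length xs ≡ cliqueLimit c → ⊥
      kind      : Fin n → Bool
      M         : ℕ
      M≥1       : 1 ≤ M
      edge-in   : ∀ c X → (∀ i → i ∈ X → kind i ≡ c) → M ≤ card X → ∃₂ λ x y → x ∈ X × y ∈ X × E c x y ≡ true

  -- Density is known for `whole` and never renewed. The embedding only shrinks `current`, the
  -- candidates adjacent to everything chosen so far, and needs its share of `whole` to stay bounded
  -- below. From a `double` slot two adjacent vertices are taken.
  record Slot (n : ℕ) : Set where
    constructor slot
    field
      whole current : Subset n
      double : Bool
  open Slot public

  weight : ∀ {n} → List (Slot n) → ℕ
  weight [] = 0
  weight (s ∷ ss) = (if double s then 2 else 1) + weight ss

  restrict : ∀ {n} → Subset n → Slot n → Slot n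
  restrict N s = slot (whole s) (N ∩ current s) (double s)

  weight-restrict : ∀ {n} N (ss : List (Slot n)) → weight (map (restrict N) ss) ≡ weight ss
  weight-restrict N [] = refl
  weight-restrict N (s ∷ ss) = cong ((if double s then 2 else 1) +_) (weight-restrict N ss)

  module Embedding {n : ℕ} (S : Setting n) (p g : ℕ) (p≥1 : 1 ≤ p) where
    open Setting S
    open Degrees E E-sym

    q : ℕ
    q = 2 * p

    q≥1 : 1 ≤ q
    q≥1 = ≤-trans p≥1 (m≤m+n p _)

    -- With q = 2 * p, the value p + 1 means density just above 1/2: two vertices that both see this
    -- much of a set have common neighbours in a 1/p share of it. For a single vertex density 1/q
    -- suffices.
    level : Bool → ℕ
    level false = 1
    level true = suc p

    -- The level depends on the earlier slot alone: its vertices are chosen first and must leave a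
    -- common neighbourhood in the later one. So a single slot followed by a double one only needs
    -- density 1/q, and density above 1/2 is asked of a double slot towards the slots after it.
    SlotDense : Bool → Slot n → Slot n → Set
    SlotDense c s s′ = Dense q g (level (double s)) c (whole s) (whole s′)

    record Usable (c : Bool) (t K : ℕ) (s : Slot n) : Set where
      field
        inside  : current s ⊑ whole s
        share   : card (whole s) ≤ t * card (current s)
        large   : K * M ≤ card (whole s)
        typed   : double s ≡ true → ∀ i → i ∈ current s → kind i ≡ c
    open Usable

    Rich : Bool → ℕ → Fin n → Slot n → Set
    Rich c a x s = a * card (current s) ≤ q * deg c x (current s)

    module _ (c : Bool) (t K : ℕ) (K≥1 : 1 ≤ K) (t≤g : t ≤ g) (a : ℕ) (W C : Subset n) (C⊑W : C ⊑ W) (W≥1 : 1 ≤ card W) where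

      -- The vertices with few neighbours in `current s` are jointly sparse to it. If they made up
      -- more than a 1/g share of `W`, they would contradict the density of the pair. Each slot thus
      -- spoils at most card W / g vertices.
      typical : ∀ ss → All (λ s → Dense q g a c W (whole s)) ss → All (Usable c t K) ss →
        ∃[ C′ ] C′ ⊑ C × (∀ x → x ∈ C′ → All (Rich c a x) ss) × g * card C ≤ g * card C′ + length ss * card W
      typical [] [] [] = C , ⊑-refl {X = C} , (λ _ _ → []) , m≤m+n _ _
      typical (s ∷ ss) (D ∷ Ds) (u ∷ us) with typical ss Ds us
      ... | C₁ , C₁⊑C , rich , size = C₁ ∩ good , ⊑-trans {X = C₁ ∩ good} (∩-⊑ˡ C₁ good) C₁⊑C ,
        (λ x x∈ → ≤ᵇ-true (∧-snd {C₁ x} x∈) ∷ rich x (∧-fst x∈)) , size′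
        where
        good bad : Subset n
        good x = a * card (current s) ≤ᵇ q * deg c x (current s)
        bad = C₁ ∖ good
        few : g * card bad ≤ card W
        few = ≮⇒≥ λ many → <-irrefl refl (begin-strict
          a * (card bad * card (current s))                           ≤⟨ spans D bad (current s) (λ i → C⊑W i ∘ C₁⊑C i ∘ ∧-fst) (inside u)
                                                                            (<⇒≤ many) (≤-trans (share u) (*-monoˡ-≤ _ t≤g)) ⟩
          q * edgesBetween c bad (current s)                          ≡⟨ sym (sumOver-* bad q (λ x → deg c x (current s))) ⟩
          sumOver bad (λ x → q * deg c x (current s))                 <⟨ m<m+n _ (bad≥1 many) ⟩
          sumOver bad (λ x → q * deg c x (current s)) + card bad      ≡⟨ sym (+-one bad) ⟩
          sumOver bad (λ x → q * deg c x (current s) + 1)             ≤⟨ sumOver-≤ bad (λ x x∈ → ≤-trans (≤-reflexive (+-comm _ 1))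
                                                                            (≤ᵇ-false (not-true (∧-snd {C₁ x} x∈)))) ⟩
          card bad * (a * card (current s))                           ≡⟨ swap (card bad) a _ ⟩
          a * (card bad * card (current s)) ∎)
          where
          open ≤-Reasoning
          swap : ∀ x y z → x * (y * z) ≡ y * (x * z)
          swap = solve-∀
          +-one : ∀ X {f} → sumOver X (λ x → f x + 1) ≡ sumOver X f + card X
          +-one X {f} = trans (sumOver-+ X f (λ _ → 1)) (cong (sumOver X f +_) (sum-cong-≗ λ i → *-identityʳ ⟦ X i ⟧))
          bad≥1 : card W < g * card bad → 1 ≤ card bad
          bad≥1 h with card bad
          ... | zero = ⊥-elim (<⇒≱ h (≤-trans (≤-reflexive (*-zeroʳ g)) z≤n))
          ... | suc _ = s≤s z≤n
        size′ : g * card C ≤ g * card (C₁ ∩ good) + (card W + length ss * card W)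
        size′ = begin
          g * card C                                                        ≤⟨ size ⟩
          g * card C₁ + length ss * card W                                  ≡⟨ cong (λ z → g * z + length ss * card W) (card-split C₁ good) ⟩
          g * (card (C₁ ∩ good) + card bad) + length ss * card W            ≡⟨ id₁ g _ (card bad) _ ⟩
          g * card (C₁ ∩ good) + (g * card bad + length ss * card W)        ≤⟨ +-monoʳ-≤ (g * card (C₁ ∩ good)) (+-monoˡ-≤ _ few) ⟩
          g * card (C₁ ∩ good) + (card W + length ss * card W) ∎
          where
          open ≤-Reasoning
          id₁ : ∀ g x y z → g * (x + y) + z ≡ g * x + (g * y + z)
          id₁ = solve-∀

    restrict-usable : ∀ {c t K} N {s} → card (current s) ≤ q * card (N ∩ current s) → Usable c t K s → Usable c (t * q) K (restrict N s)
    restrict-usable {t = t} N {s} h u = record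
      { inside = λ i i∈ → inside u i (∩-⊑ʳ N (current s) i i∈)
      ; share = ≤-trans (share u) (≤-trans (*-monoʳ-≤ t h) (≤-reflexive (sym (*-assoc t q _))))
      ; large = large u
      ; typed = λ d i i∈ → typed u d i (∩-⊑ʳ N (current s) i i∈) }

    -- The clause on `Q` locates the clique without naming the slot of each vertex. With `Q` a
    -- neighbourhood it says that the clique is joined to a vertex chosen before.
    Embedded : Bool → List (Slot n) → Set
    Embedded c ss = ∃[ xs ] length xs ≡ weight ss × AllPairs (λ x y → E c x y ≡ true) xs ×
      (∀ (Q : Subset n) → All (λ s → current s ⊑ Q) ss → All (_∈ Q) xs)

    private
      restricted-⊑ : ∀ (N Q : Subset n) (ss : List (Slot n)) → N ⊑ Q → All (λ s → current s ⊑ Q) (map (restrict N) ss)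
      restricted-⊑ N Q [] h = []
      restricted-⊑ N Q (s ∷ ss) h = (λ i i∈ → h i (∩-⊑ˡ N (current s) i i∈)) ∷ restricted-⊑ N Q ss h

      restricted-⊑′ : ∀ (N Q : Subset n) (ss : List (Slot n)) → All (λ s → current s ⊑ Q) ss → All (λ s → current s ⊑ Q) (map (restrict N) ss)
      restricted-⊑′ N Q [] [] = []
      restricted-⊑′ N Q (s ∷ ss) (h ∷ hs) = (λ i i∈ → h i (∩-⊑ʳ N (current s) i i∈)) ∷ restricted-⊑′ N Q ss hs

    private
      count : Bool → ℕ
      count d = if d then 2 else 1

    extend-single : ∀ {c s ss} x → double s ≡ false → x ∈ current s → Embedded c (map (restrict (E c x)) ss) → Embedded c (s ∷ ss)
    extend-single {c} {s} {ss} x eq x∈ (xs , len , adj , within) = x ∷ xs ,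
      trans (cong suc (trans len (weight-restrict (E c x) ss))) (cong (λ d → count d + weight ss) (sym eq)) ,
      (within (E c x) (restricted-⊑ (E c x) (E c x) ss (⊑-refl {X = E c x})) ∷ adj) ,
      λ { Q (h ∷ hs) → h x x∈ ∷ within Q (restricted-⊑′ (E c x) Q ss hs) }

    extend-double : ∀ {c s ss} x y → double s ≡ true → x ∈ current s → y ∈ current s → E c x y ≡ true →
      Embedded c (map (restrict (E c x ∩ E c y)) ss) → Embedded c (s ∷ ss)
    extend-double {c} {s} {ss} x y eq x∈ y∈ xy (xs , len , adj , within) = x ∷ y ∷ xs ,
      trans (cong (2 +_) (trans len (weight-restrict N ss))) (cong (λ d → count d + weight ss) (sym eq)) ,
      ((xy ∷ within (E c x) (restricted-⊑ N (E c x) ss (∩-⊑ˡ (E c x) (E c y)))) ∷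
        (within (E c y) (restricted-⊑ N (E c y) ss (∩-⊑ʳ (E c x) (E c y))) ∷ adj)) ,
      λ { Q (h ∷ hs) → h x x∈ ∷ h y y∈ ∷ within Q (restricted-⊑′ N Q ss hs) }
      where
      N : Subset n
      N = E c x ∩ E c y

    common-neighbours : ∀ c x y Y → suc p * card Y ≤ q * deg c x Y → suc p * card Y ≤ q * deg c y Y →
      card Y ≤ q * card ((E c x ∩ E c y) ∩ Y)
    common-neighbours c x y Y hx hy = ≤-trans half (*-monoˡ-≤ (card Z) (m≤m+n p (p + 0)))
      where
      open ≤-Reasoning
      Z : Subset n
      Z = (E c x ∩ E c y) ∩ Y
      Z⊒ : card ((E c x ∩ Y) ∩ (E c y ∩ Y)) ≤ card Z
      Z⊒ = card-mono λ i h →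
        let hx = ∩-⊑ˡ (E c x ∩ Y) (E c y ∩ Y) i h
            hy = ∩-⊑ʳ (E c x ∩ Y) (E c y ∩ Y) i h
        in ∧-intro (∧-intro (∩-⊑ˡ (E c x) Y i hx) (∩-⊑ˡ (E c y) Y i hy)) (∩-⊑ʳ (E c x) Y i hx)
      step : suc p * card Y + suc p * card Y ≤ q * (card Y + card Z)
      step = begin
        suc p * card Y + suc p * card Y             ≤⟨ +-mono-≤ hx hy ⟩
        q * deg c x Y + q * deg c y Y               ≡⟨ sym (*-distribˡ-+ q (deg c x Y) _) ⟩
        q * (deg c x Y + deg c y Y)                 ≤⟨ *-monoʳ-≤ q (≤-trans (card-∩ (∩-⊑ʳ (E c x) Y) (∩-⊑ʳ (E c y) Y)) (+-monoʳ-≤ (card Y) Z⊒)) ⟩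
        q * (card Y + card Z) ∎
      identity : ∀ p y z → 2 * y + 2 * p * (y + z) + 0 ≡ 2 * (p * z) + (suc p * y + suc p * y)
      identity = solve-∀
      half : card Y ≤ p * card Z
      half = *-cancelˡ-≤ 2 (by-identity step 0 (identity p (card Y) (card Z)))

    private
      -- At most five other slots each spoil at most a sixth of the candidates, so a sixth survives.
      -- This is the factor 6 in all later conditions on `g` and `K`.
      typical-share : ∀ {t x y w l} → 6 * t ≤ g → 1 ≤ g → l ≤ 5 → w ≤ t * x → g * x ≤ g * y + l * w → x ≤ 6 * y
      typical-share {t} {x} {y} {w} {l} 6t≤g g≥1 l≤5 w≤tx h =
        *-cancelˡ-≤ g {{>-nonZero g≥1}} (by-identity total 0 (id₁ g x y))
        where
        id₁ : ∀ g x y → g * x + (6 * (g * y) + 5 * (g * x)) + 0 ≡ g * (6 * y) + 6 * (g * x)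
        id₁ = solve-∀
        id₂ : ∀ z t x → 6 * (z + 5 * (t * x)) ≡ 6 * z + 5 * (6 * t * x)
        id₂ = solve-∀
        total : 6 * (g * x) ≤ 6 * (g * y) + 5 * (g * x)
        total = begin
          6 * (g * x)                     ≤⟨ *-monoʳ-≤ 6 h ⟩
          6 * (g * y + l * w)             ≤⟨ *-monoʳ-≤ 6 (+-monoʳ-≤ (g * y) (*-mono-≤ l≤5 w≤tx)) ⟩
          6 * (g * y + 5 * (t * x))       ≡⟨ id₂ (g * y) t x ⟩
          6 * (g * y) + 5 * (6 * t * x)   ≤⟨ +-monoʳ-≤ (6 * (g * y)) (*-monoʳ-≤ 5 (*-monoˡ-≤ x 6t≤g)) ⟩
          6 * (g * y) + 5 * (g * x) ∎
          where open ≤-Reasoning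

      size-bound : ∀ {t K w x y} → 1 ≤ t → 6 * t ≤ K → K * M ≤ w → w ≤ t * x → x ≤ 6 * y → M ≤ y
      size-bound {t} {K} {w} {x} {y} t≥1 hK hw hx hy = *-cancelˡ-≤ (6 * t) {{>-nonZero (≤-trans t≥1 (m≤m+n t _))}} (begin
        6 * t * M         ≤⟨ *-monoˡ-≤ M hK ⟩
        K * M             ≤⟨ hw ⟩
        w                 ≤⟨ hx ⟩
        t * x             ≤⟨ *-monoʳ-≤ t hy ⟩
        t * (6 * y)       ≡⟨ id₃ t y ⟩
        6 * t * y ∎)
        where
        open ≤-Reasoning
        id₃ : ∀ t x → t * (6 * x) ≡ 6 * t * x
        id₃ = solve-∀

    module _ (c : Bool) (K : ℕ) where

      private
        -- 1/t bounds the share of the current sets from below. Each of the ℓ remaining slots may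
        -- multiply `t` by `q`, so q ^ ℓ * t is reserved at the outset.
        Embeds : ℕ → Set
        Embeds ℓ = ∀ t ss → length ss ≡ ℓ → AllPairs (SlotDense c) ss → All (Usable c t K) ss → ℓ ≤ 6 →
          6 * (q ^ ℓ * t) ≤ g → 6 * (q ^ ℓ * t) ≤ K → 1 ≤ t → Embedded c ss

        module Step (ℓ : ℕ) (rec : Embeds ℓ) (t : ℕ) (s : Slot n) (ss : List (Slot n)) (len : length ss ≡ ℓ)
          (Ds : All (SlotDense c s) ss) (Dss : AllPairs (SlotDense c) ss) (u : Usable c t K s) (us : All (Usable c t K) ss)
          (ℓ<6 : suc ℓ ≤ 6) (hg : 6 * (q ^ suc ℓ * t) ≤ g) (hK : 6 * (q ^ suc ℓ * t) ≤ K) (t≥1 : 1 ≤ t) where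
          C : Subset n
          C = current s
          t≤6t : t ≤ 6 * t
          t≤6t = m≤m+n t _
          6t≤ : 6 * t ≤ 6 * (q ^ suc ℓ * t)
          6t≤ = *-monoʳ-≤ 6 (≤-trans (≤-reflexive (sym (*-identityˡ t)))
            (*-monoˡ-≤ t (≤-trans (≤-reflexive (sym (^-zeroˡ (suc ℓ)))) (^-monoˡ-≤ (suc ℓ) q≥1))))
          K≥1 : 1 ≤ K
          K≥1 = ≤-trans (≤-trans t≥1 t≤6t) (≤-trans 6t≤ hK)
          6t≤g : 6 * t ≤ g
          6t≤g = ≤-trans 6t≤ hg
          W≥1 : 1 ≤ card (whole s)
          W≥1 = ≤-trans (*-mono-≤ K≥1 M≥1) (large u)
          typ : ∃[ C′ ] C′ ⊑ C × (∀ x → x ∈ C′ → All (Rich c (level (double s)) x) ss) ×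
            g * card C ≤ g * card C′ + length ss * card (whole s)
          typ = typical c t K K≥1 (≤-trans t≤6t 6t≤g) (level (double s)) (whole s) C (inside u) W≥1 ss Ds us
          C′ : Subset n
          C′ = proj₁ typ
          C′⊑C : C′ ⊑ C
          C′⊑C = proj₁ (proj₂ typ)
          rich : ∀ d → double s ≡ d → ∀ x → x ∈ C′ → All (Rich c (level d) x) ss
          rich d refl = proj₁ (proj₂ (proj₂ typ))
          M≤C′ : M ≤ card C′
          M≤C′ = size-bound {t} t≥1 (≤-trans 6t≤ hK) (large u) (share u)
            (typical-share {t} 6t≤g (≤-trans t≥1 (≤-trans t≤6t 6t≤g)) (≤-trans (≤-reflexive len) (s≤s⁻¹ ℓ<6)) (share u) (proj₂ (proj₂ (proj₂ typ))))
          reorder : 6 * (q ^ ℓ * (t * q)) ≡ 6 * (q ^ suc ℓ * t)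
          reorder = id₄ (q ^ ℓ) t q
            where
            id₄ : ∀ e t q → 6 * (e * (t * q)) ≡ 6 * (q * e * t)
            id₄ = solve-∀
          recurse : ∀ N → All (λ s′ → card (current s′) ≤ q * card (N ∩ current s′)) ss → Embedded c (map (restrict N) ss)
          recurse N h = rec (t * q) (map (restrict N) ss) (trans (length-map (restrict N) ss) len) (AllPairs.map⁺ Dss)
            (All.map⁺ (All.zipWith (λ (h , u) → restrict-usable N h u) (h , us)))
            (≤-trans (n≤1+n ℓ) ℓ<6) (≤-trans (≤-reflexive reorder) hg) (≤-trans (≤-reflexive reorder) hK) (*-mono-≤ t≥1 q≥1)
          single : double s ≡ false → ∃[ x ] x ∈ C′ → Embedded c (s ∷ ss)
          single eq (x , x∈) = extend-single x eq (C′⊑C x x∈)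
            (recurse (E c x) (All.map (λ r → ≤-trans (≤-reflexive (sym (*-identityˡ _))) r) (rich false eq x x∈)))
          doubled : double s ≡ true → (∃₂ λ x y → x ∈ C′ × y ∈ C′ × E c x y ≡ true) → Embedded c (s ∷ ss)
          doubled eq (x , y , x∈ , y∈ , xy) = extend-double x y eq (C′⊑C x x∈) (C′⊑C y y∈) xy
            (recurse (E c x ∩ E c y) (All.zipWith (λ {s′} (r , r′) → common-neighbours c x y (current s′) r r′)
              (rich true eq x x∈ , rich true eq y y∈)))
          result : Embedded c (s ∷ ss)
          result = [ (λ eq → doubled eq (edge-in c C′ (λ i i∈ → typed u eq i (C′⊑C i i∈)) M≤C′)) ,
                     (λ eq → single eq (card-positive C′ (≤-trans M≥1 M≤C′))) ]′ (bool-cases (double s))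

        embeds : ∀ ℓ → Embeds ℓ
        embeds zero t [] _ _ _ _ _ _ _ = [] , refl , [] , (λ _ _ → [])
        embeds (suc ℓ) t (s ∷ ss) len (Ds ∷ Dss) (u ∷ us) ℓ<6 hg hK t≥1 =
          Step.result ℓ (embeds ℓ) t s ss (suc-injective len) Ds Dss u us ℓ<6 hg hK t≥1

      embed : ∀ t ss → AllPairs (SlotDense c) ss → All (Usable c t K) ss → length ss ≤ 6 →
        6 * (q ^ length ss * t) ≤ g → 6 * (q ^ length ss * t) ≤ K → 1 ≤ t → Embedded c ss
      embed t ss = embeds (length ss) t ss refl


open CliqueEmbedding

-- Configurations of labelled clusters and their realisations in the graph.

module Configurations where
  open import Data.Bool using (Bool; true; false; _∧_; if_then_else_)
  open import Data.Empty using (⊥; ⊥-elim)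
  open import Data.Fin using (zero; suc)
  open import Data.List using (List; []; _∷_; length; map)
  open import Data.List.Relation.Unary.All using (All; []; _∷_)
  open import Data.List.Relation.Unary.AllPairs using (AllPairs; []; _∷_)
  open import Data.Maybe using (Maybe; just; nothing)
  open import Data.Nat hiding (_≟_)
  open import Data.Nat.Properties hiding (_≟_)
  open import Data.Product using (_×_; _,_)
  open import Data.Unit using (⊤; tt)
  open import Relation.Binary.PropositionalEquality

  -- How a cluster Y sees a cluster X: blue edges hereditarily of positive density
  -- (half) or of density above 1/2 (full), red edges of positive density (red).
  data Label : Set where
    none half full red : Label

  -- A configuration lists its clusters; each carries its kind (nothing: any kind)
  -- and the labels towards the clusters further down the list.
  Config : Set
  Config = List (Maybe Bool × List Label)

  nth : List Label → ℕ → Label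
  nth [] _ = none
  nth (l ∷ ls) zero = l
  nth (l ∷ ls) (suc i) = nth ls i

  label : Config → ℕ → ℕ → Label
  label [] _ _ = none
  label (_ ∷ _) zero zero = none
  label ((_ , ls) ∷ c) zero (suc j) = nth ls j
  label ((_ , ls) ∷ c) (suc i) zero = nth ls i
  label (_ ∷ c) (suc i) (suc j) = label c i j

  kindAt : Config → ℕ → Maybe (Maybe Bool)
  kindAt [] _ = nothing
  kindAt ((k , _) ∷ c) zero = just k
  kindAt (_ ∷ c) (suc i) = kindAt c i

  covers : Label → Label → Bool
  covers _ none = true
  covers half half = true
  covers full half = true
  covers full full = true
  covers red red = true
  covers _ _ = false

  coversKind : Maybe (Maybe Bool) → Maybe Bool → Bool
  coversKind nothing _ = false
  coversKind (just _) nothing = true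
  coversKind (just (just true)) (just true) = true
  coversKind (just (just false)) (just false) = true
  coversKind (just _) (just _) = false

  labelsFit : Config → ℕ → List Label → List ℕ → Bool
  labelsFit c i [] _ = true
  labelsFit c i (_ ∷ _) [] = false
  labelsFit c i (l ∷ ls) (j ∷ js) = covers (label c i j) l ∧ labelsFit c i ls js

  contains : Config → Config → List ℕ → Bool
  contains c [] [] = true
  contains c [] (_ ∷ _) = false
  contains c (_ ∷ _) [] = false
  contains c ((k , ls) ∷ d) (i ∷ is) = coversKind (kindAt c i) k ∧ labelsFit c i ls is ∧ contains c d is

  slotConfig : Bool → List Bool → Config
  slotConfig c [] = []
  slotConfig c (d ∷ ds) = ((if d then just c else nothing) , map (λ _ → if c then red else if d then full else half) ds) ∷ slotConfig c ds

  slotWeight : List Bool → ℕ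
  slotWeight [] = 0
  slotWeight (d ∷ ds) = (if d then 2 else 1) + slotWeight ds

  -- Red labels promise only positive density, so a red double slot must come last. In blue any
  -- order is fine, because `slotConfig` demands `full` after a double slot.
  allowed : Bool → List Bool → Bool
  allowed true (true ∷ _ ∷ _) = false
  allowed true (_ ∷ ds) = allowed true ds
  allowed _ _ = true

  module Realisation (p : ℕ) (p≥1 : 1 ≤ p) {n : ℕ} (S : Setting n) (U : Subset n) where
    open Setting S
    open Degrees E E-sym

    q : ℕ
    q = 2 * p

    Related : ℕ → Label → Subset n → Subset n → Set
    Related g none X Y = ⊤
    Related g half X Y = Dense q g 1 false X Y
    Related g full X Y = Dense q g (suc p) false X Y
    Related g red X Y = Dense q g 1 true X Y

    RelatedAll : ℕ → Subset n → List Label → List (Subset n) → Set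
    RelatedAll g X [] _ = ⊤
    RelatedAll g X (_ ∷ _) [] = ⊥
    RelatedAll g X (l ∷ ls) (Y ∷ Ys) = Related g l X Y × RelatedAll g X ls Ys

    OfKind : Maybe Bool → Subset n → Set
    OfKind nothing X = ⊤
    OfKind (just k) X = ∀ i → i ∈ X → kind i ≡ k

    Cluster : ℕ → Maybe Bool → Subset n → Set
    Cluster s k X = X ⊑ U × card U ≤ s * card X × OfKind k X

    -- `g` is the depth to which densities are inherited, and every cluster has at least a 1/s share
    -- of `U`.
    Realised : ℕ → ℕ → Config → List (Subset n) → Set
    Realised g s [] [] = ⊤
    Realised g s [] (_ ∷ _) = ⊥
    Realised g s (_ ∷ _) [] = ⊥
    Realised g s ((k , ls) ∷ c) (X ∷ Xs) = Cluster s k X × RelatedAll g X ls Xs × Realised g s c Xs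

    at : List (Subset n) → ℕ → Subset n
    at [] _ _ = false
    at (X ∷ Xs) zero = X
    at (X ∷ Xs) (suc i) = at Xs i

    Related-sym : ∀ {g} l {X Y} → Related g l X Y → Related g l Y X
    Related-sym none r = tt
    Related-sym half r = Dense-sym r
    Related-sym full r = Dense-sym r
    Related-sym red r = Dense-sym r

    Related-⊑ : ∀ {g h k} l {X Y X′ Y′} → X′ ⊑ X → Y′ ⊑ Y → card X ≤ k * card X′ → card Y ≤ k * card Y′ → k * h ≤ g →
      Related g l X Y → Related h l X′ Y′
    Related-⊑ none _ _ _ _ _ _ = tt
    Related-⊑ {k = k} half a b c d e = Dense-⊑ {k = k} a b c d e
    Related-⊑ {k = k} full a b c d e = Dense-⊑ {k = k} a b c d e
    Related-⊑ {k = k} red a b c d e = Dense-⊑ {k = k} a b c d e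

    related-covers : ∀ {g} l l′ {X Y} → covers l l′ ≡ true → Related g l X Y → Related g l′ X Y
    related-covers none none _ r = r
    related-covers half none _ r = tt
    related-covers full none _ r = tt
    related-covers red none _ r = tt
    related-covers half half _ r = r
    related-covers full half _ D = dense λ X Y hX hY cX cY → ≤-trans (*-monoˡ-≤ (card X * card Y) {1} {suc p} (s≤s z≤n)) (spans D X Y hX hY cX cY)
    related-covers full full _ r = r
    related-covers red red _ r = r

    related-nth : ∀ {g X} ls Xs → RelatedAll g X ls Xs → ∀ j → Related g (nth ls j) X (at Xs j)
    related-nth [] Xs _ j = tt
    related-nth (l ∷ ls) (X ∷ Xs) (r , rs) zero = r
    related-nth (l ∷ ls) (X ∷ Xs) (r , rs) (suc j) = related-nth ls Xs rs j

    related-at : ∀ {g s} c Xs → Realised g s c Xs → ∀ i j → Related g (label c i j) (at Xs i) (at Xs j)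
    related-at [] _ _ i j = tt
    related-at (_ ∷ c) (X ∷ Xs) r zero zero = tt
    related-at ((_ , ls) ∷ c) (X ∷ Xs) (_ , rs , _) zero (suc j) = related-nth ls Xs rs j
    related-at ((_ , ls) ∷ c) (X ∷ Xs) (_ , rs , _) (suc i) zero = Related-sym (nth ls i) {X} {at Xs i} (related-nth ls Xs rs i)
    related-at (_ ∷ c) (X ∷ Xs) (_ , _ , r) (suc i) (suc j) = related-at c Xs r i j

    cluster-covers : ∀ {g s} c Xs → Realised g s c Xs → ∀ i k → coversKind (kindAt c i) k ≡ true → Cluster s k (at Xs i)
    cluster-covers ((k′ , _) ∷ c) (X ∷ Xs) ((X⊑U , size , typed) , _) zero k h = X⊑U , size , weaken k′ k h typed
      where
      weaken : ∀ k′ k → coversKind (just k′) k ≡ true → OfKind k′ X → OfKind k X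
      weaken k′ nothing _ _ = tt
      weaken (just true) (just true) _ t = t
      weaken (just false) (just false) _ t = t
    cluster-covers (_ ∷ c) (X ∷ Xs) (_ , _ , r) (suc i) k h = cluster-covers c Xs r i k h

    subconfig : ∀ {g s} c d is Xs → contains c d is ≡ true → Realised g s c Xs → Realised g s d (map (at Xs) is)
    subconfig c [] [] Xs h r = tt
    subconfig {g} c ((k , ls) ∷ d) (i ∷ is) Xs h r =
      cluster-covers c Xs r i k (∧-fst h) ,
      relate ls is (∧-fst (∧-snd {coversKind (kindAt c i) k} h)) ,
      subconfig c d is Xs (∧-snd {labelsFit c i ls is} (∧-snd {coversKind (kindAt c i) k} h)) r
      where
      relate : ∀ ls is → labelsFit c i ls is ≡ true → RelatedAll g (at Xs i) ls (map (at Xs) is)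
      relate [] is h = tt
      relate (l ∷ ls) (j ∷ is) h = related-covers (label c i j) l {at Xs i} {at Xs j} (∧-fst h) (related-at c Xs r i j) ,
        relate ls is (∧-snd {covers (label c i j) l} h)

    slots : List Bool → List (Subset n) → List (Slot n)
    slots (d ∷ ds) (X ∷ Xs) = slot X X d ∷ slots ds Xs
    slots _ _ = []

    share-cancel : ∀ {s x y u} → 1 ≤ u → s * x ≤ u → u ≤ s * y → x ≤ y
    share-cancel {zero} u≥1 _ h = ⊥-elim (<⇒≱ u≥1 h)
    share-cancel {suc s} _ h h′ = *-cancelˡ-≤ (suc s) (≤-trans h h′)

    module Forbidden (g s : ℕ) (c : Bool) (K : ℕ) (U≥1 : 1 ≤ card U) (hK : s * (K * M) ≤ card U) where

      slots-length : ∀ ds Xs → Realised g s (slotConfig c ds) Xs → length (slots ds Xs) ≡ length ds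
      slots-length [] Xs r = refl
      slots-length (d ∷ ds) (X ∷ Xs) (_ , _ , r) = cong suc (slots-length ds Xs r)

      slots-weight : ∀ ds Xs → Realised g s (slotConfig c ds) Xs → weight (slots ds Xs) ≡ slotWeight ds
      slots-weight [] Xs r = refl
      slots-weight (d ∷ ds) (X ∷ Xs) (_ , _ , r) = cong ((if d then 2 else 1) +_) (slots-weight ds Xs r)

      usable : ∀ ds Xs → Realised g s (slotConfig c ds) Xs → All (Embedding.Usable S p g p≥1 c 1 K) (slots ds Xs)
      usable [] Xs r = []
      usable (d ∷ ds) (X ∷ Xs) ((X⊑U , size , typed) , _ , r) = record
        { inside = ⊑-refl {X = X} ; share = ≤-reflexive (sym (*-identityˡ _))
        ; large = share-cancel {s} U≥1 hK size ; typed = ofKind d typed } ∷ usable ds Xs r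
        where
        ofKind : ∀ d → OfKind (if d then just c else nothing) X → d ≡ true → ∀ i → i ∈ X → kind i ≡ c
        ofKind true t refl = t

      related-slots : ∀ d d′ ds Xs X → allowed c (d ∷ d′ ∷ ds) ≡ true → ∀ ds →
        RelatedAll g X (map (λ _ → if c then red else if d then full else half) ds) Xs →
        All (Embedding.SlotDense S p g p≥1 c (slot X X d)) (slots ds Xs)
      related-slots d d′ ds₀ Xs X ok [] rs = []
      related-slots d d′ ds₀ (Y ∷ Xs) X ok (e ∷ ds) (r , rs) = convert c d ok r ∷ related-slots d d′ ds₀ Xs X ok ds rs
        where
        convert : ∀ c d → allowed c (d ∷ d′ ∷ ds₀) ≡ true → Related g (if c then red else if d then full else half) X Y →
          Embedding.SlotDense S p g p≥1 c (slot X X d) (slot Y Y e)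
        convert true true ()
        convert true false _ r = r
        convert false true _ r = r
        convert false false _ r = r

      pairs : ∀ ds Xs → allowed c ds ≡ true → Realised g s (slotConfig c ds) Xs → AllPairs (Embedding.SlotDense S p g p≥1 c) (slots ds Xs)
      pairs [] Xs ok r = []
      pairs (d ∷ []) (X ∷ []) ok (_ , rs , r) = [] ∷ []
      pairs (d ∷ d′ ∷ ds) (X ∷ Xs) ok (_ , rs , r) = related-slots d d′ ds Xs X ok (d′ ∷ ds) rs ∷ pairs (d′ ∷ ds) Xs (tail c d ok) r
        where
        tail : ∀ c d → allowed c (d ∷ d′ ∷ ds) ≡ true → allowed c (d′ ∷ ds) ≡ true
        tail true false h = h
        tail false d h = refl

    -- Every contradiction of the search arises here: slots whose weight equals the clique limit
    -- would embed a forbidden clique.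
    forbidden : ∀ {g s} c ds Xs → allowed c ds ≡ true → slotWeight ds ≡ cliqueLimit c → length ds ≤ 6 → 6 * q ^ length ds ≤ g →
      1 ≤ card U → s * (6 * q ^ length ds * M) ≤ card U → Realised g s (slotConfig c ds) Xs → ⊥
    forbidden {g} {s} c ds Xs ok hw len hg U≥1 hK r =
      let (xs , lenxs , adj , _) = Embedding.embed S p g p≥1 c K 1 (slots ds Xs) (pairs ds Xs ok r) (usable ds Xs r)
            (subst (_≤ 6) (sym (slots-length ds Xs r)) len)
            (subst (λ l → 6 * (q ^ l * 1) ≤ g) (sym (slots-length ds Xs r)) (≤-trans (≤-reflexive one) hg))
            (subst (λ l → 6 * (q ^ l * 1) ≤ K) (sym (slots-length ds Xs r)) (≤-reflexive one)) ≤-refl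
      in no-clique c xs adj (trans lenxs (trans (slots-weight ds Xs r) hw))
      where
      K : ℕ
      K = 6 * q ^ length ds
      open Forbidden g s c K U≥1 hK
      one : 6 * (q ^ length ds * 1) ≡ K
      one = cong (6 *_) (*-identityʳ (q ^ length ds))


open Configurations

-- Extending a weighted configuration by a cluster of large weighted density.

module NewClusters where
  open import Data.Bool using (Bool; true; false; _∧_; _∨_; not; if_then_else_)
  open import Data.Empty using (⊥; ⊥-elim)
  open import Data.Fin using (Fin; zero; suc)
  open import Data.List using (List; []; _∷_; length; map)
  open import Data.List.Relation.Unary.All using (All; []; _∷_)
  open import Data.Maybe using (just; nothing)
  open import Data.Nat hiding (_≟_)
  open import Data.Nat.Properties hiding (_≟_)
  open import Data.Nat.Tactic.RingSolver using (solve-∀)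
  open import Data.Product using (_×_; _,_; proj₁; proj₂; ∃-syntax)
  open import Data.Sum using (inj₁; inj₂)
  open import Data.Unit using (⊤; tt)
  open import Relation.Binary.PropositionalEquality
  open import Algebra.Properties.CommutativeMonoid.Sum +-0-commutativeMonoid using (sum-cong-≗)

  -- Entries: weight, kind of the cluster, labels towards the later clusters.
  State : Set
  State = List (ℕ × Bool × List Label)

  config : State → Config
  config = map λ (_ , k , ls) → just k , ls

  totalWeight : State → ℕ
  totalWeight [] = 0
  totalWeight ((w , _) ∷ st) = w + totalWeight st

  -- Twice the density guaranteed by a label; the flag tells that both clusters are of blue kind.
  value : Bool → Label → ℕ
  value _ none = 0
  value true half = 1
  value false half = 2
  value _ full = 2
  value _ red = 2

  -- Twice a weighted sum of densities: weighted density 5/6 reads 5 * totalWeight ≤ 3 * score.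
  score : Bool → State → List Label → ℕ
  score k ((w , t , _) ∷ st) (l ∷ ls) = w * value (not k ∧ not t) l + score k st ls
  score k _ _ = 0

  plausible : Bool → State → List Label → Bool
  plausible k ((_ , t , _) ∷ st) (full ∷ ls) = not k ∧ not t ∧ plausible k st ls
  plausible k (_ ∷ st) (_ ∷ ls) = plausible k st ls
  plausible k _ _ = true

  value≤2 : ∀ b l → value b l ≤ 2
  value≤2 b none = z≤n
  value≤2 true half = s≤s z≤n
  value≤2 false half = ≤-refl
  value≤2 b full = ≤-refl
  value≤2 b red = ≤-refl

  score≤ : ∀ k st ls → score k st ls ≤ 2 * totalWeight st
  score≤ k [] ls = z≤n
  score≤ k (_ ∷ st) [] = z≤n
  score≤ k ((w , t , _) ∷ st) (l ∷ ls) = ≤-trans (+-mono-≤ (*-monoʳ-≤ w (value≤2 (not k ∧ not t) l)) (score≤ k st ls))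
    (≤-reflexive (identity w (totalWeight st)))
    where
    identity : ∀ w t → w * 2 + 2 * t ≡ 2 * (w + t)
    identity = solve-∀

  sameLabel : Label → Label → Bool
  sameLabel none none = true
  sameLabel half half = true
  sameLabel full full = true
  sameLabel red red = true
  sameLabel _ _ = false

  sameLabel⇒≡ : ∀ l l′ → sameLabel l l′ ≡ true → l ≡ l′
  sameLabel⇒≡ none none _ = refl
  sameLabel⇒≡ half half _ = refl
  sameLabel⇒≡ full full _ = refl
  sameLabel⇒≡ red red _ = refl

  pigeonhole₂ : ∀ {n} (Y Z : Subset n) → ∃[ b ] card Y ≤ 2 * card (Y ∩ λ y → if b then Z y else not (Z y))
  pigeonhole₂ Y Z with ≤-total (card (Y ∩ Z)) (card (Y ∖ Z))
  ... | inj₁ h = false , ≤-trans (≤-reflexive (card-split Y Z)) (≤-trans (+-monoˡ-≤ _ h) (≤-reflexive (cong (card (Y ∖ Z) +_) (sym (+-identityʳ _)))))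
  ... | inj₂ h = true , ≤-trans (≤-reflexive (card-split Y Z)) (≤-trans (+-monoʳ-≤ _ h) (≤-reflexive (cong (card (Y ∩ Z) +_) (sym (+-identityʳ _)))))

  pigeonhole₄ : ∀ {n} (Y : Subset n) (f : Fin n → Label) → ∃[ l ] card Y ≤ 4 * card (Y ∩ λ y → sameLabel l (f y))
  pigeonhole₄ {n} Y f = split (pigeonhole₂ Y strong)
    where
    strong : Subset n
    strong y = sameLabel red (f y) ∨ sameLabel full (f y)
    side : Bool → Subset n → Subset n
    side b Z = Y ∩ λ y → if b then Z y else not (Z y)
    class : Label → Subset n
    class l = Y ∩ λ y → sameLabel l (f y)
    chain : ∀ X Z l → card Y ≤ 2 * card X → card X ≤ 2 * card Z → Z ⊑ class l → ∃[ l ] card Y ≤ 4 * card (class l)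
    chain X Z l h h₁ h₂ = l , ≤-trans h (≤-trans (*-monoʳ-≤ 2 (≤-trans h₁ (*-monoʳ-≤ 2 (card-mono h₂)))) (≤-reflexive (sym (*-assoc 2 2 (card (class l))))))
    not-red : ∀ l → sameLabel red l ∨ sameLabel full l ≡ true → not (sameLabel red l) ≡ true → sameLabel full l ≡ true
    not-red full _ _ = refl
    not-half : ∀ l → not (sameLabel red l ∨ sameLabel full l) ≡ true → not (sameLabel half l) ≡ true → sameLabel none l ≡ true
    not-half none _ _ = refl
    split : ∃[ b ] card Y ≤ 2 * card (side b strong) → ∃[ l ] card Y ≤ 4 * card (class l)
    split (true , h) with pigeonhole₂ (side true strong) (λ y → sameLabel red (f y))
    ... | true , h₁ = chain (side true strong) (side true strong ∩ λ y → sameLabel red (f y)) red h h₁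
      λ y y∈ → ∧-intro (∧-fst {Y y} (∧-fst y∈)) (∧-snd {side true strong y} y∈)
    ... | false , h₁ = chain (side true strong) (side true strong ∩ λ y → not (sameLabel red (f y))) full h h₁
      λ y y∈ → ∧-intro (∧-fst {Y y} (∧-fst y∈)) (not-red (f y) (∧-snd {Y y} (∧-fst y∈)) (∧-snd {side true strong y} y∈))
    split (false , h) with pigeonhole₂ (side false strong) (λ y → sameLabel half (f y))
    ... | true , h₁ = chain (side false strong) (side false strong ∩ λ y → sameLabel half (f y)) half h h₁
      λ y y∈ → ∧-intro (∧-fst {Y y} (∧-fst y∈)) (∧-snd {side false strong y} y∈)
    ... | false , h₁ = chain (side false strong) (side false strong ∩ λ y → not (sameLabel half (f y))) none h h₁
      λ y y∈ → ∧-intro (∧-fst {Y y} (∧-fst y∈)) (not-half (f y) (∧-snd {Y y} (∧-fst y∈)) (∧-snd {side false strong y} y∈))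

  module Losses (p : ℕ) (p≥1 : 1 ≤ p) where
    private
      q : ℕ
      q = 2 * p

    q≥1 : 1 ≤ q
    q≥1 = ≤-trans p≥1 (m≤m+n p _)

    loss : ℕ → ℕ
    loss g = (q * g) ^ (q * g)

    -- Densifying against the remaining clusters shrinks the new cluster once more, by the factor
    -- `lossAll k g`. The first pair is therefore prepared with depth `lossAll k g * g`, so that
    -- depth `g` is left.
    lossAll : ℕ → ℕ → ℕ
    lossAll zero g = 1
    lossAll (suc k) g = loss (lossAll k g * g) * lossAll k g

    lossAll≥1 : ∀ k {g} → 1 ≤ g → 1 ≤ lossAll k g
    lossAll≥1 zero g≥1 = ≤-refl
    lossAll≥1 (suc k) {g} g≥1 = *-mono-≤ (≤-trans (≤-reflexive (sym (^-zeroˡ e))) (^-monoˡ-≤ e (*-mono-≤ q≥1 (*-mono-≤ (lossAll≥1 k g≥1) g≥1)))) (lossAll≥1 k g≥1)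
      where
      e : ℕ
      e = q * (lossAll k g * g)

    -- One factor for each thinning in `extend`: heavy vertices, one kind, one list of labels,
    -- densification.
    newShare : State → ℕ → ℕ
    newShare st g = (2 + 2 * totalWeight st) * (2 * (4 ^ length st * lossAll (length st) g))

  module Extension (p : ℕ) (p≥2 : 2 ≤ p) {n : ℕ} (S : Setting n) (U : Subset n) where
    open Setting S
    open Degrees E E-sym

    p≥1 : 1 ≤ p
    p≥1 = ≤-trans (s≤s z≤n) p≥2

    open Realisation p p≥1 S U
    open Losses p p≥1

    total : Fin n → Subset n → ℕ
    total v X = deg true v X + deg false v X

    total≤card : ∀ v X → total v X ≤ card X
    total≤card v X = begin
      card (E true v ∩ X) + card (E false v ∩ X)   ≤⟨ +-mono-≤ (card-mono (λ i h → ∧-intro (∧-snd {E true v i} h) (∧-fst h)))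
                                                        (card-mono (λ i h → ∧-intro (∧-snd {E false v i} h) (not-false (blue i (∧-fst h))))) ⟩
      card (X ∩ E true v) + card (X ∖ E true v)    ≡⟨ sym (card-split X (E true v)) ⟩
      card X ∎
      where
      open ≤-Reasoning
      blue : ∀ i → E false v i ≡ true → E true v i ≡ false
      blue i h with E true v i in eq
      ... | false = refl
      ... | true = ⊥-elim (true≢false h (disjoint v i eq))

    total-swap : ∀ X Y → sumOver X (λ x → total x Y) ≡ sumOver Y (λ y → total y X)
    total-swap X Y = trans (sumOver-+ X (λ x → deg true x Y) (λ x → deg false x Y))
      (trans (cong₂ _+_ (edgesBetween-sym true X Y) (edgesBetween-sym false X Y))
        (sym (sumOver-+ Y (λ y → deg true y X) (λ y → deg false y X))))

    -- The thresholds 3 = 1 + 2 and 3 + p = (p + 1) + 2 lie two units of 1/q above the densities to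
    -- be produced, which is the gap that `densify` consumes.
    labelFor : Bool → ℕ → ℕ → ℕ → Label
    labelFor both r b m =
      if 3 * m ≤ᵇ q * r then red else
      if both ∧ ((3 + p) * m ≤ᵇ q * b) then full else
      if 3 * m ≤ᵇ q * b then half else none

    -- A label accounts for all of the density except 6/q: a colour below its threshold contributes
    -- at most 3/q, and when `full` is refused between blue kinds, the blue density is below 1/2 +
    -- 3/q.
    labelFor-value : ∀ both r b m → r + b ≤ m → q * (r + b) ≤ (p * value both (labelFor both r b m) + 6) * m
    labelFor-value both r b m h with 3 * m ≤ᵇ q * r in eᵣ
    ... | true = all
      where
      all : q * (r + b) ≤ (p * 2 + 6) * m
      all = ≤-trans (*-monoʳ-≤ q h) (*-monoˡ-≤ m (≤-trans (≤-reflexive (*-comm 2 p)) (m≤m+n (p * 2) 6)))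
    ... | false with both
    ...   | true with (3 + p) * m ≤ᵇ q * b in e_f
    ...     | true = ≤-trans (*-monoʳ-≤ q h) (*-monoˡ-≤ m (≤-trans (≤-reflexive (*-comm 2 p)) (m≤m+n (p * 2) 6)))
    ...     | false with 3 * m ≤ᵇ q * b in e_b
    ...       | true = ≤-trans (≤-reflexive (*-distribˡ-+ q r b)) (≤-trans (+-mono-≤ (<⇒≤ (≤ᵇ-false {3 * m} {q * r} eᵣ)) (<⇒≤ (≤ᵇ-false {(3 + p) * m} {q * b} e_f))) (≤-reflexive (id₁ p m)))
      where
      id₁ : ∀ p m → 3 * m + (3 + p) * m ≡ (p * 1 + 6) * m
      id₁ = solve-∀
    ...       | false = ≤-trans (≤-reflexive (*-distribˡ-+ q r b)) (≤-trans (+-mono-≤ (<⇒≤ (≤ᵇ-false {3 * m} {q * r} eᵣ)) (<⇒≤ (≤ᵇ-false {3 * m} {q * b} e_b))) (≤-reflexive (id₂ p m)))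
      where
      id₂ : ∀ p m → 3 * m + 3 * m ≡ (p * 0 + 6) * m
      id₂ = solve-∀
    labelFor-value both r b m h | false | false with 3 * m ≤ᵇ q * b in e_b
    ... | true = ≤-trans (*-monoʳ-≤ q h) (*-monoˡ-≤ m (≤-trans (≤-reflexive (*-comm 2 p)) (m≤m+n (p * 2) 6)))
    ... | false = ≤-trans (≤-reflexive (*-distribˡ-+ q r b)) (≤-trans (+-mono-≤ (<⇒≤ (≤ᵇ-false {3 * m} {q * r} eᵣ)) (<⇒≤ (≤ᵇ-false {3 * m} {q * b} e_b))) (≤-reflexive (id₂ p m)))
      where
      id₂ : ∀ p m → 3 * m + 3 * m ≡ (p * 0 + 6) * m
      id₂ = solve-∀

    Rich : Label → Fin n → Subset n → Set
    Rich none y X = ⊤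
    Rich half y X = 3 * card X ≤ q * deg false y X
    Rich full y X = (3 + p) * card X ≤ q * deg false y X
    Rich red y X = 3 * card X ≤ q * deg true y X

    labelOf : Fin n → Bool → Subset n → Label
    labelOf y t X = labelFor (not (kind y) ∧ not t) (deg true y X) (deg false y X) (card X)

    labelOf-rich : ∀ y t X → Rich (labelOf y t X) y X
    labelOf-rich y t X with 3 * card X ≤ᵇ q * deg true y X in eᵣ
    ... | true = ≤ᵇ-true {3 * card X} {q * deg true y X} eᵣ
    ... | false with not (kind y) ∧ not t
    ...   | true with (3 + p) * card X ≤ᵇ q * deg false y X in e_f
    ...     | true = ≤ᵇ-true {(3 + p) * card X} {q * deg false y X} e_f
    ...     | false with 3 * card X ≤ᵇ q * deg false y X in e_b
    ...       | true = ≤ᵇ-true {3 * card X} {q * deg false y X} e_b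
    ...       | false = tt
    labelOf-rich y t X | false | false with 3 * card X ≤ᵇ q * deg false y X in e_b
    ... | true = ≤ᵇ-true {3 * card X} {q * deg false y X} e_b
    ... | false = tt

    MinDegree : Set
    MinDegree = ∀ v → v ∈ U → 5 * p * card U ≤ 6 * p * total v U + card U

    labelsTo : Fin n → State → List (Subset n) → List Label
    labelsTo y ((_ , t , _) ∷ st) (X ∷ Xs) = labelOf y t X ∷ labelsTo y st Xs
    labelsTo y _ _ = []

    module _ (mindeg : MinDegree) where

      -- Edges between `X` and `U` are counted from both sides: from `X` by the degree condition,
      -- from `U` by `labelFor-value`. The error 19 is 3 * 6 from the labels and 1 from the degrees.
      value-sum : ∀ t X → X ⊑ U → 1 ≤ card X →
        5 * p * card U ≤ 3 * p * sumOver U (λ y → value (not (kind y) ∧ not t) (labelOf y t X)) + 19 * card U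
      value-sum t X X⊑U X≥1 = *-cancelˡ-≤ m {{>-nonZero X≥1}} (begin
        m * (5 * p * u)                                                     ≤⟨ sumOver-≥ X (λ x x∈ → mindeg x (X⊑U x x∈)) ⟩
        sumOver X (λ x → 6 * p * total x U + u)                             ≡⟨ sumOver-+ X (λ x → 6 * p * total x U) (λ _ → u) ⟩
        sumOver X (λ x → 6 * p * total x U) + sumOver X (λ _ → u)           ≤⟨ +-mono-≤ (≤-reflexive (trans (sumOver-* X (6 * p) (λ x → total x U)) (cong (6 * p *_) (total-swap X U)))) (sumOver-≤ X (λ _ _ → ≤-refl)) ⟩
        6 * p * D + m * u                                                   ≡⟨ cong (_+ m * u) (id₁ p D) ⟩
        3 * (q * D) + m * u                                                 ≤⟨ +-monoˡ-≤ (m * u) (*-monoʳ-≤ 3 upper) ⟩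
        3 * ((p * W + 6 * u) * m) + m * u                                   ≡⟨ id₂ p W u m ⟩
        m * (3 * p * W + 19 * u) ∎)
        where
        open ≤-Reasoning
        m u D W : ℕ
        m = card X
        u = card U
        D = sumOver U (λ y → total y X)
        val : Fin n → ℕ
        val y = value (not (kind y) ∧ not t) (labelOf y t X)
        W = sumOver U val
        id₁ : ∀ p D → 6 * p * D ≡ 3 * (2 * p * D)
        id₁ = solve-∀
        id₂ : ∀ p W u m → 3 * ((p * W + 6 * u) * m) + m * u ≡ m * (3 * p * W + 19 * u)
        id₂ = solve-∀
        id₃ : ∀ m p v → (p * v + 6) * m ≡ m * (p * v) + m * 6
        id₃ = solve-∀
        id₄ : ∀ m p W u → m * (p * W) + m * (u * 6) ≡ (p * W + 6 * u) * m
        id₄ = solve-∀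
        upper : q * D ≤ (p * W + 6 * u) * m
        upper = begin
          q * D                                                   ≡⟨ sym (sumOver-* U q (λ y → total y X)) ⟩
          sumOver U (λ y → q * total y X)                         ≤⟨ sumOver-mono U (λ y _ → ≤-trans (labelFor-value (not (kind y) ∧ not t) _ _ m (total≤card y X)) (≤-reflexive (id₃ m p (val y)))) ⟩
          sumOver U (λ y → m * (p * val y) + m * 6)               ≡⟨ sumOver-+ U (λ y → m * (p * val y)) (λ _ → m * 6) ⟩
          sumOver U (λ y → m * (p * val y)) + sumOver U (λ _ → m * 6) ≤⟨ +-mono-≤
              (≤-reflexive (trans (sumOver-* U m (λ y → p * val y)) (cong (m *_) (sumOver-* U p val))))
              (≤-trans (≤-reflexive (sumOver-* U m (λ _ → 6))) (*-monoʳ-≤ m (sumOver-≤ U {λ _ → 6} (λ _ _ → ≤-refl)))) ⟩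
          m * (p * W) + m * (u * 6)                               ≡⟨ id₄ m p W u ⟩
          (p * W + 6 * u) * m ∎

      score-sum : ∀ {g s} st Xs → 1 ≤ card U → Realised g s (config st) Xs →
        5 * p * card U * totalWeight st ≤ 3 * p * sumOver U (λ y → score (kind y) st (labelsTo y st Xs)) + 19 * card U * totalWeight st
      score-sum [] [] _ _ = ≤-trans (≤-reflexive (*-zeroʳ (5 * p * card U))) z≤n
      score-sum {s = s} ((w , t , _) ∷ st) (X ∷ Xs) U≥1 ((X⊑U , size , _) , _ , r) = begin
        5 * p * u * (w + T)                                     ≡⟨ id₁ (5 * p * u) w T ⟩
        w * (5 * p * u) + 5 * p * u * T                         ≤⟨ +-mono-≤ (*-monoʳ-≤ w (value-sum t X X⊑U X≥1)) (score-sum st Xs U≥1 r) ⟩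
        w * (3 * p * V + 19 * u) + (3 * p * R + 19 * u * T)     ≡⟨ id₂ w p V u R T ⟩
        3 * p * (w * V + R) + 19 * u * (w + T)                  ≡⟨ cong (λ z → 3 * p * z + 19 * u * (w + T)) (trans (cong (_+ R) (sym (sumOver-* U w val))) (sym (sumOver-+ U (λ y → w * val y) rest))) ⟩
        3 * p * sumOver U (λ y → w * val y + rest y) + 19 * u * (w + T) ∎
        where
        open ≤-Reasoning
        u T V R : ℕ
        u = card U
        T = totalWeight st
        val rest : Fin n → ℕ
        val y = value (not (kind y) ∧ not t) (labelOf y t X)
        rest y = score (kind y) st (labelsTo y st Xs)
        V = sumOver U val
        R = sumOver U rest
        X≥1 : 1 ≤ card X
        X≥1 = positive s U≥1 size
        id₁ : ∀ a w T → a * (w + T) ≡ w * a + a * T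
        id₁ = solve-∀
        id₂ : ∀ w p V u R T → w * (3 * p * V + 19 * u) + (3 * p * R + 19 * u * T) ≡ 3 * p * (w * V + R) + 19 * u * (w + T)
        id₂ = solve-∀

      module _ (st : State) (Xs : List (Subset n)) where

        heavy : Subset n
        heavy y = U y ∧ (5 * totalWeight st ≤ᵇ 3 * score (kind y) st (labelsTo y st Xs))

        -- Scores are integers, so three times the score of a light vertex is at most 5 * T - 1,
        -- where T is the total weight. The average of three times the score is at least 5 * T - 19
        -- * T / p, hence at least 5 * T - 1/2 once 38 * T ≤ p. As scores are also at most 2 * T,
        -- the heavy vertices must have a fixed share.
        heavy-share : ∀ {g s} → 1 ≤ card U → 38 * totalWeight st ≤ p → Realised g s (config st) Xs →
          card U ≤ (2 + 2 * totalWeight st) * card heavy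
        heavy-share U≥1 small r = subst (_≤ (2 + 2 * T) * h) (sym split) (by-identity (+-mono-≤ second (*-monoʳ-≤ 2 first)) 0 (id₁ h b T Σᵤ))
          where
          open ≤-Reasoning
          u T h b Σᵤ Σₕ Σₗ : ℕ
          sc : Fin n → ℕ
          sc y = score (kind y) st (labelsTo y st Xs)
          test light : Subset n
          test y = 5 * totalWeight st ≤ᵇ 3 * sc y
          light = U ∖ test
          u = card U
          T = totalWeight st
          h = card heavy
          b = card light
          Σᵤ = sumOver U sc
          Σₕ = sumOver heavy sc
          Σₗ = sumOver light sc
          split : u ≡ h + b
          split = card-split U test
          lightSum : 3 * Σₗ + b ≤ b * (5 * T)
          lightSum = begin
            3 * Σₗ + b                                  ≡⟨ cong₂ _+_ (sym (sumOver-* light 3 sc)) (sum-cong-≗ (λ i → sym (*-identityʳ ⟦ light i ⟧))) ⟩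
            sumOver light (λ y → 3 * sc y) + sumOver light (λ _ → 1) ≡⟨ sym (sumOver-+ light (λ y → 3 * sc y) (λ _ → 1)) ⟩
            sumOver light (λ y → 3 * sc y + 1)          ≤⟨ sumOver-≤ light (λ y y∈ → ≤-trans (≤-reflexive (+-comm _ 1)) (≤ᵇ-false (not-true (∧-snd {U y} y∈)))) ⟩
            b * (5 * T) ∎
          first : 3 * Σᵤ + b ≤ h * (6 * T) + b * (5 * T)
          first = begin
            3 * Σᵤ + b                       ≡⟨ cong (λ z → 3 * z + b) (sumOver-split U test sc) ⟩
            3 * (Σₕ + Σₗ) + b                ≡⟨ id₂ Σₕ Σₗ b ⟩
            3 * Σₕ + (3 * Σₗ + b)            ≤⟨ +-mono-≤ (*-monoʳ-≤ 3 (sumOver-≤ heavy (λ y _ → score≤ (kind y) st (labelsTo y st Xs)))) lightSum ⟩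
            3 * (h * (2 * T)) + b * (5 * T)  ≡⟨ id₃ h b T ⟩
            h * (6 * T) + b * (5 * T) ∎
            where
            id₂ : ∀ x y b → 3 * (x + y) + b ≡ 3 * x + (3 * y + b)
            id₂ = solve-∀
            id₃ : ∀ h b T → 3 * (h * (2 * T)) + b * (5 * T) ≡ h * (6 * T) + b * (5 * T)
            id₃ = solve-∀
          second : 10 * (h + b) * T ≤ 6 * Σᵤ + (h + b)
          second = *-cancelˡ-≤ p {{>-nonZero p≥1}} (begin
            p * (10 * (h + b) * T)              ≡⟨ cong (λ z → p * (10 * z * T)) (sym split) ⟩
            p * (10 * u * T)                    ≡⟨ id₂ p u T ⟩
            2 * (5 * p * u * T)                 ≤⟨ *-monoʳ-≤ 2 (score-sum st Xs U≥1 r) ⟩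
            2 * (3 * p * Σᵤ + 19 * u * T)       ≡⟨ id₃ p Σᵤ u T ⟩
            6 * p * Σᵤ + (38 * T) * u           ≤⟨ +-monoʳ-≤ (6 * p * Σᵤ) (*-monoˡ-≤ u small) ⟩
            6 * p * Σᵤ + p * u                  ≡⟨ id₄ p Σᵤ u ⟩
            p * (6 * Σᵤ + u)                    ≡⟨ cong (λ z → p * (6 * Σᵤ + z)) split ⟩
            p * (6 * Σᵤ + (h + b)) ∎)
            where
            id₂ : ∀ p u T → p * (10 * u * T) ≡ 2 * (5 * p * u * T)
            id₂ = solve-∀
            id₃ : ∀ p s u T → 2 * (3 * p * s + 19 * u * T) ≡ 6 * p * s + (38 * T) * u
            id₃ = solve-∀
            id₄ : ∀ p s u → 6 * p * s + p * u ≡ p * (6 * s + u)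
            id₄ = solve-∀
          id₁ : ∀ h b T s → h + b + (6 * s + (h + b) + 2 * (h * (6 * T) + b * (5 * T))) + 0 ≡ (2 + 2 * T) * h + (10 * (h + b) * T + 2 * (3 * s + b))
          id₁ = solve-∀

    common-labels : ∀ st Xs Y → ∃[ ls ] ∃[ Y′ ] Y′ ⊑ Y × card Y ≤ 4 ^ length st * card Y′ × (∀ y → y ∈ Y′ → labelsTo y st Xs ≡ ls)
    common-labels [] Xs Y = [] , Y , ⊑-refl {X = Y} , ≤-reflexive (sym (*-identityˡ _)) , λ _ _ → refl
    common-labels (_ ∷ st) [] Y = [] , Y , ⊑-refl {X = Y} , ≤-trans (≤-reflexive (sym (*-identityˡ _))) (*-monoˡ-≤ (card Y)
      (≤-trans (≤-reflexive (sym (^-zeroˡ (suc (length st))))) (^-monoˡ-≤ (suc (length st)) {1} {4} (s≤s z≤n)))) , λ _ _ → refl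
    common-labels ((_ , t , _) ∷ st) (X ∷ Xs) Y =
      let (l , h) = pigeonhole₄ Y (λ y → labelOf y t X)
          Y₁ = Y ∩ λ y → sameLabel l (labelOf y t X)
          (ls , Y₂ , Y₂⊑Y₁ , h₂ , same) = common-labels st Xs Y₁
      in l ∷ ls , Y₂ , (λ y y∈ → ∧-fst (Y₂⊑Y₁ y y∈)) ,
         ≤-trans h (≤-trans (*-monoʳ-≤ 4 h₂) (≤-reflexive (sym (*-assoc 4 (4 ^ length st) (card Y₂))))) ,
         λ y y∈ → cong₂ _∷_ (sym (sameLabel⇒≡ l _ (∧-snd {Y y} (Y₂⊑Y₁ y y∈)))) (same y y∈)

    RichAll : Fin n → List Label → List (Subset n) → Set
    RichAll y [] [] = ⊤
    RichAll y (l ∷ ls) (X ∷ Xs) = Rich l y X × RichAll y ls Xs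
    RichAll y _ _ = ⊥

    labelsTo-rich : ∀ {g s} st Xs y → Realised g s (config st) Xs → RichAll y (labelsTo y st Xs) Xs
    labelsTo-rich [] [] y r = tt
    labelsTo-rich ((_ , t , _) ∷ st) (X ∷ Xs) y (_ , _ , r) = labelOf-rich y t X , labelsTo-rich st Xs y r

    Shrunk : List (Subset n) → List (Subset n) → Set
    Shrunk [] [] = ⊤
    Shrunk (X ∷ Xs) (X′ ∷ Xs′) = (X′ ⊑ X × card X ≤ q * card X′) × Shrunk Xs Xs′
    Shrunk _ _ = ⊥

    densify-label : ∀ l g X Y → 1 ≤ g → 1 ≤ card X → 1 ≤ card Y → (∀ y → y ∈ Y → Rich l y X) →
      ∃[ X′ ] ∃[ Y′ ] X′ ⊑ X × Y′ ⊑ Y × card X ≤ q * card X′ × card Y ≤ loss g * card Y′ × Related g l Y′ X′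
    densify-label none g X Y g≥1 X≥1 Y≥1 h = X , Y , ⊑-refl {X = X} , ⊑-refl {X = Y} ,
      ≤-trans (≤-reflexive (sym (*-identityˡ _))) (*-monoˡ-≤ (card X) q≥1) ,
      ≤-trans (≤-reflexive (sym (*-identityˡ _))) (*-monoˡ-≤ (card Y) (≤-trans (≤-reflexive (sym (^-zeroˡ (q * g)))) (^-monoˡ-≤ (q * g) (*-mono-≤ q≥1 g≥1)))) , tt
    densify-label half g X Y g≥1 X≥1 Y≥1 h =
      let (X′ , Y′ , a , b , c , d , D) = densify q g 1 false X (*-monoʳ-≤ 2 p≥1) g≥1 X≥1 Y Y≥1 h in X′ , Y′ , a , b , c , d , Dense-sym D
    densify-label full g X Y g≥1 X≥1 Y≥1 h =
      let (X′ , Y′ , a , b , c , d , D) = densify q g (suc p) false X (≤-trans (+-monoˡ-≤ p p≥2) (+-monoʳ-≤ p (≤-reflexive (sym (+-identityʳ p))))) g≥1 X≥1 Y Y≥1 h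
      in X′ , Y′ , a , b , c , d , Dense-sym D
    densify-label red g X Y g≥1 X≥1 Y≥1 h =
      let (X′ , Y′ , a , b , c , d , D) = densify q g 1 true X (*-monoʳ-≤ 2 p≥1) g≥1 X≥1 Y Y≥1 h in X′ , Y′ , a , b , c , d , Dense-sym D

    densify-all : ∀ g → 1 ≤ g → ∀ ls Xs Y → 1 ≤ card Y → All (λ X → 1 ≤ card X) Xs → (∀ y → y ∈ Y → RichAll y ls Xs) →
      ∃[ Xs′ ] ∃[ Y′ ] Shrunk Xs Xs′ × Y′ ⊑ Y × card Y ≤ lossAll (length Xs) g * card Y′ × RelatedAll g Y′ ls Xs′
    densify-all g g≥1 [] [] Y Y≥1 _ h = [] , Y , tt , ⊑-refl {X = Y} , ≤-reflexive (sym (*-identityˡ _)) , tt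
    densify-all g g≥1 [] (_ ∷ _) Y Y≥1 _ h = let (y , y∈) = card-positive Y Y≥1 in ⊥-elim (h y y∈)
    densify-all g g≥1 (_ ∷ _) [] Y Y≥1 _ h = let (y , y∈) = card-positive Y Y≥1 in ⊥-elim (h y y∈)
    densify-all g g≥1 (l ∷ ls) (X ∷ Xs) Y Y≥1 (X≥1 ∷ Xs≥1) h =
      let L = lossAll (length Xs) g
          L≥1 = lossAll≥1 (length Xs) g≥1
          (X′ , Y₁ , X′⊑X , Y₁⊑Y , cX , cY , rel) = densify-label l (L * g) X Y (*-mono-≤ L≥1 g≥1) X≥1 Y≥1 (λ y y∈ → proj₁ (h y y∈))
          (Xs′ , Y₂ , sh , Y₂⊑Y₁ , cY₁ , rels) = densify-all g g≥1 ls Xs Y₁ (positive (loss (L * g)) Y≥1 cY) Xs≥1 (λ y y∈ → proj₂ (h y (Y₁⊑Y y y∈)))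
      in X′ ∷ Xs′ , Y₂ , ((X′⊑X , cX) , sh) , ⊑-trans {X = Y₂} Y₂⊑Y₁ Y₁⊑Y ,
         ≤-trans cY (≤-trans (*-monoʳ-≤ (loss (L * g)) cY₁) (≤-reflexive (sym (*-assoc (loss (L * g)) L (card Y₂))))) ,
         Related-⊑ {k = L} l Y₂⊑Y₁ (⊑-refl {X = X′}) cY₁ (≤-trans (≤-reflexive (sym (*-identityˡ _))) (*-monoˡ-≤ (card X′) L≥1)) ≤-refl rel , rels

    shrink-realised : ∀ {g h s} c Xs Xs′ → q * h ≤ g → Shrunk Xs Xs′ → Realised g s c Xs → Realised h (s * q) c Xs′
    shrink-realised [] [] [] hg sh r = tt
    shrink-realised {g} {h} {s} ((k , ls) ∷ c) (X ∷ Xs) (X′ ∷ Xs′) hg ((X′⊑X , cX) , sh) ((X⊑U , size , typed) , rs , r) =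
      (⊑-trans {X = X′} X′⊑X X⊑U , ≤-trans size (≤-trans (*-monoʳ-≤ s cX) (≤-reflexive (sym (*-assoc s q _)))) , ofKind k typed) ,
      related ls Xs Xs′ sh rs , shrink-realised c Xs Xs′ hg sh r
      where
      ofKind : ∀ k → OfKind k X → OfKind k X′
      ofKind nothing t = tt
      ofKind (just k) t i i∈ = t i (X′⊑X i i∈)
      related : ∀ ls Ys Ys′ → Shrunk Ys Ys′ → RelatedAll g X ls Ys → RelatedAll h X′ ls Ys′
      related [] _ _ _ _ = tt
      related (l ∷ ls) (Y ∷ Ys) (Y′ ∷ Ys′) ((Y′⊑Y , cY) , sh) (r , rs) = Related-⊑ {k = q} l X′⊑X Y′⊑Y cX cY hg r , related ls Ys Ys′ sh rs

    realised-mono : ∀ {g s s′} c Xs → s ≤ s′ → Realised g s c Xs → Realised g s′ c Xs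
    realised-mono [] [] h r = tt
    realised-mono (_ ∷ c) (X ∷ Xs) h ((a , b , t) , rs , r) = (a , ≤-trans b (*-monoˡ-≤ (card X) h) , t) , rs , realised-mono c Xs h r

    realised-nonempty : ∀ {g s} c Xs → 1 ≤ card U → Realised g s c Xs → All (λ X → 1 ≤ card X) Xs
    realised-nonempty [] [] _ _ = []
    realised-nonempty {s = s} (_ ∷ c) (X ∷ Xs) U≥1 ((_ , size , _) , _ , r) = positive s U≥1 size ∷ realised-nonempty c Xs U≥1 r

    realised-length : ∀ {g s} st Xs → Realised g s (config st) Xs → length Xs ≡ length st
    realised-length [] [] r = refl
    realised-length (_ ∷ st) (X ∷ Xs) (_ , _ , r) = cong suc (realised-length st Xs r)

    labelsTo-length : ∀ {g s} y st Xs → Realised g s (config st) Xs → length (labelsTo y st Xs) ≡ length st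
    labelsTo-length y [] [] r = refl
    labelsTo-length y (_ ∷ st) (X ∷ Xs) (_ , _ , r) = cong suc (labelsTo-length y st Xs r)

    labelFor-full : ∀ both r b m → labelFor both r b m ≡ full → both ≡ true
    labelFor-full both r b m h with 3 * m ≤ᵇ q * r
    labelFor-full both r b m () | true
    labelFor-full true r b m h | false = refl
    labelFor-full false r b m h | false with 3 * m ≤ᵇ q * b
    labelFor-full false r b m () | false | true
    labelFor-full false r b m () | false | false

    labelsTo-plausible : ∀ y st Xs → plausible (kind y) st (labelsTo y st Xs) ≡ true
    labelsTo-plausible y [] Xs = refl
    labelsTo-plausible y (_ ∷ st) [] = refl
    labelsTo-plausible y ((_ , t , _) ∷ st) (X ∷ Xs) with labelOf y t X in eq
    ... | none = labelsTo-plausible y st Xs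
    ... | half = labelsTo-plausible y st Xs
    ... | red = labelsTo-plausible y st Xs
    ... | full = let both = labelFor-full (not (kind y) ∧ not t) _ _ (card X) eq in
      ∧-intro (∧-fst {not (kind y)} both) (∧-intro (∧-snd {not (kind y)} both) (labelsTo-plausible y st Xs))

    -- Among the heavy vertices, pigeonholing leaves many with one kind and one list of labels.
    -- Densifying against each cluster in turn makes these labels of vertices into labels of a
    -- cluster. Each old cluster shrinks at most by `q`, so depth q * g is required beforehand.
    extend : ∀ {s} st Xs g → MinDegree → 1 ≤ g → 1 ≤ card U → 38 * totalWeight st ≤ p → Realised (q * g) s (config st) Xs →
      ∃[ k ] ∃[ ls ] ∃[ Ys ] length ls ≡ length st × plausible k st ls ≡ true × 5 * totalWeight st ≤ 3 * score k st ls ×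
        Realised g (s * q + newShare st g) ((just k , ls) ∷ config st) Ys
    extend {s} st Xs g mindeg g≥1 U≥1 small r =
      let H = heavy mindeg st Xs
          hH = heavy-share mindeg st Xs U≥1 small r
          H≥1 = positive (2 + 2 * totalWeight st) U≥1 hH
          (k , hk) = pigeonhole₂ H kind
          H₁ = H ∩ λ y → if k then kind y else not (kind y)
          H₁≥1 = positive 2 H≥1 hk
          (ls , Y , Y⊑H₁ , hY , same) = common-labels st Xs H₁
          Y≥1 = positive (4 ^ length st) H₁≥1 hY
          (y₀ , y₀∈) = card-positive Y Y≥1
          (Xs′ , Y′ , sh , Y′⊑Y , hY′ , rels) = densify-all g g≥1 ls Xs Y Y≥1 (realised-nonempty (config st) Xs U≥1 r)
            (λ y y∈ → subst (λ l → RichAll y l Xs) (same y y∈) (labelsTo-rich st Xs y r))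
          inH = λ y (y∈ : y ∈ Y) → ∧-fst {H y} (Y⊑H₁ y y∈)
          kindY = λ y (y∈ : y ∈ Y) → ofKind k (kind y) (∧-snd {H y} (Y⊑H₁ y y∈))
          bound = subst₂ (λ k ls → 5 * totalWeight st ≤ 3 * score k st ls) (kindY y₀ y₀∈) (same y₀ y₀∈)
            (≤ᵇ-true (∧-snd {U y₀} (inH y₀ y₀∈)))
          size = ≤-trans hH (≤-trans (*-monoʳ-≤ (2 + 2 * totalWeight st) (≤-trans hk (*-monoʳ-≤ 2 (≤-trans hY (*-monoʳ-≤ (4 ^ length st) hY′)))))
            (≤-reflexive (trans (cong (λ l → (2 + 2 * totalWeight st) * (2 * (4 ^ length st * (lossAll l g * card Y′)))) (realised-length st Xs r))
              (reassoc (2 + 2 * totalWeight st) (4 ^ length st) (lossAll (length st) g) (card Y′)))))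
      in k , ls , Y′ ∷ Xs′ , trans (cong length (sym (same y₀ y₀∈))) (labelsTo-length y₀ st Xs r) ,
         subst₂ (λ k ls → plausible k st ls ≡ true) (kindY y₀ y₀∈) (same y₀ y₀∈) (labelsTo-plausible y₀ st Xs) , bound ,
         ((λ y y∈ → ∧-fst (inH y (Y′⊑Y y y∈))) , ≤-trans size (*-monoˡ-≤ (card Y′) (m≤n+m (newShare st g) (s * q))) , (λ y y∈ → kindY y (Y′⊑Y y y∈))) ,
         rels , realised-mono (config st) Xs′ (m≤m+n (s * q) _) (shrink-realised (config st) Xs Xs′ ≤-refl sh r)
      where
      ofKind : ∀ k b → (if k then b else not b) ≡ true → b ≡ k
      ofKind true b h = h
      ofKind false b h = not-true h
      reassoc : ∀ a b c d → a * (2 * (b * (c * d))) ≡ a * (2 * (b * c)) * d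
      reassoc = solve-∀


open NewClusters

-- The table of states and the decision procedure that checks it.

module StateTable where
  open import Data.List using (concatMap; filterᵇ; upTo; _++_)
  open import Data.Bool using (Bool; true; false; _∧_; _∨_; not; if_then_else_)
  open import Data.Fin using (zero; suc)
  open import Data.List using (List; []; _∷_; length; map)
  open import Data.Maybe using (Maybe; just; nothing)
  open import Data.Nat hiding (_≟_)
  open import Data.Nat.Properties hiding (_≟_)
  open import Data.Product using (_×_; _,_)
  open import Relation.Binary.PropositionalEquality

  containsAny : Config → List (Config × List ℕ) → Bool
  containsAny c [] = false
  containsAny c ((d , is) ∷ ds) = contains c d is ∨ containsAny c ds

  isForbidden : Bool → List Bool → Bool
  isForbidden c ds = allowed c ds ∧ (slotWeight ds ≡ᵇ cliqueLimit c) ∧ (length ds ≤ᵇ 6)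

  -- A forbidden list of slots placed on a configuration: colour, single clusters, double clusters.
  Placement : Set
  Placement = Bool × List ℕ × List ℕ

  private
    orElse : {A : Set} → Maybe A → Maybe A → Maybe A
    orElse nothing y = y
    orElse (just x) _ = just x

    ofKind : Config → Bool → ℕ → Bool
    ofKind c k i = coversKind (kindAt c i) (just k)

  firstJust : {A B : Set} → (A → Maybe B) → List A → Maybe B
  firstJust f [] = nothing
  firstJust f (x ∷ xs) with f x
  ... | nothing = firstJust f xs
  ... | just y = just y

  -- Blue cliques through x and y of size 3 with three full edges, of size 4 with
  -- a full edge, of size 5 with a cluster of blue kind, or of size 6.
  blueClique : Config → ℕ → ℕ → List ℕ → Maybe Placement
  blueClique c x y is = orElse (firstJust triangle is) (quads is)
    where
    isFull isBlue : ℕ → ℕ → Bool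
    isFull i j = covers (label c i j) full
    isBlue i j = covers (label c i j) half
    triangle : ℕ → Maybe Placement
    triangle i = if isFull x y ∧ isFull x i ∧ isFull y i then just (false , [] , x ∷ y ∷ i ∷ []) else nothing
    pairs : List (ℕ × ℕ) → List ℕ → List ℕ → Maybe Placement
    pairs [] _ _ = nothing
    pairs ((i , j) ∷ ps) (k ∷ ks) (l ∷ ls) = if isFull i j then just (false , k ∷ l ∷ [] , i ∷ j ∷ []) else pairs ps ks ls
    pairs _ _ _ = nothing
    fullEdge : ℕ → ℕ → Maybe Placement
    fullEdge i j = pairs ((x , y) ∷ (x , i) ∷ (x , j) ∷ (y , i) ∷ (y , j) ∷ (i , j) ∷ [])
      (i ∷ y ∷ y ∷ x ∷ x ∷ x ∷ []) (j ∷ j ∷ i ∷ j ∷ i ∷ y ∷ [])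
    lone : List ℕ → List ℕ → Maybe Placement
    lone [] _ = nothing
    lone (i ∷ is) js = if ofKind c false i then just (false , is ++ js , i ∷ []) else lone is (i ∷ js)
    quint : ℕ → ℕ → ℕ → List ℕ → Maybe Placement
    quint i j k ls = orElse (lone (x ∷ y ∷ i ∷ j ∷ k ∷ []) [])
      (firstJust (λ l → if isBlue k l then just (false , x ∷ y ∷ i ∷ j ∷ k ∷ l ∷ [] , []) else nothing) ls)
    triples : ℕ → ℕ → List ℕ → Maybe Placement
    triples i j [] = nothing
    triples i j (k ∷ ks) = orElse (quint i j k ks) (triples i j ks)
    edges : ℕ → List ℕ → Maybe Placement
    edges i [] = nothing
    edges i (j ∷ js) = orElse (orElse (fullEdge i j) (triples i j (filterᵇ (isBlue j) js))) (edges i js)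
    quads : List ℕ → Maybe Placement
    quads [] = nothing
    quads (i ∷ is) = orElse (edges i (filterᵇ (isBlue i) is)) (quads is)

  redTriangle : Config → ℕ → List ℕ → Maybe Placement
  redTriangle c j [] = nothing
  redTriangle c j (i ∷ is) = if covers (label c 0 i) red ∧ covers (label c i j) red
    then just (true , 0 ∷ i ∷ j ∷ [] , []) else redTriangle c j is

  -- Only looks for placements using the first cluster and the j-th one.
  placement : Config → ℕ → Label → Maybe Placement
  placement c j none = nothing
  placement c j red = if ofKind c true 0 then just (true , j ∷ [] , 0 ∷ []) else
    if ofKind c true j then just (true , 0 ∷ [] , j ∷ []) else redTriangle c j (upTo j)
  placement c j _ = blueClique c 0 j (filterᵇ (λ i → covers (label c 0 i) half ∧ covers (label c i j) half) (upTo j))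

  -- The suggested placement is verified in full here, so soundness does not depend on how
  -- `placement` finds it.
  placed : Config → Maybe Placement → Bool
  placed c nothing = false
  placed c (just (col , ss , ds)) =
    let slots = map (λ _ → false) ss ++ map (λ _ → true) ds in isForbidden col slots ∧ contains c (slotConfig col slots) (ss ++ ds)

  lastLabel : List Label → Label
  lastLabel [] = none
  lastLabel (l ∷ []) = l
  lastLabel (_ ∷ ls) = lastLabel ls

  newLabels : Bool → List Label
  newLabels true = none ∷ half ∷ full ∷ red ∷ []
  newLabels false = none ∷ half ∷ red ∷ []

  -- Does every sufficiently heavy way of adding a cluster of kind k produce a
  -- target or a forbidden placement?  The labels are guessed one by one; pre is
  -- what has been fixed, gained its score.
  module _ (k : Bool) (c : Config) (bound : ℕ) (targets : List (Config × List ℕ)) where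

    covered : List Label → ℕ → State → Bool
    coveredAll : List Label → ℕ → ℕ → Bool → State → List Label → Bool

    covered pre gained rest =
      -- Pruning: even value 2 on all remaining clusters would leave the weighted density below 5/6.
      (3 * (gained + 2 * totalWeight rest) <ᵇ bound)
      ∨ placed ((just k , pre) ∷ c) (placement ((just k , pre) ∷ c) (length pre) (lastLabel pre))
      ∨ continue rest
      where
      continue : State → Bool
      continue [] = containsAny ((just k , pre) ∷ c) targets
      continue ((w , t , _) ∷ rest) = coveredAll pre gained w (not k ∧ not t) rest (newLabels (not k ∧ not t))

    coveredAll pre gained w both rest [] = true
    coveredAll pre gained w both rest (l ∷ ls) = covered (pre ++ l ∷ []) (gained + w * value both l) rest ∧ coveredAll pre gained w both rest ls

  -- The five later clusters carry the critical colouring of K₅ for r(3,3) = 6. Red weight 2 comes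
  -- from the doubled apex or a red edge; blue weight 5 from two pentagon clusters joined in blue,
  -- both doubled, and the apex once.
  pentagonWithApex : Config
  pentagonWithApex =
    (just true , half ∷ half ∷ half ∷ half ∷ half ∷ []) ∷
    (just false , red ∷ full ∷ full ∷ red ∷ []) ∷
    (just false , red ∷ full ∷ full ∷ []) ∷
    (just false , red ∷ full ∷ []) ∷
    (just false , red ∷ []) ∷
    (just false , []) ∷ []

  -- The bound 100 on the weight is what makes p ≥ 3800 = 38 * 100 sufficient for `heavy-share` at
  -- every state.
  checkState : State → List (Config × List ℕ) → Bool
  checkState st targets = (1 ≤ᵇ totalWeight st) ∧ (totalWeight st ≤ᵇ 100) ∧
    covered true (config st) (5 * totalWeight st) targets [] 0 st ∧ covered false (config st) (5 * totalWeight st) targets [] 0 st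

  -- Lists of digits below 10 are written as numbers with a leading 1.
  digits : ℕ → ℕ → List ℕ → List ℕ
  digits zero n is = is
  digits (suc f) n is = if n <ᵇ 10 then is else digits f (n / 10) (n % 10 ∷ is)

  decodeLabel : ℕ → Label
  decodeLabel 0 = none
  decodeLabel 1 = half
  decodeLabel 2 = full
  decodeLabel _ = red

  decodeState : List (ℕ × Bool × ℕ) → State
  decodeState = map λ (w , k , code) → w , k , map decodeLabel (digits 9 code [])

  private
    A B : Bool
    A = true
    B = false

  -- Each state comes with the targets that suffice for it, given by their position
  -- among the pentagon and the later states, and by the clusters where they occur.
  -- The weights maximise the Lagrangian of the state, so that a new cluster of
  -- weighted density 5/6 leads to a state of larger Lagrangian.
  table : List (List (ℕ × Bool × ℕ) × List (ℕ × ℕ))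
  table =
    ((1 , A , 1) ∷ [] , (1 , 10) ∷ (134 , 110) ∷ []) ∷
    ((1 , B , 1) ∷ [] , (1 , 110) ∷ (2 , 110) ∷ (111 , 110) ∷ []) ∷
    ((1 , B , 13) ∷ (1 , B , 1) ∷ [] , (1 , 110) ∷ (1 , 120) ∷ (110 , 110) ∷ []) ∷
    ((1 , B , 12) ∷ (1 , B , 1) ∷ [] , (1 , 1201) ∷ (1 , 1102) ∷ (7 , 1021) ∷ (109 , 110) ∷ []) ∷
    ((1 , B , 132) ∷ (1 , B , 12) ∷ (1 , B , 1) ∷ [] , (2 , 11032) ∷ (6 , 1032) ∷ (6 , 1031) ∷ (1 , 13021) ∷ (2 , 12031) ∷ (3 , 11023) ∷ (3 , 12013) ∷ (6 , 1210) ∷ (6 , 1120) ∷ (108 , 110) ∷ []) ∷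
    ((2 , B , 1122) ∷ (2 , B , 122) ∷ (3 , B , 13) ∷ (3 , B , 1) ∷ [] , (5 , 1042) ∷ (5 , 1032) ∷ (1 , 10432) ∷ (1 , 10341) ∷ (5 , 1041) ∷ (5 , 1031) ∷ []) ∷
    ((2 , B , 1123) ∷ (2 , B , 132) ∷ (3 , B , 12) ∷ (3 , B , 1) ∷ [] , (4 , 1320) ∷ (4 , 1410) ∷ (1 , 11043) ∷ (1 , 12034) ∷ (1 , 13024) ∷ (1 , 14013) ∷ (106 , 110) ∷ []) ∷
    ((2 , B , 1132) ∷ (2 , B , 132) ∷ (3 , B , 12) ∷ (3 , B , 1) ∷ [] , (3 , 1230) ∷ (3 , 1041) ∷ (3 , 1043) ∷ (2 , 130214) ∷ (1 , 132104) ∷ (3 , 1042) ∷ (3 , 1130) ∷ (49 , 14320) ∷ (49 , 14310) ∷ []) ∷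
    ((2 , B , 13312) ∷ (2 , B , 1132) ∷ (2 , B , 132) ∷ (2 , B , 12) ∷ (3 , B , 1) ∷ [] , (2 , 1054) ∷ (2 , 1053) ∷ (48 , 15430) ∷ (1 , 140325) ∷ (1 , 130415) ∷ (2 , 1052) ∷ (2 , 1051) ∷ []) ∷
    ((2 , B , 11332) ∷ (2 , B , 1223) ∷ (2 , B , 112) ∷ (2 , B , 12) ∷ (3 , B , 1) ∷ [] , (1 , 1410) ∷ (1 , 1053) ∷ (1 , 1032) ∷ (47 , 13520) ∷ []) ∷
    ((1 , B , 133) ∷ (1 , B , 12) ∷ (1 , B , 1) ∷ [] , (1 , 11032) ∷ (4 , 12031) ∷ (4 , 13021) ∷ (2 , 11203) ∷ (2 , 11302) ∷ (7 , 12103) ∷ (7 , 13102) ∷ (11 , 11032) ∷ (11 , 11023) ∷ (102 , 110) ∷ []) ∷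
    ((2 , B , 1133) ∷ (2 , B , 133) ∷ (3 , B , 12) ∷ (3 , B , 1) ∷ [] , (1 , 14210) ∷ (3 , 14032) ∷ (1 , 12304) ∷ (1 , 12403) ∷ (6 , 13204) ∷ (6 , 14203) ∷ (10 , 11043) ∷ (3 , 14031) ∷ (48 , 14320) ∷ (48 , 14310) ∷ (101 , 110) ∷ []) ∷
    ((3 , B , 1333) ∷ (2 , B , 112) ∷ (2 , B , 12) ∷ (3 , B , 1) ∷ [] , (2 , 12041) ∷ (2 , 14031) ∷ (9 , 11043) ∷ (1 , 110324) ∷ (2 , 14021) ∷ (2 , 13041) ∷ (5 , 13024) ∷ (9 , 11024) ∷ []) ∷
    ((2 , B , 11333) ∷ (2 , B , 1333) ∷ (2 , B , 112) ∷ (2 , B , 12) ∷ (3 , B , 1) ∷ [] , (1 , 13052) ∷ (1 , 15032) ∷ (46 , 15320) ∷ (1 , 15041) ∷ (1 , 13051) ∷ (46 , 15310) ∷ []) ∷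
    ((2 , B , 1123) ∷ (2 , B , 132) ∷ (3 , B , 13) ∷ (3 , B , 1) ∷ [] , (7 , 13024) ∷ (7 , 14013) ∷ (7 , 13042) ∷ (7 , 14031) ∷ (1 , 123041) ∷ (1 , 114032) ∷ (45 , 14230) ∷ (45 , 13140) ∷ (98 , 110) ∷ []) ∷
    ((2 , B , 13321) ∷ (2 , B , 1132) ∷ (2 , B , 132) ∷ (3 , B , 13) ∷ (2 , B , 1) ∷ [] , (6 , 14052) ∷ (6 , 14053) ∷ (6 , 14025) ∷ (1 , 1324051) ∷ (44 , 15340) ∷ []) ∷
    ((1 , B , 113323) ∷ (1 , B , 13323) ∷ (1 , B , 1132) ∷ (1 , B , 132) ∷ (1 , B , 11) ∷ (1 , B , 1) ∷ [] , (5 , 13052) ∷ (5 , 11064) ∷ (5 , 12063) ∷ (43 , 15230) ∷ (5 , 13610) ∷ (5 , 11530) ∷ (43 , 16410) ∷ []) ∷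
    ((2 , B , 1312) ∷ (3 , B , 123) ∷ (2 , B , 12) ∷ (3 , B , 1) ∷ [] , (4 , 10243) ∷ (4 , 12014) ∷ (4 , 10423) ∷ (4 , 12041) ∷ (1 , 112043) ∷ (2 , 141302) ∷ (4 , 11302) ∷ (39 , 13420) ∷ (42 , 14120) ∷ []) ∷
    ((2 , B , 13321) ∷ (2 , B , 1132) ∷ (2 , B , 132) ∷ (3 , B , 12) ∷ (2 , B , 1) ∷ [] , (3 , 10245) ∷ (3 , 10435) ∷ (38 , 15430) ∷ (1 , 141503) ∷ (3 , 11502) ∷ []) ∷
    ((2 , B , 12213) ∷ (2 , B , 1123) ∷ (2 , B , 132) ∷ (2 , B , 12) ∷ (3 , B , 1) ∷ [] , (2 , 15021) ∷ (2 , 15012) ∷ (2 , 10524) ∷ (2 , 10513) ∷ (1 , 1215043) ∷ []) ∷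
    ((1 , B , 123321) ∷ (1 , B , 13312) ∷ (1 , B , 1122) ∷ (1 , B , 122) ∷ (1 , B , 13) ∷ (1 , B , 1) ∷ [] , (1 , 12130) ∷ (1 , 11230) ∷ (39 , 12130) ∷ (1 , 13602) ∷ (1 , 13501) ∷ []) ∷
    ((2 , B , 1133) ∷ (2 , B , 132) ∷ (3 , B , 12) ∷ (3 , B , 1) ∷ [] , (41 , 14130) ∷ (38 , 14310) ∷ (1 , 112403) ∷ (2 , 110324) ∷ (5 , 121403) ∷ (6 , 113024) ∷ (9 , 114230) ∷ (11 , 112043) ∷ (13 , 113042) ∷ (16 , 113204) ∷ (26 , 113024) ∷ (35 , 14320) ∷ (41 , 13042) ∷ (41 , 12043) ∷ (41 , 13140) ∷ (91 , 110) ∷ []) ∷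
    ((2 , B , 11333) ∷ (2 , B , 1223) ∷ (2 , B , 112) ∷ (2 , B , 12) ∷ (3 , B , 1) ∷ [] , (25 , 114305) ∷ (37 , 15410) ∷ (1 , 110524) ∷ (1 , 110523) ∷ (5 , 115024) ∷ (37 , 15310) ∷ (5 , 115023) ∷ (40 , 15032) ∷ []) ∷
    ((2 , B , 12313) ∷ (2 , B , 1133) ∷ (2 , B , 132) ∷ (2 , B , 12) ∷ (3 , B , 1) ∷ [] , (11 , 115230) ∷ (11 , 125140) ∷ (11 , 152410) ∷ (11 , 151320) ∷ (1 , 1215043) ∷ (24 , 124035) ∷ (24 , 113045) ∷ (39 , 15240) ∷ (39 , 14053) ∷ (89 , 110) ∷ []) ∷
    ((1 , B , 123331) ∷ (1 , B , 13313) ∷ (1 , B , 1122) ∷ (1 , B , 122) ∷ (1 , B , 13) ∷ (1 , B , 1) ∷ [] , (23 , 124306) ∷ (23 , 114305) ∷ (35 , 16320) ∷ (35 , 15310) ∷ (6 , 104563) ∷ (6 , 104653) ∷ (10 , 114250) ∷ (10 , 124160) ∷ (32 , 13650) ∷ (88 , 110) ∷ (1 , 11062435) ∷ (1 , 12051436) ∷ (2 , 152306) ∷ (2 , 152406) ∷ (2 , 161305) ∷ (2 , 161405) ∷ (3 , 132540) ∷ (3 , 131640) ∷ (23 , 124310) ∷ (23 , 114320) ∷ []) ∷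
    ((3 , B , 1112333) ∷ (3 , B , 112333) ∷ (3 , B , 13223) ∷ (4 , B , 1331) ∷ (4 , B , 112) ∷ (4 , B , 12) ∷ (4 , B , 1) ∷ [] , (22 , 146510) ∷ (22 , 152170) ∷ (22 , 116540) ∷ []) ∷
    ((2 , B , 11233) ∷ (2 , B , 1323) ∷ (2 , B , 112) ∷ (2 , B , 12) ∷ (3 , B , 1) ∷ [] , (36 , 15042) ∷ (36 , 13250) ∷ (36 , 15031) ∷ (36 , 14150) ∷ (1 , 130542) ∷ []) ∷
    ((2 , B , 13213) ∷ (2 , B , 1132) ∷ (2 , B , 123) ∷ (2 , B , 12) ∷ (3 , B , 1) ∷ [] , (3 , 151034) ∷ (5 , 105143) ∷ (10 , 151043) ∷ (35 , 14052) ∷ (35 , 13510) ∷ (1 , 1123504) ∷ (2 , 1543210) ∷ []) ∷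
    ((1 , B , 132331) ∷ (1 , B , 11223) ∷ (1 , B , 1332) ∷ (1 , B , 112) ∷ (1 , B , 12) ∷ (1 , B , 1) ∷ [] , (34 , 16042) ∷ (6 , 105163) ∷ (34 , 15063) ∷ (2 , 104265) ∷ (19 , 135410) ∷ (4 , 124160) ∷ (4 , 104163) ∷ (9 , 141260) ∷ (9 , 141063) ∷ []) ∷
    ((1 , B , 123231) ∷ (1 , B , 12313) ∷ (1 , B , 1123) ∷ (1 , B , 132) ∷ (1 , B , 12) ∷ (1 , B , 1) ∷ [] , (8 , 140312) ∷ (8 , 130421) ∷ (33 , 16053) ∷ (33 , 16240) ∷ (33 , 12630) ∷ (33 , 10241) ∷ (3 , 132610) ∷ (3 , 141520) ∷ []) ∷
    ((2 , B , 13132) ∷ (2 , B , 1221) ∷ (2 , B , 132) ∷ (3 , B , 12) ∷ (2 , B , 1) ∷ [] , (7 , 112054) ∷ (32 , 14051) ∷ (7 , 103415) ∷ (17 , 103145) ∷ (26 , 15430) ∷ (1 , 1124053) ∷ (2 , 101254) ∷ (32 , 10342) ∷ []) ∷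
    ((1 , B , 133221) ∷ (1 , B , 12312) ∷ (1 , B , 1123) ∷ (1 , B , 132) ∷ (1 , B , 12) ∷ (1 , B , 1) ∷ [] , (31 , 16053) ∷ (6 , 105426) ∷ (31 , 12064) ∷ (31 , 10541) ∷ (3 , 102164) ∷ (25 , 15630) ∷ (1 , 132160) ∷ (1 , 141250) ∷ (6 , 121064) ∷ []) ∷
    ((2 , B , 11333) ∷ (2 , B , 1323) ∷ (2 , B , 112) ∷ (2 , B , 12) ∷ (3 , B , 1) ∷ [] , (27 , 15410) ∷ (30 , 14150) ∷ (2 , 115042) ∷ (2 , 141503) ∷ (30 , 15042) ∷ (30 , 13250) ∷ (30 , 15140) ∷ (1 , 1135042) ∷ []) ∷
    ((1 , B , 133231) ∷ (1 , B , 12313) ∷ (1 , B , 1123) ∷ (1 , B , 132) ∷ (1 , B , 12) ∷ (1 , B , 1) ∷ [] , (29 , 14210) ∷ (1 , 106253) ∷ (4 , 130456) ∷ (4 , 140365) ∷ (26 , 15310) ∷ (29 , 16053) ∷ (4 , 151360) ∷ (4 , 162450) ∷ (26 , 16420) ∷ []) ∷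
    ((2 , B , 13231) ∷ (3 , B , 1323) ∷ (2 , B , 112) ∷ (2 , B , 12) ∷ (2 , B , 1) ∷ [] , (28 , 13210) ∷ (28 , 15042) ∷ (3 , 123045) ∷ (13 , 125103) ∷ (25 , 13120) ∷ (1 , 1204153) ∷ (3 , 112504) ∷ (13 , 112054) ∷ []) ∷
    ((1 , B , 112333) ∷ (1 , B , 13233) ∷ (1 , B , 1321) ∷ (1 , B , 112) ∷ (1 , B , 12) ∷ (1 , B , 1) ∷ [] , (24 , 16520) ∷ (27 , 15260) ∷ (27 , 16150) ∷ (27 , 15031) ∷ (12 , 141053) ∷ (12 , 132064) ∷ (27 , 16042) ∷ (24 , 16510) ∷ (77 , 110) ∷ (1 , 13601542) ∷ (1 , 14502631) ∷ (2 , 125046) ∷ (2 , 141503) ∷ (2 , 116035) ∷ []) ∷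
    ((3 , B , 1112233) ∷ (3 , B , 113223) ∷ (3 , B , 12332) ∷ (4 , B , 1331) ∷ (4 , B , 113) ∷ (4 , B , 12) ∷ (4 , B , 1) ∷ [] , (1 , 142015) ∷ (1 , 120367) ∷ (1 , 130276) ∷ []) ∷
    ((2 , B , 13123) ∷ (2 , B , 1312) ∷ (2 , B , 132) ∷ (2 , B , 12) ∷ (3 , B , 1) ∷ [] , (25 , 14053) ∷ (25 , 15120) ∷ (19 , 15430) ∷ (22 , 15210) ∷ (1 , 1413250) ∷ (3 , 1104235) ∷ (6 , 1201345) ∷ (19 , 14510) ∷ (25 , 13052) ∷ []) ∷
    ((1 , B , 123123) ∷ (1 , B , 11332) ∷ (1 , B , 1322) ∷ (1 , B , 122) ∷ (1 , B , 11) ∷ (1 , B , 1) ∷ [] , (24 , 15240) ∷ (24 , 14063) ∷ (24 , 13051) ∷ (18 , 16430) ∷ (21 , 15420) ∷ (24 , 13064) ∷ (1 , 11402563) ∷ (1 , 12301654) ∷ (2 , 1052346) ∷ (2 , 1061435) ∷ (18 , 15310) ∷ (24 , 14062) ∷ []) ∷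
    ((3 , B , 1112233) ∷ (3 , B , 113223) ∷ (3 , B , 12332) ∷ (4 , B , 1321) ∷ (4 , B , 112) ∷ (4 , B , 12) ∷ (4 , B , 1) ∷ [] , []) ∷
    ((1 , B , 132313) ∷ (1 , B , 13221) ∷ (1 , B , 1132) ∷ (1 , B , 132) ∷ (1 , B , 12) ∷ (1 , B , 1) ∷ [] , (7 , 116204) ∷ (19 , 16410) ∷ (16 , 16530) ∷ (22 , 13065) ∷ (22 , 15063) ∷ (22 , 10452) ∷ (22 , 16140) ∷ (22 , 13210) ∷ (1 , 10341256) ∷ (2 , 13041562) ∷ (3 , 1142603) ∷ (3 , 1213065) ∷ (7 , 104356) ∷ (7 , 121063) ∷ (19 , 14210) ∷ (72 , 110) ∷ []) ∷
    ((3 , B , 1112333) ∷ (3 , B , 112332) ∷ (3 , B , 13232) ∷ (4 , B , 1313) ∷ (4 , B , 121) ∷ (4 , B , 12) ∷ (4 , B , 1) ∷ [] , (6 , 103267) ∷ (15 , 17630) ∷ (6 , 152160) ∷ (6 , 117540) ∷ []) ∷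
    ((3 , B , 1112323) ∷ (3 , B , 112332) ∷ (3 , B , 13322) ∷ (4 , B , 1133) ∷ (4 , B , 122) ∷ (4 , B , 11) ∷ (4 , B , 1) ∷ [] , (5 , 103257) ∷ (5 , 103156) ∷ (14 , 16510) ∷ (14 , 11640) ∷ []) ∷
    ((1 , B , 133312) ∷ (1 , B , 12231) ∷ (1 , B , 1123) ∷ (1 , B , 132) ∷ (1 , B , 12) ∷ (1 , B , 1) ∷ [] , (19 , 14061) ∷ (13 , 16410) ∷ (16 , 14250) ∷ (19 , 14520) ∷ (19 , 12540) ∷ (1 , 11054263) ∷ (2 , 13042156) ∷ (3 , 11502364) ∷ (4 , 105146) ∷ (19 , 16310) ∷ []) ∷
    ((3 , B , 1113323) ∷ (3 , B , 113332) ∷ (3 , B , 13322) ∷ (4 , B , 1221) ∷ (4 , B , 112) ∷ (4 , B , 13) ∷ (4 , B , 1) ∷ [] , []) ∷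
    ((3 , B , 1112323) ∷ (3 , B , 113223) ∷ (3 , B , 12332) ∷ (4 , B , 1331) ∷ (4 , B , 112) ∷ (4 , B , 12) ∷ (4 , B , 1) ∷ [] , (2 , 136540) ∷ []) ∷
    ((3 , B , 1113323) ∷ (3 , B , 113223) ∷ (3 , B , 13232) ∷ (4 , B , 1212) ∷ (4 , B , 131) ∷ (4 , B , 12) ∷ (4 , B , 1) ∷ [] , (1 , 172140) ∷ []) ∷
    ((2 , B , 13313) ∷ (2 , B , 1132) ∷ (2 , B , 132) ∷ (2 , B , 12) ∷ (3 , B , 1) ∷ [] , (15 , 15130) ∷ (12 , 15310) ∷ (9 , 15420) ∷ (15 , 12054) ∷ (15 , 14052) ∷ (1 , 1314250) ∷ (1 , 1214350) ∷ (5 , 1132045) ∷ (15 , 12150) ∷ []) ∷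
    ((1 , B , 133123) ∷ (1 , B , 11332) ∷ (1 , B , 1322) ∷ (1 , B , 122) ∷ (1 , B , 11) ∷ (1 , B , 1) ∷ [] , (14 , 15210) ∷ (14 , 16130) ∷ (14 , 15240) ∷ (14 , 14062) ∷ (11 , 16310) ∷ (14 , 14053) ∷ (14 , 13054) ∷ (1 , 10142356) ∷ (1 , 10231465) ∷ (3 , 11042563) ∷ (3 , 12031654) ∷ (8 , 15430) ∷ (14 , 13051) ∷ []) ∷
    ((3 , B , 1112333) ∷ (3 , B , 113323) ∷ (3 , B , 13322) ∷ (4 , B , 1132) ∷ (4 , B , 122) ∷ (4 , B , 11) ∷ (4 , B , 1) ∷ [] , (13 , 13075) ∷ (13 , 16420) ∷ (1 , 101423576) ∷ []) ∷
    ((3 , B , 12123133) ∷ (3 , B , 1211333) ∷ (3 , B , 133123) ∷ (3 , B , 11332) ∷ (3 , B , 1322) ∷ (3 , B , 122) ∷ (4 , B , 11) ∷ (4 , B , 1) ∷ [] , []) ∷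
    ((3 , B , 1113233) ∷ (3 , B , 112332) ∷ (3 , B , 13223) ∷ (4 , B , 1321) ∷ (4 , B , 112) ∷ (4 , B , 12) ∷ (4 , B , 1) ∷ [] , (11 , 15410) ∷ []) ∷
    ((1 , B , 133213) ∷ (1 , B , 11332) ∷ (1 , B , 1332) ∷ (1 , B , 121) ∷ (1 , B , 12) ∷ (1 , B , 1) ∷ [] , (10 , 16130) ∷ (10 , 15062) ∷ (10 , 14250) ∷ (7 , 15430) ∷ (7 , 16310) ∷ (10 , 15340) ∷ (1 , 10321456) ∷ (2 , 13201465) ∷ (3 , 11054326) ∷ (4 , 16530) ∷ (10 , 14210) ∷ []) ∷
    ((3 , B , 1112333) ∷ (3 , B , 113332) ∷ (3 , B , 13332) ∷ (4 , B , 1213) ∷ (4 , B , 121) ∷ (4 , B , 12) ∷ (4 , B , 1) ∷ [] , (9 , 17420) ∷ []) ∷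
    ((3 , B , 1113323) ∷ (3 , B , 113323) ∷ (3 , B , 12332) ∷ (4 , B , 1231) ∷ (4 , B , 112) ∷ (4 , B , 12) ∷ (4 , B , 1) ∷ [] , (8 , 16410) ∷ (8 , 14150) ∷ []) ∷
    ((3 , B , 1112333) ∷ (3 , B , 113223) ∷ (3 , B , 12332) ∷ (4 , B , 1331) ∷ (4 , B , 112) ∷ (4 , B , 12) ∷ (4 , B , 1) ∷ [] , (7 , 14510) ∷ (7 , 11540) ∷ []) ∷
    ((1 , B , 1223) ∷ (1 , B , 132) ∷ (1 , B , 12) ∷ (1 , B , 1) ∷ [] , (1 , 110432) ∷ (1 , 120341) ∷ (1 , 130241) ∷ (1 , 140132) ∷ (6 , 13042) ∷ (6 , 12043) ∷ (6 , 14031) ∷ (6 , 14021) ∷ (6 , 10143) ∷ (6 , 10321) ∷ (6 , 10142) ∷ (6 , 10231) ∷ (56 , 110) ∷ []) ∷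
    ((2 , B , 11322) ∷ (2 , B , 1322) ∷ (3 , B , 122) ∷ (3 , B , 13) ∷ (3 , B , 1) ∷ [] , (5 , 12053) ∷ (5 , 12043) ∷ (55 , 130) ∷ (1 , 1321054) ∷ (5 , 11053) ∷ (5 , 11043) ∷ (5 , 10541) ∷ (5 , 10451) ∷ []) ∷
    ((2 , B , 133122) ∷ (2 , B , 11322) ∷ (2 , B , 1322) ∷ (2 , B , 122) ∷ (3 , B , 13) ∷ (3 , B , 1) ∷ [] , []) ∷
    ((1 , B , 1233) ∷ (1 , B , 133) ∷ (1 , B , 12) ∷ (1 , B , 1) ∷ [] , (1 , 110432) ∷ (1 , 120431) ∷ (1 , 130214) ∷ (1 , 140213) ∷ (3 , 14230) ∷ (3 , 13240) ∷ (3 , 14130) ∷ (3 , 13140) ∷ (3 , 12410) ∷ (3 , 12310) ∷ (3 , 11420) ∷ (3 , 11320) ∷ (53 , 110) ∷ []) ∷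
    ((2 , B , 11332) ∷ (2 , B , 1332) ∷ (3 , B , 123) ∷ (3 , B , 13) ∷ (3 , B , 1) ∷ [] , (2 , 15410) ∷ (2 , 15310) ∷ (52 , 130) ∷ (1 , 1213054) ∷ (1 , 1214053) ∷ (2 , 15420) ∷ (2 , 15320) ∷ (2 , 11450) ∷ (2 , 11350) ∷ []) ∷
    ((2 , B , 113323) ∷ (2 , B , 13323) ∷ (2 , B , 1132) ∷ (2 , B , 132) ∷ (3 , B , 13) ∷ (3 , B , 1) ∷ [] , []) ∷
    ((1 , B , 1323) ∷ (1 , B , 132) ∷ (1 , B , 12) ∷ (1 , B , 1) ∷ [] , (6 , 110324) ∷ (1 , 110243) ∷ (1 , 120134) ∷ (3 , 102314) ∷ (3 , 101423) ∷ (6 , 120413) ∷ (11 , 130142) ∷ (11 , 140231) ∷ (13 , 123014) ∷ (13 , 114023) ∷ (20 , 110243) ∷ (20 , 120134) ∷ (50 , 110) ∷ []) ∷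
    ((2 , B , 11332) ∷ (2 , B , 1232) ∷ (3 , B , 123) ∷ (3 , B , 12) ∷ (3 , B , 1) ∷ [] , (5 , 110534) ∷ (19 , 130154) ∷ (49 , 130) ∷ (1 , 1132054) ∷ (2 , 110253) ∷ (5 , 130415) ∷ (5 , 121304) ∷ (8 , 1213054) ∷ (10 , 121530) ∷ (12 , 114035) ∷ []) ∷
    ((2 , B , 131223) ∷ (2 , B , 12132) ∷ (2 , B , 1223) ∷ (2 , B , 132) ∷ (3 , B , 12) ∷ (3 , B , 1) ∷ [] , (4 , 131206) ∷ (4 , 142105) ∷ []) ∷
    ((2 , B , 13123) ∷ (3 , B , 1332) ∷ (2 , B , 122) ∷ (3 , B , 13) ∷ (3 , B , 1) ∷ [] , (3 , 140325) ∷ (10 , 145023) ∷ (17 , 120435) ∷ (47 , 120) ∷ (1 , 1315042) ∷ (2 , 1103542) ∷ (5 , 1213054) ∷ (8 , 105243) ∷ []) ∷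
    ((2 , B , 112323) ∷ (2 , B , 13223) ∷ (2 , B , 1132) ∷ (2 , B , 132) ∷ (3 , B , 13) ∷ (3 , B , 1) ∷ [] , (2 , 142650) ∷ (2 , 131650) ∷ []) ∷
    ((2 , B , 131323) ∷ (2 , B , 13132) ∷ (2 , B , 1223) ∷ (2 , B , 132) ∷ (3 , B , 13) ∷ (3 , B , 1) ∷ [] , (1 , 143650) ∷ []) ∷
    ((2 , B , 11233) ∷ (2 , B , 1323) ∷ (3 , B , 132) ∷ (3 , B , 12) ∷ (3 , B , 1) ∷ [] , (44 , 130) ∷ (7 , 143015) ∷ (7 , 134025) ∷ (14 , 110453) ∷ (14 , 120354) ∷ (1 , 1210543) ∷ (4 , 1103254) ∷ (4 , 1204153) ∷ (7 , 115043) ∷ (39 , 154320) ∷ (39 , 153410) ∷ []) ∷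
    ((1 , B , 111323) ∷ (1 , B , 11332) ∷ (1 , B , 1322) ∷ (2 , B , 122) ∷ (2 , B , 13) ∷ (2 , B , 1) ∷ [] , (6 , 156024) ∷ (6 , 124056) ∷ (6 , 165014) ∷ (38 , 146520) ∷ (38 , 145610) ∷ (1 , 1204365) ∷ (1 , 1013465) ∷ (2 , 1325064) ∷ (2 , 1316054) ∷ (4 , 132650) ∷ (4 , 131560) ∷ (6 , 114065) ∷ (13 , 150264) ∷ (13 , 160154) ∷ (43 , 110) ∷ []) ∷
    ((2 , B , 133123) ∷ (2 , B , 11332) ∷ (2 , B , 1322) ∷ (2 , B , 122) ∷ (3 , B , 13) ∷ (3 , B , 1) ∷ [] , (2 , 1514062) ∷ (2 , 1623051) ∷ (37 , 146520) ∷ (37 , 135610) ∷ []) ∷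
    ((2 , B , 112323) ∷ (2 , B , 13223) ∷ (2 , B , 1132) ∷ (2 , B , 132) ∷ (3 , B , 12) ∷ (3 , B , 1) ∷ [] , (4 , 154306) ∷ (4 , 162105) ∷ (36 , 165320) ∷ (36 , 165410) ∷ []) ∷
    ((2 , B , 122133) ∷ (2 , B , 11233) ∷ (2 , B , 1323) ∷ (2 , B , 132) ∷ (3 , B , 12) ∷ (3 , B , 1) ∷ [] , (3 , 126054) ∷ (3 , 115063) ∷ (40 , 130) ∷ []) ∷
    ((2 , B , 11223) ∷ (2 , B , 1232) ∷ (3 , B , 133) ∷ (3 , B , 12) ∷ (3 , B , 1) ∷ [] , (9 , 140325) ∷ (9 , 150314) ∷ (34 , 152430) ∷ (34 , 141530) ∷ (39 , 130) ∷ (1 , 1412053) ∷ (1 , 1521043) ∷ []) ∷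
    ((2 , B , 123123) ∷ (2 , B , 11332) ∷ (2 , B , 1322) ∷ (2 , B , 122) ∷ (3 , B , 13) ∷ (3 , B , 1) ∷ [] , (1 , 161052) ∷ (1 , 152061) ∷ (1 , 113065) ∷ []) ∷
    ((3 , B , 13332) ∷ (2 , B , 1122) ∷ (2 , B , 122) ∷ (3 , B , 13) ∷ (3 , B , 1) ∷ [] , (32 , 135410) ∷ (32 , 125410) ∷ (37 , 110) ∷ (1 , 1403125) ∷ (1 , 1402135) ∷ (3 , 1132045) ∷ (5 , 1032415) ∷ (6 , 1301452) ∷ (6 , 1201453) ∷ (7 , 110425) ∷ (7 , 132015) ∷ (7 , 132104) ∷ (13 , 1103254) ∷ []) ∷
    ((2 , B , 112323) ∷ (2 , B , 13223) ∷ (2 , B , 1312) ∷ (3 , B , 132) ∷ (2 , B , 12) ∷ (3 , B , 1) ∷ [] , (6 , 153046) ∷ (2 , 1340526) ∷ (1 , 11205346) ∷ (5 , 1236051) ∷ (5 , 1504163) ∷ (31 , 165410) ∷ (36 , 110) ∷ []) ∷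
    ((3 , B , 1112233) ∷ (3 , B , 112323) ∷ (3 , B , 13223) ∷ (4 , B , 1132) ∷ (4 , B , 132) ∷ (6 , B , 12) ∷ (6 , B , 1) ∷ [] , (5 , 154601) ∷ (4 , 1506174) ∷ (4 , 1406175) ∷ []) ∷
    ((2 , B , 133132) ∷ (2 , B , 11322) ∷ (2 , B , 1322) ∷ (2 , B , 122) ∷ (3 , B , 13) ∷ (3 , B , 1) ∷ [] , (4 , 132016) ∷ (1 , 13150426) ∷ (1 , 12150436) ∷ (10 , 1103265) ∷ (29 , 136510) ∷ (29 , 126510) ∷ []) ∷
    ((2 , B , 1323312) ∷ (2 , B , 132132) ∷ (2 , B , 11223) ∷ (2 , B , 1223) ∷ (2 , B , 132) ∷ (2 , B , 12) ∷ (3 , B , 1) ∷ [] , []) ∷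
    ((2 , B , 133321) ∷ (2 , B , 11232) ∷ (2 , B , 1232) ∷ (3 , B , 133) ∷ (3 , B , 12) ∷ (2 , B , 1) ∷ [] , (8 , 1503264) ∷ (27 , 162540) ∷ (27 , 163540) ∷ []) ∷
    ((2 , B , 133221) ∷ (2 , B , 12312) ∷ (3 , B , 1323) ∷ (3 , B , 132) ∷ (2 , B , 12) ∷ (2 , B , 1) ∷ [] , (26 , 165430) ∷ (7 , 1405263) ∷ (7 , 1306154) ∷ (26 , 162430) ∷ (26 , 115430) ∷ []) ∷
    ((2 , B , 11332) ∷ (2 , B , 1332) ∷ (3 , B , 123) ∷ (3 , B , 12) ∷ (3 , B , 1) ∷ [] , (1 , 1021345) ∷ (30 , 130) ∷ (2 , 1213054) ∷ (3 , 1302145) ∷ (8 , 1214035) ∷ (12 , 1421305) ∷ (13 , 1201435) ∷ (13 , 1102435) ∷ (14 , 1321054) ∷ (16 , 1231054) ∷ (16 , 1132054) ∷ (23 , 1021435) ∷ (25 , 145320) ∷ (25 , 145310) ∷ []) ∷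
    ((1 , B , 111233) ∷ (1 , B , 11332) ∷ (1 , B , 1332) ∷ (2 , B , 123) ∷ (2 , B , 12) ∷ (2 , B , 1) ∷ [] , (2 , 1314065) ∷ (24 , 156430) ∷ (2 , 1214065) ∷ (5 , 1315064) ∷ (24 , 156420) ∷ (24 , 154610) ∷ (29 , 110) ∷ (1 , 1324065) ∷ (4 , 13210564) ∷ (5 , 1215064) ∷ (7 , 1325046) ∷ (12 , 1302546) ∷ (12 , 1203546) ∷ (15 , 1342065) ∷ (15 , 1243065) ∷ (22 , 1032546) ∷ []) ∷
    ((2 , B , 113323) ∷ (2 , B , 13323) ∷ (2 , B , 1132) ∷ (2 , B , 132) ∷ (3 , B , 12) ∷ (3 , B , 1) ∷ [] , (23 , 165320) ∷ (23 , 165410) ∷ (1 , 1204356) ∷ (1 , 1402165) ∷ (23 , 165420) ∷ (23 , 165310) ∷ []) ∷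
    ((2 , B , 113323) ∷ (2 , B , 12233) ∷ (2 , B , 1132) ∷ (2 , B , 132) ∷ (3 , B , 12) ∷ (3 , B , 1) ∷ [] , (3 , 1504362) ∷ (5 , 1435016) ∷ (27 , 110) ∷ (1 , 11024356) ∷ (3 , 1514360) ∷ (13 , 1413065) ∷ (13 , 1314065) ∷ (22 , 163520) ∷ (22 , 164520) ∷ []) ∷
    ((3 , B , 1113323) ∷ (3 , B , 113323) ∷ (3 , B , 12233) ∷ (4 , B , 1132) ∷ (4 , B , 132) ∷ (6 , B , 12) ∷ (6 , B , 1) ∷ [] , (2 , 1605473) ∷ (2 , 1625470) ∷ (2 , 1615470) ∷ []) ∷
    ((2 , B , 1111323) ∷ (2 , B , 111323) ∷ (2 , B , 11332) ∷ (2 , B , 1332) ∷ (5 , B , 122) ∷ (5 , B , 13) ∷ (5 , B , 1) ∷ [] , (1 , 1325076) ∷ (1 , 1415076) ∷ []) ∷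
    ((2 , B , 113323) ∷ (2 , B , 13332) ∷ (2 , B , 1122) ∷ (2 , B , 122) ∷ (3 , B , 13) ∷ (3 , B , 1) ∷ [] , (19 , 136520) ∷ (19 , 135610) ∷ (24 , 110) ∷ (1 , 12104365) ∷ (2 , 1104365) ∷ (2 , 1204356) ∷ (12 , 11425036) ∷ (12 , 12416035) ∷ (12 , 11325046) ∷ (12 , 12316045) ∷ (17 , 1143206) ∷ (17 , 1243105) ∷ (19 , 146520) ∷ (19 , 145610) ∷ []) ∷
    ((3 , B , 1113323) ∷ (3 , B , 113332) ∷ (3 , B , 13322) ∷ (4 , B , 1122) ∷ (4 , B , 122) ∷ (6 , B , 13) ∷ (6 , B , 1) ∷ [] , (18 , 147620) ∷ (18 , 146710) ∷ []) ∷
    ((2 , B , 113332) ∷ (2 , B , 13332) ∷ (2 , B , 1122) ∷ (2 , B , 122) ∷ (3 , B , 13) ∷ (3 , B , 1) ∷ [] , (17 , 136520) ∷ (17 , 146510) ∷ (1 , 10214356) ∷ (3 , 15024316) ∷ (6 , 1521063) ∷ (6 , 1521064) ∷ (17 , 146520) ∷ (17 , 136510) ∷ []) ∷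
    ((3 , B , 1113323) ∷ (3 , B , 113332) ∷ (3 , B , 13332) ∷ (4 , B , 1122) ∷ (4 , B , 122) ∷ (6 , B , 13) ∷ (6 , B , 1) ∷ [] , (16 , 147630) ∷ (16 , 147620) ∷ (16 , 146710) ∷ (1 , 132105476) ∷ []) ∷
    ((6 , B , 11113323) ∷ (6 , B , 1113323) ∷ (6 , B , 113332) ∷ (6 , B , 13332) ∷ (10 , B , 1122) ∷ (10 , B , 122) ∷ (15 , B , 13) ∷ (15 , B , 1) ∷ [] , (1 , 17046538) ∷ (1 , 18026517) ∷ []) ∷
    ((2 , B , 1132233) ∷ (2 , B , 123323) ∷ (2 , B , 13312) ∷ (2 , B , 1132) ∷ (2 , B , 132) ∷ (2 , B , 12) ∷ (3 , B , 1) ∷ [] , (14 , 173420) ∷ (14 , 174310) ∷ []) ∷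
    ((2 , B , 133212) ∷ (2 , B , 11322) ∷ (2 , B , 1322) ∷ (3 , B , 123) ∷ (2 , B , 13) ∷ (3 , B , 1) ∷ [] , (13 , 125640) ∷ (13 , 135640) ∷ (13 , 116420) ∷ []) ∷
    ((2 , B , 131332) ∷ (2 , B , 12123) ∷ (2 , B , 1332) ∷ (2 , B , 122) ∷ (3 , B , 13) ∷ (3 , B , 1) ∷ [] , (12 , 146530) ∷ (12 , 132650) ∷ (12 , 146510) ∷ []) ∷
    ((2 , B , 133132) ∷ (2 , B , 11223) ∷ (2 , B , 1223) ∷ (2 , B , 132) ∷ (3 , B , 12) ∷ (3 , B , 1) ∷ [] , (1 , 11032465) ∷ (11 , 156210) ∷ []) ∷
    ((2 , B , 1233123) ∷ (2 , B , 133312) ∷ (2 , B , 11232) ∷ (2 , B , 1232) ∷ (2 , B , 123) ∷ (2 , B , 12) ∷ (3 , B , 1) ∷ [] , (10 , 172310) ∷ []) ∷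
    ((2 , B , 131323) ∷ (2 , B , 13132) ∷ (2 , B , 1223) ∷ (2 , B , 132) ∷ (3 , B , 12) ∷ (3 , B , 1) ∷ [] , (9 , 165210) ∷ (1 , 11032456) ∷ (1 , 12041365) ∷ (9 , 156320) ∷ (9 , 165410) ∷ []) ∷
    ((3 , B , 1113323) ∷ (3 , B , 112233) ∷ (3 , B , 13223) ∷ (4 , B , 1132) ∷ (4 , B , 132) ∷ (6 , B , 12) ∷ (6 , B , 1) ∷ [] , (8 , 174620) ∷ (1 , 12034576) ∷ (8 , 176410) ∷ []) ∷
    ((2 , B , 1312233) ∷ (2 , B , 132312) ∷ (2 , B , 13232) ∷ (2 , B , 1123) ∷ (2 , B , 123) ∷ (2 , B , 12) ∷ (3 , B , 1) ∷ [] , (1 , 130527164) ∷ (2 , 140213675) ∷ (3 , 110452367) ∷ (3 , 102134756) ∷ (7 , 164710) ∷ []) ∷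
    ((3 , B , 11232133) ∷ (3 , B , 1321233) ∷ (5 , B , 133221) ∷ (5 , B , 12312) ∷ (6 , B , 1323) ∷ (6 , B , 132) ∷ (5 , B , 12) ∷ (5 , B , 1) ∷ [] , (2 , 186472350) ∷ (2 , 175381460) ∷ []) ∷
    ((3 , B , 11223231) ∷ (3 , B , 1222313) ∷ (5 , B , 133123) ∷ (5 , B , 11332) ∷ (5 , B , 1322) ∷ (5 , B , 122) ∷ (6 , B , 13) ∷ (6 , B , 1) ∷ [] , (1 , 158726430) ∷ (1 , 167815340) ∷ []) ∷
    ((3 , B , 11223133) ∷ (3 , B , 1332231) ∷ (5 , B , 112323) ∷ (5 , B , 13223) ∷ (5 , B , 1312) ∷ (6 , B , 132) ∷ (5 , B , 12) ∷ (6 , B , 1) ∷ [] , (1 , 175834260) ∷ (1 , 143716580) ∷ []) ∷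
    ((1 , B , 11222333) ∷ (1 , B , 1223233) ∷ (1 , B , 133123) ∷ (1 , B , 11332) ∷ (1 , B , 1322) ∷ (1 , B , 122) ∷ (1 , B , 11) ∷ (1 , B , 1) ∷ [] , []) ∷
    ((2 , B , 133123) ∷ (2 , B , 11332) ∷ (2 , B , 1332) ∷ (2 , B , 122) ∷ (3 , B , 13) ∷ (3 , B , 1) ∷ [] , (2 , 146520) ∷ (1 , 15143206) ∷ (2 , 146530) ∷ []) ∷
    ((2 , B , 1223313) ∷ (2 , B , 113323) ∷ (2 , B , 13332) ∷ (2 , B , 1122) ∷ (2 , B , 122) ∷ (2 , B , 13) ∷ (3 , B , 1) ∷ [] , []) ∷
    ((1 , B , 12233) ∷ (1 , B , 1323) ∷ (1 , B , 132) ∷ (1 , B , 12) ∷ (1 , B , 1) ∷ [] , (0 , 1052341) ∷ (1 , 1105432) ∷ (1 , 1205341) ∷ (1 , 1304251) ∷ (1 , 1403152) ∷ (1 , 1502143) ∷ []) ∷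
    ((2 , B , 113322) ∷ (2 , B , 13322) ∷ (3 , B , 1223) ∷ (3 , B , 132) ∷ (3 , B , 13) ∷ (3 , B , 1) ∷ [] , (4 , 130) ∷ (1 , 11023645) ∷ (1 , 11024536) ∷ (1 , 12013645) ∷ (1 , 12014536) ∷ (3 , 12130645) ∷ (3 , 12140536) ∷ []) ∷
    ((2 , B , 1113232) ∷ (2 , B , 131322) ∷ (4 , B , 13232) ∷ (4 , B , 1322) ∷ (5 , B , 123) ∷ (5 , B , 13) ∷ (5 , B , 1) ∷ [] , (0 , 1067543) ∷ (1 , 120314675) ∷ (1 , 110423576) ∷ (2 , 14230657) ∷ (2 , 14250736) ∷ (2 , 14031657) ∷ (2 , 13160745) ∷ []) ∷
    ((2 , B , 13311223) ∷ (2 , B , 1132132) ∷ (4 , B , 113322) ∷ (4 , B , 13322) ∷ (6 , B , 1223) ∷ (6 , B , 132) ∷ (7 , B , 13) ∷ (7 , B , 1) ∷ [] , []) ∷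
    ((2 , B , 1133232) ∷ (2 , B , 133232) ∷ (2 , B , 11322) ∷ (2 , B , 1322) ∷ (3 , B , 123) ∷ (3 , B , 13) ∷ (3 , B , 1) ∷ [] , []) ∷
    ((1 , B , 11) ∷ (1 , A , 1) ∷ [] , (1 , 1102) ∷ (4 , 1102) ∷ (22 , 120) ∷ []) ∷
    ((1 , B , 131) ∷ (1 , B , 11) ∷ (1 , A , 1) ∷ [] , (3 , 1203) ∷ (1 , 11023) ∷ (1 , 12013) ∷ (3 , 1103) ∷ (21 , 130) ∷ []) ∷
    ((2 , B , 1131) ∷ (2 , B , 131) ∷ (3 , B , 11) ∷ (3 , A , 1) ∷ [] , (2 , 1304) ∷ (1 , 132104) ∷ (2 , 1104) ∷ (2 , 1204) ∷ (20 , 140) ∷ []) ∷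
    ((2 , B , 13311) ∷ (2 , B , 1131) ∷ (2 , B , 131) ∷ (2 , B , 11) ∷ (3 , A , 1) ∷ [] , (19 , 150) ∷ []) ∷
    ((1 , B , 121) ∷ (1 , B , 11) ∷ (1 , A , 1) ∷ [] , (1 , 10123) ∷ (1 , 10213) ∷ (6 , 10213) ∷ []) ∷
    ((2 , B , 1131) ∷ (2 , B , 121) ∷ (3 , B , 11) ∷ (3 , A , 1) ∷ [] , (3 , 12034) ∷ (5 , 10324) ∷ (1 , 110324) ∷ (2 , 132104) ∷ []) ∷
    ((2 , B , 13311) ∷ (2 , B , 1131) ∷ (2 , B , 121) ∷ (2 , B , 11) ∷ (3 , A , 1) ∷ [] , (4 , 10435) ∷ []) ∷
    ((2 , B , 12311) ∷ (2 , B , 1131) ∷ (2 , B , 121) ∷ (2 , B , 11) ∷ (3 , A , 1) ∷ [] , []) ∷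
    ((1 , B , 1321) ∷ (1 , B , 121) ∷ (1 , B , 11) ∷ (1 , A , 1) ∷ [] , (1 , 110324) ∷ (2 , 10324) ∷ (2 , 10314) ∷ (1 , 120314) ∷ []) ∷
    ((2 , B , 11231) ∷ (2 , B , 1321) ∷ (3 , B , 121) ∷ (3 , B , 11) ∷ (3 , A , 1) ∷ [] , (1 , 10435) ∷ (1 , 12305) ∷ (1 , 11405) ∷ (10 , 143205) ∷ (10 , 134105) ∷ []) ∷
    ((1 , B , 1331) ∷ (1 , B , 121) ∷ (1 , B , 11) ∷ (1 , A , 1) ∷ [] , (1 , 120314) ∷ (1 , 130214) ∷ (2 , 110324) ∷ (4 , 110324) ∷ (4 , 110234) ∷ []) ∷
    ((2 , B , 11231) ∷ (2 , B , 1321) ∷ (3 , B , 131) ∷ (3 , B , 11) ∷ (3 , A , 1) ∷ [] , (3 , 130245) ∷ (3 , 140135) ∷ (1 , 142305) ∷ (1 , 131405) ∷ (3 , 142305) ∷ (3 , 131405) ∷ []) ∷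
    ((2 , B , 11331) ∷ (2 , B , 1331) ∷ (3 , B , 121) ∷ (3 , B , 11) ∷ (3 , A , 1) ∷ [] , (2 , 120435) ∷ (2 , 120345) ∷ (1 , 1210435) ∷ (2 , 110435) ∷ (2 , 110345) ∷ (6 , 143205) ∷ (6 , 143105) ∷ []) ∷
    ((1 , B , 111331) ∷ (1 , B , 11331) ∷ (1 , B , 1331) ∷ (2 , B , 121) ∷ (2 , B , 11) ∷ (2 , A , 1) ∷ [] , []) ∷
    ((2 , B , 11331) ∷ (2 , B , 1321) ∷ (3 , B , 121) ∷ (3 , B , 11) ∷ (3 , A , 1) ∷ [] , (6 , 120435) ∷ (1 , 1102345) ∷ (2 , 1120435) ∷ (3 , 1103245) ∷ (4 , 143105) ∷ (5 , 143205) ∷ (6 , 130425) ∷ (6 , 141305) ∷ (6 , 131405) ∷ []) ∷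
    ((1 , B , 111331) ∷ (1 , B , 11331) ∷ (1 , B , 1321) ∷ (2 , B , 121) ∷ (2 , B , 11) ∷ (2 , A , 1) ∷ [] , (5 , 130546) ∷ []) ∷
    ((1 , B , 111331) ∷ (1 , B , 11231) ∷ (1 , B , 1321) ∷ (2 , B , 121) ∷ (2 , B , 11) ∷ (2 , A , 1) ∷ [] , (4 , 130546) ∷ (4 , 102546) ∷ []) ∷
    ((2 , B , 123131) ∷ (2 , B , 11331) ∷ (2 , B , 1321) ∷ (2 , B , 121) ∷ (3 , B , 11) ∷ (3 , A , 1) ∷ [] , (3 , 152406) ∷ (3 , 151306) ∷ (3 , 125106) ∷ (3 , 115206) ∷ []) ∷
    ((1 , B , 12331) ∷ (1 , B , 1331) ∷ (1 , B , 121) ∷ (1 , B , 11) ∷ (1 , A , 1) ∷ [] , []) ∷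
    ((1 , B , 12231) ∷ (1 , B , 1321) ∷ (1 , B , 121) ∷ (1 , B , 11) ∷ (1 , A , 1) ∷ [] , []) ∷
    ((1 , B , 13231) ∷ (1 , B , 1321) ∷ (1 , B , 121) ∷ (1 , B , 11) ∷ (1 , A , 1) ∷ [] , (1 , 1103245) ∷ (1 , 1204135) ∷ []) ∷
    ((2 , B , 112331) ∷ (2 , B , 13231) ∷ (3 , B , 1321) ∷ (3 , B , 121) ∷ (3 , B , 11) ∷ (3 , A , 1) ∷ [] , (0 , 1652340) ∷ (0 , 1651430) ∷ []) ∷
    ((1 , A , 11) ∷ (1 , A , 1) ∷ [] , (1 , 1021) ∷ (6 , 1210) ∷ []) ∷
    ((1 , B , 111) ∷ (1 , A , 11) ∷ (1 , A , 1) ∷ [] , (1 , 11032) ∷ (2 , 11032) ∷ (5 , 1320) ∷ []) ∷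
    ((2 , B , 1111) ∷ (2 , B , 111) ∷ (3 , A , 11) ∷ (3 , A , 1) ∷ [] , (1 , 12043) ∷ (1 , 11043) ∷ []) ∷
    ((1 , B , 1311) ∷ (1 , B , 111) ∷ (1 , A , 11) ∷ (1 , A , 1) ∷ [] , (1 , 110243) ∷ (1 , 120143) ∷ (3 , 1430) ∷ []) ∷
    ((2 , B , 11311) ∷ (2 , B , 1311) ∷ (3 , B , 111) ∷ (3 , A , 11) ∷ (3 , A , 1) ∷ [] , (2 , 1540) ∷ (1 , 1321054) ∷ []) ∷
    ((2 , B , 133111) ∷ (2 , B , 11311) ∷ (2 , B , 1311) ∷ (2 , B , 111) ∷ (3 , A , 11) ∷ (3 , A , 1) ∷ [] , []) ∷
    ((1 , A , 111) ∷ (1 , A , 11) ∷ (1 , A , 1) ∷ [] , (1 , 10321) ∷ (3 , 13210) ∷ []) ∷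
    ((1 , B , 1111) ∷ (1 , A , 111) ∷ (1 , A , 11) ∷ (1 , A , 1) ∷ [] , (1 , 110432) ∷ []) ∷
    ((1 , B , 13111) ∷ (1 , B , 1111) ∷ (1 , A , 111) ∷ (1 , A , 11) ∷ (1 , A , 1) ∷ [] , []) ∷
    ((1 , A , 1111) ∷ (1 , A , 111) ∷ (1 , A , 11) ∷ (1 , A , 1) ∷ [] , (1 , 143210) ∷ []) ∷
    ((1 , A , 11111) ∷ (1 , A , 1111) ∷ (1 , A , 111) ∷ (1 , A , 11) ∷ (1 , A , 1) ∷ [] , []) ∷
    []

  states : List (State × List (ℕ × ℕ))
  states = map (λ (rows , hints) → decodeState rows , hints) table

  pick : List Config → ℕ → List ℕ → List (Config × List ℕ)
  pick [] _ is = []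
  pick (c ∷ cs) zero is = (c , is) ∷ []
  pick (c ∷ cs) (suc i) is = pick cs i is

  select : List Config → List (ℕ × ℕ) → List (Config × List ℕ)
  select cs = concatMap λ (i , code) → pick cs i (digits 9 code [])

  targetsOf : List (State × List (ℕ × ℕ)) → List Config
  targetsOf sts = pentagonWithApex ∷ map (λ (st , _) → config st) sts

  -- Targets are looked up among the pentagon and the states further down the list only. The moves
  -- are thus acyclic, and induction along the list ends at the pentagon.
  checkStates : List (State × List (ℕ × ℕ)) → Bool
  checkStates [] = true
  checkStates ((st , hints) ∷ sts) = checkState st (select (targetsOf sts) hints) ∧ checkStates sts


open StateTable

-- Soundness of the search: every state leads to the pentagon with apex.

module Reachability where
  open import Data.List using (_++_)
  open import Data.List.Properties using (++-assoc; map-++)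
  open import Data.List.Relation.Unary.Any using (Any; here; there)
  import Data.List.Relation.Unary.Any.Properties as Any
  open import Data.Bool using (Bool; true; false; _∧_; not)
  open import Data.Empty using (⊥; ⊥-elim)
  open import Data.Fin using (zero; suc)
  open import Data.List using (List; []; _∷_; length; map)
  open import Data.Maybe using (just)
  open import Data.Nat hiding (_≟_)
  open import Data.Nat.Properties hiding (_≟_)
  open import Data.Product using (_×_; _,_; proj₁; ∃-syntax; ∃₂)
  open import Data.Sum using (_⊎_; inj₁; inj₂; [_,_]′)
  open import Data.Unit using (tt)
  open import Relation.Binary.PropositionalEquality
  open import Data.Bool using () renaming (T to So)

  module _ (p : ℕ) (p≥1 : 1 ≤ p) {n : ℕ} (S : Setting n) (U : Subset n) where
    open Realisation p p≥1 S U

    RealisedIn : ℕ → ℕ → List Config → Set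
    RealisedIn g s ds = ∃[ d ] Any (d ≡_) ds × (∃[ Zs ] Realised g s d Zs)

    ForbiddenRealised : ℕ → ℕ → Set
    ForbiddenRealised g s = ∃₂ λ c ds → isForbidden c ds ≡ true × (∃[ Zs ] Realised g s (slotConfig c ds) Zs)

    truncate : ∀ {g s k} pre ls c Ys → Realised g s ((k , pre ++ ls) ∷ c) Ys → Realised g s ((k , pre) ∷ c) Ys
    truncate {g} pre ls c (Y ∷ Ys) (a , rs , r) = a , shorten pre Ys rs , r
      where
      shorten : ∀ pre Ys → RelatedAll g Y (pre ++ ls) Ys → RelatedAll g Y pre Ys
      shorten [] Ys rs = tt
      shorten (l ∷ pre) (Z ∷ Ys) (r , rs) = r , shorten pre Ys rs

    module _ (k : Bool) (st : State) (targets : List (Config × List ℕ)) {g s : ℕ} where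

      private
        Outcome : Set
        Outcome = RealisedIn g s (map proj₁ targets) ⊎ ForbiddenRealised g s

        light-absurd : ∀ {a b} → (a <ᵇ b) ≡ true → b ≤ a → ⊥
        light-absurd {a} {b} h = <⇒≱ (<ᵇ⇒< a b (subst (λ x → So x) (sym h) tt))

        placed-sound : ∀ c pl Ys → placed c pl ≡ true → Realised g s c Ys → Outcome
        placed-sound c (just (col , ss , ds)) Ys h r = inj₂ (col , sl , ∧-fst h , map (at Ys) (ss ++ ds) ,
          subconfig c (slotConfig col sl) (ss ++ ds) Ys (∧-snd {isForbidden col sl} h) r)
          where
          sl : List Bool
          sl = map (λ _ → false) ss ++ map (λ _ → true) ds

        target-hit : ∀ c ds Ys → containsAny c ds ≡ true → Realised g s c Ys → RealisedIn g s (map proj₁ ds)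
        target-hit c ((d , is) ∷ ds) Ys h r = [
          (λ h′ → d , here refl , map (at Ys) is , subconfig c d is Ys h′ r) ,
          (λ h′ → let (d′ , m , x) = target-hit c ds Ys h′ r in d′ , there m , x) ]′ (∪-elim (contains c d is) h)

        any-label : ∀ l b → (l ≡ full → b ≡ true) → Any (l ≡_) (newLabels b)
        any-label none true _ = here refl
        any-label half true _ = there (here refl)
        any-label full true _ = there (there (here refl))
        any-label red true _ = there (there (there (here refl)))
        any-label none false _ = here refl
        any-label half false _ = there (here refl)
        any-label full false h = ⊥-elim (true≢false (h refl) refl)
        any-label red false _ = there (there (here refl))

        plausible-tail : ∀ e rest l ls → plausible k (e ∷ rest) (l ∷ ls) ≡ true → plausible k rest ls ≡ true
        plausible-tail _ rest none ls h = h
        plausible-tail _ rest half ls h = h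
        plausible-tail _ rest red ls h = h
        plausible-tail (_ , t , _) rest full ls h = ∧-snd {not t} (∧-snd {not k} h)

        choice : ∀ w t us rest l ls → plausible k ((w , t , us) ∷ rest) (l ∷ ls) ≡ true → Any (l ≡_) (newLabels (not k ∧ not t))
        choice w t us rest l ls h = any-label l _ λ { refl → ∧-intro (∧-fst {not k} h) (∧-fst {not t} (∧-snd {not k} h)) }

        c : Config
        c = config st
        bound : ℕ
        bound = 5 * totalWeight st

      -- The actual labels of the new cluster are followed through the guesses of `covered`.
      -- Plausibility puts each actual label among those tried, and the actual score refutes the
      -- pruning test, so one of the other two exits must be taken.
      covered-sound : ∀ pre gained rest ls Ys → length ls ≡ length rest → plausible k rest ls ≡ true →
        bound ≤ 3 * (gained + score k rest ls) → covered k c bound targets pre gained rest ≡ true →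
        Realised g s ((just k , pre ++ ls) ∷ c) Ys → Outcome
      coveredAll-sound : ∀ pre gained w both rest l ls Ys choices → Any (l ≡_) choices → length ls ≡ length rest → plausible k rest ls ≡ true →
        bound ≤ 3 * (gained + (w * value both l + score k rest ls)) → coveredAll k c bound targets pre gained w both rest choices ≡ true →
        Realised g s ((just k , pre ++ l ∷ ls) ∷ c) Ys → Outcome

      covered-sound pre gained rest ls Ys len pl heavy h r with ∪-elim (3 * (gained + 2 * totalWeight rest) <ᵇ bound) h
      ... | inj₁ light = ⊥-elim (light-absurd light (≤-trans heavy (*-monoʳ-≤ 3 (+-monoʳ-≤ gained (score≤ k rest ls)))))
      ... | inj₂ h′ with ∪-elim (placed ((just k , pre) ∷ c) (placement ((just k , pre) ∷ c) (length pre) (lastLabel pre))) h′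
      ...   | inj₁ f = placed-sound ((just k , pre) ∷ c) (placement ((just k , pre) ∷ c) (length pre) (lastLabel pre)) Ys f (truncate pre ls c Ys r)
      covered-sound pre gained [] [] Ys len pl heavy h r | inj₂ h′ | inj₂ h″ =
        inj₁ (target-hit ((just k , pre) ∷ c) targets Ys h″ (truncate pre [] c Ys r))
      covered-sound pre gained ((w , t , us) ∷ rest) (l ∷ ls) Ys len pl heavy h r | inj₂ h′ | inj₂ h″ =
        coveredAll-sound pre gained w (not k ∧ not t) rest l ls Ys (newLabels (not k ∧ not t)) (choice w t us rest l ls pl) (suc-injective len)
          (plausible-tail (w , t , us) rest l ls pl) heavy h″ r

      coveredAll-sound pre gained w both rest l ls Ys (.l ∷ cs) (here refl) len pl heavy h r =
        covered-sound (pre ++ l ∷ []) (gained + w * value both l) rest ls Ys len pl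
          (subst (λ z → bound ≤ 3 * z) (sym (+-assoc gained (w * value both l) _)) heavy) (∧-fst h)
          (subst (λ z → Realised g s ((just k , z) ∷ c) Ys) (sym (++-assoc pre (l ∷ []) ls)) r)
      coveredAll-sound pre gained w both rest l ls Ys (x ∷ cs) (there m) len pl heavy h r =
        coveredAll-sound pre gained w both rest l ls Ys cs m len pl heavy (∧-snd {covered k c bound targets (pre ++ x ∷ []) (gained + w * value both x) rest} h) r

  pick-⊆ : ∀ cs i is d → Any (d ≡_) (map proj₁ (pick cs i is)) → Any (d ≡_) cs
  pick-⊆ (c ∷ cs) zero is d (here eq) = here eq
  pick-⊆ (c ∷ cs) (suc i) is d m = there (pick-⊆ cs i is d m)

  select-⊆ : ∀ cs hs d → Any (d ≡_) (map proj₁ (select cs hs)) → Any (d ≡_) cs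
  select-⊆ cs ((i , code) ∷ hs) d m = [ pick-⊆ cs i (digits 9 code []) d , select-⊆ cs hs d ]′
    (Any.++⁻ (map proj₁ (pick cs i (digits 9 code []))) (subst (Any (d ≡_)) (map-++ proj₁ (pick cs i (digits 9 code [])) (select cs hs)) m))

  module Strategy (p : ℕ) (p-large : 3800 ≤ p) where

    private
      p≥2 : 2 ≤ p
      p≥2 = ≤-trans (m≤m+n 2 3798) p-large
      p≥1 : 1 ≤ p
      p≥1 = ≤-trans (n≤1+n 1) p≥2
      q : ℕ
      q = 2 * p
      q≥1 : 1 ≤ q
      q≥1 = ≤-trans p≥1 (m≤m+n p _)
      e : ℕ
      e = 6 * q ^ 6

    open Losses p p≥1 using (newShare)

    -- The quantifiers follow the flow of the parameters: the depth `g*` wanted at the end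
    -- determines the depth `g` needed now, whereas the share `s` given now determines the final
    -- `s*` and the size bound `K`.
    Reaching : List Config → Set
    Reaching ds = ∀ g* → 1 ≤ g* → ∃[ g ] 1 ≤ g × e ≤ g × (∀ s → ∃[ s* ] ∃[ K ]
      (∀ {n} (S : Setting n) (U : Subset n) → Extension.MinDegree p p≥2 S U → 1 ≤ card U → K * Setting.M S ≤ card U →
        RealisedIn p p≥1 S U g s ds → ∃[ Xs ] Realisation.Realised p p≥1 S U g* s* pentagonWithApex Xs))

    reflexive-shrink : ∀ {n} (S : Setting n) (U : Subset n) {g s} c Xs → Realisation.Realised p p≥1 S U g s c Xs → Extension.Shrunk p p≥2 S U Xs Xs
    reflexive-shrink S U [] [] r = tt
    reflexive-shrink S U (_ ∷ c) (X ∷ Xs) (_ , _ , r) =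
      (⊑-refl {X = X} , ≤-trans (≤-reflexive (sym (*-identityˡ _))) (*-monoˡ-≤ (card X) q≥1)) , reflexive-shrink S U c Xs r

    refute : ∀ {n} (S : Setting n) (U : Subset n) {g s} → 1 ≤ card U → e ≤ g → s * e * Setting.M S ≤ card U → ForbiddenRealised p p≥1 S U g s → ⊥
    refute S U {g} {s} U≥1 hg hK (c , ds , ok , Xs , r) = Realisation.forbidden p p≥1 S U {g} {s} c ds Xs (∧-fst ok)
      (≡ᵇ⇒≡ (slotWeight ds) (cliqueLimit c) (subst So (sym (∧-fst ok′)) tt)) len
      (≤-trans e≤ hg) U≥1 (≤-trans (*-monoʳ-≤ s (*-monoˡ-≤ (Setting.M S) e≤)) (≤-trans (≤-reflexive (sym (*-assoc s e (Setting.M S)))) hK)) r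
      where
      ok′ : (slotWeight ds ≡ᵇ cliqueLimit c) ∧ (length ds ≤ᵇ 6) ≡ true
      ok′ = ∧-snd {allowed c ds} ok
      len : length ds ≤ 6
      len = ≤ᵇ-true (∧-snd {slotWeight ds ≡ᵇ cliqueLimit c} ok′)
      e≤ : 6 * q ^ length ds ≤ e
      e≤ = *-monoʳ-≤ 6 (^-monoʳ-≤ q {{>-nonZero q≥1}} len)

    base : Reaching (pentagonWithApex ∷ [])
    base g* g*≥1 = q * g* + e , ≤-trans g*≥1 (≤-trans (m≤n*m g* q {{>-nonZero q≥1}}) (m≤m+n _ _)) , m≤n+m e (q * g*) , λ s → s * q , 0 ,
      λ { S U mindeg U≥1 hK (_ , here refl , Xs , r) →
        Xs , Extension.shrink-realised p p≥2 S U {q * g* + e} {g*} {s} pentagonWithApex Xs Xs (m≤m+n (q * g*) e) (reflexive-shrink S U pentagonWithApex Xs r) r }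

    -- Extending the state by one cluster yields, by the check, a forbidden placement or a
    -- configuration further down the list. A target that is already in that list is merely
    -- rewritten with depth `g₁` and share parameter `s₁`, so that one set of bounds serves both
    -- cases.
    step : ∀ st ds ds′ → (∀ d → Any (d ≡_) (map proj₁ ds′) → Any (d ≡_) ds) → checkState st ds′ ≡ true → Reaching ds → Reaching (config st ∷ ds)
    step st ds ds′ sub ok rec g* g*≥1 with rec g* g*≥1
    ... | g₁ , g₁≥1 , e≤g₁ , rec′ = q * g₁ , *-mono-≤ q≥1 g₁≥1 , ≤-trans e≤g₁ (m≤n*m g₁ q {{>-nonZero q≥1}}) , bounds
      where
      small : 38 * totalWeight st ≤ p
      small = ≤-trans (*-monoʳ-≤ 38 (≤ᵇ-true {totalWeight st} {100} (∧-fst (∧-snd {1 ≤ᵇ totalWeight st} ok)))) p-large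
      Covered : Bool → Bool
      Covered k = covered k (config st) (5 * totalWeight st) ds′ [] 0 st
      ok′ : Covered true ∧ Covered false ≡ true
      ok′ = ∧-snd {totalWeight st ≤ᵇ 100} (∧-snd {1 ≤ᵇ totalWeight st} ok)
      both : ∀ k → Covered k ≡ true
      both true = ∧-fst ok′
      both false = ∧-snd {Covered true} ok′
      bounds : ∀ s → ∃[ s* ] ∃[ K ] (∀ {n} (S : Setting n) (U : Subset n) → Extension.MinDegree p p≥2 S U → 1 ≤ card U → K * Setting.M S ≤ card U →
        RealisedIn p p≥1 S U (q * g₁) s (config st ∷ ds) → ∃[ Xs ] Realisation.Realised p p≥1 S U g* s* pentagonWithApex Xs)
      bounds s = let (s* , K , reach) = rec′ s₁ in s* , K + s₁ * e , λ
        { {n} S U mindeg U≥1 hK (_ , here refl , Xs , r) →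
            let hK₁ = ≤-trans (*-monoˡ-≤ (Setting.M S) (m≤m+n K (s₁ * e))) hK
                hK₂ = ≤-trans (*-monoˡ-≤ (Setting.M S) (m≤n+m (s₁ * e) K)) hK
                (k , ls , Ys , len , pl , heavy , r′) = Extension.extend p p≥2 S U {s} st Xs g₁ mindeg g₁≥1 U≥1 small r
            in [ (λ { (d , m , x) → reach S U mindeg U≥1 hK₁ (d , sub d m , x) }) , (λ f → ⊥-elim (refute S U {g₁} {s₁} U≥1 e≤g₁ hK₂ f)) ]′
                 (covered-sound p p≥1 S U k st ds′ {g₁} {s₁} [] 0 st ls Ys len pl heavy (both k) r′)
        ; {n} S U mindeg U≥1 hK (d , there m , Xs , r) →
            reach S U mindeg U≥1 (≤-trans (*-monoˡ-≤ (Setting.M S) (m≤m+n K (s₁ * e))) hK) (d , m , Xs , Extension.realised-mono p p≥2 S U d Xs (m≤m+n (s * q) (newShare st g₁))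
              (Extension.shrink-realised p p≥2 S U {q * g₁} {g₁} {s} d Xs Xs ≤-refl (reflexive-shrink S U d Xs r) r)) }
        where
        s₁ : ℕ
        s₁ = s * q + newShare st g₁

    reorder : ∀ {cs} st → Reaching (config st ∷ pentagonWithApex ∷ cs) → Reaching (pentagonWithApex ∷ config st ∷ cs)
    reorder st R g* g*≥1 = let (g , g≥1 , e≤g , R′) = R g* g*≥1 in g , g≥1 , e≤g , λ s → let (s* , K , reach) = R′ s in s* , K ,
      λ S U mindeg U≥1 hK → λ
        { (d , here eq , x) → reach S U mindeg U≥1 hK (d , there (here eq) , x)
        ; (d , there (here eq) , x) → reach S U mindeg U≥1 hK (d , here eq , x)
        ; (d , there (there m) , x) → reach S U mindeg U≥1 hK (d , there (there m) , x) }

    reaching : ∀ sts → checkStates sts ≡ true → Reaching (targetsOf sts)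
    reaching [] ok = base
    reaching ((st , hints) ∷ sts) ok = reorder st (step st (targetsOf sts) (select (targetsOf sts) hints) (select-⊆ (targetsOf sts) hints) (∧-fst ok)
      (reaching sts (∧-snd {checkState st (select (targetsOf sts) hints)} ok)))


open Reachability

-- The six classes determined by a pentagon with apex.

module PentagonClasses where
  open import Data.List using (_++_)
  open import Data.List.Properties using (length-++)
  open import Data.Fin using (toℕ)
  open import Data.Fin.Patterns
  open import Data.Bool using (Bool; true; false; _∧_; _∨_; not; if_then_else_)
  open import Data.Empty using (⊥; ⊥-elim)
  open import Data.Fin using (Fin; suc)
  open import Data.List using (List; []; _∷_; length; map)
  open import Data.List.Properties using (length-map)
  open import Data.List.Relation.Unary.All as All using (All; []; _∷_)
  import Data.List.Relation.Unary.All.Properties as All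
  open import Data.List.Relation.Unary.AllPairs as AllPairs using (AllPairs; []; _∷_)
  import Data.List.Relation.Unary.AllPairs.Properties as AllPairs
  open import Data.Maybe using (just)
  open import Data.Nat hiding (_≟_)
  open import Data.Nat.Properties hiding (_≟_)
  open import Data.Nat.Tactic.RingSolver using (solve-∀)
  open import Data.Product using (_×_; _,_; proj₁; proj₂)
  open import Data.Sum using (_⊎_; inj₁; inj₂; [_,_]′)
  open import Data.Unit using (tt)
  open import Function using (_∘_; id)
  open import Relation.Binary.PropositionalEquality
  open import Relation.Nullary using (¬_)
  open import Algebra.Properties.CommutativeMonoid.Sum +-0-commutativeMonoid using (sum; ∑-distrib-+; ∑-comm; sum-cong-≗)
  open import Data.Fin using () renaming (_≟_ to _≟ᶠ_)
  open import Data.Bool using () renaming (T to So)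
  open import Relation.Nullary using (does)
  open import Relation.Nullary.Decidable using (dec-false)
  open import Data.List.Relation.Unary.Any using (Any; here; there)
  open import Algebra.Properties.Semiring.Sum +-*-semiring using (*-distribˡ-sum)

  -- Five pairs, one component of each holding; the first components are
  -- independent in a 5-cycle and the second ones in its complement.
  pentagon-cover : ∀ {R₁ R₂ R₃ R₄ R₅ B₁ B₂ B₃ B₄ B₅ : Set} →
    R₁ ⊎ B₁ → R₂ ⊎ B₂ → R₃ ⊎ B₃ → R₄ ⊎ B₄ → R₅ ⊎ B₅ →
    (R₁ → R₂ → ⊥) → (R₃ → R₄ → ⊥) → (R₁ → R₅ → ⊥) →
    (B₂ → B₅ → ⊥) → (B₁ → B₃ → ⊥) → (B₁ → B₄ → ⊥) → ⊥
  pentagon-cover (inj₁ r₁) (inj₁ r₂) _ _ _ r₁₂ _ _ _ _ _ = r₁₂ r₁ r₂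
  pentagon-cover (inj₁ r₁) (inj₂ b₂) _ _ (inj₁ r₅) _ _ r₁₅ _ _ _ = r₁₅ r₁ r₅
  pentagon-cover (inj₁ r₁) (inj₂ b₂) _ _ (inj₂ b₅) _ _ _ b₂₅ _ _ = b₂₅ b₂ b₅
  pentagon-cover (inj₂ b₁) _ (inj₂ b₃) _ _ _ _ _ _ b₁₃ _ = b₁₃ b₁ b₃
  pentagon-cover (inj₂ b₁) _ (inj₁ r₃) (inj₂ b₄) _ _ _ _ _ _ b₁₄ = b₁₄ b₁ b₄
  pentagon-cover (inj₂ b₁) _ (inj₁ r₃) (inj₁ r₄) _ _ r₃₄ _ _ _ _ = r₃₄ r₃ r₄

  -- Four consecutive vertices j₁, k₁, k₂, j₂ of the red 5-cycle: the outer ones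
  -- must be red and the inner ones blue.
  path-cover : ∀ {Rj Rk Rk′ Rj′ Bj Bk Bk′ Bj′ : Set} →
    Rj ⊎ Bj → Rk ⊎ Bk → Rk′ ⊎ Bk′ → Rj′ ⊎ Bj′ →
    (Rj → Rk → ⊥) → (Rk′ → Rj′ → ⊥) →
    (Bj → Bj′ → ⊥) → (Bj → Bk′ → ⊥) → (Bk → Bj′ → ⊥) → (¬ Bj × ¬ Rk) × (¬ Rk′ × ¬ Bj′)
  path-cover hj hk hk′ hj′ rjk rk′j′ bjj′ bjk′ bkj′ = (¬bj , ¬rk) , (¬rk′ , ¬bj′)
    where
    ¬bj : ¬ _
    ¬bj bj = [ (λ rk′ → [ rk′j′ rk′ , bjj′ bj ]′ hj′) , bjk′ bj ]′ hk′
    ¬bj′ : ¬ _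
    ¬bj′ bj′ = [ (λ rk → [ (λ rj → rjk rj rk) , (λ bj → bjj′ bj bj′) ]′ hj) , (λ bk → bkj′ bk bj′) ]′ hk
    ¬rk : ¬ _
    ¬rk rk = [ (λ rj → rjk rj rk) , ¬bj ]′ hj
    ¬rk′ : ¬ _
    ¬rk′ rk′ = [ rk′j′ rk′ , ¬bj′ ]′ hj′

  -- Divided out: each class has a share of at most 1/6 + 1/(6e) + 2/t of `U`, and all of `U` but a
  -- share 10/e + 20/t and a multiple of `M` lies in `core`, where every vertex has at most 2 * M
  -- neighbours in its own class.
  record NearPartition {n : ℕ} (S : Setting n) (U : Subset n) (e t : ℕ) : Set where
    open Setting S
    field
      class         : Fin n → Fin 6
      core          : Subset n
      core-sparse   : ∀ v → v ∈ core → let Y = core ∩ (λ w → does (class w ≟ᶠ class v)) in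
        card (E true v ∩ Y) + card (E false v ∩ Y) ≤ 2 * M
      core-missing  : e * t * card (U ∖ core) ≤ 10 * t * card U + 20 * e * card U + e * t * (5 * (t * M) + 3 * M)
      class-size    : ∀ j → 6 * e * t * card (U ∩ λ w → does (class w ≟ᶠ j)) ≤ t * card U + e * t * card U + 12 * e * card U

  module PentagonStructure (p : ℕ) (p≥2 : 2 ≤ p) {n : ℕ} (S : Setting n) (U : Subset n) (g s : ℕ) (Xs : List (Subset n))
    (realised : Realisation.Realised p (≤-trans (s≤s z≤n) p≥2) S U g s pentagonWithApex Xs)
    (t : ℕ) (t≥10 : 10 ≤ t) (hg : 6 * ((2 * p) ^ 3 * t) ≤ g) (U≥1 : 1 ≤ card U)
    (hM : s * (6 * ((2 * p) ^ 3 * t) * Setting.M S) ≤ card U) where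
    open Setting S
    open Degrees E E-sym
    open Extension p p≥2 S U using (total; total≤card; total-swap)
    private
      p≥1 : 1 ≤ p
      p≥1 = ≤-trans (s≤s z≤n) p≥2
    open Realisation p p≥1 S U
    open Embedding S p g p≥1 using (SlotDense; Usable; embed; Embedded; q≥1)

    X : Fin 6 → Subset n
    X j = at Xs (toℕ j)

    m : Fin 6 → ℕ
    m j = card (X j)

    K : ℕ
    K = 6 * ((2 * p) ^ 3 * t)

    apexKind : Fin 6 → Bool
    apexKind 0F = true
    apexKind (suc _) = false

    cluster : ∀ j → Cluster s (just (apexKind j)) (X j)
    cluster 0F = cluster-covers pentagonWithApex Xs realised 0 (just true) refl
    cluster 1F = cluster-covers pentagonWithApex Xs realised 1 (just false) refl
    cluster 2F = cluster-covers pentagonWithApex Xs realised 2 (just false) refl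
    cluster 3F = cluster-covers pentagonWithApex Xs realised 3 (just false) refl
    cluster 4F = cluster-covers pentagonWithApex Xs realised 4 (just false) refl
    cluster 5F = cluster-covers pentagonWithApex Xs realised 5 (just false) refl

    X⊑U : ∀ j → X j ⊑ U
    X⊑U j = proj₁ (cluster j)

    large : ∀ j → K * M ≤ m j
    large j = share-cancel {s} U≥1 hM (proj₁ (proj₂ (cluster j)))

    m≥1 : ∀ j → 1 ≤ m j
    m≥1 j = positive s U≥1 (proj₁ (proj₂ (cluster j)))

    related : ∀ i j → Related g (label pentagonWithApex (toℕ i) (toℕ j)) (X i) (X j)
    related i j = related-at pentagonWithApex Xs realised (toℕ i) (toℕ j)

    within : Subset n → Fin 6 → Bool → Slot n
    within N j d = slot (X j) (N ∩ X j) d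

    usable : ∀ {c} N j d → m j ≤ t * card (N ∩ X j) → (d ≡ true → apexKind j ≡ c) → Usable c t K (within N j d)
    usable N j d h k = record { inside = ∩-⊑ʳ N (X j) ; share = h ; large = large j
      ; typed = λ e i i∈ → trans (proj₂ (proj₂ (cluster j)) i (∩-⊑ʳ N (X j) i i∈)) (k e) }

    power≤ : ∀ {l} → l ≤ 3 → 6 * ((2 * p) ^ l * t) ≤ K
    power≤ h = *-monoʳ-≤ 6 (*-monoˡ-≤ t (^-monoʳ-≤ (2 * p) {{>-nonZero q≥1}} h))

    -- A clique zs of colour c completed by one embedded into the clusters inside
    -- its common neighbourhood N is too large.
    clash : ∀ c (zs : List (Fin n)) (N : Subset n) (js : List (Fin 6 × Bool)) → AllPairs (λ x y → E c x y ≡ true) zs → All (λ z → N ⊑ E c z) zs →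
      let ss = map (λ (j , d) → within N j d) js in
      AllPairs (SlotDense c) ss → All (λ (j , d) → m j ≤ t * card (N ∩ X j) × (d ≡ true → apexKind j ≡ c)) js → length js ≤ 3 →
      length zs + weight ss ≡ cliqueLimit c → ⊥
    clash c zs N js adj nbr pairs ok len size =
      let (xs , lenxs , adjxs , in-N) = embed c K t ss pairs (All.map⁺ (All.map (λ {(j , d)} (h , k) → usable N j d h k) ok))
            (≤-trans len′ (m≤m+n 3 3)) (≤-trans (power≤ len′) hg) (power≤ len′) (≤-trans (s≤s z≤n) t≥10)
      in no-clique c (zs ++ xs) (AllPairs.++⁺ adj adjxs (All.map (λ N⊑ → All.map (λ {x} → N⊑ x) (in-N N (inside js))) nbr))
           (trans (length-++ zs) (trans (cong (length zs +_) lenxs) size))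
      where
      ss : List (Slot n)
      ss = map (λ (j , d) → within N j d) js
      len′ : length ss ≤ 3
      len′ = ≤-trans (≤-reflexive (length-map _ js)) len
      inside : ∀ js → All (λ s → current s ⊑ N) (map (λ (j , d) → within N j d) js)
      inside [] = []
      inside ((j , d) ∷ js) = ∩-⊑ˡ N (X j) ∷ inside js

    hits : Bool → Fin 6 → Subset n
    hits c j v = m j ≤ᵇ t * deg c v (X j)

    hit-share : ∀ c j v → v ∈ hits c j → m j ≤ t * card (E c v ∩ X j)
    hit-share c j v h = ≤ᵇ-true h

    no-red-apex : ∀ v → v ∈ hits true 0F → ⊥
    no-red-apex v h = clash true (v ∷ []) (E true v) ((0F , true) ∷ []) ([] ∷ []) ((⊑-refl {X = E true v}) ∷ [])
      ([] ∷ []) ((hit-share true 0F v h , λ _ → refl) ∷ []) (s≤s z≤n) refl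

    no-red-pair : ∀ {j k} v → Dense q g 1 true (X j) (X k) → v ∈ hits true j → v ∈ hits true k → ⊥
    no-red-pair {j} {k} v D hj hk = clash true (v ∷ []) (E true v) ((j , false) ∷ (k , false) ∷ []) ([] ∷ []) ((⊑-refl {X = E true v}) ∷ [])
      ((D ∷ []) ∷ [] ∷ []) ((hit-share true j v hj , λ ()) ∷ (hit-share true k v hk , λ ()) ∷ []) (s≤s (s≤s z≤n)) refl

    -- The weights are 1 + 1 + 2 + 2 = 6: the vertex, the apex cluster once, and two pentagon
    -- clusters of blue kind doubled. The apex slot comes first, so positive density from it is
    -- enough.
    no-blue-triple : ∀ {j k} v → apexKind j ≡ false → apexKind k ≡ false →
      Dense q g 1 false (X 0F) (X j) → Dense q g 1 false (X 0F) (X k) → Dense q g (suc p) false (X j) (X k) →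
      v ∈ hits false 0F → v ∈ hits false j → v ∈ hits false k → ⊥
    no-blue-triple {j} {k} v kj kk D₁ D₂ D₃ h₀ hj hk = clash false (v ∷ []) (E false v) ((0F , false) ∷ (j , true) ∷ (k , true) ∷ [])
      ([] ∷ []) ((⊑-refl {X = E false v}) ∷ []) ((D₁ ∷ D₂ ∷ []) ∷ (D₃ ∷ []) ∷ [] ∷ [])
      ((hit-share false 0F v h₀ , λ ()) ∷ (hit-share false j v hj , λ _ → kj) ∷ (hit-share false k v hk , λ _ → kk) ∷ []) ≤-refl refl

    misses : Fin 6 → Subset n
    misses j v = not (hits true j v) ∧ not (hits false j v)

    not-missed : ∀ j v → misses j v ≡ false → (v ∈ hits true j) ⊎ (v ∈ hits false j)
    not-missed j v = help (hits true j v) (hits false j v)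
      where
      help : ∀ a b → not a ∧ not b ≡ false → (a ≡ true) ⊎ (b ≡ true)
      help true b _ = inj₁ refl
      help false true _ = inj₂ refl

    class : Fin n → Fin 6
    class v = if misses 0F v then 0F else if misses 1F v then 1F else if misses 2F v then 2F else
      -- The default `5F` is legitimate because `class-missed` shows that some cluster is always
      -- missed.
      if misses 3F v then 3F else if misses 4F v then 4F else 5F

    class-missed : ∀ v → misses (class v) v ≡ true
    class-missed v with misses 0F v in e₀
    ... | true = e₀
    ... | false with misses 1F v in e₁
    ... | true = e₁
    ... | false with misses 2F v in e₂
    ... | true = e₂
    ... | false with misses 3F v in e₃
    ... | true = e₃
    ... | false with misses 4F v in e₄
    ... | true = e₄
    ... | false with misses 5F v in e₅
    ... | true = refl
    ... | false = ⊥-elim (contra (not-missed 0F v e₀))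
      where
      contra : (v ∈ hits true 0F) ⊎ (v ∈ hits false 0F) → ⊥
      contra (inj₁ r₀) = no-red-apex v r₀
      contra (inj₂ b₀) = pentagon-cover (not-missed 1F v e₁) (not-missed 2F v e₂) (not-missed 3F v e₃) (not-missed 4F v e₄) (not-missed 5F v e₅)
        (no-red-pair v (related 1F 2F)) (no-red-pair v (related 3F 4F)) (no-red-pair v (related 1F 5F))
        (no-blue-triple v refl refl (related 0F 2F) (related 0F 5F) (related 2F 5F) b₀)
        (no-blue-triple v refl refl (related 0F 1F) (related 0F 3F) (related 1F 3F) b₀)
        (no-blue-triple v refl refl (related 0F 1F) (related 0F 4F) (related 1F 4F) b₀)

    class-sparse : ∀ v → t * total v (X (class v)) ≤ 2 * m (class v)
    class-sparse v = begin
      t * total v (X j)                                 ≡⟨ *-distribˡ-+ t (deg true v (X j)) _ ⟩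
      t * deg true v (X j) + t * deg false v (X j)      ≤⟨ +-mono-≤ (<⇒≤ (below true (not-true (∧-fst {not (hits true j v)} miss)))) (<⇒≤ (below false (not-true (∧-snd {not (hits true j v)} miss)))) ⟩
      m j + m j                                         ≡⟨ cong (m j +_) (sym (+-identityʳ (m j))) ⟩
      2 * m j ∎
      where
      open ≤-Reasoning
      j : Fin 6
      j = class v
      miss : misses j v ≡ true
      miss = class-missed v
      below : ∀ c → hits c j v ≡ false → t * deg c v (X j) < m j
      below c h = ≤ᵇ-false {m j} {t * deg c v (X j)} h

    inClass : Fin 6 → Subset n
    inClass j v = does (class v ≟ᶠ j)

    -- A vertex that is not poor and does not hit the cluster in one colour keeps 9/10 - 1/10 = 4/5
    -- of it in the other; this is `Strong`. Two strong vertices share 3/5 of the cluster and three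
    -- still share 2/5.
    poor : Fin 6 → Subset n
    poor j v = 10 * total v (X j) <ᵇ 9 * m j

    exceptional : Fin 6 → Subset n
    exceptional j = (U ∖ inClass j) ∩ poor j

    <ᵇ-true : ∀ {a b} → (a <ᵇ b) ≡ true → a < b
    <ᵇ-true {a} {b} h = <ᵇ⇒< a b (subst So (sym h) tt)

    <ᵇ-false : ∀ {a b} → (a <ᵇ b) ≡ false → b ≤ a
    <ᵇ-false {a} {b} h = ≮⇒≥ λ a<b → subst So h (<⇒<ᵇ a<b)

    -- Edges between `U` and `X j`, counted from both sides. A vertex of the class sees at most 2/t
    -- of `X j`, an exceptional one at most 9/10, the rest at most everything; the degrees of the
    -- vertices of `X j` bound the sum below. `L` and `R` allow both a strict surplus and a small
    -- deficit in the degrees.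
    class-count : ∀ e L R → (∀ x → x ∈ U → L ≤ 6 * e * total x U + R) → ∀ j →
      10 * t * L + 6 * e * t * card (exceptional j) + 60 * e * t * card (U ∩ inClass j) ≤
      10 * t * R + 120 * e * card (U ∩ inClass j) + 60 * e * t * card U
    class-count e L R mindeg j = *-cancelˡ-≤ k {{>-nonZero (m≥1 j)}} (begin
      k * (10 * t * L + 6 * e * t * x + 60 * e * t * c)                            ≡⟨ id₁ k t L e x c ⟩
      10 * t * (k * L) + 6 * e * (t * (k * x) + 10 * t * (k * c))                  ≤⟨ +-monoˡ-≤ _ (*-monoʳ-≤ (10 * t) below) ⟩
      10 * t * (6 * e * D + k * R) + 6 * e * (t * (k * x) + 10 * t * (k * c))      ≡⟨ id₂ k t R e x c D ⟩
      10 * t * k * R + 6 * e * (10 * (t * D) + t * (k * x) + 10 * t * (k * c))     ≤⟨ +-monoʳ-≤ (10 * t * k * R) (*-monoʳ-≤ (6 * e) above) ⟩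
      10 * t * k * R + 6 * e * (20 * (k * c) + 10 * (t * (k * u)))                 ≡⟨ id₃ k t R e u c ⟩
      k * (10 * t * R + 120 * e * c + 60 * e * t * u) ∎)
      where
      open ≤-Reasoning
      k x c u D : ℕ
      rest : Subset n
      rest = U ∖ inClass j
      k = m j
      x = card (exceptional j)
      c = card (U ∩ inClass j)
      u = card U
      D = sumOver U (λ v → total v (X j))
      Dᵢ Dᵣ : ℕ
      Dᵢ = sumOver (U ∩ inClass j) (λ v → total v (X j))
      Dᵣ = sumOver rest (λ v → total v (X j))
      id₁ : ∀ k t L e x c → k * (10 * t * L + 6 * e * t * x + 60 * e * t * c) ≡ 10 * t * (k * L) + 6 * e * (t * (k * x) + 10 * t * (k * c))
      id₁ = solve-∀
      id₂ : ∀ k t R e x c D → 10 * t * (6 * e * D + k * R) + 6 * e * (t * (k * x) + 10 * t * (k * c)) ≡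
        10 * t * k * R + 6 * e * (10 * (t * D) + t * (k * x) + 10 * t * (k * c))
      id₂ = solve-∀
      id₃ : ∀ k t R e u c → 10 * t * k * R + 6 * e * (20 * (k * c) + 10 * (t * (k * u))) ≡ k * (10 * t * R + 120 * e * c + 60 * e * t * u)
      id₃ = solve-∀
      below : k * L ≤ 6 * e * D + k * R
      below = begin
        k * L                                                       ≤⟨ sumOver-≥ (X j) (λ x x∈ → mindeg x (X⊑U j x x∈)) ⟩
        sumOver (X j) (λ x → 6 * e * total x U + R)                 ≡⟨ sumOver-+ (X j) (λ x → 6 * e * total x U) (λ _ → R) ⟩
        sumOver (X j) (λ x → 6 * e * total x U) + sumOver (X j) (λ _ → R) ≤⟨ +-mono-≤
           (≤-reflexive (trans (sumOver-* (X j) (6 * e) (λ x → total x U)) (cong (6 * e *_) (total-swap (X j) U)))) (sumOver-≤ (X j) (λ _ _ → ≤-refl)) ⟩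
        6 * e * D + k * R ∎
      classSum : t * Dᵢ ≤ c * (2 * k)
      classSum = begin
        t * Dᵢ                                                  ≡⟨ sym (sumOver-* (U ∩ inClass j) t (λ v → total v (X j))) ⟩
        sumOver (U ∩ inClass j) (λ v → t * total v (X j))       ≤⟨ sumOver-≤ (U ∩ inClass j) (λ v v∈ →
           subst (λ i → t * total v (X i) ≤ 2 * m i) (does-sound (∧-snd {U v} v∈)) (class-sparse v)) ⟩
        c * (2 * k) ∎
      restSum : 10 * Dᵣ + k * x ≤ card rest * (10 * k)
      restSum = begin
        10 * Dᵣ + k * x                                                            ≡⟨ cong₂ _+_ (sym (sumOver-* rest 10 (λ v → total v (X j)))) (cong (k *_) (sum-cong-≗ λ v → ⟦∧⟧ (rest v) (poor j v))) ⟩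
        sumOver rest (λ v → 10 * total v (X j)) + k * sumOver rest (λ v → ⟦ poor j v ⟧) ≡⟨ cong (sumOver rest (λ v → 10 * total v (X j)) +_) (sym (sumOver-* rest k (λ v → ⟦ poor j v ⟧))) ⟩
        sumOver rest (λ v → 10 * total v (X j)) + sumOver rest (λ v → k * ⟦ poor j v ⟧) ≡⟨ sym (sumOver-+ rest (λ v → 10 * total v (X j)) (λ v → k * ⟦ poor j v ⟧)) ⟩
        sumOver rest (λ v → 10 * total v (X j) + k * ⟦ poor j v ⟧)                 ≤⟨ sumOver-≤ rest (λ v _ → pointwise v) ⟩
        card rest * (10 * k) ∎
        where
        pointwise : ∀ v → 10 * total v (X j) + k * ⟦ poor j v ⟧ ≤ 10 * k
        pointwise v with poor j v in eq
        ... | true = ≤-trans (+-mono-≤ (<⇒≤ (<ᵇ-true eq)) (≤-reflexive (*-identityʳ k))) (≤-reflexive (nine k))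
          where
          nine : ∀ k → 9 * k + k ≡ 10 * k
          nine = solve-∀
        ... | false = ≤-trans (≤-reflexive (trans (cong (10 * total v (X j) +_) (*-zeroʳ k)) (+-identityʳ _))) (*-monoʳ-≤ 10 (total≤card v (X j)))
      above : 10 * (t * D) + t * (k * x) + 10 * t * (k * c) ≤ 20 * (k * c) + 10 * (t * (k * u))
      above = begin
        10 * (t * D) + t * (k * x) + 10 * t * (k * c)                   ≡⟨ cong (λ z → 10 * (t * z) + t * (k * x) + 10 * t * (k * c)) (sumOver-split U (inClass j) (λ v → total v (X j))) ⟩
        10 * (t * (Dᵢ + Dᵣ)) + t * (k * x) + 10 * t * (k * c)           ≡⟨ id₄ t Dᵢ Dᵣ k x c ⟩
        10 * (t * Dᵢ) + t * (10 * Dᵣ + k * x) + 10 * t * (k * c)        ≤⟨ +-monoˡ-≤ (10 * t * (k * c)) (+-mono-≤ (*-monoʳ-≤ 10 classSum) (*-monoʳ-≤ t restSum)) ⟩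
        10 * (c * (2 * k)) + t * (card rest * (10 * k)) + 10 * t * (k * c) ≡⟨ id₅ t c (card rest) k ⟩
        20 * (k * c) + 10 * (t * (k * (c + card rest)))                 ≡⟨ cong (λ z → 20 * (k * c) + 10 * (t * (k * z))) (sym (card-split U (inClass j))) ⟩
        20 * (k * c) + 10 * (t * (k * u)) ∎
        where
        id₄ : ∀ t a b k x c → 10 * (t * (a + b)) + t * (k * x) + 10 * t * (k * c) ≡ 10 * (t * a) + t * (10 * b + k * x) + 10 * t * (k * c)
        id₄ = solve-∀
        id₅ : ∀ t c r k → 10 * (c * (2 * k)) + t * (r * (10 * k)) + 10 * t * (k * c) ≡ 20 * (k * c) + 10 * (t * (k * (c + r)))
        id₅ = solve-∀

    class-sizes : sum (λ j → card (U ∩ inClass j)) ≡ card U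
    class-sizes = trans (∑-comm (λ j v → ⟦ U v ∧ inClass j v ⟧)) (sum-cong-≗ λ v → one (U v) (class v))
      where
      one : ∀ b (i : Fin 6) → sum (λ j → ⟦ b ∧ does (i ≟ᶠ j) ⟧) ≡ ⟦ b ⟧
      one false _ = refl
      one true 0F = refl
      one true 1F = refl
      one true 2F = refl
      one true 3F = refl
      one true 4F = refl
      one true 5F = refl

    Strong : Bool → Fin 6 → Fin n → Set
    Strong c j v = 4 * m j ≤ 5 * deg c v (X j)

    strong-hit : ∀ c j v → Strong c j v → v ∈ hits c j
    strong-hit c j v h = ≤ᵇ-intro (≤-trans (≤-trans (m≤m+n (m j) _) h) (*-monoˡ-≤ (deg c v (X j)) (≤-trans (m≤m+n 5 5) t≥10)))

    enough : ∀ N j → m j ≤ 5 * card (N ∩ X j) → m j ≤ t * card (N ∩ X j)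
    enough N j h = ≤-trans h (*-monoˡ-≤ (card (N ∩ X j)) (≤-trans (m≤m+n 5 5) t≥10))

    strong-∩ : ∀ c a N j x → a * m j ≤ 5 * card (N ∩ X j) → Strong c j x →
      a * m j + 4 * m j ≤ 5 * card ((E c x ∩ N) ∩ X j) + 5 * m j
    strong-∩ c a N j x hN hx = begin
      a * m j + 4 * m j                                         ≤⟨ +-mono-≤ hN hx ⟩
      5 * card (N ∩ X j) + 5 * deg c x (X j)                    ≡⟨ sym (*-distribˡ-+ 5 (card (N ∩ X j)) _) ⟩
      5 * (card (N ∩ X j) + deg c x (X j))                      ≤⟨ *-monoʳ-≤ 5 (≤-trans (card-∩ (∩-⊑ʳ N (X j)) (∩-⊑ʳ (E c x) (X j))) (+-monoʳ-≤ (m j) (card-mono regroup))) ⟩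
      5 * (m j + card ((E c x ∩ N) ∩ X j))                      ≡⟨ trans (*-distribˡ-+ 5 (m j) _) (+-comm (5 * m j) _) ⟩
      5 * card ((E c x ∩ N) ∩ X j) + 5 * m j ∎
      where
      open ≤-Reasoning
      regroup : ((N ∩ X j) ∩ (E c x ∩ X j)) ⊑ ((E c x ∩ N) ∩ X j)
      regroup i h = let a = ∩-⊑ˡ (N ∩ X j) (E c x ∩ X j) i h ; b = ∩-⊑ʳ (N ∩ X j) (E c x ∩ X j) i h in
        ∧-intro (∧-intro (∩-⊑ˡ (E c x) (X j) i b) (∩-⊑ˡ N (X j) i a)) (∩-⊑ʳ N (X j) i a)

    common₂ : ∀ c j x y → Strong c j x → Strong c j y → m j ≤ t * card ((E c x ∩ E c y) ∩ X j)
    common₂ c j x y hx hy = enough (E c x ∩ E c y) j (≤-trans (≤-trans (≤-reflexive (sym (*-identityˡ (m j)))) (*-monoˡ-≤ (m j) {1} {3} (s≤s z≤n)))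
        (by-identity (strong-∩ c 4 (E c y) j x hy hx) 0 (identity (m j) (card ((E c x ∩ E c y) ∩ X j)))))
      where
      identity : ∀ k z → 3 * k + (5 * z + 5 * k) + 0 ≡ 5 * z + (4 * k + 4 * k)
      identity = solve-∀

    common₃ : ∀ c j x y z → Strong c j x → Strong c j y → Strong c j z → m j ≤ t * card ((E c x ∩ (E c y ∩ E c z)) ∩ X j)
    common₃ c j x y z hx hy hz = enough (E c x ∩ (E c y ∩ E c z)) j (≤-trans (≤-trans (≤-reflexive (sym (*-identityˡ (m j)))) (*-monoˡ-≤ (m j) {1} {2} (s≤s z≤n)))
        (by-identity (strong-∩ c 3 (E c y ∩ E c z) j x two hx) 0 (identity (m j) (card ((E c x ∩ (E c y ∩ E c z)) ∩ X j)))))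
      where
      identity₂ : ∀ k z → 3 * k + (5 * z + 5 * k) + 0 ≡ 5 * z + (4 * k + 4 * k)
      identity₂ = solve-∀
      identity : ∀ k z → 2 * k + (5 * z + 5 * k) + 0 ≡ 5 * z + (3 * k + 4 * k)
      identity = solve-∀
      two : 3 * m j ≤ 5 * card ((E c y ∩ E c z) ∩ X j)
      two = by-identity (strong-∩ c 4 (E c z) j y hz hy) 0 (identity₂ (m j) (card ((E c y ∩ E c z) ∩ X j)))

    data Corner : Fin 6 → Set where
      corner₁ : Corner 1F
      corner₂ : Corner 2F
      corner₃ : Corner 3F
      corner₄ : Corner 4F
      corner₅ : Corner 5F

    -- The red path r₁, b₁, b₂, r₂ of the other four pentagon clusters around the i-th one.
    record Around (i : Fin 6) : Set where
      field
        r₁ b₁ b₂ r₂ : Fin 6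
        kinds : (apexKind r₁ ≡ false × apexKind b₁ ≡ false) × (apexKind b₂ ≡ false × apexKind r₂ ≡ false)
        apart : (r₁ ≢ i × b₁ ≢ i) × (b₂ ≢ i × r₂ ≢ i) × 0F ≢ i
        red-edges : Dense q g 1 true (X r₁) (X b₁) × Dense q g 1 true (X b₂) (X r₂)
        blue-edges : Dense q g (suc p) false (X r₁) (X r₂) × Dense q g (suc p) false (X r₁) (X b₂) × Dense q g (suc p) false (X b₁) (X r₂)
        apex-edges : Dense q g 1 false (X 0F) (X r₁) × Dense q g 1 false (X 0F) (X b₁) × Dense q g 1 false (X 0F) (X b₂) × Dense q g 1 false (X 0F) (X r₂)

    around : ∀ {i} → Corner i → Around i
    around corner₁ = record { r₁ = 2F ; b₁ = 3F ; b₂ = 4F ; r₂ = 5F ; kinds = (refl , refl) , (refl , refl)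
      ; apart = ((λ ()) , (λ ())) , ((λ ()) , (λ ())) , (λ ())
      ; red-edges = related 2F 3F , related 4F 5F ; blue-edges = related 2F 5F , related 2F 4F , related 3F 5F
      ; apex-edges = related 0F 2F , related 0F 3F , related 0F 4F , related 0F 5F }
    around corner₂ = record { r₁ = 3F ; b₁ = 4F ; b₂ = 5F ; r₂ = 1F ; kinds = (refl , refl) , (refl , refl)
      ; apart = ((λ ()) , (λ ())) , ((λ ()) , (λ ())) , (λ ())
      ; red-edges = related 3F 4F , related 5F 1F ; blue-edges = related 3F 1F , related 3F 5F , related 4F 1F
      ; apex-edges = related 0F 3F , related 0F 4F , related 0F 5F , related 0F 1F }
    around corner₃ = record { r₁ = 4F ; b₁ = 5F ; b₂ = 1F ; r₂ = 2F ; kinds = (refl , refl) , (refl , refl)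
      ; apart = ((λ ()) , (λ ())) , ((λ ()) , (λ ())) , (λ ())
      ; red-edges = related 4F 5F , related 1F 2F ; blue-edges = related 4F 2F , related 4F 1F , related 5F 2F
      ; apex-edges = related 0F 4F , related 0F 5F , related 0F 1F , related 0F 2F }
    around corner₄ = record { r₁ = 5F ; b₁ = 1F ; b₂ = 2F ; r₂ = 3F ; kinds = (refl , refl) , (refl , refl)
      ; apart = ((λ ()) , (λ ())) , ((λ ()) , (λ ())) , (λ ())
      ; red-edges = related 5F 1F , related 2F 3F ; blue-edges = related 5F 3F , related 5F 2F , related 1F 3F
      ; apex-edges = related 0F 5F , related 0F 1F , related 0F 2F , related 0F 3F }
    around corner₅ = record { r₁ = 1F ; b₁ = 2F ; b₂ = 3F ; r₂ = 4F ; kinds = (refl , refl) , (refl , refl)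
      ; apart = ((λ ()) , (λ ())) , ((λ ()) , (λ ())) , (λ ())
      ; red-edges = related 1F 2F , related 3F 4F ; blue-edges = related 1F 4F , related 1F 3F , related 2F 4F
      ; apex-edges = related 0F 1F , related 0F 2F , related 0F 3F , related 0F 4F }

    anyRed : Subset n
    anyRed v = hits true 1F v ∨ hits true 2F v ∨ hits true 3F v ∨ hits true 4F v ∨ hits true 5F v

    anyExceptional : Subset n
    anyExceptional v = exceptional 0F v ∨ exceptional 1F v ∨ exceptional 2F v ∨ exceptional 3F v ∨ exceptional 4F v ∨ exceptional 5F v

    -- The kind has to agree with the kind of the missed cluster. A vertex of the apex class must
    -- also hit no pentagon cluster in red, which makes it strong in blue to all five.
    fits : Fin 6 → Bool → Bool → Bool
    fits 0F k r = k ∧ not r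
    fits (suc _) k r = not k

    core : Subset n
    core v = U v ∧ not (anyExceptional v) ∧ fits (class v) (kind v) (anyRed v)

    exceptional-any : ∀ j v → v ∈ exceptional j → v ∈ anyExceptional
    exceptional-any 0F v h = ∪-left h
    exceptional-any 1F v h = ∪-right {exceptional 0F v} (∪-left h)
    exceptional-any 2F v h = ∪-right {exceptional 0F v} (∪-right {exceptional 1F v} (∪-left h))
    exceptional-any 3F v h = ∪-right {exceptional 0F v} (∪-right {exceptional 1F v} (∪-right {exceptional 2F v} (∪-left h)))
    exceptional-any 4F v h = ∪-right {exceptional 0F v} (∪-right {exceptional 1F v} (∪-right {exceptional 2F v} (∪-right {exceptional 3F v} (∪-left h))))
    exceptional-any 5F v h = ∪-right {exceptional 0F v} (∪-right {exceptional 1F v} (∪-right {exceptional 2F v} (∪-right {exceptional 3F v} (∪-right {exceptional 4F v} h))))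

    anyRed-hit : ∀ j v → j ≢ 0F → anyRed v ≡ false → hits true j v ≡ false
    anyRed-hit j v j≢0 h with hits true j v in eq
    ... | false = refl
    ... | true = ⊥-elim (true≢false (yes-red j j≢0 eq) h)
      where
      yes-red : ∀ j → j ≢ 0F → hits true j v ≡ true → anyRed v ≡ true
      yes-red 0F j≢0 _ = ⊥-elim (j≢0 refl)
      yes-red 1F _ h = ∪-left h
      yes-red 2F _ h = ∪-right {hits true 1F v} (∪-left h)
      yes-red 3F _ h = ∪-right {hits true 1F v} (∪-right {hits true 2F v} (∪-left h))
      yes-red 4F _ h = ∪-right {hits true 1F v} (∪-right {hits true 2F v} (∪-right {hits true 3F v} (∪-left h)))
      yes-red 5F _ h = ∪-right {hits true 1F v} (∪-right {hits true 2F v} (∪-right {hits true 3F v} (∪-right {hits true 4F v} h)))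

    Regular : Fin n → Set
    Regular v = v ∈ U × anyExceptional v ≡ false

    rich-elsewhere : ∀ v j → Regular v → j ≢ class v → 9 * m j ≤ 10 * total v (X j)
    rich-elsewhere v j (v∈U , reg) j≢ = <ᵇ-false {10 * total v (X j)} {9 * m j} not-poor
      where
      not-poor : poor j v ≡ false
      not-poor with poor j v in eq
      ... | false = refl
      ... | true = ⊥-elim (true≢false (exceptional-any j v (∧-intro (∧-intro v∈U (not-false (dec-false (class v ≟ᶠ j) (λ h → j≢ (sym h))))) eq)) reg)

    other : Bool → Bool
    other true = false
    other false = true

    strong-elsewhere : ∀ c v j → Regular v → j ≢ class v → hits (other c) j v ≡ false → Strong c j v
    strong-elsewhere c v j reg j≢ h = *-cancelˡ-≤ 2 (by-identity (+-mono-≤ (rich-elsewhere v j reg j≢) few) 0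
      (trans (cong (λ z → 2 * (4 * m j) + (10 * z + m j) + 0) (split c)) (identity (m j) (deg c v (X j)) (deg (other c) v (X j)))))
      where
      few : 10 * deg (other c) v (X j) ≤ m j
      few = ≤-trans (*-monoˡ-≤ (deg (other c) v (X j)) t≥10) (<⇒≤ (≤ᵇ-false {m j} {t * deg (other c) v (X j)} h))
      split : ∀ c → total v (X j) ≡ deg c v (X j) + deg (other c) v (X j)
      split true = refl
      split false = +-comm (deg true v (X j)) _
      identity : ∀ k a b → 2 * (4 * k) + (10 * (a + b) + k) + 0 ≡ 2 * (5 * a) + (9 * k + 10 * b)
      identity = solve-∀

    hits-elsewhere : ∀ v j → Regular v → j ≢ class v → (v ∈ hits true j) ⊎ (v ∈ hits false j)
    hits-elsewhere v j reg j≢ = [ inj₁ , (λ eq → inj₂ (strong-hit false j v (strong-elsewhere false v j reg j≢ eq))) ]′ (bool-cases (hits true j v))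

    apex-strong : ∀ v → Regular v → 0F ≢ class v → Strong false 0F v
    apex-strong v reg j≢ = [ (λ eq → ⊥-elim (no-red-apex v eq)) , strong-elsewhere false v 0F reg j≢ ]′ (bool-cases (hits true 0F v))

    false-of : ∀ {b} → ¬ (b ≡ true) → b ≡ false
    false-of {true} h = ⊥-elim (h refl)
    false-of {false} h = refl

    module AtCorner {i : Fin 6} (corner : Corner i) where
      open Around (around corner)

      apart-from : ∀ {v} j → j ≢ i → class v ≡ i → j ≢ class v
      apart-from j h refl = h

      -- A regular vertex hits the other five clusters, so `path-cover` forces the colours: it takes
      -- over the role of the `i`-th cluster in the pentagon.
      separation : ∀ v → Regular v → class v ≡ i → (¬ (v ∈ hits false r₁) × ¬ (v ∈ hits true b₁)) × (¬ (v ∈ hits true b₂) × ¬ (v ∈ hits false r₂))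
      separation v reg eq = path-cover
        (hits-elsewhere v r₁ reg (apart-from r₁ (proj₁ (proj₁ apart)) eq)) (hits-elsewhere v b₁ reg (apart-from b₁ (proj₂ (proj₁ apart)) eq))
        (hits-elsewhere v b₂ reg (apart-from b₂ (proj₁ (proj₁ (proj₂ apart))) eq)) (hits-elsewhere v r₂ reg (apart-from r₂ (proj₂ (proj₁ (proj₂ apart))) eq))
        (no-red-pair v (proj₁ red-edges)) (no-red-pair v (proj₂ red-edges))
        (no-blue-triple v (proj₁ (proj₁ kinds)) (proj₂ (proj₂ kinds)) (proj₁ apex-edges) (proj₂ (proj₂ (proj₂ apex-edges))) (proj₁ blue-edges) apex)
        (no-blue-triple v (proj₁ (proj₁ kinds)) (proj₁ (proj₂ kinds)) (proj₁ apex-edges) (proj₁ (proj₂ (proj₂ apex-edges))) (proj₁ (proj₂ blue-edges)) apex)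
        (no-blue-triple v (proj₂ (proj₁ kinds)) (proj₂ (proj₂ kinds)) (proj₁ (proj₂ apex-edges)) (proj₂ (proj₂ (proj₂ apex-edges))) (proj₂ (proj₂ blue-edges)) apex)
        where
        apex : v ∈ hits false 0F
        apex = strong-hit false 0F v (apex-strong v reg (apart-from 0F (proj₂ (proj₂ apart)) eq))

      red-strong : ∀ v → Regular v → class v ≡ i → Strong true r₁ v
      red-strong v reg eq = strong-elsewhere true v r₁ reg (apart-from r₁ (proj₁ (proj₁ apart)) eq) (false-of (proj₁ (proj₁ (separation v reg eq))))

      blue-strong : ∀ v → Regular v → class v ≡ i → Strong false b₁ v
      blue-strong v reg eq = strong-elsewhere false v b₁ reg (apart-from b₁ (proj₂ (proj₁ apart)) eq) (false-of (proj₂ (proj₁ (separation v reg eq))))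

      -- Without red hits, both outer clusters of the path would be joined to v in blue.
      red-hit-needed : ∀ v → Regular v → class v ≡ i → anyRed v ≡ false → ⊥
      red-hit-needed v reg eq none-red = proj₁ (proj₁ (separation v reg eq))
        (strong-hit false r₁ v (strong-elsewhere false v r₁ reg (apart-from r₁ (proj₁ (proj₁ apart)) eq)
          (anyRed-hit r₁ v (λ h → blue-kind (trans (sym (proj₁ (proj₁ kinds))) (cong apexKind h))) none-red)))
        where
        blue-kind : ¬ (false ≡ true)
        blue-kind ()

      no-red-edge : ∀ y z → Regular y → Regular z → class y ≡ i → class z ≡ i → E true y z ≡ true → ⊥
      no-red-edge y z ry rz ey ez yz = clash true (y ∷ z ∷ []) (E true y ∩ E true z) ((r₁ , false) ∷ []) ((yz ∷ []) ∷ [] ∷ [])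
        (∩-⊑ˡ (E true y) (E true z) ∷ ∩-⊑ʳ (E true y) (E true z) ∷ []) ([] ∷ [])
        ((common₂ true r₁ y z (red-strong y ry ey) (red-strong z rz ez) , λ ()) ∷ []) (s≤s z≤n) refl

      -- The weights are 3 + 1 + 2 = 6: the triangle, the apex cluster once, and the cluster `b₁`
      -- doubled, all inside the common blue neighbourhood.
      no-blue-triangle : ∀ x y z → Regular x → Regular y → Regular z → class x ≡ i → class y ≡ i → class z ≡ i →
        E false x y ≡ true → E false x z ≡ true → E false y z ≡ true → ⊥
      no-blue-triangle x y z rx ry rz ex ey ez xy xz yz = clash false (x ∷ y ∷ z ∷ []) N ((0F , false) ∷ (b₁ , true) ∷ [])
        ((xy ∷ xz ∷ []) ∷ (yz ∷ []) ∷ [] ∷ [])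
        (∩-⊑ˡ (E false x) (E false y ∩ E false z) ∷ (λ i h → ∩-⊑ˡ (E false y) (E false z) i (∩-⊑ʳ (E false x) (E false y ∩ E false z) i h)) ∷
          (λ i h → ∩-⊑ʳ (E false y) (E false z) i (∩-⊑ʳ (E false x) (E false y ∩ E false z) i h)) ∷ [])
        ((proj₁ (proj₂ apex-edges) ∷ []) ∷ [] ∷ [])
        ((common₃ false 0F x y z (apex x rx ex) (apex y ry ey) (apex z rz ez) , λ ()) ∷
         (common₃ false b₁ x y z (blue-strong x rx ex) (blue-strong y ry ey) (blue-strong z rz ez) , λ _ → proj₂ (proj₁ kinds)) ∷ []) (s≤s (s≤s z≤n)) refl
        where
        N : Subset n
        N = E false x ∩ (E false y ∩ E false z)
        apex : ∀ v → Regular v → class v ≡ i → Strong false 0F v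
        apex v reg eq = apex-strong v reg (apart-from 0F (proj₂ (proj₂ apart)) eq)

    no-blue-edge : ∀ {j k} y z → apexKind j ≡ false → apexKind k ≡ false → Dense q g (suc p) false (X j) (X k) →
      Strong false j y → Strong false j z → Strong false k y → Strong false k z → E false y z ≡ true → ⊥
    no-blue-edge {j} {k} y z kj kk D jy jz ky kz yz = clash false (y ∷ z ∷ []) (E false y ∩ E false z) ((j , true) ∷ (k , true) ∷ [])
      ((yz ∷ []) ∷ [] ∷ []) (∩-⊑ˡ (E false y) (E false z) ∷ ∩-⊑ʳ (E false y) (E false z) ∷ []) ((D ∷ []) ∷ [] ∷ [])
      ((common₂ false j y z jy jz , λ _ → kj) ∷ (common₂ false k y z ky kz , λ _ → kk) ∷ []) (s≤s (s≤s z≤n)) refl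

    few-red : ∀ v Y → (∀ i → i ∈ Y → kind i ≡ true) → deg true v Y ≤ M
    few-red v Y typed with ≤-total (deg true v Y) M
    ... | inj₁ h = h
    ... | inj₂ h = let (x , y , x∈ , y∈ , xy) = edge-in true (E true v ∩ Y) (λ i i∈ → typed i (∩-⊑ʳ (E true v) Y i i∈)) h in
      ⊥-elim (no-clique true (v ∷ x ∷ y ∷ []) ((∧-fst x∈ ∷ ∧-fst y∈ ∷ []) ∷ (xy ∷ []) ∷ [] ∷ []) refl)

    coreIn : Fin 6 → Subset n
    coreIn i = core ∩ inClass i

    core-regular : ∀ v → v ∈ core → Regular v
    core-regular v h = ∧-fst h , not-true (∧-fst {not (anyExceptional v)} (∧-snd {U v} h))

    core-fits : ∀ {i} v → v ∈ core → class v ≡ i → fits i (kind v) (anyRed v) ≡ true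
    core-fits v h refl = ∧-snd {not (anyExceptional v)} (∧-snd {U v} h)

    -- In a corner class there are no red edges and no blue triangles; as its vertices are of blue
    -- kind, `M` blue neighbours would span a blue edge. In the apex class the colours change roles:
    -- blue edges are excluded, and `M` red neighbours of red kind would span a red edge and close a
    -- red triangle.
    core-sparse : ∀ v → v ∈ core → total v (coreIn (class v)) ≤ 2 * M
    core-sparse v h = ≤-trans (at-class (class v) refl) (≤-reflexive (cong (M +_) (sym (+-identityʳ M))))
      where
      member : ∀ {i} w → w ∈ coreIn i → w ∈ core × class w ≡ i
      member {i} w w∈ = ∩-⊑ˡ core (inClass i) w w∈ , does-sound (∩-⊑ʳ core (inClass i) w w∈)
      none≤M : ∀ c Y → (∀ w → w ∈ Y → E c v w ≡ true → ⊥) → deg c v Y ≤ M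
      none≤M c Y h = ≤-trans (≮⇒≥ λ d>0 → let (w , w∈) = card-positive (E c v ∩ Y) d>0 in h w (∩-⊑ʳ (E c v) Y w w∈) (∩-⊑ˡ (E c v) Y w w∈)) z≤n
      at-corner : ∀ i → Corner i → class v ≡ i → total v (coreIn i) ≤ M + M
      at-corner i corner eq = +-mono-≤
        (none≤M true (coreIn i) λ w w∈ vw → let (c , e) = member w w∈ in no-red-edge v w (core-regular v h) (core-regular w c) eq e vw)
        (blue (≤-total (deg false v (coreIn i)) M))
        where
        open AtCorner corner
        typed : ∀ w → w ∈ coreIn i → kind w ≡ false
        typed w w∈ = let (c , e) = member w w∈ in blue-kind corner (core-fits w c e)
          where
          blue-kind : ∀ {i k r} → Corner i → fits i k r ≡ true → k ≡ false
          blue-kind corner₁ = not-true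
          blue-kind corner₂ = not-true
          blue-kind corner₃ = not-true
          blue-kind corner₄ = not-true
          blue-kind corner₅ = not-true
        blue : deg false v (coreIn i) ≤ M ⊎ M ≤ deg false v (coreIn i) → deg false v (coreIn i) ≤ M
        blue (inj₁ h) = h
        blue (inj₂ big) =
          let N = E false v ∩ coreIn i
              (x , y , x∈ , y∈ , xy) = edge-in false N (λ w w∈ → typed w (∩-⊑ʳ (E false v) (coreIn i) w w∈)) big
              (cx , ex) = member x (∩-⊑ʳ (E false v) (coreIn i) x x∈)
              (cy , ey) = member y (∩-⊑ʳ (E false v) (coreIn i) y y∈)
          in ⊥-elim (no-blue-triangle v x y (core-regular v h) (core-regular x cx) (core-regular y cy) eq ex ey
               (∩-⊑ˡ (E false v) (coreIn i) x x∈) (∩-⊑ˡ (E false v) (coreIn i) y y∈) xy)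
      at-class : ∀ i → class v ≡ i → total v (coreIn i) ≤ M + M
      at-class 0F eq = +-mono-≤
        (few-red v (coreIn 0F) λ w w∈ → let (c , e) = member w w∈ in ∧-fst (core-fits w c e))
        (none≤M false (coreIn 0F) λ w w∈ vw → let (c , e) = member w w∈ in
          no-blue-edge v w refl refl (related 1F 3F) (blue 1F (λ ()) v h eq) (blue 1F (λ ()) w c e) (blue 3F (λ ()) v h eq) (blue 3F (λ ()) w c e) vw)
        where
        blue : ∀ j → j ≢ 0F → ∀ w → w ∈ core → class w ≡ 0F → Strong false j w
        blue j j≢0 w c e = strong-elsewhere false w j (core-regular w c) (λ h → j≢0 (trans h e))
          (anyRed-hit j w j≢0 (not-true (∧-snd {kind w} (core-fits w c e))))
      at-class 1F eq = at-corner 1F corner₁ eq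
      at-class 2F eq = at-corner 2F corner₂ eq
      at-class 3F eq = at-corner 3F corner₃ eq
      at-class 4F eq = at-corner 4F corner₄ eq
      at-class 5F eq = at-corner 5F corner₅ eq

    totalCard : List (Subset n) → ℕ
    totalCard [] = 0
    totalCard (Y ∷ Ys) = card Y + totalCard Ys

    card-cover-list : ∀ Z Ys → (∀ i → i ∈ Z → Any (λ Y → i ∈ Y) Ys) → card Z ≤ totalCard Ys
    card-cover-list Z [] h = ≮⇒≥ λ z>0 → let (i , i∈) = card-positive Z z>0 in empty (h i i∈)
      where
      empty : ∀ {i : Fin n} → Any (λ Y → i ∈ Y) [] → ⊥
      empty ()
    card-cover-list Z (Y ∷ Ys) h = ≤-trans (≤-reflexive (card-split Z Y)) (+-mono-≤ (card-mono (∩-⊑ʳ Z Y))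
      (card-cover-list (Z ∖ Y) Ys λ i i∈ → rest i (h i (∖-⊑ Z Y i i∈)) (not-true (∧-snd {Z i} i∈))))
      where
      rest : ∀ i → Any (λ Y → i ∈ Y) (Y ∷ Ys) → Y i ≡ false → Any (λ Y → i ∈ Y) Ys
      rest i (here p) q = ⊥-elim (true≢false p q)
      rest i (there m) q = m

    redApex : Fin 6 → Subset n
    redApex j v = kind v ∧ hits true j v

    -- Double counting of red edges: each vertex of `redApex j` is joined to a 1/t share of `X j`,
    -- while a vertex of `X j` has at most `M` red neighbours of red kind.
    redApex-few : ∀ j → card (redApex j) ≤ t * M
    redApex-few j = *-cancelˡ-≤ (m j) {{>-nonZero (m≥1 j)}} (begin
      m j * card (redApex j)                             ≡⟨ *-comm (m j) _ ⟩
      card (redApex j) * m j                             ≤⟨ sumOver-≥ (redApex j) (λ v v∈ → ≤ᵇ-true {m j} (∧-snd {kind v} v∈)) ⟩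
      sumOver (redApex j) (λ v → t * deg true v (X j))   ≡⟨ sumOver-* (redApex j) t (λ v → deg true v (X j)) ⟩
      t * edgesBetween true (redApex j) (X j)            ≡⟨ cong (t *_) (edgesBetween-sym true (redApex j) (X j)) ⟩
      t * edgesBetween true (X j) (redApex j)            ≤⟨ *-monoʳ-≤ t (sumOver-≤ (X j) (λ x _ → few-red x (redApex j) (λ i i∈ → ∧-fst i∈))) ⟩
      t * (m j * M)                                      ≡⟨ swap t (m j) M ⟩
      m j * (t * M) ∎)
      where
      open ≤-Reasoning
      swap : ∀ a b c → a * (b * c) ≡ b * (a * c)
      swap = solve-∀

    strongPair : Fin 6 → Fin 6 → Subset n
    strongPair j k v = not (kind v) ∧ (4 * m j ≤ᵇ 5 * deg false v (X j)) ∧ (4 * m k ≤ᵇ 5 * deg false v (X k))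

    -- These vertices are of blue kind, so `M` of them span a blue edge, and this edge together with
    -- two doubled clusters has weight 6.
    strongPair-few : ∀ {j k} → apexKind j ≡ false → apexKind k ≡ false → Dense q g (suc p) false (X j) (X k) → card (strongPair j k) ≤ M
    strongPair-few {j} {k} kj kk D with ≤-total (card (strongPair j k)) M
    ... | inj₁ h = h
    ... | inj₂ h = let (y , z , y∈ , z∈ , yz) = edge-in false (strongPair j k) (λ v v∈ → not-true (∧-fst v∈)) h in
      ⊥-elim (no-blue-edge y z kj kk D (left y y∈) (left z z∈) (right y y∈) (right z z∈) yz)
      where
      left : ∀ v → v ∈ strongPair j k → Strong false j v
      left v h = ≤ᵇ-true (∧-fst (∧-snd {not (kind v)} h))
      right : ∀ v → v ∈ strongPair j k → Strong false k v
      right v h = ≤ᵇ-true (∧-snd {4 * m j ≤ᵇ 5 * deg false v (X j)} (∧-snd {not (kind v)} h))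

    badSets : List (Subset n)
    badSets = redApex 1F ∷ redApex 2F ∷ redApex 3F ∷ redApex 4F ∷ redApex 5F ∷ strongPair 1F 3F ∷ strongPair 2F 4F ∷ strongPair 2F 5F ∷ []

    red-apex-bad : ∀ v → kind v ≡ true → v ∈ anyRed → Any (λ Y → v ∈ Y) badSets
    red-apex-bad v k = choose 1F (choose 2F (choose 3F (choose 4F λ r → here (∧-intro k r))))
      where
      choose : ∀ j {b Ys} → (b ≡ true → Any (λ Y → v ∈ Y) Ys) → hits true j v ∨ b ≡ true → Any (λ Y → v ∈ Y) (redApex j ∷ Ys)
      choose j f e = [ here ∘ ∧-intro k , there ∘ f ]′ (∪-elim (hits true j v) e)

    -- The clusters hit in red are independent in the red 5-cycle, so two clusters joined in blue
    -- are hit strongly in blue: 2 and 5 if 1 is hit in red, 2 and 4 if 3 is, and 1 and 3 if neither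
    -- is.
    blue-apex-bad : ∀ v → Regular v → class v ≡ 0F → kind v ≡ false → Any (λ Y → v ∈ Y) badSets
    blue-apex-bad v reg eq k = decide (bool-cases (hits true 1F v)) (bool-cases (hits true 3F v))
      where
      strong : ∀ j → j ≢ 0F → hits true j v ≡ false → (4 * m j ≤ᵇ 5 * deg false v (X j)) ≡ true
      strong j j≢0 h = ≤ᵇ-intro (strong-elsewhere false v j reg (λ e → j≢0 (trans e eq)) h)
      avoid : ∀ {j k} → Dense q g 1 true (X j) (X k) → hits true j v ≡ true → hits true k v ≡ false
      avoid {j} {k} D h = false-of (no-red-pair v D h)
      decide : (hits true 1F v ≡ true) ⊎ (hits true 1F v ≡ false) → (hits true 3F v ≡ true) ⊎ (hits true 3F v ≡ false) → Any (λ Y → v ∈ Y) badSets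
      decide (inj₁ h₁) _ = there (there (there (there (there (there (there (here pair)))))))
        where
        pair : v ∈ strongPair 2F 5F
        pair = ∧-intro (not-false k) (∧-intro (strong 2F (λ ()) (avoid (related 1F 2F) h₁)) (strong 5F (λ ()) (avoid (related 1F 5F) h₁)))
      decide (inj₂ _) (inj₁ h₃) = there (there (there (there (there (there (here pair))))))
        where
        pair : v ∈ strongPair 2F 4F
        pair = ∧-intro (not-false k) (∧-intro (strong 2F (λ ()) (avoid (related 3F 2F) h₃)) (strong 4F (λ ()) (avoid (related 3F 4F) h₃)))
      decide (inj₂ h₁) (inj₂ h₃) = there (there (there (there (there (here pair)))))
        where
        pair : v ∈ strongPair 1F 3F
        pair = ∧-intro (not-false k) (∧-intro (strong 1F (λ ()) h₁) (strong 3F (λ ()) h₃))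

    outside-core : ∀ v → v ∈ (U ∖ core) → (v ∈ anyExceptional) ⊎ Any (λ Y → v ∈ Y) badSets
    outside-core v h = [ inj₁ , (λ reg → inj₂ (bad (class v) refl reg (bool-cases (kind v)) (bool-cases (anyRed v)))) ]′ (bool-cases (anyExceptional v))
      where
      v∈U : v ∈ U
      v∈U = ∖-⊑ U core v h
      not-core : core v ≡ false
      not-core = not-true (∧-snd {U v} h)
      not-fitting : anyExceptional v ≡ false → fits (class v) (kind v) (anyRed v) ≡ true → ⊥
      not-fitting reg f = true≢false (∧-intro v∈U (∧-intro (not-false reg) f)) not-core
      bad-corner : ∀ {i} → Corner i → (∀ {k r} → k ≡ false → fits i k r ≡ true) → class v ≡ i → anyExceptional v ≡ false →
        (kind v ≡ true) ⊎ (kind v ≡ false) → (anyRed v ≡ true) ⊎ (anyRed v ≡ false) → Any (λ Y → v ∈ Y) badSets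
      bad-corner corner f eq reg (inj₁ k) (inj₁ r) = red-apex-bad v k r
      bad-corner corner f eq reg (inj₁ k) (inj₂ r) = ⊥-elim (AtCorner.red-hit-needed corner v (v∈U , reg) eq r)
      bad-corner corner f eq reg (inj₂ k) _ = ⊥-elim (not-fitting reg (subst (λ i → fits i (kind v) (anyRed v) ≡ true) (sym eq) (f k)))
      bad : ∀ i → class v ≡ i → anyExceptional v ≡ false → (kind v ≡ true) ⊎ (kind v ≡ false) → (anyRed v ≡ true) ⊎ (anyRed v ≡ false) →
        Any (λ Y → v ∈ Y) badSets
      bad 0F eq reg (inj₂ k) _ = blue-apex-bad v (v∈U , reg) eq k
      bad 0F eq reg (inj₁ k) (inj₁ r) = red-apex-bad v k r
      bad 0F eq reg (inj₁ k) (inj₂ r) = ⊥-elim (not-fitting reg (subst (λ i → fits i (kind v) (anyRed v) ≡ true) (sym eq) (∧-intro k (not-false r))))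
      bad 1F = bad-corner corner₁ not-false
      bad 2F = bad-corner corner₂ not-false
      bad 3F = bad-corner corner₃ not-false
      bad 4F = bad-corner corner₄ not-false
      bad 5F = bad-corner corner₅ not-false

    core-missing : card (U ∖ core) ≤ sum (λ j → card (exceptional j)) + (5 * (t * M) + 3 * M)
    core-missing = ≤-trans (≤-reflexive (card-split (U ∖ core) anyExceptional)) (+-mono-≤ exceptional-part bad-part)
      where
      exceptional-part : card ((U ∖ core) ∩ anyExceptional) ≤ sum (λ j → card (exceptional j))
      exceptional-part = card-cover-list ((U ∖ core) ∩ anyExceptional)
        (exceptional 0F ∷ exceptional 1F ∷ exceptional 2F ∷ exceptional 3F ∷ exceptional 4F ∷ exceptional 5F ∷ [])
        λ v v∈ → find v (∩-⊑ʳ (U ∖ core) anyExceptional v v∈)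
        where
        find : ∀ v → v ∈ anyExceptional → Any (λ Y → v ∈ Y) (exceptional 0F ∷ exceptional 1F ∷ exceptional 2F ∷ exceptional 3F ∷ exceptional 4F ∷ exceptional 5F ∷ [])
        find v h = choose 0F (choose 1F (choose 2F (choose 3F (choose 4F λ x → here x)))) h
          where
          choose : ∀ j {b Ys} → (b ≡ true → Any (λ Y → v ∈ Y) Ys) → exceptional j v ∨ b ≡ true → Any (λ Y → v ∈ Y) (exceptional j ∷ Ys)
          choose j f e = [ here , there ∘ f ]′ (∪-elim (exceptional j v) e)
      bad-part : card ((U ∖ core) ∖ anyExceptional) ≤ 5 * (t * M) + 3 * M
      bad-part = ≤-trans (card-cover-list ((U ∖ core) ∖ anyExceptional) badSets
          (λ v v∈ → [ (λ ex → ⊥-elim (true≢false ex (not-true (∧-snd {(U ∖ core) v} v∈)))) , id ]′ (outside-core v (∖-⊑ (U ∖ core) anyExceptional v v∈))))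
        (≤-trans (+-mono-≤ (redApex-few 1F) (+-mono-≤ (redApex-few 2F) (+-mono-≤ (redApex-few 3F) (+-mono-≤ (redApex-few 4F) (+-mono-≤ (redApex-few 5F)
          (+-mono-≤ (strongPair-few refl refl (related 1F 3F)) (+-mono-≤ (strongPair-few refl refl (related 2F 4F)) (+-mono-≤ (strongPair-few refl refl (related 2F 5F)) z≤n))))))))
          (≤-reflexive (identity (t * M) M)))
        where
        identity : ∀ a b → a + (a + (a + (a + (a + (b + (b + (b + 0))))))) ≡ 5 * a + 3 * b
        identity = solve-∀

    private
      sum-linear : ∀ a b (f : Fin 6 → ℕ) → sum (λ j → a + b * f j) ≡ 6 * a + b * sum f
      sum-linear a b f = trans (∑-distrib-+ (λ _ → a) (λ j → b * f j)) (cong₂ _+_ (sum-const 6 a) (sym (*-distribˡ-sum b f)))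

      classes exceptions : Fin 6 → ℕ
      classes j = card (U ∩ inClass j)
      exceptions j = card (exceptional j)

    -- Degrees above 5/6 + 1/(6e) keep every class below a sixth of `U` by more than the error from
    -- `t` can restore, yet the six classes cover `U`. Summing `class-count` over the classes gives
    -- t ≤ 2 * e.
    too-dense : ∀ e → 2 * e < t → (∀ x → x ∈ U → 5 * e * card U + card U ≤ 6 * e * total x U) → ⊥
    too-dense e e<t mindeg = <⇒≱ e<t (*-cancelˡ-≤ (60 * u) {{>-nonZero (≤-trans U≥1 (m≤m+n u _))}}
      (by-identity summed 0 (identity t e u)))
      where
      u : ℕ
      u = card U
      term : ∀ j → (10 * t * (5 * e * u + u)) + 60 * e * t * classes j ≤ 60 * e * t * u + 120 * e * classes j
      term j = by-identity (class-count e (5 * e * u + u) 0 (λ x x∈ → ≤-trans (mindeg x x∈) (m≤m+n _ 0)) j) (6 * e * t * exceptions j)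
        (id₁ t (10 * t * (5 * e * u + u)) e (exceptions j) (classes j) u)
        where
        id₁ : ∀ t a e x c u → a + 60 * e * t * c + (10 * t * 0 + 120 * e * c + 60 * e * t * u) + 6 * e * t * x ≡
          60 * e * t * u + 120 * e * c + (a + 6 * e * t * x + 60 * e * t * c)
        id₁ = solve-∀
      summed : 6 * (10 * t * (5 * e * u + u)) + 60 * e * t * u ≤ 6 * (60 * e * t * u) + 120 * e * u
      summed = subst₂ _≤_ (trans (sum-linear (10 * t * (5 * e * u + u)) (60 * e * t) classes) (cong (λ z → 6 * (10 * t * (5 * e * u + u)) + 60 * e * t * z) class-sizes))
        (trans (sum-linear (60 * e * t * u) (120 * e) classes) (cong (λ z → 6 * (60 * e * t * u) + 120 * e * z) class-sizes)) (sum-mono term)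
      identity : ∀ t e u → 60 * u * t + (6 * (60 * e * t * u) + 120 * e * u) + 0 ≡ 60 * u * (2 * e) + (6 * (10 * t * (5 * e * u + u)) + 60 * e * t * u)
      identity = solve-∀

    module NearlyExtremal (e : ℕ) (mindeg : ∀ x → x ∈ U → 5 * e * card U ≤ 6 * e * total x U + card U) where
      private
        u : ℕ
        u = card U

      class-size : ∀ j → 6 * e * t * card (U ∩ inClass j) ≤ t * u + e * t * u + 12 * e * u
      class-size j = *-cancelˡ-≤ 10 (by-identity (+-mono-≤ (class-count e (5 * e * u) u mindeg j) (*-monoʳ-≤ (120 * e) (card-mono (∩-⊑ˡ U (inClass j)))))
        (6 * e * t * exceptions j) (identity e t u (classes j) (exceptions j)))
        where
        identity : ∀ e t u c x → 10 * (6 * e * t * c) + ((10 * t * u + 120 * e * c + 60 * e * t * u) + 120 * e * u) + 6 * e * t * x ≡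
          10 * (t * u + e * t * u + 12 * e * u) + ((10 * t * (5 * e * u) + 6 * e * t * x + 60 * e * t * c) + 120 * e * c)
        identity = solve-∀

      exceptional-few : e * t * sum exceptions ≤ 10 * t * u + 20 * e * u
      exceptional-few = *-cancelˡ-≤ 6 (by-identity summed 0 (identity e t u (sum exceptions)))
        where
        term : ∀ j → (50 * t * e * u + 6 * e * t * exceptions j) + 60 * e * t * classes j ≤ (10 * t * u + 60 * e * t * u) + 120 * e * classes j
        term j = ≤-trans (≤-reflexive (id₁ t e u (exceptions j) (classes j))) (≤-trans (class-count e (5 * e * u) u mindeg j) (≤-reflexive (id₂ t e u (classes j))))
          where
          id₁ : ∀ t e u x c → (50 * t * e * u + 6 * e * t * x) + 60 * e * t * c ≡ 10 * t * (5 * e * u) + 6 * e * t * x + 60 * e * t * c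
          id₁ = solve-∀
          id₂ : ∀ t e u c → 10 * t * u + 120 * e * c + 60 * e * t * u ≡ (10 * t * u + 60 * e * t * u) + 120 * e * c
          id₂ = solve-∀
        summed : (6 * (50 * t * e * u) + 6 * e * t * sum exceptions) + 60 * e * t * u ≤ 6 * (10 * t * u + 60 * e * t * u) + 120 * e * u
        summed = subst₂ _≤_
          (trans (∑-distrib-+ (λ j → 50 * t * e * u + 6 * e * t * exceptions j) (λ j → 60 * e * t * classes j))
            (cong₂ _+_ (sum-linear (50 * t * e * u) (6 * e * t) exceptions) (trans (sym (*-distribˡ-sum (60 * e * t) classes)) (cong (60 * e * t *_) class-sizes))))
          (trans (sum-linear (10 * t * u + 60 * e * t * u) (120 * e) classes) (cong (λ z → 6 * (10 * t * u + 60 * e * t * u) + 120 * e * z) class-sizes)) (sum-mono term)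
        identity : ∀ e t u x → 6 * (e * t * x) + (6 * (10 * t * u + 60 * e * t * u) + 120 * e * u) + 0 ≡
          6 * (10 * t * u + 20 * e * u) + ((6 * (50 * t * e * u) + 6 * e * t * x) + 60 * e * t * u)
        identity = solve-∀

    near-partition : ∀ e → (∀ x → x ∈ U → 5 * e * card U ≤ 6 * e * total x U + card U) → NearPartition S U e t
    near-partition e mindeg = record
      { class = class
      ; core = core
      ; core-sparse = core-sparse
      ; core-missing = ≤-trans (*-monoʳ-≤ (e * t) core-missing) (≤-trans (≤-reflexive (*-distribˡ-+ (e * t) (sum exceptions) (5 * (t * M) + 3 * M)))
          (+-monoˡ-≤ (e * t * (5 * (t * M) + 3 * M)) (NearlyExtremal.exceptional-few e mindeg)))
      ; class-size = NearlyExtremal.class-size e mindeg }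

open PentagonClasses

-- Assigning kinds to vertices and deleting vertices of small degree.

module Peeling where
  open import Data.Fin using () renaming (_≟_ to _≟ᶠ_)
  open import Data.Fin.Properties using (any?; all?)
  open import Relation.Nullary using (does; _×-dec_; _→-dec_)
  open import Data.Bool using (Bool; true; false; _∧_; not)
  open import Data.Bool.Properties using (_≟_; ∧-comm)
  open import Data.Empty using (⊥; ⊥-elim)
  open import Data.Fin using (Fin; zero; suc)
  open import Data.List using (length)
  open import Data.List.Relation.Unary.AllPairs using (AllPairs)
  open import Data.Nat hiding (_≟_)
  open import Data.Nat.Properties hiding (_≟_)
  open import Data.Nat.Tactic.RingSolver using (solve-∀)
  open import Data.Product using (_×_; _,_; ∃; ∃-syntax; ∃₂)
  open import Data.Sum using (_⊎_; inj₁; inj₂; [_,_]′)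
  open import Function using (_∘_; id; case_of_)
  open import Relation.Binary.PropositionalEquality
  open import Relation.Nullary using (Dec; yes; no)

  -- A `Setting` before the kinds and `M` are chosen. They are fixed only after peeling, since `M`
  -- is taken proportional to the set that is left.
  record Coloured (n : ℕ) : Set where
    field
      E         : Colours n
      E-sym     : Symmetric E
      disjoint  : ∀ x y → E true x y ≡ true → E false x y ≡ false
      no-clique : ∀ c xs → AllPairs (λ x y → E c x y ≡ true) xs → length xs ≡ cliqueLimit c → ⊥

    SpansEdge : ℕ → Set
    SpansEdge M₀ = ∀ X → M₀ ≤ card X → ∃[ c ] ∃₂ λ x y → x ∈ X × y ∈ X × E c x y ≡ true

    total : Fin n → Subset n → ℕ
    total v X = card (E true v ∩ X) + card (E false v ∩ X)

    totalDegree : Subset n → ℕ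
    totalDegree U = sumOver U (λ v → total v U)

  module _ {n : ℕ} (G : Coloured n) where
    open Coloured G
    open Degrees E E-sym

    RedFree : Subset n → Set
    RedFree X = ∀ x y → x ∈ X → y ∈ X → E true x y ≡ false

    redFree? : ∀ X → Dec (RedFree X)
    redFree? X = all? λ x → all? λ y → (X x ≟ true) →-dec ((X y ≟ true) →-dec (E true x y ≟ false))

    red-edge-or-free : ∀ X → (∃₂ λ x y → x ∈ X × y ∈ X × E true x y ≡ true) ⊎ RedFree X
    red-edge-or-free X with any? (λ x → any? λ y → (X x ≟ true) ×-dec ((X y ≟ true) ×-dec (E true x y ≟ true)))
    ... | yes e = inj₁ e
    ... | no ¬e = inj₂ λ x y x∈ y∈ → [ (λ xy → ⊥-elim (¬e (x , y , x∈ , y∈ , xy))) , id ]′ (bool-cases (E true x y))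

    -- Repeatedly set aside large sets without red edges: every subset of what is
    -- left contains red edges, and large subsets of the union contain blue ones.
    kinds : ∀ M M₀ L → 1 ≤ M → SpansEdge M₀ → n < L * M → 1 + L * M₀ ≤ M →
      ∃[ kind ] (∀ c X → (∀ i → i ∈ X → kind i ≡ c) → M ≤ card X → ∃₂ λ x y → x ∈ X × y ∈ X × E c x y ≡ true)
    kinds M M₀ L M≥1 spans n<LM LM₀≤M = loop L 0 (λ _ → false) (+-identityʳ L) z≤n λ X X⊑ X≥1 →
      ⊥-elim (case card-positive X X≥1 of λ (x , x∈) → true≢false (X⊑ x x∈) refl)
      where
      BlueIn : Subset n → Set
      BlueIn X = ∃₂ λ x y → x ∈ X × y ∈ X × E false x y ≡ true
      Goal : Set
      Goal = ∃[ kind ] (∀ c X → (∀ i → i ∈ X → kind i ≡ c) → M ≤ card X → ∃₂ λ x y → x ∈ X × y ∈ X × E c x y ≡ true)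
      Removable : Subset n → Subset n → Set
      Removable B I = (∀ i → i ∈ I → B i ≡ false) × M ≤ card I × RedFree I
      removable? : ∀ B → Dec (∃ (Removable B))
      removable? B = search (λ {X} {Y} h (d , s , f) → (λ i i∈ → d i (trans (h i) i∈)) , ≤-trans s (≤-reflexive (card-cong h)) ,
          (λ x y x∈ y∈ → f x y (trans (h x) x∈) (trans (h y) y∈)))
        (λ I → all? (λ i → (I i ≟ true) →-dec (B i ≟ false)) ×-dec (M ≤? card I) ×-dec redFree? I)
      loop : ∀ k c B → k + c ≡ L → c * M ≤ card B → (∀ X → X ⊑ B → 1 + c * M₀ ≤ card X → BlueIn X) → Goal
      -- Here `L` disjoint sets of size at least `M` have been set aside, more than `n` vertices
      -- allow.
      loop zero c B refl size _ = ⊥-elim (<⇒≱ n<LM (≤-trans size (card≤n B)))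
      loop (suc k) c B eq size blue with removable? B
      ... | yes (I , apart , large , free) = loop k (suc c) (B ∪ I) (trans (+-suc k c) eq) size′ blue′
        where
        size′ : M + c * M ≤ card (B ∪ I)
        size′ = begin
          M + c * M                                   ≤⟨ +-mono-≤ large size ⟩
          card I + card B                             ≡⟨ +-comm (card I) (card B) ⟩
          card B + card I                             ≤⟨ +-mono-≤ (card-mono {X = B} {Y = (B ∪ I) ∩ B} λ i i∈ → ∧-intro (∪-left i∈) i∈) (card-mono {X = I} {Y = (B ∪ I) ∖ B} λ i i∈ → ∧-intro (∪-right {B i} i∈) (not-false (apart i i∈))) ⟩
          card ((B ∪ I) ∩ B) + card ((B ∪ I) ∖ B)     ≡⟨ sym (card-split (B ∪ I) B) ⟩
          card (B ∪ I) ∎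
          where open ≤-Reasoning
        blue′ : ∀ X → X ⊑ (B ∪ I) → 1 + (M₀ + c * M₀) ≤ card X → BlueIn X
        blue′ X X⊑ big = choose (≤-total (1 + c * M₀) (card (X ∩ B)))
          where
          choose : 1 + c * M₀ ≤ card (X ∩ B) ⊎ card (X ∩ B) ≤ 1 + c * M₀ → BlueIn X
          choose (inj₁ h) = let (x , y , x∈ , y∈ , xy) = blue (X ∩ B) (∩-⊑ʳ X B) h in x , y , ∧-fst x∈ , ∧-fst y∈ , xy
          choose (inj₂ h) = edge (spans (X ∖ B) (+-cancelˡ-≤ (1 + c * M₀) _ _ (begin
            1 + c * M₀ + M₀                   ≡⟨ cong suc (+-comm (c * M₀) M₀) ⟩
            1 + (M₀ + c * M₀)                 ≤⟨ big ⟩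
            card X                            ≡⟨ card-split X B ⟩
            card (X ∩ B) + card (X ∖ B)       ≤⟨ +-monoˡ-≤ _ h ⟩
            1 + c * M₀ + card (X ∖ B) ∎)))
            where
            open ≤-Reasoning
            inI : ∀ i → i ∈ (X ∖ B) → i ∈ I
            inI i i∈ = [ (λ b → ⊥-elim (true≢false b (not-true (∧-snd {X i} i∈)))) , id ]′ (∪-elim (B i) (X⊑ i (∧-fst i∈)))
            edge : (∃[ c ] ∃₂ λ x y → x ∈ (X ∖ B) × y ∈ (X ∖ B) × E c x y ≡ true) → BlueIn X
            edge (true , x , y , x∈ , y∈ , xy) = ⊥-elim (true≢false xy (free x y (inI x x∈) (inI y y∈)))
            edge (false , x , y , x∈ , y∈ , xy) = x , y , ∧-fst x∈ , ∧-fst y∈ , xy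
      ... | no ∄ = not ∘ B , edges
        where
        cM₀ : 1 + c * M₀ ≤ M
        cM₀ = ≤-trans (s≤s (*-monoˡ-≤ M₀ (≤-trans (m≤n+m c (suc k)) (≤-reflexive eq)))) LM₀≤M
        edges : ∀ c X → (∀ i → i ∈ X → not (B i) ≡ c) → M ≤ card X → ∃₂ λ x y → x ∈ X × y ∈ X × E c x y ≡ true
        edges true X typed big = [ id , (λ f → ⊥-elim (∄ (X , (λ i i∈ → not-true (typed i i∈)) , big , f))) ]′ (red-edge-or-free X)
        edges false X typed big = blue X (λ i i∈ → not-not (typed i i∈)) (≤-trans cM₀ big)
          where
          not-not : ∀ {b} → not b ≡ false → b ≡ true
          not-not {true} _ = refl

    setting : (kind : Fin n → Bool) (M : ℕ) → 1 ≤ M →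
      (∀ c X → (∀ i → i ∈ X → kind i ≡ c) → M ≤ card X → ∃₂ λ x y → x ∈ X × y ∈ X × E c x y ≡ true) → Setting n
    setting kind M M≥1 edge-in = record { E = E ; E-sym = E-sym ; disjoint = disjoint ; no-clique = no-clique ; kind = kind ; M = M ; M≥1 = M≥1 ; edge-in = edge-in }

  single : ∀ {n} → Fin n → Subset n
  single v x = does (x ≟ᶠ v)

  card-single : ∀ {n} (v : Fin n) → card (single v) ≡ 1
  card-single {suc n} zero = cong suc (trans (sum-const n 0) (*-zeroʳ n))
  card-single {suc n} (suc v) = card-single v

  card-remove : ∀ {n} (U : Subset n) v → v ∈ U → card U ≡ suc (card (U ∖ single v))
  card-remove U v v∈ = trans (card-split U (single v)) (cong (_+ card (U ∖ single v)) (trans (card-cong pointwise) (card-single v)))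
    where
    pointwise : ∀ x → U x ∧ single v x ≡ single v x
    pointwise x with x ≟ᶠ v
    ... | yes refl = ∧-intro v∈ refl
    ... | no _ = ∧-comm (U x) false

  module _ {n : ℕ} (G : Coloured n) where
    open Coloured G
    open Degrees E E-sym

    totalDegree-remove : ∀ U v → v ∈ U → totalDegree U ≤ totalDegree (U ∖ single v) + 2 * total v U
    totalDegree-remove U v v∈ = begin
      sumOver U (λ x → total x U)                                          ≡⟨ sumOver-split U (single v) (λ x → total x U) ⟩
      sumOver (U ∩ single v) (λ x → total x U) + sumOver U₁ (λ x → total x U) ≤⟨ +-mono-≤ self others ⟩
      total v U + (totalDegree U₁ + total v U)                             ≡⟨ identity (total v U) (totalDegree U₁) ⟩
      totalDegree U₁ + 2 * total v U ∎
      where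
      open ≤-Reasoning
      U₁ : Subset n
      U₁ = U ∖ single v
      identity : ∀ a b → a + (b + a) ≡ b + 2 * a
      identity = solve-∀
      only-v : ∀ (X : Subset n) f → sumOver (X ∩ single v) f ≤ f v
      only-v X f = ≤-trans (sumOver-≤ (X ∩ single v) (λ x x∈ → ≤-reflexive (cong f (does-sound (∩-⊑ʳ X (single v) x x∈)))))
        (≤-trans (*-monoˡ-≤ (f v) (≤-trans (card-mono (∩-⊑ʳ X (single v))) (≤-reflexive (card-single v)))) (≤-reflexive (*-identityˡ (f v))))
      self : sumOver (U ∩ single v) (λ x → total x U) ≤ total v U
      self = only-v U (λ x → total x U)
      toward : ∀ c → sumOver U₁ (λ x → deg c x (U ∩ single v)) ≤ deg c v U
      toward c = begin
        edgesBetween c U₁ (U ∩ single v)        ≡⟨ edgesBetween-sym c U₁ (U ∩ single v) ⟩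
        sumOver (U ∩ single v) (λ x → deg c x U₁) ≤⟨ only-v U (λ x → deg c x U₁) ⟩
        deg c v U₁                              ≤⟨ deg-mono {c} {v} (∖-⊑ U (single v)) ⟩
        deg c v U ∎
      split-deg : ∀ c x → deg c x U ≤ deg c x U₁ + deg c x (U ∩ single v)
      split-deg c x = deg-cover {c} {x} {U} {U₁} {U ∩ single v} λ i i∈ →
        [ (λ s → inj₂ (∧-intro i∈ s)) , (λ s → inj₁ (∧-intro i∈ (not-false s))) ]′ (bool-cases (single v i))
      others : sumOver U₁ (λ x → total x U) ≤ totalDegree U₁ + total v U
      others = begin
        sumOver U₁ (λ x → total x U)      ≤⟨ sumOver-mono U₁ (λ x _ → ≤-trans (+-mono-≤ (split-deg true x) (split-deg false x))
                                               (≤-reflexive (regroup (deg true x U₁) (deg true x (U ∩ single v)) (deg false x U₁) (deg false x (U ∩ single v))))) ⟩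
        sumOver U₁ (λ x → total x U₁ + (deg true x (U ∩ single v) + deg false x (U ∩ single v)))
          ≡⟨ trans (sumOver-+ U₁ (λ x → total x U₁) (λ x → deg true x (U ∩ single v) + deg false x (U ∩ single v)))
               (cong (totalDegree U₁ +_) (sumOver-+ U₁ (λ x → deg true x (U ∩ single v)) (λ x → deg false x (U ∩ single v)))) ⟩
        totalDegree U₁ + (sumOver U₁ (λ x → deg true x (U ∩ single v)) + sumOver U₁ (λ x → deg false x (U ∩ single v)))
          ≤⟨ +-monoʳ-≤ (totalDegree U₁) (+-mono-≤ (toward true) (toward false)) ⟩
        totalDegree U₁ + total v U ∎
        where
        regroup : ∀ a b c d → (a + b) + (c + d) ≡ (a + c) + (b + d)
        regroup = solve-∀

    -- Deleting a vertex of degree below a/b of the current size u lowers b * totalDegree by at most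
    -- 2 * a * u, which is exactly the drop of a * (u * u + u). The bound is the telescoped sum of
    -- these steps.
    peel : ∀ a b k U → card U ≤ k → ∃[ U′ ] U′ ⊑ U × (∀ v → v ∈ U′ → a * card U′ ≤ b * total v U′) ×
      b * totalDegree U + a * (card U′ * card U′ + card U′) ≤ b * totalDegree U′ + a * (card U * card U + card U)
    peel a b k U U≤k with any? (λ v → (U v ≟ true) ×-dec (b * total v U <? a * card U))
    ... | no ∄ = U , ⊑-refl {X = U} , (λ v v∈ → ≮⇒≥ λ h → ∄ (v , v∈ , h)) , ≤-refl
    peel a b zero U U≤k | yes (v , v∈ , low) = ⊥-elim (<⇒≱ low (≤-trans (≤-reflexive (trans (cong (a *_) (n≤0⇒n≡0 U≤k)) (*-zeroʳ a))) z≤n))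
    peel a b (suc k) U U≤k | yes (v , v∈ , low) with peel a b k (U ∖ single v) (s≤s⁻¹ (≤-trans (≤-reflexive (sym (card-remove U v v∈))) U≤k))
    ... | U′ , U′⊑ , rich , bound = U′ , ⊑-trans {X = U′} U′⊑ (∖-⊑ U (single v)) , rich , (begin
      b * totalDegree U + a * (u′ * u′ + u′)                       ≤⟨ +-monoˡ-≤ _ (*-monoʳ-≤ b (totalDegree-remove U v v∈)) ⟩
      b * (totalDegree U₁ + 2 * total v U) + a * (u′ * u′ + u′)    ≡⟨ id₁ b (totalDegree U₁) (total v U) (a * (u′ * u′ + u′)) ⟩
      (b * totalDegree U₁ + a * (u′ * u′ + u′)) + 2 * (b * total v U) ≤⟨ +-mono-≤ bound (*-monoʳ-≤ 2 (<⇒≤ low)) ⟩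
      b * totalDegree U′ + a * (u₁ * u₁ + u₁) + 2 * (a * card U)   ≡⟨ cong (λ z → b * totalDegree U′ + a * (u₁ * u₁ + u₁) + 2 * (a * z)) (card-remove U v v∈) ⟩
      b * totalDegree U′ + a * (u₁ * u₁ + u₁) + 2 * (a * suc u₁)   ≡⟨ id₂ (b * totalDegree U′) a u₁ ⟩
      b * totalDegree U′ + a * (suc u₁ * suc u₁ + suc u₁)          ≡⟨ cong (λ z → b * totalDegree U′ + a * (z * z + z)) (sym (card-remove U v v∈)) ⟩
      b * totalDegree U′ + a * (card U * card U + card U) ∎)
      where
      open ≤-Reasoning
      U₁ : Subset n
      U₁ = U ∖ single v
      u′ u₁ : ℕ
      u′ = card U′
      u₁ = card U₁
      id₁ : ∀ b D t z → b * (D + 2 * t) + z ≡ (b * D + z) + 2 * (b * t)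
      id₁ = solve-∀
      id₂ : ∀ z a u → z + a * (u * u + u) + 2 * (a * suc u) ≡ z + a * (suc u * suc u + suc u)
      id₂ = solve-∀


open Peeling

-- From minimum degree to the pentagon, and the upper bound on edges.

module MinimumDegree where
  open import Data.List.Relation.Unary.Any using (Any; here; there)
  open import Data.Nat.DivMod using (m/n*n≤m; m≡m%n+[m/n]*n; m%n<n)
  open import Data.Bool using (Bool; true; false; not; if_then_else_)
  open import Data.Empty using (⊥; ⊥-elim)
  open import Data.Fin using (Fin; suc)
  open import Data.List using ([]; _∷_)
  open import Data.Maybe using (just)
  open import Data.Nat hiding (_≟_)
  open import Data.Nat.Properties hiding (_≟_)
  open import Data.Nat.Tactic.RingSolver using (solve-∀)
  open import Data.Product using (_×_; _,_; proj₁; proj₂; ∃; ∃-syntax; ∃₂)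
  open import Data.Sum using (inj₁; inj₂; [_,_]′)
  open import Data.Unit using (tt)
  open import Function using (id)
  open import Relation.Binary.PropositionalEquality

  -- Abstract, so that the search over all states is evaluated only here.
  abstract
    states-verified : checkStates states ≡ true
    states-verified = refl

    roots : ∀ k → Any (((just k , []) ∷ []) ≡_) (targetsOf states)
    roots true = there (here refl)
    roots false = there (there (here refl))

  PentagonExists : (p : ℕ) → 3800 ≤ p → Set
  PentagonExists p p-large = let p≥2 = ≤-trans (m≤m+n 2 3798) p-large in ∀ g → 1 ≤ g → ∃[ s ] ∃[ K ]
    (∀ {n} (S : Setting n) (U : Subset n) → Extension.MinDegree p p≥2 S U → 1 ≤ card U → K * Setting.M S ≤ card U →
      ∃[ Xs ] Realisation.Realised p (≤-trans (s≤s z≤n) p≥2) S U g s pentagonWithApex Xs)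

  pentagon-from : ∀ p p-large sts → checkStates sts ≡ true → (∀ k → Any (((just k , []) ∷ []) ≡_) (targetsOf sts)) → PentagonExists p p-large
  pentagon-from p p-large sts ok root g g≥1 =
    let (g₀ , _ , _ , reach) = Strategy.reaching p p-large sts ok g g≥1
        -- The search starts from one cluster: by pigeonhole the vertices of one kind fill at least
        -- half of `U`.
        (s , K , go) = reach 2
    in s , K , λ S U mindeg U≥1 hK → go S U mindeg U≥1 hK (start g₀ S U (pigeonhole₂ U (Setting.kind S)))
    where
    start : ∀ g₀ {n} (S : Setting n) (U : Subset n) → (∃[ b ] card U ≤ 2 * card (U ∩ λ v → if b then Setting.kind S v else not (Setting.kind S v))) →
      RealisedIn p (≤-trans (n≤1+n 1) (≤-trans (m≤m+n 2 3798) p-large)) S U g₀ 2 (targetsOf sts)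
    start g₀ S U (true , h) = (just true , []) ∷ [] , root true , (U ∩ Setting.kind S) ∷ [] ,
      (∩-⊑ˡ U (Setting.kind S) , h , λ i → ∩-⊑ʳ U (Setting.kind S) i) , tt , tt
    start g₀ S U (false , h) = (just false , []) ∷ [] , root false , (U ∖ Setting.kind S) ∷ [] ,
      (∖-⊑ U (Setting.kind S) , h , λ i i∈ → not-true (∧-snd {U i} i∈)) , tt , tt

  abstract
    pentagon-exists : ∀ p p-large → PentagonExists p p-large
    pentagon-exists p p-large = pentagon-from p p-large states states-verified roots

  -- This replaces an error 1/e by the coarser 1/p. Only x > y needs an argument, and there the
  -- hypothesis says e * (x - y) ≤ z, which a smaller factor preserves.
  scale-down : ∀ {p e} x y z → p ≤ e → e * x ≤ e * y + z → p * x ≤ p * y + z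
  scale-down {p} {e} x y z p≤e h with ≤-total x y
  ... | inj₁ le = ≤-trans (*-monoʳ-≤ p le) (m≤m+n (p * y) z)
  ... | inj₂ ge = begin
    p * x               ≡⟨ cong (p *_) (sym (m+[n∸m]≡n ge)) ⟩
    p * (y + (x ∸ y))   ≡⟨ *-distribˡ-+ p y (x ∸ y) ⟩
    p * y + p * (x ∸ y) ≤⟨ +-monoʳ-≤ (p * y) (≤-trans (*-monoˡ-≤ (x ∸ y) p≤e) rest) ⟩
    p * y + z ∎
    where
    open ≤-Reasoning
    rest : e * (x ∸ y) ≤ z
    rest = +-cancelˡ-≤ (e * y) _ _ (≤-trans (≤-reflexive (trans (sym (*-distribˡ-+ e y (x ∸ y))) (cong (e *_) (m+[n∸m]≡n ge)))) h)

  weaken-degree : ∀ p e u τ → p ≤ e → 5 * e * u ≤ 6 * e * τ + u → 5 * p * u ≤ 6 * p * τ + u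
  weaken-degree p e u τ p≤e h = subst₂ _≤_ (sym (five p u)) (cong (_+ u) (sym (six p τ)))
    (scale-down (5 * u) (6 * τ) u p≤e (subst₂ _≤_ (five e u) (cong (_+ u) (six e τ)) h))
    where
    five : ∀ p u → 5 * p * u ≡ p * (5 * u)
    five = solve-∀
    six : ∀ p t → 6 * p * t ≡ p * (6 * t)
    six = solve-∀

  HasEdges : ∀ {n} → Coloured n → (Fin n → Bool) → ℕ → Set
  HasEdges {n} G kind M = ∀ c (X : Subset n) → (∀ i → i ∈ X → kind i ≡ c) → M ≤ card X → ∃₂ λ x y → x ∈ X × y ∈ X × Coloured.E G c x y ≡ true

  module _ (p : ℕ) (p-large : 3800 ≤ p) where

    private
      p≥2 : 2 ≤ p
      p≥2 = ≤-trans (m≤m+n 2 3798) p-large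
      density : ℕ → ℕ
      density t = 6 * ((2 * p) ^ 3 * t)

    density≥1 : ∀ t → 1 ≤ t → 1 ≤ density t
    density≥1 t t≥1 = *-mono-≤ {1} {6} (s≤s z≤n) (*-mono-≤ (≤-trans (≤-reflexive (sym (^-zeroˡ 3)))
      (^-monoˡ-≤ 3 {1} {2 * p} (≤-trans (≤-trans (s≤s z≤n) p≥2) (m≤m+n p _)))) t≥1)

    Realises : ℕ → ℕ → ℕ → Set
    Realises g s K = ∀ {n} (S : Setting n) (U : Subset n) → Extension.MinDegree p p≥2 S U → 1 ≤ card U → K * Setting.M S ≤ card U →
      ∃[ Xs ] Realisation.Realised p (≤-trans (s≤s z≤n) p≥2) S U g s pentagonWithApex Xs

    share-bound : ∀ {K} s d M {u} → (K + s * d) * M ≤ u → s * (d * M) ≤ u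
    share-bound {K} s d M h = ≤-trans (≤-reflexive (sym (*-assoc s d M))) (≤-trans (*-monoˡ-≤ M (m≤n+m (s * d) K)) h)

    very-dense : ∀ e u τ → 1 ≤ e → (5 * e + 1) * u ≤ 6 * e * τ → 5 * p * u ≤ 6 * p * τ + u
    very-dense e u τ e≥1 h = begin
      5 * p * u         ≡⟨ id₁ p u ⟩
      p * (5 * u)       ≤⟨ *-monoʳ-≤ p (*-cancelˡ-≤ e {{>-nonZero e≥1}} (begin
        e * (5 * u)       ≡⟨ id₂ e u ⟩
        5 * e * u         ≤⟨ *-monoˡ-≤ u (m≤m+n (5 * e) 1) ⟩
        (5 * e + 1) * u   ≤⟨ h ⟩
        6 * e * τ         ≡⟨ id₃ e τ ⟩
        e * (6 * τ) ∎)) ⟩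
      p * (6 * τ)       ≡⟨ sym (id₃ p τ) ⟩
      6 * p * τ         ≤⟨ m≤m+n (6 * p * τ) u ⟩
      6 * p * τ + u ∎
      where
      open ≤-Reasoning
      id₁ : ∀ p u → 5 * p * u ≡ p * (5 * u)
      id₁ = solve-∀
      id₂ : ∀ e u → e * (5 * u) ≡ 5 * e * u
      id₂ = solve-∀
      id₃ : ∀ e t → 6 * e * t ≡ e * (6 * t)
      id₃ = solve-∀

    Absurd : ℕ → ℕ → Set
    Absurd e K = ∀ {n} (G : Coloured n) kind M → 1 ≤ M → HasEdges G kind M → ∀ U → 1 ≤ card U → K * M ≤ card U →
      (∀ v → v ∈ U → (5 * e + 1) * card U ≤ 6 * e * Coloured.total G v U) → ⊥

    no-dense-set-from : ∀ e s K → 1 ≤ e → Realises (density (11 + 2 * e)) s K → Absurd e (K + s * density (11 + 2 * e))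
    no-dense-set-from e s K e≥1 exists G kind M M≥1 edges U U≥1 hK mindeg =
      let (Xs , r) = exists S U (λ v v∈ → very-dense e u (Coloured.total G v U) e≥1 (mindeg v v∈)) U≥1 (≤-trans (*-monoˡ-≤ M (m≤m+n K _)) hK)
      in PentagonStructure.too-dense p p≥2 S U (density t) s Xs r t (m≤m+n 10 _) ≤-refl U≥1 (share-bound {K} s (density t) M hK)
           e (s≤s (m≤n+m (2 * e) 10)) (λ x x∈ → ≤-trans (≤-reflexive (identity e u)) (mindeg x x∈))
      where
      S : Setting _
      S = setting G kind M M≥1 edges
      t u : ℕ
      -- Both 2 * e < t, as `too-dense` requires, and 10 ≤ t hold.
      t = 11 + 2 * e
      u = card U
      identity : ∀ e u → 5 * e * u + u ≡ (5 * e + 1) * u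
      identity = solve-∀

    Partitions : ℕ → ℕ → ℕ → Set
    Partitions e t K = ∀ {n} (G : Coloured n) kind M (M≥1 : 1 ≤ M) (edges : HasEdges G kind M) U → 1 ≤ card U → K * M ≤ card U →
      (∀ v → v ∈ U → 5 * e * card U ≤ 6 * e * Coloured.total G v U + card U) → NearPartition (setting G kind M M≥1 edges) U e t

    near-partition-from : ∀ e t s K → p ≤ e → 10 ≤ t → Realises (density t) s K → Partitions e t (K + s * density t)
    near-partition-from e t s K p≤e t≥10 exists G kind M M≥1 edges U U≥1 hK mindeg =
      let (Xs , r) = exists S U (λ v v∈ → weaken-degree p e (card U) (Coloured.total G v U) p≤e (mindeg v v∈)) U≥1 (≤-trans (*-monoˡ-≤ M (m≤m+n K _)) hK)
      in PentagonStructure.near-partition p p≥2 S U (density t) s Xs r t t≥10 ≤-refl U≥1 (share-bound {K} s (density t) M hK) e mindeg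
      where
      S : Setting _
      S = setting G kind M M≥1 edges

    no-dense-set : ∀ e → 1 ≤ e → ∃ (Absurd e)
    no-dense-set e e≥1 =
      let (s , K , exists) = pentagon-exists p p-large (density (11 + 2 * e)) (density≥1 (11 + 2 * e) (s≤s z≤n))
      in K + s * density (11 + 2 * e) , no-dense-set-from e s K e≥1 exists

    near-partition : ∀ e t → p ≤ e → 10 ≤ t → ∃ (Partitions e t)
    near-partition e t p≤e t≥10 =
      let (s , K , exists) = pentagon-exists p p-large (density t) (density≥1 t (≤-trans (s≤s z≤n) t≥10))
      in K + s * density t , near-partition-from e t s K p≤e t≥10 exists

  -- `M` is the largest scale with K * M ≤ card U. Then 2 * c * K sets of size `M` exceed `n`, and
  -- the size hypothesis on `U` lets `M` dominate the scale `M₀` on which edges of some colour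
  -- appear.
  kinds-exist : ∀ K c {n} (G : Coloured n) M₀ (U : Subset n) → 1 ≤ K → Coloured.SpansEdge G M₀ → n ≤ c * card U → K * (1 + 2 * c * K * M₀) ≤ card U →
    ∃[ kind ] ∃[ M ] 1 ≤ M × HasEdges {n} G kind M × K * M ≤ card U
  kinds-exist (suc k) c {n} G M₀ U K≥1 spans n≤cu large =
    let (kind , edges) = kinds G M M₀ (2 * c * K) M≥1 spans n<LM M-large in kind , M , M≥1 , edges , ≤-trans (≤-reflexive (*-comm K M)) (m/n*n≤m (card U) K)
    where
    open ≤-Reasoning
    K M u : ℕ
    K = suc k
    u = card U
    M = u / K
    u<2KM : u < K + M * K
    u<2KM = ≤-trans (s≤s (≤-reflexive (m≡m%n+[m/n]*n u K))) (+-monoˡ-≤ (M * K) (m%n<n u K))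
    M-large : 1 + 2 * c * K * M₀ ≤ M
    M-large = s≤s⁻¹ (*-cancelʳ-< K _ _ (begin-strict
      (1 + 2 * c * K * M₀) * K    ≡⟨ *-comm (1 + 2 * c * K * M₀) K ⟩
      K * (1 + 2 * c * K * M₀)    ≤⟨ large ⟩
      u                           <⟨ u<2KM ⟩
      suc M * K ∎))
    M≥1 : 1 ≤ M
    M≥1 = ≤-trans (s≤s z≤n) M-large
    c≥1 : 1 ≤ n → 1 ≤ c
    c≥1 h = positive u h (≤-trans n≤cu (≤-reflexive (*-comm c u)))
    n≥1 : 1 ≤ n
    n≥1 = ≤-trans (≤-trans (*-mono-≤ K≥1 (s≤s z≤n)) large) (card≤n U)
    n<LM : n < 2 * c * K * M
    n<LM = begin-strict
      n                   ≤⟨ n≤cu ⟩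
      c * u               <⟨ *-monoʳ-< c {{>-nonZero (c≥1 n≥1)}} u<2KM ⟩
      c * (K + M * K)     ≤⟨ *-monoʳ-≤ c (+-monoˡ-≤ (M * K) (m≤n*m K M {{>-nonZero M≥1}})) ⟩
      c * (M * K + M * K) ≡⟨ identity c M K ⟩
      2 * c * K * M ∎
      where
      identity : ∀ c m k → c * (m * k + m * k) ≡ 2 * c * k * m
      identity = solve-∀

  totalDegree≤ : ∀ {n} (G : Coloured n) U → Coloured.totalDegree G U ≤ card U * card U
  totalDegree≤ G U = sumOver-≤ U λ v _ → total≤ v
    where
    open Coloured G
    total≤ : ∀ v → total v U ≤ card U
    total≤ v = begin
      card (E true v ∩ U) + card (E false v ∩ U)   ≤⟨ +-mono-≤ (card-mono {X = E true v ∩ U} {Y = U ∩ E true v} (λ i h → ∧-intro (∧-snd {E true v i} h) (∧-fst h)))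
                                                        (card-mono {X = E false v ∩ U} {Y = U ∖ E true v} (λ i h → ∧-intro (∧-snd {E false v i} h)
                                                          (not-false ([ (λ r → ⊥-elim (true≢false (∧-fst h) (disjoint v i r))) , id ]′ (bool-cases (E true v i)))))) ⟩
      card (U ∩ E true v) + card (U ∖ E true v)    ≡⟨ sym (card-split U (E true v)) ⟩
      card U ∎
      where open ≤-Reasoning

  -- A denser graph could be peeled at the threshold (5e + 1)/(6e). The slack between 5e + 1 and 5e
  -- + 3 pays for the linear term of the peeling bound and leaves a surplus card U * card U, so at
  -- least a 1/(6e) share of `U` survives. Its minimum degree contradicts `Absurd`.
  upper : ∀ p → 3800 ≤ p → ∀ e c → 1 ≤ e → ∃[ L ] (∀ {n} (G : Coloured n) M₀ U → 1 ≤ M₀ → Coloured.SpansEdge G M₀ → n ≤ c * card U → L * M₀ ≤ card U →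
    6 * e * Coloured.totalDegree G U ≤ (5 * e + 3) * (card U * card U))
  upper p p-large e c e≥1 = let (K , absurd) = no-dense-set p p-large e e≥1 in bound K absurd , λ G M₀ U M₀≥1 spans n≤cu hL →
    ≮⇒≥ λ dense → contradict K absurd G M₀ U M₀≥1 spans n≤cu hL dense
    where
    factor bound₀ : ℕ → ℕ
    factor K = 6 * e * c
    bound₀ K = (1 + K) * (1 + 2 * factor K * (1 + K))
    bound : ∀ K → Absurd p p-large e K → ℕ
    bound K _ = 6 * e * bound₀ K + (5 * e + 1)
    contradict : ∀ K (absurd : Absurd p p-large e K) {n} (G : Coloured n) M₀ U → 1 ≤ M₀ → Coloured.SpansEdge G M₀ → n ≤ c * card U → bound K absurd * M₀ ≤ card U →
      (5 * e + 3) * (card U * card U) < 6 * e * Coloured.totalDegree G U → ⊥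
    contradict K absurd {n} G M₀ U M₀≥1 spans n≤cu hL dense =
      let (kind , M , M≥1 , edges , hM) = kinds-exist (1 + K) (factor K) G M₀ U′ (s≤s z≤n) spans n≤ large
      in absurd G kind M M≥1 edges U′ u′≥1 (≤-trans (*-monoˡ-≤ M (n≤1+n K)) hM) rich
      where
      open ≤-Reasoning
      peeled = peel G (5 * e + 1) (6 * e) (card U) U ≤-refl
      U′ : Subset n
      U′ = proj₁ peeled
      rich : ∀ v → v ∈ U′ → (5 * e + 1) * card U′ ≤ 6 * e * Coloured.total G v U′
      rich = proj₁ (proj₂ (proj₂ peeled))
      u u′ : ℕ
      u = card U
      u′ = card U′
      u′≤u : u′ ≤ u
      u′≤u = card-mono (proj₁ (proj₂ peeled))
      e₆≥1 : 1 ≤ 6 * e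
      e₆≥1 = ≤-trans e≥1 (m≤m+n e _)
      u-large : 5 * e + 1 ≤ u
      u-large = ≤-trans (≤-trans (m≤n+m (5 * e + 1) (6 * e * bound₀ K)) (m≤m*n _ M₀ {{>-nonZero M₀≥1}})) hL
      u≥1 : 1 ≤ u
      u≥1 = ≤-trans (m≤n+m 1 (5 * e)) u-large
      D D′ : ℕ
      D = Coloured.totalDegree G U
      D′ = Coloured.totalDegree G U′
      chain : (5 * e + 1) * (u * u + u) + u * u ≤ 6 * e * D
      chain = begin
        (5 * e + 1) * (u * u + u) + u * u              ≡⟨ id₁ e u ⟩
        (5 * e + 2) * (u * u) + (5 * e + 1) * u        ≤⟨ +-monoʳ-≤ ((5 * e + 2) * (u * u)) (*-monoˡ-≤ u u-large) ⟩
        (5 * e + 2) * (u * u) + u * u                  ≡⟨ id₂ e u ⟩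
        (5 * e + 3) * (u * u)                          ≤⟨ <⇒≤ dense ⟩
        6 * e * D ∎
        where
        id₁ : ∀ e u → (5 * e + 1) * (u * u + u) + u * u ≡ (5 * e + 2) * (u * u) + (5 * e + 1) * u
        id₁ = solve-∀
        id₂ : ∀ e u → (5 * e + 2) * (u * u) + u * u ≡ (5 * e + 3) * (u * u)
        id₂ = solve-∀
      u≤6eu′ : u ≤ 6 * e * u′
      u≤6eu′ = *-cancelʳ-≤ u (6 * e * u′) u {{>-nonZero u≥1}} (begin
        u * u                 ≤⟨ by-identity (+-mono-≤ chain (proj₂ (proj₂ (proj₂ peeled)))) ((5 * e + 1) * (u′ * u′ + u′)) (id₃ (u * u) ((5 * e + 1) * (u * u + u)) ((5 * e + 1) * (u′ * u′ + u′)) (6 * e * D) (6 * e * D′)) ⟩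
        6 * e * D′            ≤⟨ *-monoʳ-≤ (6 * e) (≤-trans (totalDegree≤ G U′) (*-monoʳ-≤ u′ u′≤u)) ⟩
        6 * e * (u′ * u)      ≡⟨ sym (*-assoc (6 * e) u′ u) ⟩
        6 * e * u′ * u ∎)
        where
        id₃ : ∀ s a b d d′ → s + (d + (d′ + a)) + b ≡ d′ + ((a + s) + (d + b))
        id₃ = solve-∀
      n≤ : n ≤ 6 * e * c * u′
      n≤ = ≤-trans n≤cu (≤-trans (*-monoʳ-≤ c u≤6eu′) (≤-reflexive (id₄ c e u′)))
        where
        id₄ : ∀ c e x → c * (6 * e * x) ≡ 6 * e * c * x
        id₄ = solve-∀
      large₀ : bound₀ K * M₀ ≤ u′
      large₀ = *-cancelˡ-≤ (6 * e) {{>-nonZero e₆≥1}} (≤-trans (≤-reflexive (sym (*-assoc (6 * e) (bound₀ K) M₀)))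
        (≤-trans (*-monoˡ-≤ M₀ (m≤m+n (6 * e * bound₀ K) (5 * e + 1))) (≤-trans hL u≤6eu′)))
      large : (1 + K) * (1 + 2 * (6 * e * c) * (1 + K) * M₀) ≤ u′
      large = ≤-trans (*-monoʳ-≤ (1 + K) (+-monoˡ-≤ (2 * (6 * e * c) * (1 + K) * M₀) M₀≥1)) (≤-trans (≤-reflexive (id₅ (1 + K) (2 * (6 * e * c)) M₀)) large₀)
        where
        id₅ : ∀ k a m → k * (m + a * k * m) ≡ k * (1 + a * k) * m
        id₅ = solve-∀
      u′≥1 : 1 ≤ u′
      u′≥1 = positive (6 * e) u≥1 u≤6eu′


open MinimumDegree

-- Closeness to the balanced complete 6-partite graph.

module NearTuran where
  open import Data.Bool using (_xor_)
  open import Data.Fin using () renaming (_≟_ to _≟ᶠ_)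
  open import Relation.Nullary using (does)
  open import Data.Bool using (Bool; true; false; _∧_; _∨_; not)
  open import Data.Bool.Properties using (∧-comm)
  open import Data.Fin using (Fin; zero; suc)
  open import Data.Nat hiding (_≟_)
  open import Data.Nat.Properties hiding (_≟_)
  open import Data.Nat.Tactic.RingSolver using (solve-∀)
  open import Data.Product using (_,_; proj₁; proj₂; ∃; ∃-syntax)
  open import Data.Sum using (_⊎_; inj₁; inj₂; [_,_]′)
  open import Function using (_∘_)
  open import Relation.Binary.PropositionalEquality
  open import Algebra.Properties.CommutativeMonoid.Sum +-0-commutativeMonoid using (sum; ∑-distrib-+; ∑-comm; sum-cong-≗)
  open import Algebra.Properties.Semiring.Sum +-*-semiring using (*-distribˡ-sum)

  private
    two-products : ∀ a b → 2 * (a * b) ≤ a * a + b * b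
    two-products a b with ≤-total a b
    ... | inj₁ h = subst (λ b → 2 * (a * b) ≤ a * a + b * b) (m+[n∸m]≡n h) (ordered a (b ∸ a))
      where
      ordered : ∀ a d → 2 * (a * (a + d)) ≤ a * a + (a + d) * (a + d)
      ordered a d = ≤-trans (m≤m+n _ (d * d)) (≤-reflexive (identity a d))
        where
        identity : ∀ a d → 2 * (a * (a + d)) + d * d ≡ a * a + (a + d) * (a + d)
        identity = solve-∀
    ... | inj₂ h = subst (λ a → 2 * (a * b) ≤ a * a + b * b) (m+[n∸m]≡n h) (ordered b (a ∸ b))
      where
      ordered : ∀ b d → 2 * ((b + d) * b) ≤ (b + d) * (b + d) + b * b
      ordered b d = ≤-trans (m≤m+n _ (d * d)) (≤-reflexive (identity b d))
        where
        identity : ∀ b d → 2 * ((b + d) * b) + d * d ≡ (b + d) * (b + d) + b * b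
        identity = solve-∀

  -- Cauchy-Schwarz against the all-ones vector, obtained by summing 2ab ≤ a² + b² over all pairs.
  square-sum : ∀ {k} (f : Fin k → ℕ) → sum f * sum f ≤ k * sum (λ i → f i * f i)
  square-sum {k} f = *-cancelˡ-≤ 2 (begin
    2 * (sum f * sum f)                               ≡⟨ cong (2 *_) product ⟩
    2 * sum (λ i → sum (λ j → f i * f j))             ≡⟨ trans (*-distribˡ-sum 2 (λ i → sum (λ j → f i * f j))) (sum-cong-≗ (λ i → *-distribˡ-sum 2 (λ j → f i * f j))) ⟩
    sum (λ i → sum (λ j → 2 * (f i * f j)))           ≤⟨ sum-mono (λ i → sum-mono (λ j → two-products (f i) (f j))) ⟩
    sum (λ i → sum (λ j → f i * f i + f j * f j))     ≡⟨ sum-cong-≗ (λ i → trans (∑-distrib-+ (λ _ → f i * f i) (λ j → f j * f j)) (cong (_+ Q) (sum-const k (f i * f i)))) ⟩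
    sum (λ i → k * (f i * f i) + Q)                   ≡⟨ trans (∑-distrib-+ (λ i → k * (f i * f i)) (λ _ → Q)) (cong₂ _+_ (sym (*-distribˡ-sum k (λ i → f i * f i))) (sum-const k Q)) ⟩
    k * Q + k * Q                                     ≡⟨ cong (k * Q +_) (sym (+-identityʳ (k * Q))) ⟩
    2 * (k * Q) ∎)
    where
    open ≤-Reasoning
    Q : ℕ
    Q = sum (λ i → f i * f i)
    product : sum f * sum f ≡ sum (λ i → sum (λ j → f i * f j))
    product = trans (*-distribˡ-sum (sum f) f) (sum-cong-≗ λ i → trans (*-comm (sum f) (f i)) (*-distribˡ-sum (f i) f))

  sum-pick : ∀ {k} (i : Fin k) (g : Fin k → ℕ) → sum (λ j → ⟦ does (i ≟ᶠ j) ⟧ * g j) ≡ g i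
  sum-pick {suc k} zero g = trans (cong₂ _+_ (+-identityʳ (g zero)) (trans (sum-const k 0) (*-zeroʳ k))) (+-identityʳ (g zero))
  sum-pick (suc i) g = sum-pick i (g ∘ suc)

  module _ {n : ℕ} where

    sameClass : (Fin n → Fin 6) → Fin n → Fin n → Bool
    sameClass cls x y = does (cls y ≟ᶠ cls x)

    classOf : (Fin n → Fin 6) → Fin 6 → Subset n
    classOf cls j v = does (cls v ≟ᶠ j)

    -- Counted over ordered pairs: for a symmetric irreflexive `adj`, twice the edit distance to the
    -- complete 6-partite graph with the classes `cls`.
    edits : (Fin n → Fin n → Bool) → (Fin n → Fin 6) → ℕ
    edits adj cls = sum λ x → sum λ y → ⟦ adj x y xor not (sameClass cls x y) ⟧

    within-classes : ∀ cls → n * n ≤ 6 * sum (λ x → sum (λ y → ⟦ sameClass cls x y ⟧))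
    within-classes cls = begin
      n * n                                                  ≡⟨ cong₂ _*_ (sym total) (sym total) ⟩
      sum sizes * sum sizes                                  ≤⟨ square-sum sizes ⟩
      6 * sum (λ j → sizes j * sizes j)                      ≡⟨ cong (6 *_) squares ⟩
      6 * sum (λ x → sum (λ y → ⟦ sameClass cls x y ⟧)) ∎
      where
      open ≤-Reasoning
      sizes : Fin 6 → ℕ
      sizes j = card (classOf cls j)
      total : sum sizes ≡ n
      total = trans (∑-comm (λ j v → ⟦ does (cls v ≟ᶠ j) ⟧)) (trans (sum-cong-≗ λ v → trans (sum-cong-≗ λ j → sym (*-identityʳ ⟦ does (cls v ≟ᶠ j) ⟧)) (sum-pick (cls v) (λ _ → 1)))
        (trans (sum-const n 1) (*-identityʳ n)))
      squares : sum (λ j → sizes j * sizes j) ≡ sum (λ x → sizes (cls x))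
      squares = trans (sum-cong-≗ λ j → trans (*-distribˡ-sum (sizes j) (λ v → ⟦ does (cls v ≟ᶠ j) ⟧)) (sum-cong-≗ λ v → *-comm (sizes j) ⟦ does (cls v ≟ᶠ j) ⟧))
        (trans (∑-comm (λ j v → ⟦ does (cls v ≟ᶠ j) ⟧ * sizes j)) (sum-cong-≗ λ v → sum-pick (cls v) sizes))

    edit-identity : ∀ adj cls → edits adj cls + sum (λ x → sum (λ y → ⟦ adj x y ⟧)) + sum (λ x → sum (λ y → ⟦ sameClass cls x y ⟧)) ≡
      2 * sum (λ x → sum (λ y → ⟦ adj x y ∧ sameClass cls x y ⟧)) + n * n
    edit-identity adj cls = begin
      edits adj cls + sum (λ x → sum (A x)) + sum (λ x → sum (B x))         ≡⟨ cong (_+ sum (λ x → sum (B x))) (sym (sum-+₂ D A)) ⟩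
      sum (λ x → sum (λ y → D x y + A x y)) + sum (λ x → sum (B x))         ≡⟨ sym (sum-+₂ (λ x y → D x y + A x y) B) ⟩
      sum (λ x → sum (λ y → D x y + A x y + B x y))                         ≡⟨ sum-cong-≗ (λ x → sum-cong-≗ (λ y → pointwise (adj x y) (sameClass cls x y))) ⟩
      sum (λ x → sum (λ y → 2 * C x y + 1))                                 ≡⟨ sum-+₂ (λ x y → 2 * C x y) (λ _ _ → 1) ⟩
      sum (λ x → sum (λ y → 2 * C x y)) + sum {n} (λ _ → sum {n} (λ _ → 1)) ≡⟨ cong₂ _+_ (trans (sum-cong-≗ λ x → sym (*-distribˡ-sum 2 (C x))) (sym (*-distribˡ-sum 2 (λ x → sum (C x)))))
        (trans (sum-cong-≗ {n} λ _ → trans (sum-const n 1) (*-identityʳ n)) (sum-const n n)) ⟩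
      2 * sum (λ x → sum (C x)) + n * n ∎
      where
      open ≡-Reasoning
      A B C D : Fin n → Fin n → ℕ
      A x y = ⟦ adj x y ⟧
      B x y = ⟦ sameClass cls x y ⟧
      C x y = ⟦ adj x y ∧ sameClass cls x y ⟧
      D x y = ⟦ adj x y xor not (sameClass cls x y) ⟧
      sum-+₂ : ∀ (f g : Fin n → Fin n → ℕ) → sum (λ x → sum (λ y → f x y + g x y)) ≡ sum (λ x → sum (f x)) + sum (λ x → sum (g x))
      sum-+₂ f g = trans (sum-cong-≗ λ x → ∑-distrib-+ (f x) (g x)) (∑-distrib-+ (λ x → sum (f x)) (λ x → sum (g x)))
      pointwise : ∀ a s → ⟦ a xor not s ⟧ + ⟦ a ⟧ + ⟦ s ⟧ ≡ 2 * ⟦ a ∧ s ⟧ + 1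
      pointwise true true = refl
      pointwise true false = refl
      pointwise false true = refl
      pointwise false false = refl

    -- By `edit-identity` the edits are n² plus twice the adjacent pairs within classes, minus all
    -- adjacent pairs and minus all pairs within classes. The last two are nearly 5/6 n² and at
    -- least n²/6, so only the inner edges and the density error remain.
    few-edits : ∀ f I adj cls → 5 * f * (n * n) ≤ 6 * f * sum (λ x → sum (λ y → ⟦ adj x y ⟧)) + n * n →
      sum (λ x → sum (λ y → ⟦ adj x y ∧ sameClass cls x y ⟧)) ≤ I → 6 * f * edits adj cls ≤ 12 * f * I + n * n
    few-edits f I adj cls dense few = by-identity
      (+-mono-≤ (+-mono-≤ dense (*-monoʳ-≤ (12 * f) few)) (*-monoʳ-≤ f (within-classes cls))) 0
      (final (edit-identity adj cls))
      where
      X D B C N : ℕ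
      X = edits adj cls
      D = sum (λ x → sum (λ y → ⟦ adj x y ⟧))
      B = sum (λ x → sum (λ y → ⟦ sameClass cls x y ⟧))
      C = sum (λ x → sum (λ y → ⟦ adj x y ∧ sameClass cls x y ⟧))
      N = n * n
      final : X + D + B ≡ 2 * C + N → 6 * f * X + (6 * f * D + N + 12 * f * I + f * (6 * B)) + 0 ≡ 12 * f * I + N + (5 * f * N + 12 * f * C + f * N)
      final eq = trans (id₁ f X D B N I) (trans (cong (λ z → 6 * f * z + N + 12 * f * I) eq) (id₂ f C N I))
        where
        id₁ : ∀ f X D B N I → 6 * f * X + (6 * f * D + N + 12 * f * I + f * (6 * B)) + 0 ≡ 6 * f * (X + D + B) + N + 12 * f * I
        id₁ = solve-∀
        id₂ : ∀ f C N I → 6 * f * (2 * C + N) + N + 12 * f * I ≡ 12 * f * I + N + (5 * f * N + 12 * f * C + f * N)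
        id₂ = solve-∀

    inside-classes : ∀ (adj : Fin n → Fin n → Bool) cls core m b → card (λ v → not (core v)) ≤ b →
      (∀ v → v ∈ core → card (λ w → adj v w ∧ core w ∧ sameClass cls v w) ≤ m) →
      sum (λ x → sum (λ y → ⟦ adj x y ∧ sameClass cls x y ⟧)) ≤ n * (m + b) + b * n
    inside-classes adj cls core m b outside sparse = begin
      sum row                                                  ≤⟨ sum-mono (λ x → pointwise x (core x) refl) ⟩
      sum (λ x → (m + b) + ⟦ not (core x) ⟧ * n)               ≡⟨ ∑-distrib-+ (λ _ → m + b) (λ x → ⟦ not (core x) ⟧ * n) ⟩
      sum {n} (λ _ → m + b) + sum (λ x → ⟦ not (core x) ⟧ * n) ≤⟨ +-mono-≤ (≤-reflexive (sum-const n (m + b))) (≤-trans (sumOver-≤ (λ x → not (core x)) (λ _ _ → ≤-refl)) (*-monoˡ-≤ n outside)) ⟩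
      n * (m + b) + b * n ∎
      where
      open ≤-Reasoning
      row : Fin n → ℕ
      row x = card (λ y → adj x y ∧ sameClass cls x y)
      pointwise : ∀ x c → core x ≡ c → row x ≤ (m + b) + ⟦ not c ⟧ * n
      pointwise x false eq = ≤-trans (card≤n _) (≤-trans (≤-reflexive (sym (+-identityʳ n))) (m≤n+m (n + 0) (m + b)))
      pointwise x true eq = ≤-trans (card-cover {X = λ y → adj x y ∧ sameClass cls x y} {λ w → adj x w ∧ core w ∧ sameClass cls x w} {λ v → not (core v)} cover)
        (≤-trans (+-mono-≤ (sparse x eq) outside) (≤-reflexive (sym (+-identityʳ (m + b)))))
        where
        cover : ∀ y → adj x y ∧ sameClass cls x y ≡ true → (adj x y ∧ core y ∧ sameClass cls x y ≡ true) ⊎ (not (core y) ≡ true)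
        cover y h = [ (λ c → inj₁ (∧-intro (∧-fst {adj x y} h) (∧-intro c (∧-snd {adj x y} h)))) , (λ c → inj₂ (not-false c)) ]′ (bool-cases (core y))

  private
    peel-gain : ∀ {w a N n u D D′} → w * (a + 1) * N ≤ 6 * (w * w) * D + N → 6 * w * D + a * (u * u + u) ≤ 6 * w * D′ + a * (N + n) →
      w * N + w * a * (u * u + u) ≤ 6 * (w * w) * D′ + w * a * n + N
    peel-gain {w} {a} {N} {n} {u} {D} {D′} h h′ = by-identity (+-mono-≤ h (*-monoʳ-≤ w h′)) 0 (identity w a N n u D D′)
      where
      identity : ∀ w a N n u D D′ → w * N + w * a * (u * u + u) + (6 * (w * w) * D + N + w * (6 * w * D′ + a * (N + n))) + 0 ≡
        6 * (w * w) * D′ + w * a * n + N + (w * (a + 1) * N + w * (6 * w * D + a * (u * u + u)))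
      identity = solve-∀

    linear-share : ∀ {w a n u D′} → 1 ≤ n → 3 ≤ w → w * a ≤ n → D′ ≤ u * n → w * (n * n) + w * a * (u * u + u) ≤ 6 * (w * w) * D′ + w * a * n + n * n →
      n ≤ 6 * (w * w) * u
    linear-share {w} {a} {n} {u} {D′} n≥1 w≥3 wa≤n D′≤ h = *-cancelʳ-≤ n (6 * (w * w) * u) n {{>-nonZero n≥1}} (by-identity chain 0 (identity n (6 * (w * w) * u)))
      where
      open ≤-Reasoning
      chain : 3 * (n * n) ≤ 6 * (w * w) * u * n + 2 * (n * n)
      chain = begin
        3 * (n * n)                                          ≤⟨ *-monoˡ-≤ (n * n) w≥3 ⟩
        w * (n * n)                                          ≤⟨ m≤m+n _ _ ⟩
        w * (n * n) + w * a * (u * u + u)                    ≤⟨ h ⟩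
        6 * (w * w) * D′ + w * a * n + n * n                 ≤⟨ +-monoˡ-≤ (n * n) (+-mono-≤ (*-monoʳ-≤ (6 * (w * w)) D′≤) (*-monoˡ-≤ n wa≤n)) ⟩
        6 * (w * w) * (u * n) + n * n + n * n                ≡⟨ id₁ (6 * (w * w)) u n ⟩
        6 * (w * w) * u * n + 2 * (n * n) ∎
        where
        id₁ : ∀ f u n → f * (u * n) + n * n + n * n ≡ f * u * n + 2 * (n * n)
        id₁ = solve-∀
      identity : ∀ n z → n * n + (z * n + 2 * (n * n)) + 0 ≡ z * n + 3 * (n * n)
      identity = solve-∀

    -- Vertices peeled at the threshold a/(6w) = 5/6 - 1/(6w) have less than their due degree, so
    -- each deletion raises the density of what is left above the 5/6 expected of it. The upper
    -- bound on `U` limits this gain, and with it the number `d` of deletions.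
    few-deleted : ∀ {w a n u d D′} → 1 ≤ n → 5 * w ≡ a + 1 → n ≡ u + d → w * a ≤ n → 6 * (3 * (w * w)) * D′ ≤ (5 * (3 * (w * w)) + 3) * (u * u) →
      w * (n * n) + w * a * (u * u + u) ≤ 6 * (w * w) * D′ + w * a * n + n * n → w * d ≤ 3 * n
    few-deleted {w} {a} {n} {u} {d} {D′} n≥1 a-eq split wa≤n up h = ≤-trans (+-cancelˡ-≤ (w * u) _ _ (begin
        w * u + w * d           ≡⟨ trans (sym (*-distribˡ-+ w u d)) (cong (w *_) (sym split)) ⟩
        w * n                   ≤⟨ *-cancelʳ-≤ (w * n) (w * u + (u + 2 * n)) n {{>-nonZero n≥1}} per-n ⟩
        w * u + (u + 2 * n) ∎)) (+-monoˡ-≤ (2 * n) u≤n)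
      where
      open ≤-Reasoning
      u≤n : u ≤ n
      u≤n = ≤-trans (m≤m+n u d) (≤-reflexive (sym split))
      third : 6 * (w * w) * D′ ≤ (w * (a + 1) + 1) * (u * u)
      third = *-cancelˡ-≤ 3 (≤-trans (≤-reflexive (id₁ w D′)) (≤-trans up (≤-reflexive (trans (id₂ w u) (cong (λ z → 3 * ((w * z + 1) * (u * u))) a-eq)))))
        where
        id₁ : ∀ w D → 3 * (6 * (w * w) * D) ≡ 6 * (3 * (w * w)) * D
        id₁ = solve-∀
        id₂ : ∀ w u → (5 * (3 * (w * w)) + 3) * (u * u) ≡ 3 * ((w * (5 * w) + 1) * (u * u))
        id₂ = solve-∀
      squares : w * (n * n) ≤ (w + 1) * (u * u) + 2 * (n * n)
      squares = by-identity (+-mono-≤ h (+-mono-≤ third (*-monoˡ-≤ n wa≤n))) (w * a * u) (id₃ w a (w * w) n u D′)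
        where
        id₃ : ∀ w a f n u D → w * (n * n) + (6 * f * D + w * a * n + n * n + ((w * (a + 1) + 1) * (u * u) + n * n)) + w * a * u ≡
          (w + 1) * (u * u) + 2 * (n * n) + (w * (n * n) + w * a * (u * u + u) + (6 * f * D + w * a * n))
        id₃ = solve-∀
      per-n : w * n * n ≤ (w * u + (u + 2 * n)) * n
      per-n = begin
        w * n * n                            ≡⟨ *-assoc w n n ⟩
        w * (n * n)                          ≤⟨ squares ⟩
        (w + 1) * (u * u) + 2 * (n * n)      ≤⟨ +-monoˡ-≤ (2 * (n * n)) (*-monoʳ-≤ (w + 1) (*-monoʳ-≤ u u≤n)) ⟩
        (w + 1) * (u * n) + 2 * (n * n)      ≡⟨ id₄ w u n ⟩
        (w * u + (u + 2 * n)) * n ∎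
        where
        id₄ : ∀ w u n → (w + 1) * (u * n) + 2 * (n * n) ≡ (w * u + (u + 2 * n)) * n
        id₄ = solve-∀

    few-outside : ∀ {w u n M x} → 1 ≤ w → u ≤ n → w * w * M ≤ u → w * w * x ≤ 10 * w * u + 20 * w * u + w * w * (5 * (w * M) + 3 * M) → w * x ≤ 38 * n
    few-outside {w} {u} {n} {M} {x} w≥1 u≤n hM h = *-cancelˡ-≤ w {{>-nonZero w≥1}} (begin
      w * (w * x)                                                    ≡⟨ sym (*-assoc w w x) ⟩
      w * w * x                                                      ≤⟨ h ⟩
      10 * w * u + 20 * w * u + w * w * (5 * (w * M) + 3 * M)        ≡⟨ id₁ w u M ⟩
      w * (30 * u + 5 * (w * w * M) + 3 * (w * M))                   ≤⟨ *-monoʳ-≤ w (+-mono-≤ (+-monoʳ-≤ (30 * u) (*-monoʳ-≤ 5 hM)) (*-monoʳ-≤ 3 (≤-trans (*-monoˡ-≤ M (m≤n*m w w {{>-nonZero w≥1}})) hM))) ⟩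
      w * (30 * u + 5 * u + 3 * u)                                   ≡⟨ id₂ w u ⟩
      w * (38 * u)                                                   ≤⟨ *-monoʳ-≤ w (*-monoʳ-≤ 38 u≤n) ⟩
      w * (38 * n) ∎)
      where
      open ≤-Reasoning
      id₁ : ∀ w u M → 10 * w * u + 20 * w * u + w * w * (5 * (w * M) + 3 * M) ≡ w * (30 * u + 5 * (w * w * M) + 3 * (w * M))
      id₁ = solve-∀
      id₂ : ∀ w u → w * (30 * u + 5 * u + 3 * u) ≡ w * (38 * u)
      id₂ = solve-∀

    -- 41 = 3 + 38 collects deleted and non-core vertices, 84 = 2 + 2 * 41, and 1009 = 12 * 84 + 1
    -- stays below 1200 = 6 * 200; hence the condition 200 * r ≤ w.
    final-edits : ∀ {w r n M b X} → 1 ≤ w → 200 * r ≤ w → w * M ≤ n → w * b ≤ 41 * n →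
      6 * (w * w) * X ≤ 12 * (w * w) * (n * (2 * M + b) + b * n) + n * n → r * X ≤ n * n
    final-edits {w} {r} {n} {M} {b} {X} w≥1 r≤w hM hb h = *-cancelˡ-≤ 1200 (begin
      1200 * (r * X)     ≡⟨ id₃ r X ⟩
      6 * (200 * r * X)  ≤⟨ *-monoʳ-≤ 6 (*-monoˡ-≤ X r≤w) ⟩
      6 * (w * X)        ≤⟨ *-cancelˡ-≤ (w * w) {{>-nonZero (*-mono-≤ w≥1 w≥1)}} weighted ⟩
      1009 * (n * n)     ≤⟨ *-monoˡ-≤ (n * n) (m≤m+n 1009 191) ⟩
      1200 * (n * n) ∎)
      where
      open ≤-Reasoning
      id₃ : ∀ r X → 1200 * (r * X) ≡ 6 * (200 * r * X)
      id₃ = solve-∀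
      inner : w * (n * (2 * M + b) + b * n) ≤ 84 * (n * n)
      inner = begin
        w * (n * (2 * M + b) + b * n)       ≡⟨ id₁ w n M b ⟩
        n * (2 * (w * M) + 2 * (w * b))     ≤⟨ *-monoʳ-≤ n (+-mono-≤ (*-monoʳ-≤ 2 hM) (*-monoʳ-≤ 2 hb)) ⟩
        n * (2 * n + 2 * (41 * n))          ≡⟨ id₂ n ⟩
        84 * (n * n) ∎
        where
        id₁ : ∀ w n M b → w * (n * (2 * M + b) + b * n) ≡ n * (2 * (w * M) + 2 * (w * b))
        id₁ = solve-∀
        id₂ : ∀ n → n * (2 * n + 2 * (41 * n)) ≡ 84 * (n * n)
        id₂ = solve-∀
      weighted : w * w * (6 * (w * X)) ≤ w * w * (1009 * (n * n))
      weighted = begin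
        w * w * (6 * (w * X))                                                ≡⟨ id₁ w X ⟩
        w * (6 * (w * w) * X)                                                ≤⟨ *-monoʳ-≤ w h ⟩
        w * (12 * (w * w) * (n * (2 * M + b) + b * n) + n * n)               ≡⟨ id₂ w (n * (2 * M + b) + b * n) (n * n) ⟩
        12 * (w * w) * (w * (n * (2 * M + b) + b * n)) + w * (n * n)         ≤⟨ +-mono-≤ (*-monoʳ-≤ (12 * (w * w)) inner) (*-monoˡ-≤ (n * n) (m≤n*m w w {{>-nonZero w≥1}})) ⟩
        12 * (w * w) * (84 * (n * n)) + w * w * (n * n)                      ≡⟨ id₄ (w * w) (n * n) ⟩
        w * w * (1009 * (n * n)) ∎
        where
        id₁ : ∀ w X → w * w * (6 * (w * X)) ≡ w * (6 * (w * w) * X)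
        id₁ = solve-∀
        id₂ : ∀ w I N → w * (12 * (w * w) * I + N) ≡ 12 * (w * w) * (w * I) + w * N
        id₂ = solve-∀
        id₄ : ∀ f N → 12 * f * (84 * N) + f * N ≡ f * (1009 * N)
        id₄ = solve-∀

    final-sizes : ∀ {w r n u d c k} → 1 ≤ w → 200 * r ≤ w → u ≤ n → w * d ≤ 3 * n → 6 * w * w * c ≤ w * u + w * w * u + 12 * w * u → k ≤ c + d → 6 * r * k ≤ (r + 1) * n
    final-sizes {w} {r} {n} {u} {d} {c} {k} w≥1 r≤w u≤n hd hc hk = *-cancelˡ-≤ w {{>-nonZero w≥1}} (begin
      w * (6 * r * k)              ≤⟨ *-monoʳ-≤ w (*-monoʳ-≤ (6 * r) hk) ⟩
      w * (6 * r * (c + d))        ≡⟨ id₁ w r c d ⟩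
      r * (6 * w * c + 6 * (w * d)) ≤⟨ *-monoʳ-≤ r (+-mono-≤ (≤-trans class (*-monoʳ-≤ (w + 13) u≤n)) (*-monoʳ-≤ 6 hd)) ⟩
      r * ((w + 13) * n + 6 * (3 * n)) ≡⟨ id₂ r w n ⟩
      w * (r * n) + 31 * r * n     ≤⟨ +-monoʳ-≤ (w * (r * n)) (*-monoˡ-≤ n (≤-trans (*-monoˡ-≤ r (m≤m+n 31 169)) r≤w)) ⟩
      w * (r * n) + w * n          ≡⟨ id₃ w r n ⟩
      w * ((r + 1) * n) ∎)
      where
      open ≤-Reasoning
      id₁ : ∀ w r c d → w * (6 * r * (c + d)) ≡ r * (6 * w * c + 6 * (w * d))
      id₁ = solve-∀
      id₂ : ∀ r w n → r * ((w + 13) * n + 6 * (3 * n)) ≡ w * (r * n) + 31 * r * n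
      id₂ = solve-∀
      id₃ : ∀ w r n → w * (r * n) + w * n ≡ w * ((r + 1) * n)
      id₃ = solve-∀
      class : 6 * w * c ≤ (w + 13) * u
      class = *-cancelˡ-≤ w {{>-nonZero w≥1}} (≤-trans (≤-reflexive (id₄ w c)) (≤-trans hc (≤-reflexive (id₅ w u))))
        where
        id₄ : ∀ w c → w * (6 * w * c) ≡ 6 * w * w * c
        id₄ = solve-∀
        id₅ : ∀ w u → w * u + w * w * u + 12 * w * u ≡ w * ((w + 13) * u)
        id₅ = solve-∀

  adjacent : ∀ {n} → Coloured n → Fin n → Fin n → Bool
  adjacent G x y = Coloured.E G true x y ∨ Coloured.E G false x y

  degreeSum : ∀ {n} → (Fin n → Fin n → Bool) → ℕ
  degreeSum adj = sum λ x → sum λ y → ⟦ adj x y ⟧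

  module _ {n : ℕ} (G : Coloured n) where
    open Coloured G

    everything : Subset n
    everything _ = true

    total-adjacent : ∀ v Y → total v Y ≡ card (λ w → adjacent G v w ∧ Y w)
    total-adjacent v Y = trans (sym (∑-distrib-+ (λ w → ⟦ E true v w ∧ Y w ⟧) (λ w → ⟦ E false v w ∧ Y w ⟧)))
      (sum-cong-≗ λ w → pointwise (E true v w) (E false v w) (Y w) (disjoint v w))
      where
      pointwise : ∀ a b y → (a ≡ true → b ≡ false) → ⟦ a ∧ y ⟧ + ⟦ b ∧ y ⟧ ≡ ⟦ (a ∨ b) ∧ y ⟧
      pointwise true b y h rewrite h refl = +-identityʳ ⟦ y ⟧
      pointwise false b y h = refl

    totalDegree-everything : totalDegree everything ≡ degreeSum (adjacent G)
    totalDegree-everything = sum-cong-≗ λ v → trans (+-identityʳ (total v everything)) (trans (total-adjacent v everything)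
      (card-cong λ w → trans (∧-comm (adjacent G v w) true) refl))

    record Approximation (r : ℕ) : Set where
      field
        part   : Fin n → Fin 6
        close  : r * edits (adjacent G) part ≤ n * n
        sizes  : ∀ j → 6 * r * card (classOf part j) ≤ (r + 1) * n

    module Assemble (r w a M : ℕ) (U : Subset n) (kind : Fin n → Bool) (M≥1 : 1 ≤ M) (edges : HasEdges G kind M)
      (part : NearPartition (setting G kind M M≥1 edges) U w w)
      (w≥3 : 3 ≤ w) (r≤w : 200 * r ≤ w) (n≥1 : 1 ≤ n) (a-eq : 5 * w ≡ a + 1) (wa≤n : w * a ≤ n) (hM : w * w * M ≤ card U)
      (upper : 6 * (3 * (w * w)) * totalDegree U ≤ (5 * (3 * (w * w)) + 3) * (card U * card U))
      (gain : w * (n * n) + w * a * (card U * card U + card U) ≤ 6 * (w * w) * totalDegree U + w * a * n + n * n)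
      (dense : 5 * (w * w) * (n * n) ≤ 6 * (w * w) * degreeSum (adjacent G) + n * n) where
      open NearPartition part

      private
        w≥1 : 1 ≤ w
        w≥1 = ≤-trans (s≤s z≤n) w≥3
        u d x b : ℕ
        u = card U
        d = card (everything ∖ U)
        x = card (U ∖ core)
        b = card (λ v → not (core v))
        split : n ≡ u + d
        split = trans (sym (card-full n)) (card-split everything U)
        u≤n : u ≤ n
        u≤n = card≤n U
        deleted : w * d ≤ 3 * n
        deleted = few-deleted {w} {a} {n} {u} {d} {totalDegree U} n≥1 a-eq split wa≤n upper gain
        outside : w * x ≤ 38 * n
        outside = few-outside {w} {u} {n} {M} {x} w≥1 u≤n hM core-missing
        b≤ : b ≤ d + x
        b≤ = card-cover {X = λ v → not (core v)} {everything ∖ U} {U ∖ core} λ i h →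
          [ (λ i∈U → inj₂ (∧-intro i∈U h)) , (λ i∉U → inj₁ (not-false i∉U)) ]′ (bool-cases (U i))
        wb≤ : w * b ≤ 41 * n
        wb≤ = ≤-trans (*-monoʳ-≤ w b≤) (≤-trans (≤-reflexive (*-distribˡ-+ w d x)) (≤-trans (+-mono-≤ deleted outside) (≤-reflexive (sym (*-distribʳ-+ n 3 38)))))
        inside : sum (λ x → sum (λ y → ⟦ adjacent G x y ∧ sameClass class x y ⟧)) ≤ n * (2 * M + b) + b * n
        inside = inside-classes (adjacent G) class core (2 * M) b ≤-refl λ v v∈ →
          ≤-trans (≤-reflexive (sym (total-adjacent v (core ∩ λ w → does (class w ≟ᶠ class v))))) (core-sparse v v∈)

      approximation : Approximation r
      approximation = record
        { part = class
        ; close = final-edits {w} {r} {n} {M} {b} {edits (adjacent G) class} w≥1 r≤w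
            (≤-trans (*-monoˡ-≤ M (m≤n*m w w {{>-nonZero w≥1}})) (≤-trans hM u≤n)) wb≤
            (few-edits (w * w) (n * (2 * M + b) + b * n) (adjacent G) class dense inside)
        ; sizes = λ j → final-sizes {w} {r} {n} {u} {d} {card (U ∩ classOf class j)} {card (classOf class j)} w≥1 r≤w u≤n deleted (class-size j)
            (card-cover {X = classOf class j} {U ∩ classOf class j} {everything ∖ U} λ i h →
              [ (λ i∈U → inj₁ (∧-intro i∈U h)) , (λ i∉U → inj₂ (not-false i∉U)) ]′ (bool-cases (U i))) }

  approximation : ∀ p → 3800 ≤ p → ∀ r → ∃[ L ] ∃[ f ] (∀ {n} (G : Coloured n) M₀ → 1 ≤ M₀ → Coloured.SpansEdge G M₀ → L * M₀ ≤ n →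
    5 * f * (n * n) ≤ 6 * f * degreeSum (adjacent G) + n * n → Approximation G r)
  approximation p p-large r = bound (near-partition p p-large w w (m≤m+n p _) w≥10) (upper p p-large (3 * f) (6 * f) f₃≥1)
    where
    w a f : ℕ
    -- One number serves as both error scales `e` and `t` of the near partition: at least `p` for
    -- `near-partition`, at least 200 * r for the final estimates.
    w = p + 200 * r
    a = 5 * w ∸ 1
    -- Edge counts must be known up to order 1/w², so that peeling at scale 1/w removes only O(n/w)
    -- vertices.
    f = w * w
    w≥10 : 10 ≤ w
    w≥10 = ≤-trans (m≤m+n 10 3790) (≤-trans p-large (m≤m+n p _))
    w≥3 : 3 ≤ w
    w≥3 = ≤-trans (m≤m+n 3 7) w≥10
    w≥1 : 1 ≤ w
    w≥1 = ≤-trans (s≤s z≤n) w≥10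
    f≥1 : 1 ≤ f
    f≥1 = *-mono-≤ w≥1 w≥1
    f₃≥1 : 1 ≤ 3 * f
    f₃≥1 = ≤-trans f≥1 (m≤m+n f _)
    a-eq : 5 * w ≡ a + 1
    a-eq = sym (m∸n+n≡m {5 * w} {1} (≤-trans w≥1 (m≤m+n w _)))
    UpperBound : ℕ → Set
    UpperBound L = ∀ {n} (G : Coloured n) M₀ (U : Subset n) → 1 ≤ M₀ → Coloured.SpansEdge G M₀ → n ≤ 6 * f * card U → L * M₀ ≤ card U →
      6 * (3 * f) * Coloured.totalDegree G U ≤ (5 * (3 * f) + 3) * (card U * card U)
    bound : ∃ (Partitions p p-large w w) → ∃ UpperBound → ∃[ L ] ∃[ f ] (∀ {n} (G : Coloured n) M₀ → 1 ≤ M₀ → Coloured.SpansEdge G M₀ → L * M₀ ≤ n →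
      5 * f * (n * n) ≤ 6 * f * degreeSum (adjacent G) + n * n → Approximation G r)
    bound (K , partition) (Lᵤ , up) = L , f , build
      where
      K₁ Lₖ L : ℕ
      K₁ = suc (K + w * w)
      Lₖ = K₁ * (1 + 2 * (6 * f) * K₁)
      L = w * a + 6 * f * (Lᵤ + Lₖ)
      build : ∀ {n} (G : Coloured n) M₀ → 1 ≤ M₀ → Coloured.SpansEdge G M₀ → L * M₀ ≤ n →
        5 * f * (n * n) ≤ 6 * f * degreeSum (adjacent G) + n * n → Approximation G r
      build {n} G M₀ M₀≥1 spans hL dense =
        let (kind , M , M≥1 , edges , hM) = kinds-exist K₁ (6 * f) G M₀ U (s≤s z≤n) spans n≤ large
            K≤ = ≤-trans (*-monoˡ-≤ M (≤-trans (m≤m+n K (w * w)) (n≤1+n _))) hM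
            ww≤ = ≤-trans (*-monoˡ-≤ M (≤-trans (m≤n+m (w * w) K) (n≤1+n _))) hM
        in Assemble.approximation G r w a M U kind M≥1 edges (partition G kind M M≥1 edges U u≥1 K≤ rich′)
             w≥3 (m≤n+m (200 * r) p) n≥1 a-eq wa≤n ww≤ (up G M₀ U M₀≥1 spans n≤ (≤-trans (*-monoˡ-≤ M₀ (m≤m+n Lᵤ Lₖ)) large₀)) gain dense
        where
        open Coloured G
        V : Subset n
        V = everything G
        peeled = peel G a (6 * w) n V (≤-reflexive (card-full n))
        U : Subset n
        U = proj₁ peeled
        u : ℕ
        u = card U
        wa≥1 : 1 ≤ w * a
        wa≥1 = *-mono-≤ w≥1 (+-cancelʳ-≤ 1 1 a (≤-trans (≤-trans (m≤m+n 2 8) w≥10) (≤-trans (m≤m+n w _) (≤-reflexive a-eq))))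
        wa≤n : w * a ≤ n
        wa≤n = ≤-trans (≤-trans (m≤m+n (w * a) _) (m≤m*n L M₀ {{>-nonZero M₀≥1}})) hL
        n≥1 : 1 ≤ n
        n≥1 = ≤-trans wa≥1 wa≤n
        gain : w * (n * n) + w * a * (u * u + u) ≤ 6 * (w * w) * totalDegree U + w * a * n + n * n
        gain = peel-gain {w} {a} {n * n} {n} {u} {totalDegree V} {totalDegree U}
          (≤-trans (≤-reflexive (cong (_* (n * n)) (trans (cong (w *_) (sym a-eq)) (id₁ w)))) (subst (λ D → 5 * f * (n * n) ≤ 6 * f * D + n * n) (sym (totalDegree-everything G)) dense))
          (subst (λ c → 6 * w * totalDegree V + a * (u * u + u) ≤ 6 * w * totalDegree U + a * (c * c + c)) (card-full n) (proj₂ (proj₂ (proj₂ peeled))))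
          where
          id₁ : ∀ w → w * (5 * w) ≡ 5 * (w * w)
          id₁ = solve-∀
        n≤ : n ≤ 6 * f * u
        n≤ = linear-share {w} {a} {n} {u} {totalDegree U} n≥1 w≥3 wa≤n (≤-trans (totalDegree≤ G U) (*-monoʳ-≤ u (card≤n U))) gain
        large₀ : (Lᵤ + Lₖ) * M₀ ≤ u
        large₀ = *-cancelˡ-≤ (6 * f) {{>-nonZero (≤-trans f≥1 (m≤m+n f _))}} (≤-trans (≤-reflexive (sym (*-assoc (6 * f) (Lᵤ + Lₖ) M₀)))
          (≤-trans (*-monoˡ-≤ M₀ (m≤n+m (6 * f * (Lᵤ + Lₖ)) (w * a))) (≤-trans hL n≤)))
        large : K₁ * (1 + 2 * (6 * f) * K₁ * M₀) ≤ u
        large = ≤-trans (*-monoʳ-≤ K₁ (+-monoˡ-≤ (2 * (6 * f) * K₁ * M₀) M₀≥1)) (≤-trans (≤-reflexive (id₂ K₁ (2 * (6 * f)) M₀))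
          (≤-trans (*-monoˡ-≤ M₀ (m≤n+m Lₖ Lᵤ)) large₀))
          where
          id₂ : ∀ k a m → k * (m + a * k * m) ≡ k * (1 + a * k) * m
          id₂ = solve-∀
        u≥1 : 1 ≤ u
        u≥1 = positive (6 * f) n≥1 n≤
        rich′ : ∀ v → v ∈ U → 5 * w * u ≤ 6 * w * total v U + u
        rich′ v v∈ = ≤-trans (≤-reflexive (trans (cong (_* u) a-eq) (trans (*-distribʳ-+ u a 1) (cong (a * u +_) (*-identityˡ u)))))
          (+-monoˡ-≤ u (proj₁ (proj₂ (proj₂ peeled)) v v∈))


open NearTuran

-- Matching the classes of two near-extremal graphs by a permutation.

module VertexMatching where
  open import Data.Bool using (_xor_)
  open import Data.Fin using () renaming (_≟_ to _≟ᶠ_)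
  open import Data.Fin.Properties using (any?)
  open import Data.Fin.Permutation using (Permutation′; _⟨$⟩ʳ_; _∘ₚ_) renaming (transpose to swap; id to idₚ)
  open import Relation.Nullary using (does; _×-dec_)
  open import Relation.Nullary.Decidable using (dec-true)
  open import Data.Bool using (Bool; true; false; _∧_; not; if_then_else_)
  open import Data.Bool.Properties using (_≟_)
  open import Data.Empty using (⊥-elim)
  open import Data.Fin using (Fin; zero; suc)
  open import Data.Nat hiding (_≟_)
  open import Data.Nat.Properties hiding (_≟_)
  open import Data.Nat.Tactic.RingSolver using (solve-∀)
  open import Data.Product using (_,_; ∃; ∃-syntax)
  open import Data.Sum using (_⊎_; inj₁; inj₂)
  open import Relation.Binary.PropositionalEquality
  open import Relation.Nullary using (yes; no)
  open import Algebra.Properties.CommutativeMonoid.Sum +-0-commutativeMonoid using (sum; ∑-distrib-+; ∑-comm; sum-permute; sum-cong-≗)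
  open import Algebra.Properties.Semiring.Sum +-*-semiring using (*-distribˡ-sum)

  mismatches : ∀ {n k} → (Fin n → Fin k) → (Fin n → Fin k) → Subset n
  mismatches f g i = not (does (f i ≟ᶠ g i))

  module Matching {n k : ℕ} (f g : Fin n → Fin k) where

    after : Permutation′ n → Fin n → Fin k
    after σ i = g (σ ⟨$⟩ʳ i)

    wrong : Permutation′ n → Subset n
    wrong σ = mismatches f (after σ)

    wrongly : (Fin n → Fin k) → Permutation′ n → Fin k → Subset n
    wrongly h σ a i = wrong σ i ∧ does (h i ≟ᶠ a)

    Settled : Permutation′ n → Set
    Settled σ = ∀ i j → i ∈ wrong σ → j ∈ wrong σ → f i ≢ after σ j

    -- Exchanging the images of i and j repairs i if the image of j has the class of i.
    swap-better : ∀ σ i j → i ∈ wrong σ → j ∈ wrong σ → f i ≡ after σ j → card (wrong (swap i j ∘ₚ σ)) < card (wrong σ)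
    swap-better σ i j i∈ j∈ eq = ≤-trans (s≤s (card-mono smaller)) (≤-reflexive (sym (card-remove (wrong σ) i i∈)))
      where
      smaller : wrong (swap i j ∘ₚ σ) ⊑ (wrong σ ∖ single i)
      smaller x x∈ with x ≟ᶠ i
      ... | yes refl = ⊥-elim (true≢false x∈ (cong not (dec-true (f x ≟ᶠ g (σ ⟨$⟩ʳ j)) eq)))
      ... | no _ with x ≟ᶠ j
      ...   | yes refl = ∧-intro j∈ refl
      ...   | no _ = ∧-intro x∈ refl

    settle : ∀ b σ → card (wrong σ) ≤ b → ∃ Settled
    settle b σ h with any? (λ i → any? λ j → (wrong σ i ≟ true) ×-dec ((wrong σ j ≟ true) ×-dec (f i ≟ᶠ after σ j)))
    ... | no ∄ = σ , λ i j i∈ j∈ eq → ∄ (i , j , i∈ , j∈ , eq)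
    settle zero σ h | yes (i , j , i∈ , j∈ , eq) = ⊥-elim (<⇒≱ (swap-better σ i j i∈ j∈ eq) (≤-trans h z≤n))
    settle (suc b) σ h | yes (i , j , i∈ , j∈ , eq) = settle b (swap i j ∘ₚ σ) (s≤s⁻¹ (≤-trans (swap-better σ i j i∈ j∈ eq) h))

    class : (Fin n → Fin k) → Fin k → Subset n
    class h a i = does (h i ≟ᶠ a)

    class-after : ∀ σ a → card (class g a) ≡ card (class (after σ) a)
    class-after σ a = sum-permute (λ i → ⟦ does (g i ≟ᶠ a) ⟧) σ

    wrong-classes : ∀ σ → card (wrong σ) ≡ sum (λ a → card (wrongly f σ a))
    wrong-classes σ = trans (sum-cong-≗ λ i → sym (trans (sum-cong-≗ λ a → trans (⟦∧⟧ (wrong σ i) (does (f i ≟ᶠ a))) (*-comm ⟦ wrong σ i ⟧ _)) (sum-pick (f i) (λ _ → ⟦ wrong σ i ⟧))))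
      (∑-comm (λ i a → ⟦ wrong σ i ∧ does (f i ≟ᶠ a) ⟧))

    -- If class `a` contains a wrong vertex, no wrong vertex has its image in class `a`. All
    -- vertices mapped into that class then belong to it and are right, so the wrong ones fit into
    -- the excess of the class of `f` over that of `g`.
    settled-class : ∀ σ → Settled σ → ∀ a → (card (wrongly f σ a) ≡ 0) ⊎ (card (wrongly f σ a) + card (class g a) ≤ card (class f a))
    settled-class σ settled a with ≤-total (card (wrongly f σ a)) 0
    ... | inj₁ h = inj₁ (n≤0⇒n≡0 h)
    ... | inj₂ _ with bool-cases (1 ≤ᵇ card (wrongly f σ a))
    ...   | inj₂ h = inj₁ (n≤0⇒n≡0 (s≤s⁻¹ (≤ᵇ-false {1} {card (wrongly f σ a)} h)))
    ...   | inj₁ h = inj₂ (begin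
      card (wrongly f σ a) + card (class g a)                    ≡⟨ cong (card (wrongly f σ a) +_) (class-after σ a) ⟩
      card (wrongly f σ a) + card (class (after σ) a)            ≤⟨ +-mono-≤ (card-mono {X = wrongly f σ a} {Y = class f a ∩ wrong σ} (λ i i∈ → ∧-intro (∧-snd {wrong σ i} i∈) (∧-fst i∈)))
                                                                      (card-mono {X = class (after σ) a} {Y = class f a ∖ wrong σ} right) ⟩
      card (class f a ∩ wrong σ) + card (class f a ∖ wrong σ)    ≡⟨ sym (card-split (class f a) (wrong σ)) ⟩
      card (class f a) ∎)
      where
      open ≤-Reasoning
      witness : ∃[ i ] i ∈ wrongly f σ a
      witness = card-positive (wrongly f σ a) (≤ᵇ-true h)
      right : class (after σ) a ⊑ (class f a ∖ wrong σ)
      right j j∈ = decide (bool-cases (wrong σ j))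
        where
        decide : (wrong σ j ≡ true) ⊎ (wrong σ j ≡ false) → j ∈ (class f a ∖ wrong σ)
        decide (inj₁ w) = let (i , i∈) = witness in ⊥-elim (settled i j (∧-fst i∈) w (trans (does-sound (∧-snd {wrong σ i} i∈)) (sym (does-sound j∈))))
        decide (inj₂ w) with f j ≟ᶠ g (σ ⟨$⟩ʳ j)
        ... | yes eq = ∧-intro (trans (cong (λ x → does (x ≟ᶠ a)) eq) j∈) refl

  -- Upper bounds on all six classes give lower bounds as well: the other five leave at least (r -
  -- 5) * n / (6 * r) for each. The excess in `settled-class` is thus at most n / r per class.
  few-mismatches : ∀ {n} r (f g : Fin n → Fin 6) → (∀ a → 6 * r * card (classOf f a) ≤ (r + 1) * n) → (∀ a → 6 * r * card (classOf g a) ≤ (r + 1) * n) →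
    ∃[ σ ] r * card (mismatches f (λ i → g (σ ⟨$⟩ʳ i))) ≤ 6 * n
  few-mismatches {n} r f g hf hg =
    let (σ , settled) = settle n idₚ (card≤n (wrong idₚ)) in σ , (begin
      r * card (wrong σ)                              ≡⟨ cong (r *_) (wrong-classes σ) ⟩
      r * sum (λ a → card (wrongly f σ a))            ≡⟨ *-distribˡ-sum r (λ a → card (wrongly f σ a)) ⟩
      sum (λ a → r * card (wrongly f σ a))            ≤⟨ sum-mono (λ a → each σ a (settled-class σ settled a)) ⟩
      sum {6} (λ _ → n)                               ≡⟨ sum-const 6 n ⟩
      6 * n ∎)
    where
    open Matching f g
    open ≤-Reasoning
    total : sum (λ a → card (class g a)) ≡ n
    total = trans (∑-comm (λ a v → ⟦ does (g v ≟ᶠ a) ⟧)) (trans (sum-cong-≗ λ v → trans (sum-cong-≗ λ a → sym (*-identityʳ ⟦ does (g v ≟ᶠ a) ⟧)) (sum-pick (g v) (λ _ → 1)))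
      (trans (sum-const n 1) (*-identityʳ n)))
    other : Fin 6 → Fin 6 → ℕ
    other a b = if does (a ≟ᶠ b) then 0 else (r + 1) * n
    others : ∀ a → sum (other a) ≡ 5 * ((r + 1) * n)
    others zero = refl
    others (suc zero) = refl
    others (suc (suc zero)) = refl
    others (suc (suc (suc zero))) = refl
    others (suc (suc (suc (suc zero)))) = refl
    others (suc (suc (suc (suc (suc zero))))) = refl
    lower : ∀ a → r * n ≤ 6 * r * card (class g a) + 5 * n
    lower a = by-identity bound 0 (identity r n (6 * r * card (class g a)))
      where
      pointwise : ∀ b → 6 * r * card (class g b) ≤ ⟦ does (a ≟ᶠ b) ⟧ * (6 * r * card (class g b)) + other a b
      pointwise b with does (a ≟ᶠ b)
      ... | true = ≤-reflexive (sym (trans (+-identityʳ _) (+-identityʳ _)))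
      ... | false = hg b
      bound : 6 * (r * n) ≤ 6 * r * card (class g a) + 5 * ((r + 1) * n)
      bound = begin
        6 * (r * n)                                            ≡⟨ sym (*-assoc 6 r n) ⟩
        6 * r * n                                              ≡⟨ cong (6 * r *_) (sym total) ⟩
        6 * r * sum (λ b → card (class g b))                   ≡⟨ *-distribˡ-sum (6 * r) (λ b → card (class g b)) ⟩
        sum (λ b → 6 * r * card (class g b))                   ≤⟨ sum-mono pointwise ⟩
        sum (λ b → ⟦ does (a ≟ᶠ b) ⟧ * (6 * r * card (class g b)) + other a b) ≡⟨ ∑-distrib-+ (λ b → ⟦ does (a ≟ᶠ b) ⟧ * (6 * r * card (class g b))) (other a) ⟩
        sum (λ b → ⟦ does (a ≟ᶠ b) ⟧ * (6 * r * card (class g b))) + sum (other a) ≡⟨ cong₂ _+_ (sum-pick a (λ b → 6 * r * card (class g b))) (others a) ⟩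
        6 * r * card (class g a) + 5 * ((r + 1) * n) ∎
      identity : ∀ r n z → r * n + (z + 5 * ((r + 1) * n)) + 0 ≡ z + 5 * n + 6 * (r * n)
      identity = solve-∀
    each : ∀ σ a → (card (wrongly f σ a) ≡ 0) ⊎ (card (wrongly f σ a) + card (class g a) ≤ card (class f a)) → r * card (wrongly f σ a) ≤ n
    each σ a (inj₁ h) = ≤-trans (≤-reflexive (trans (cong (r *_) h) (*-zeroʳ r))) z≤n
    each σ a (inj₂ h) = *-cancelˡ-≤ 6 (by-identity (+-mono-≤ (≤-trans (*-monoʳ-≤ (6 * r) h) (hf a)) (lower a)) 0
      (identity r n (card (wrongly f σ a)) (card (class g a))))
      where
      identity : ∀ r n w c → 6 * (r * w) + ((r + 1) * n + (6 * r * c + 5 * n)) + 0 ≡ 6 * n + (6 * r * (w + c) + r * n)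
      identity = solve-∀

  -- A triangle inequality through the two complete 6-partite graphs. After the permutation these
  -- agree on all pairs of matched vertices, and a mismatched vertex costs at most its row and its
  -- column.
  edits-between : ∀ {n} (S Z : Fin n → Fin n → Bool) (f g : Fin n → Fin 6) (σ : Permutation′ n) →
    sum (λ i → sum (λ j → ⟦ S i j xor Z (σ ⟨$⟩ʳ i) (σ ⟨$⟩ʳ j) ⟧)) ≤ edits S f + edits Z g + 2 * (n * card (mismatches f (λ i → g (σ ⟨$⟩ʳ i))))
  edits-between {n} S Z f g σ = begin
    sum (λ i → sum (λ j → ⟦ S i j xor Z′ i j ⟧))                                        ≤⟨ sum-mono (λ i → sum-mono (λ j → pointwise i j)) ⟩
    sum (λ i → sum (λ j → (A i j + B i j) + (W i + W j)))                               ≡⟨ trans (sum-+₂ (λ i j → A i j + B i j) (λ i j → W i + W j)) (cong₂ _+_ (sum-+₂ A B) (sum-+₂ (λ i _ → W i) (λ _ j → W j))) ⟩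
    edits S f + sum (λ i → sum (B i)) + (sum (λ i → sum {n} (λ _ → W i)) + sum {n} (λ _ → sum W)) ≡⟨ cong₂ (λ x y → edits S f + x + y) permuted
        (trans (cong₂ _+_ (trans (sum-cong-≗ λ i → sum-const n (W i)) (sym (*-distribˡ-sum n W))) (sum-const n (sum W))) (cong (n * sum W +_) (sym (+-identityʳ _)))) ⟩
    edits S f + edits Z g + 2 * (n * sum W) ∎
    where
    open ≤-Reasoning
    Z′ : Fin n → Fin n → Bool
    Z′ i j = Z (σ ⟨$⟩ʳ i) (σ ⟨$⟩ʳ j)
    g′ : Fin n → Fin 6
    g′ i = g (σ ⟨$⟩ʳ i)
    A B : Fin n → Fin n → ℕ
    A i j = ⟦ S i j xor not (sameClass f i j) ⟧
    B i j = ⟦ Z′ i j xor not (sameClass g′ i j) ⟧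
    W : Fin n → ℕ
    W i = ⟦ mismatches f g′ i ⟧
    sum-+₂ : ∀ (f g : Fin n → Fin n → ℕ) → sum (λ x → sum (λ y → f x y + g x y)) ≡ sum (λ x → sum (f x)) + sum (λ x → sum (g x))
    sum-+₂ f g = trans (sum-cong-≗ λ x → ∑-distrib-+ (f x) (g x)) (∑-distrib-+ (λ x → sum (f x)) (λ x → sum (g x)))
    permuted : sum (λ i → sum (B i)) ≡ edits Z g
    permuted = sym (trans (sum-permute (λ x → sum (λ y → ⟦ Z x y xor not (sameClass g x y) ⟧)) σ)
      (sum-cong-≗ λ i → sum-permute (λ y → ⟦ Z (σ ⟨$⟩ʳ i) y xor not (sameClass g (σ ⟨$⟩ʳ i) y) ⟧) σ))
    triangle : ∀ s z a b → a ≡ b → ⟦ s xor z ⟧ ≤ ⟦ s xor not a ⟧ + ⟦ z xor not b ⟧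
    triangle true true a b eq = z≤n
    triangle false false a b eq = z≤n
    triangle true false true .true refl = s≤s z≤n
    triangle true false false .false refl = s≤s z≤n
    triangle false true true .true refl = s≤s z≤n
    triangle false true false .false refl = s≤s z≤n
    pointwise : ∀ i j → ⟦ S i j xor Z′ i j ⟧ ≤ (A i j + B i j) + (W i + W j)
    pointwise i j with f i ≟ᶠ g′ i | f j ≟ᶠ g′ j
    ... | yes p | yes q = ≤-trans (triangle (S i j) (Z′ i j) _ _ (cong₂ (λ x y → does (y ≟ᶠ x)) p q)) (m≤m+n _ 0)
    ... | no _ | _ = ≤-trans (⟦⟧≤1 (S i j xor Z′ i j)) (≤-trans (s≤s z≤n) (m≤n+m _ (A i j + B i j)))
    ... | yes _ | no _ = ≤-trans (⟦⟧≤1 (S i j xor Z′ i j)) (m≤n+m 1 (A i j + B i j))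


open VertexMatching

-- Translation to graphs: the upper bound and weak stability.

module UpperBoundAndStability where
  open import Defs renaming (sym to adj-sym)
  open import Data.Bool using (_xor_)
  open import Data.Fin using (toℕ) renaming (_≟_ to _≟ᶠ_)
  open import Data.Fin.Properties using (any?; toℕ-injective; suc-injective)
  open import Data.Fin.Permutation using (_⟨$⟩ʳ_)
  open import Data.List using (lookup; tabulate; allFin)
  open import Data.List.Properties using (map-tabulate)
  open import Data.Nat.DivMod using (m/n*n≤m; m≡m%n+[m/n]*n; m%n<n)
  import Data.Nat.ListAction as List
  open import Relation.Nullary using (_×-dec_)
  open import Relation.Binary.Definitions using (tri<; tri≈; tri>)
  open import Function.Definitions using (Injective)
  open import Data.Bool using (Bool; true; false; _∧_; _∨_; not; if_then_else_)
  open import Data.Bool.Properties using (_≟_)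
  open import Data.Empty using (⊥; ⊥-elim)
  open import Data.Fin using (Fin; zero; suc)
  open import Data.List using (List; _∷_; length; map)
  open import Data.List.Relation.Unary.All using (All; _∷_)
  open import Data.List.Relation.Unary.AllPairs using (AllPairs; _∷_)
  open import Data.Nat hiding (_≟_)
  open import Data.Nat.Properties hiding (_≟_; suc-injective)
  open import Data.Nat.Tactic.RingSolver using (solve-∀)
  open import Data.Product using (Σ; _×_; _,_; proj₁; proj₂; ∃-syntax; ∃₂)
  open import Data.Sum using ([_,_]′)
  open import Data.Unit using (tt)
  open import Function using (_∘_; id)
  open import Relation.Binary.PropositionalEquality
  open import Relation.Nullary using (¬_; yes; no)
  open import Algebra.Properties.CommutativeMonoid.Sum +-0-commutativeMonoid using (sum; ∑-distrib-+; ∑-comm; sum-cong-≗)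
  open import Data.Bool using () renaming (T to So)

  sum-allFin : ∀ {n} (f : Fin n → ℕ) → List.sum (map f (allFin n)) ≡ sum f
  sum-allFin f = trans (cong List.sum (map-tabulate id f)) (tabulated f)
    where
    tabulated : ∀ {n} (f : Fin n → ℕ) → List.sum (tabulate f) ≡ sum f
    tabulated {zero} f = refl
    tabulated {suc n} f = cong (f zero +_) (tabulated (f ∘ suc))

  ordered : ∀ {n} → (Fin n → Fin n → Bool) → Fin n → Fin n → Bool
  ordered P i j = (toℕ i <ᵇ toℕ j) ∧ P i j

  countPairs-sum : ∀ {n} (P : Fin n → Fin n → Bool) → countPairs P ≡ degreeSum (ordered P)
  countPairs-sum {n} P = trans (sum-allFin row) (sum-cong-≗ λ i → trans (sum-allFin (entry i)) (sum-cong-≗ λ j → indicator (ordered P i j)))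
    where
    entry : Fin n → Fin n → ℕ
    entry i j = if ordered P i j then 1 else 0
    row : Fin n → ℕ
    row i = List.sum (map (entry i) (allFin n))
    indicator : ∀ b → (if b then 1 else 0) ≡ ⟦ b ⟧
    indicator true = refl
    indicator false = refl

  countPairs-≤ : ∀ {n} (P : Fin n → Fin n → Bool) → countPairs P ≤ degreeSum P
  countPairs-≤ P = ≤-trans (≤-reflexive (countPairs-sum P)) (sum-mono λ i → sum-mono λ j → ⟦⟧-mono {ordered P i j} {P i j} (∧-snd {toℕ i <ᵇ toℕ j}))

  countPairs-twice : ∀ {n} (P : Fin n → Fin n → Bool) → (∀ i j → P i j ≡ P j i) → (∀ i → P i i ≡ false) → 2 * countPairs P ≡ degreeSum P
  countPairs-twice P P-sym P-irr = begin
    2 * countPairs P                                                        ≡⟨ cong (2 *_) (countPairs-sum P) ⟩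
    2 * degreeSum (ordered P)                                               ≡⟨ cong (degreeSum (ordered P) +_) (+-identityʳ _) ⟩
    degreeSum (ordered P) + degreeSum (ordered P)                           ≡⟨ cong (degreeSum (ordered P) +_) (∑-comm (λ i j → ⟦ ordered P i j ⟧)) ⟩
    degreeSum (ordered P) + degreeSum (λ j i → ordered P i j)               ≡⟨ sym (trans (sum-cong-≗ λ i → ∑-distrib-+ (λ j → ⟦ ordered P i j ⟧) (λ j → ⟦ ordered P j i ⟧)) (∑-distrib-+ (λ i → sum λ j → ⟦ ordered P i j ⟧) (λ i → sum λ j → ⟦ ordered P j i ⟧))) ⟩
    sum (λ i → sum (λ j → ⟦ ordered P i j ⟧ + ⟦ ordered P j i ⟧))           ≡⟨ sum-cong-≗ (λ i → sum-cong-≗ (λ j → pointwise i j)) ⟩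
    degreeSum P ∎
    where
    open ≡-Reasoning
    below : ∀ {a b} → a < b → (a <ᵇ b) ≡ true
    below {a} {b} h with a <ᵇ b in eq
    ... | true = refl
    ... | false = ⊥-elim (subst So eq (<⇒<ᵇ h))
    not-below : ∀ {a b} → ¬ (a < b) → (a <ᵇ b) ≡ false
    not-below {a} {b} h with a <ᵇ b in eq
    ... | true = ⊥-elim (h (<ᵇ⇒< a b (subst So (sym eq) tt)))
    ... | false = refl
    pointwise : ∀ i j → ⟦ ordered P i j ⟧ + ⟦ ordered P j i ⟧ ≡ ⟦ P i j ⟧
    pointwise i j with <-cmp (toℕ i) (toℕ j)
    ... | tri< l _ g rewrite below l | not-below g = +-identityʳ _
    ... | tri> l _ g rewrite below g | not-below l = cong ⟦_⟧ (P-sym j i)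
    ... | tri≈ l e g rewrite not-below l | not-below g | toℕ-injective e = cong ⟦_⟧ (sym (P-irr j))

  lookup-All : ∀ {A : Set} {P : A → Set} {xs} → All P xs → ∀ i → P (lookup xs i)
  lookup-All (p ∷ ps) zero = p
  lookup-All (p ∷ ps) (suc i) = lookup-All ps i

  lookup-AllPairs : ∀ {A : Set} {R : A → A → Set} {xs} → (∀ {x y} → R x y → R y x) → AllPairs R xs → ∀ i j → i ≢ j → R (lookup xs i) (lookup xs j)
  lookup-AllPairs s (p ∷ ps) zero zero i≢j = ⊥-elim (i≢j refl)
  lookup-AllPairs s (p ∷ ps) zero (suc j) i≢j = lookup-All p j
  lookup-AllPairs s (p ∷ ps) (suc i) zero i≢j = s (lookup-All p i)
  lookup-AllPairs s (p ∷ ps) (suc i) (suc j) i≢j = lookup-AllPairs s ps i j (i≢j ∘ cong suc)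

  enumerate : ∀ {n} (X : Subset n) → Σ (Fin (card X) → Fin n) λ f → Injective _≡_ _≡_ f × (∀ i → f i ∈ X)
  enumerate {zero} X = (λ ()) , (λ {}) , λ ()
  enumerate {suc n} X with X zero in eq | enumerate (X ∘ suc)
  ... | false | f , inj , mem = suc ∘ f , (λ h → inj (suc-injective h)) , mem
  ... | true | f , inj , mem = g , g-inj , g-mem
    where
    g : Fin (suc (card (X ∘ suc))) → Fin (suc n)
    g zero = zero
    g (suc i) = suc (f i)
    g-inj : Injective _≡_ _≡_ g
    g-inj {zero} {zero} h = refl
    g-inj {suc i} {suc j} h = cong suc (inj (suc-injective h))
    g-mem : ∀ i → X (g i) ≡ true
    g-mem zero = eq
    g-mem (suc i) = mem i

  module FromGraph {n : ℕ} (G : Graph n) (χ : Colouring G) (no-red : ¬ MonoClique G χ true 3) (no-blue : ¬ MonoClique G χ false 6) where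

    private
      pick-colour : Bool → Bool → Bool
      pick-colour c x = if c then x else not x

      pick-sound : ∀ c x → pick-colour c x ≡ true → x ≡ c
      pick-sound true x h = h
      pick-sound false x h = not-true h

      E : Colours n
      E c x y = adj G x y ∧ pick-colour c (col χ x y)

      E-sym : Symmetric E
      E-sym c x y = cong₂ (λ a b → a ∧ pick-colour c b) (adj-sym G x y) (colSym χ x y)

      E-irr : ∀ c x → E c x x ≡ true → ⊥
      E-irr c x h = true≢false (∧-fst h) (irrefl G x)

      clique : ∀ c xs → AllPairs (λ x y → E c x y ≡ true) xs → MonoClique G χ c (length xs)
      clique c xs h = lookup xs , injective , λ a b a≢b → ∧-fst (edge a b a≢b) , pick-sound c _ (∧-snd {adj G (lookup xs a) (lookup xs b)} (edge a b a≢b))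
        where
        edge : ∀ a b → a ≢ b → E c (lookup xs a) (lookup xs b) ≡ true
        edge = lookup-AllPairs (λ {x} {y} p → trans (E-sym c y x) p) h
        injective : Injective _≡_ _≡_ (lookup xs)
        injective {a} {b} eq with a ≟ᶠ b
        ... | yes p = p
        ... | no a≢b = ⊥-elim (E-irr c (lookup xs b) (subst (λ x → E c x (lookup xs b) ≡ true) eq (edge a b a≢b)))

      refute-clique : ∀ c → MonoClique G χ c (cliqueLimit c) → ⊥
      refute-clique true = no-red
      refute-clique false = no-blue

    coloured : Coloured n
    coloured = record
      { E = E
      ; E-sym = E-sym
      ; disjoint = λ x y → exclusive (adj G x y) (col χ x y)
      ; no-clique = λ c xs h len → refute-clique c (subst (MonoClique G χ c) len (clique c xs h)) }
      where
      exclusive : ∀ a x → a ∧ x ≡ true → a ∧ not x ≡ false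
      exclusive true true h = refl

    adjacent-adj : ∀ x y → adjacent coloured x y ≡ adj G x y
    adjacent-adj x y = pointwise (adj G x y) (col χ x y)
      where
      pointwise : ∀ a c → a ∧ c ∨ a ∧ not c ≡ a
      pointwise true true = refl
      pointwise true false = refl
      pointwise false c = refl

    degreeSum-edges : degreeSum (adjacent coloured) ≡ 2 * edges G
    degreeSum-edges = trans (sum-cong-≗ λ x → sum-cong-≗ λ y → cong ⟦_⟧ (adjacent-adj x y)) (sym (countPairs-twice (adj G) (adj-sym G) (irrefl G)))

    -- A set of more than n / (d + 1) vertices is too large to be independent; the edge it contains
    -- has one of the two colours.
    spans : ∀ d → AlphaSmall G d → Coloured.SpansEdge coloured (suc (n / suc d))
    spans d small X big with any? (λ x → any? λ y → (X x ≟ true) ×-dec ((X y ≟ true) ×-dec (adj G x y ≟ true)))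
    ... | yes (x , y , x∈ , y∈ , xy) = coloured-edge (col χ x y) refl
      where
      coloured-edge : ∀ c → col χ x y ≡ c → ∃[ c ] ∃₂ λ x y → x ∈ X × y ∈ X × E c x y ≡ true
      coloured-edge true eq = true , x , y , x∈ , y∈ , ∧-intro xy eq
      coloured-edge false eq = false , x , y , x∈ , y∈ , ∧-intro xy (cong not eq)
    ... | no ∄ = ⊥-elim (<⇒≱ (small (card X) (f , inj , λ a b _ → [ (λ h → ⊥-elim (∄ (f a , f b , mem a , mem b , h))) , id ]′ (bool-cases (adj G (f a) (f b))))) (begin
      n                              ≡⟨ m≡m%n+[m/n]*n n (suc d) ⟩
      n % suc d + n / suc d * suc d  ≤⟨ +-monoˡ-≤ _ (<⇒≤ (m%n<n n (suc d))) ⟩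
      suc (n / suc d) * suc d        ≤⟨ *-monoˡ-≤ (suc d) big ⟩
      card X * suc d ∎))
      where
      open ≤-Reasoning
      enumeration = enumerate X
      f : Fin (card X) → Fin n
      f = proj₁ enumeration
      inj : Injective _≡_ _≡_ f
      inj = proj₁ (proj₂ enumeration)
      mem : ∀ i → f i ∈ X
      mem = proj₂ (proj₂ enumeration)

  -- Taking 1/(2L + 1) for the independence ratio leaves half of `n` for the quotient and half for
  -- rounding it up.
  independence-bound : ∀ L n → 2 * L ≤ n → L * suc (n / suc (2 * L)) ≤ n
  independence-bound L n h = *-cancelˡ-≤ 2 (begin
    2 * (L * suc (n / suc (2 * L)))            ≡⟨ identity L (n / suc (2 * L)) ⟩
    n / suc (2 * L) * (2 * L) + 2 * L          ≤⟨ +-mono-≤ (≤-trans (*-monoʳ-≤ (n / suc (2 * L)) (n≤1+n (2 * L))) (m/n*n≤m n (suc (2 * L)))) h ⟩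
    n + n                                      ≡⟨ cong (n +_) (sym (+-identityʳ n)) ⟩
    2 * n ∎)
    where
    open ≤-Reasoning
    identity : ∀ L x → 2 * (L * suc x) ≡ x * (2 * L) + 2 * L
    identity = solve-∀

  upper-bound : (k : ℕ) → ∃[ d ] ∃[ N ] ((n : ℕ) → n ≥ N → (G : Graph n) → KFree 3 6 G → AlphaSmall G d →
    12 * suc k * edges G ≤ (5 * suc k + 12) * (n * n))
  upper-bound k = from (upper 3800 ≤-refl (suc k) 1 (s≤s z≤n))
    where
    from : (∃[ L ] (∀ {n} (G : Coloured n) M₀ U → 1 ≤ M₀ → Coloured.SpansEdge G M₀ → n ≤ 1 * card U → L * M₀ ≤ card U →
        6 * suc k * Coloured.totalDegree G U ≤ (5 * suc k + 3) * (card U * card U))) →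
      ∃[ d ] ∃[ N ] ((n : ℕ) → n ≥ N → (G : Graph n) → KFree 3 6 G → AlphaSmall G d → 12 * suc k * edges G ≤ (5 * suc k + 12) * (n * n))
    from (L , bound) = 2 * L , 2 * L , λ n n≥ G (χ , no-red , no-blue) small → result n n≥ G χ no-red no-blue small
      where
      result : ∀ n → n ≥ 2 * L → (G : Graph n) (χ : Colouring G) → ¬ MonoClique G χ true 3 → ¬ MonoClique G χ false 6 → AlphaSmall G (2 * L) →
        12 * suc k * edges G ≤ (5 * suc k + 12) * (n * n)
      result n n≥ G χ no-red no-blue small = begin
        12 * suc k * edges G                             ≡⟨ identity (suc k) (edges G) ⟩
        6 * suc k * (2 * edges G)                        ≡⟨ cong (6 * suc k *_) (sym (trans (totalDegree-everything coloured) degreeSum-edges)) ⟩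
        6 * suc k * Coloured.totalDegree coloured V      ≤⟨ bound coloured (suc (n / suc (2 * L))) V (s≤s z≤n) (spans (2 * L) small) (≤-reflexive (sym (trans (*-identityˡ (card V)) (card-full n))))
                                                              (≤-trans (independence-bound L n n≥) (≤-reflexive (sym (card-full n)))) ⟩
        (5 * suc k + 3) * (card V * card V)              ≡⟨ cong (λ c → (5 * suc k + 3) * (c * c)) (card-full n) ⟩
        (5 * suc k + 3) * (n * n)                        ≤⟨ *-monoˡ-≤ (n * n) (+-monoʳ-≤ (5 * suc k) (m≤m+n 3 9)) ⟩
        (5 * suc k + 12) * (n * n) ∎
        where
        open FromGraph G χ no-red no-blue
        open ≤-Reasoning
        V : Subset n
        V = everything coloured
        identity : ∀ k e → 12 * k * e ≡ 6 * k * (2 * e)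
        identity = solve-∀

  weak-stability : (S Z : GraphSeq) → AsympExtremal S → AsympExtremal Z → (k : ℕ) → ∃[ N ] ((n : ℕ) → n ≥ N → DeltaSmall (S n) (Z n) k)
  weak-stability S Z extS extZ k = from (approximation 3800 ≤-refl r)
    where
    r : ℕ
    -- 14 = 1 + 1 + 2 * 6: the edits of the two approximations and those caused by mismatches.
    r = 14 * suc k
    Approximates : ℕ → ℕ → Set
    Approximates L f = ∀ {n} (G : Coloured n) M₀ → 1 ≤ M₀ → Coloured.SpansEdge G M₀ → L * M₀ ≤ n →
      5 * f * (n * n) ≤ 6 * f * degreeSum (adjacent G) + n * n → Approximation G r
    from : (∃[ L ] ∃[ f ] Approximates L f) → ∃[ N ] ((n : ℕ) → n ≥ N → DeltaSmall (S n) (Z n) k)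
    from (L , f , approx) =
      let (NS , hS) = close S extS ; (NZ , hZ) = close Z extZ
      in NS + NZ , λ n n≥ → conclude n (hS n (≤-trans (m≤m+n NS NZ) n≥)) (hZ n (≤-trans (m≤n+m NZ NS) n≥))
      where
      Close : ∀ {n} → Graph n → Set
      Close {n} G = ∃[ f ] r * edits (adj G) f ≤ n * n × (∀ j → 6 * r * card (classOf f j) ≤ (r + 1) * n)
      close : ∀ (T : GraphSeq) → AsympExtremal T → ∃[ N ] (∀ n → n ≥ N → Close (T n))
      close T (free , small , extremal) =
        -- With index 12 * f the error term 12 * (n * n) turns into n * n once the inequality is
        -- scaled down to `f`.
        let (N₁ , small-from) = small (2 * L) ; (N₂ , extremal-from) = extremal (12 * f)
        in N₁ + (N₂ + 2 * L) , λ n n≥ → build n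
             (small-from n (≤-trans (m≤m+n N₁ _) n≥))
             (proj₂ (extremal-from n (≤-trans (≤-trans (m≤m+n N₂ (2 * L)) (m≤n+m (N₂ + 2 * L) N₁)) n≥)))
             (≤-trans (≤-trans (m≤n+m (2 * L) N₂) (m≤n+m (N₂ + 2 * L) N₁)) n≥)
        where
        build : ∀ n → AlphaSmall (T n) (2 * L) → 5 * suc (12 * f) * (n * n) ≤ 12 * suc (12 * f) * edges (T n) + 12 * (n * n) → 2 * L ≤ n → Close (T n)
        build n α e n≥ = part , subst (λ x → r * x ≤ n * n) (sum-cong-≗ λ x → sum-cong-≗ λ y → cong (λ a → ⟦ a xor not (sameClass part x y) ⟧) (adjacent-adj x y)) close-part , sizes
          where
          open FromGraph (T n) (proj₁ (free n)) (proj₁ (proj₂ (free n))) (proj₂ (proj₂ (free n)))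
          dense : 5 * f * (n * n) ≤ 6 * f * degreeSum (adjacent coloured) + n * n
          dense = *-cancelˡ-≤ 12 (begin
            12 * (5 * f * (n * n))                                    ≡⟨ id₁ f (n * n) ⟩
            12 * f * (5 * (n * n))                                    ≤⟨ scale-down (5 * (n * n)) (6 * D) (12 * (n * n)) (n≤1+n (12 * f)) (≤-trans (≤-reflexive (id₂ (suc (12 * f)) (n * n))) (≤-trans e (≤-reflexive twice))) ⟩
            12 * f * (6 * D) + 12 * (n * n)                           ≡⟨ id₃ f D (n * n) ⟩
            12 * (6 * f * D + n * n) ∎)
            where
            open ≤-Reasoning
            D : ℕ
            D = degreeSum (adjacent coloured)
            id₁ : ∀ f N → 12 * (5 * f * N) ≡ 12 * f * (5 * N)
            id₁ = solve-∀
            id₂ : ∀ q N → q * (5 * N) ≡ 5 * q * N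
            id₂ = solve-∀
            id₃ : ∀ f D N → 12 * f * (6 * D) + 12 * N ≡ 12 * (6 * f * D + N)
            id₃ = solve-∀
            id₄ : ∀ q e → 12 * q * e ≡ q * (6 * (2 * e))
            id₄ = solve-∀
            twice : 12 * suc (12 * f) * edges (T n) + 12 * (n * n) ≡ suc (12 * f) * (6 * D) + 12 * (n * n)
            twice = cong (_+ 12 * (n * n)) (trans (id₄ (suc (12 * f)) (edges (T n))) (cong (λ z → suc (12 * f) * (6 * z)) (sym degreeSum-edges)))
          open Approximation (approx coloured (suc (n / suc (2 * L))) (s≤s z≤n) (spans (2 * L) α) (independence-bound L n n≥) dense) renaming (close to close-part)
      conclude : ∀ n → Close (S n) → Close (Z n) → DeltaSmall (S n) (Z n) k
      conclude n (f , closeS , sizesS) (g , closeZ , sizesZ) =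
        let (σ , few) = few-mismatches r f g sizesS sizesZ in σ , *-cancelˡ-≤ 14 (bound σ few)
        where
        open ≤-Reasoning
        bound : ∀ σ → r * card (mismatches f (λ i → g (σ ⟨$⟩ʳ i))) ≤ 6 * n → 14 * (editCount (S n) (Z n) σ * suc k) ≤ 14 * (n * n)
        bound σ few = begin
          14 * (editCount (S n) (Z n) σ * suc k)              ≡⟨ id₁ (editCount (S n) (Z n) σ) (suc k) ⟩
          r * editCount (S n) (Z n) σ                         ≤⟨ *-monoʳ-≤ r (≤-trans (countPairs-≤ (λ i j → adj (S n) i j xor adj (Z n) (σ ⟨$⟩ʳ i) (σ ⟨$⟩ʳ j))) (edits-between (adj (S n)) (adj (Z n)) f g σ)) ⟩
          r * (edits (adj (S n)) f + edits (adj (Z n)) g + 2 * (n * W)) ≡⟨ id₂ r (edits (adj (S n)) f) (edits (adj (Z n)) g) n W ⟩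
          r * edits (adj (S n)) f + r * edits (adj (Z n)) g + 2 * (n * (r * W)) ≤⟨ +-mono-≤ (+-mono-≤ closeS closeZ) (*-monoʳ-≤ 2 (*-monoʳ-≤ n few)) ⟩
          n * n + n * n + 2 * (n * (6 * n))                   ≡⟨ id₃ n ⟩
          14 * (n * n) ∎
          where
          W : ℕ
          W = card (mismatches f (λ i → g (σ ⟨$⟩ʳ i)))
          id₁ : ∀ x k → 14 * (x * k) ≡ 14 * k * x
          id₁ = solve-∀
          id₂ : ∀ r a b n w → r * (a + b + 2 * (n * w)) ≡ r * a + r * b + 2 * (n * (r * w))
          id₂ = solve-∀
          id₃ : ∀ n → n * n + n * n + 2 * (n * (6 * n)) ≡ 14 * (n * n)
          id₃ = solve-∀


open UpperBoundAndStability

-- The lower bound: a blow-up of a sparse triangle-free graph.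

module LowerBound where
  open import Defs renaming (sym to adj-sym)
  open import Data.Fin using () renaming (_≟_ to _≟ᶠ_)
  open import Data.Fin.Properties using (any?; all?; suc-injective)
  open import Data.Fin.Patterns
  open import Data.List using (lookup; allFin; _++_; replicate; concat; take)
  open import Data.List.Properties using (length-take; take++drop≡id)
  open import Data.Nat.DivMod using (m/n*n≤m; m≡m%n+[m/n]*n; m%n<n; m≥n⇒m/n>0)
  open import Relation.Nullary using (does)
  open import Relation.Nullary.Decidable using (dec-true; dec-false; toWitness)
  open import Relation.Binary.Definitions using (DecidableEquality)
  open import Function.Definitions using (Injective)
  open import Data.Bool using (Bool; true; false; _∧_; _∨_; not; if_then_else_)
  open import Data.Bool.Properties using (_≟_)
  open import Data.Empty using (⊥; ⊥-elim)
  open import Data.Fin using (Fin; zero; suc)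
  open import Data.List using (List; []; _∷_; length; map)
  open import Data.List.Relation.Unary.All using (All; []; _∷_)
  open import Data.List.Relation.Unary.AllPairs using (AllPairs; []; _∷_)
  open import Data.Nat hiding (_≟_)
  open import Data.Nat.Properties hiding (_≟_; suc-injective)
  open import Data.Nat.Tactic.RingSolver using (solve-∀)
  open import Data.Product using (Σ; _×_; _,_; proj₁; ∃-syntax)
  open import Data.Sum using (inj₁; inj₂; [_,_]′)
  open import Data.Unit using (⊤; tt)
  open import Function using (_∘_; id)
  open import Relation.Binary.PropositionalEquality
  open import Relation.Nullary using (¬_; Dec; yes; no)
  open import Algebra.Properties.CommutativeMonoid.Sum +-0-commutativeMonoid using (sum; ∑-distrib-+; ∑-comm; sum-cong-≗)

  tally : {A : Set} → (A → ℕ) → List A → ℕ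
  tally h [] = 0
  tally h (x ∷ xs) = h x + tally h xs

  tally-++ : ∀ {A : Set} (h : A → ℕ) xs ys → tally h (xs ++ ys) ≡ tally h xs + tally h ys
  tally-++ h [] ys = refl
  tally-++ h (x ∷ xs) ys = trans (cong (h x +_) (tally-++ h xs ys)) (sym (+-assoc (h x) _ _))

  tally-map : ∀ {A B : Set} (h : B → ℕ) (f : A → B) xs → tally h (map f xs) ≡ tally (h ∘ f) xs
  tally-map h f [] = refl
  tally-map h f (x ∷ xs) = cong (h (f x) +_) (tally-map h f xs)

  tally-mono : ∀ {A : Set} {h g : A → ℕ} → (∀ x → h x ≤ g x) → ∀ xs → tally h xs ≤ tally g xs
  tally-mono p [] = z≤n
  tally-mono p (x ∷ xs) = +-mono-≤ (p x) (tally-mono p xs)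

  tally-+ : ∀ {A : Set} (h g : A → ℕ) xs → tally (λ x → h x + g x) xs ≡ tally h xs + tally g xs
  tally-+ h g [] = refl
  tally-+ h g (x ∷ xs) = trans (cong (h x + g x +_) (tally-+ h g xs)) (identity (h x) (g x) (tally h xs) (tally g xs))
    where
    identity : ∀ a b c d → a + b + (c + d) ≡ (a + c) + (b + d)
    identity = solve-∀

  tally-const : ∀ {A : Set} c (xs : List A) → tally (λ _ → c) xs ≡ length xs * c
  tally-const c [] = refl
  tally-const c (x ∷ xs) = cong (c +_) (tally-const c xs)

  tally-* : ∀ {A : Set} c (h : A → ℕ) xs → tally (λ x → c * h x) xs ≡ c * tally h xs
  tally-* c h [] = sym (*-zeroʳ c)
  tally-* c h (x ∷ xs) = trans (cong (c * h x +_) (tally-* c h xs)) (sym (*-distribˡ-+ c (h x) _))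

  tally-replicate : ∀ {A : Set} (h : A → ℕ) k (x : A) → tally h (replicate k x) ≡ k * h x
  tally-replicate h zero x = refl
  tally-replicate h (suc k) x = cong (h x +_) (tally-replicate h k x)

  tally-copies : ∀ {A : Set} (h : A → ℕ) k (xs : List A) → tally h (concat (replicate k xs)) ≡ k * tally h xs
  tally-copies h zero xs = refl
  tally-copies h (suc k) xs = trans (tally-++ h xs _) (cong (tally h xs +_) (tally-copies h k xs))

  tally-sum : ∀ {A : Set} {k} (h : Fin k → A → ℕ) xs → tally (λ x → sum (λ j → h j x)) xs ≡ sum (λ j → tally (h j) xs)
  tally-sum {k = k} h [] = sym (trans (sum-const k 0) (*-zeroʳ k))
  tally-sum h (x ∷ xs) = trans (cong (sum (λ j → h j x) +_) (tally-sum h xs)) (sym (∑-distrib-+ (λ j → h j x) (λ j → tally (h j) xs)))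

  tally-lookup : ∀ {A : Set} (h : A → ℕ) xs → sum (λ i → h (lookup xs i)) ≡ tally h xs
  tally-lookup h [] = refl
  tally-lookup h (x ∷ xs) = cong (h x +_) (tally-lookup h xs)

  Independent : {V : Set} → (V → V → Bool) → (V → Bool) → Set
  Independent A X = ∀ u v → X u ≡ true → X v ≡ true → A u v ≡ false

  -- A triangle-free graph with weights, given as multiplicities in the list of
  -- sites, in which independent sets have weight at most α.
  record Sparse : Set₁ where
    field
      V             : Set
      equal?        : DecidableEquality V
      A             : V → V → Bool
      A-sym         : ∀ u v → A u v ≡ A v u
      triangle-free : ∀ u v w → A u v ≡ true → A v w ≡ true → A u w ≡ true → ⊥
      k             : ℕ
      colour        : V → Fin k
      proper        : ∀ u v → A u v ≡ true → colour u ≢ colour v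
      sites         : List V
      α             : ℕ
      independent   : ∀ X → Independent A X → tally (λ v → ⟦ X v ⟧) sites ≤ α
      k≥1           : 1 ≤ k
      α≥1           : 1 ≤ α

    irreflexive : ∀ v → A v v ≡ false
    irreflexive v = [ (λ h → ⊥-elim (proper v v h refl)) , id ]′ (bool-cases (A v v))

  point : Sparse
  point = record
    { V = ⊤ ; equal? = λ _ _ → yes refl ; A = λ _ _ → false ; A-sym = λ _ _ → refl ; triangle-free = λ _ _ _ ()
    ; k = 1 ; colour = λ _ → zero ; proper = λ _ _ () ; sites = tt ∷ [] ; α = 1
    ; independent = λ X _ → ≤-trans (+-monoˡ-≤ 0 (⟦⟧≤1 (X tt))) ≤-refl ; k≥1 = ≤-refl ; α≥1 = ≤-refl }

  data Mycielskian (V : Set) : Set where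
    original shadow : V → Mycielskian V
    apex : Mycielskian V

  -- The originals get weight k − 1, the shadows weight 1 and the apex weight α:
  -- then m becomes k m + α while α becomes k α, so m/α grows by 1/k.
  module Step (H : Sparse) where
    open Sparse H

    A′ : Mycielskian V → Mycielskian V → Bool
    A′ (original u) (original v) = A u v
    A′ (original u) (shadow v) = A u v
    A′ (shadow u) (original v) = A u v
    A′ (shadow _) apex = true
    A′ apex (shadow _) = true
    A′ _ _ = false

    A′-sym : ∀ u v → A′ u v ≡ A′ v u
    A′-sym (original u) (original v) = A-sym u v
    A′-sym (original u) (shadow v) = A-sym u v
    A′-sym (original u) apex = refl
    A′-sym (shadow u) (original v) = A-sym u v
    A′-sym (shadow u) (shadow v) = refl
    A′-sym (shadow u) apex = refl
    A′-sym apex (original v) = refl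
    A′-sym apex (shadow v) = refl
    A′-sym apex apex = refl

    triangle-free′ : ∀ u v w → A′ u v ≡ true → A′ v w ≡ true → A′ u w ≡ true → ⊥
    triangle-free′ (original u) (original v) (original w) = triangle-free u v w
    triangle-free′ (original u) (original v) (shadow w) = triangle-free u v w
    triangle-free′ (original u) (original v) apex _ ()
    triangle-free′ (original u) (shadow v) (original w) = triangle-free u v w
    triangle-free′ (original u) (shadow v) (shadow w) _ ()
    triangle-free′ (original u) (shadow v) apex _ _ ()
    triangle-free′ (original u) apex w ()
    triangle-free′ (shadow u) (original v) (original w) = triangle-free u v w
    triangle-free′ (shadow u) (original v) (shadow w) _ _ ()
    triangle-free′ (shadow u) (original v) apex _ ()
    triangle-free′ (shadow u) (shadow v) w ()
    triangle-free′ (shadow u) apex (original w) _ ()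
    triangle-free′ (shadow u) apex (shadow w) _ _ ()
    triangle-free′ (shadow u) apex apex _ ()
    triangle-free′ apex (original v) w ()
    triangle-free′ apex (shadow v) (original w) _ _ ()
    triangle-free′ apex (shadow v) (shadow w) _ ()
    triangle-free′ apex (shadow v) apex _ _ ()
    triangle-free′ apex apex w ()

    equal?′ : DecidableEquality (Mycielskian V)
    equal?′ (original u) (original v) with equal? u v
    ... | yes refl = yes refl
    ... | no u≢v = no λ { refl → u≢v refl }
    equal?′ (original _) (shadow _) = no λ ()
    equal?′ (original _) apex = no λ ()
    equal?′ (shadow _) (original _) = no λ ()
    equal?′ (shadow u) (shadow v) with equal? u v
    ... | yes refl = yes refl
    ... | no u≢v = no λ { refl → u≢v refl }
    equal?′ (shadow _) apex = no λ ()
    equal?′ apex (original _) = no λ ()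
    equal?′ apex (shadow _) = no λ ()
    equal?′ apex apex = yes refl

    colour′ : Mycielskian V → Fin (suc k)
    colour′ (original v) = suc (colour v)
    colour′ (shadow v) = suc (colour v)
    colour′ apex = zero

    proper′ : ∀ u v → A′ u v ≡ true → colour′ u ≢ colour′ v
    proper′ (original u) (original v) h e = proper u v h (suc-injective e)
    proper′ (original u) (shadow v) h e = proper u v h (suc-injective e)
    proper′ (shadow u) (original v) h e = proper u v h (suc-injective e)
    proper′ (shadow u) apex h ()
    proper′ apex (shadow v) h ()

    j : ℕ
    j = k ∸ 1

    k≡ : k ≡ suc j
    k≡ = sym (m+[n∸m]≡n k≥1)

    sites′ : List (Mycielskian V)
    sites′ = concat (replicate j (map original sites)) ++ (map shadow sites ++ replicate α apex)

    tally-sites′ : ∀ h → tally h sites′ ≡ j * tally (h ∘ original) sites + (tally (h ∘ shadow) sites + α * h apex)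
    tally-sites′ h = trans (tally-++ h (concat (replicate j (map original sites))) _)
      (cong₂ _+_ (trans (tally-copies h j (map original sites)) (cong (j *_) (tally-map h original sites)))
        (trans (tally-++ h (map shadow sites) _) (cong₂ _+_ (tally-map h shadow sites) (tally-replicate h α apex))))

    independent′ : ∀ X → Independent A′ X → tally (λ v → ⟦ X v ⟧) sites′ ≤ k * α
    independent′ X ind = ≤-trans (≤-reflexive (tally-sites′ (λ v → ⟦ X v ⟧))) (decide (X apex) refl)
      where
      open ≤-Reasoning
      S T : V → Bool
      S v = X (original v)
      T v = X (shadow v)
      s τ : ℕ
      s = tally (λ v → ⟦ S v ⟧) sites
      τ = tally (λ v → ⟦ T v ⟧) sites
      s≤α : s ≤ α
      s≤α = independent S λ u v hu hv → ind (original u) (original v) hu hv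
      mixed : Fin k → V → Bool
      mixed c v = S v ∨ (does (colour v ≟ᶠ c) ∧ T v)
      mixed-independent : ∀ c → Independent A (mixed c)
      mixed-independent c u v hu hv with ∪-elim (S u) hu | ∪-elim (S v) hv
      ... | inj₁ su | inj₁ sv = ind (original u) (original v) su sv
      ... | inj₁ su | inj₂ tv = ind (original u) (shadow v) su (∧-snd {does (colour v ≟ᶠ c)} tv)
      ... | inj₂ tu | inj₁ sv = ind (shadow u) (original v) (∧-snd {does (colour u ≟ᶠ c)} tu) sv
      ... | inj₂ tu | inj₂ tv = [ (λ h → ⊥-elim (proper u v h (trans (does-sound (∧-fst tu)) (sym (does-sound (∧-fst tv)))))) , id ]′ (bool-cases (A u v))
      -- Averaging over the colour classes c the independent sets S ∪ (T ∩ c).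
      average : j * s + τ ≤ k * α
      average = begin
        j * s + τ                                                   ≡⟨ sym (trans (tally-+ (λ v → j * ⟦ S v ⟧) (λ v → ⟦ T v ⟧) sites) (cong (_+ τ) (tally-* j (λ v → ⟦ S v ⟧) sites))) ⟩
        tally (λ v → j * ⟦ S v ⟧ + ⟦ T v ⟧) sites                   ≤⟨ tally-mono pointwise sites ⟩
        tally (λ v → sum (λ c → ⟦ mixed c v ⟧)) sites               ≡⟨ tally-sum (λ c v → ⟦ mixed c v ⟧) sites ⟩
        sum (λ c → tally (λ v → ⟦ mixed c v ⟧) sites)               ≤⟨ sum-mono (λ c → independent (mixed c) (mixed-independent c)) ⟩
        sum {k} (λ _ → α)                                           ≡⟨ sum-const k α ⟩
        k * α ∎
        where
        pointwise : ∀ v → j * ⟦ S v ⟧ + ⟦ T v ⟧ ≤ sum (λ c → ⟦ mixed c v ⟧)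
        pointwise v with S v
        ... | true = begin
          j * 1 + ⟦ T v ⟧      ≤⟨ +-mono-≤ (≤-reflexive (*-identityʳ j)) (⟦⟧≤1 (T v)) ⟩
          j + 1                ≡⟨ trans (+-comm j 1) (sym k≡) ⟩
          k                    ≡⟨ sym (trans (sum-const k 1) (*-identityʳ k)) ⟩
          sum {k} (λ _ → 1) ∎
        ... | false = begin
          j * 0 + ⟦ T v ⟧                                        ≡⟨ cong (_+ ⟦ T v ⟧) (*-zeroʳ j) ⟩
          ⟦ T v ⟧                                                ≡⟨ sym (sum-pick (colour v) (λ _ → ⟦ T v ⟧)) ⟩
          sum (λ c → ⟦ does (colour v ≟ᶠ c) ⟧ * ⟦ T v ⟧)         ≡⟨ sum-cong-≗ (λ c → sym (⟦∧⟧ (does (colour v ≟ᶠ c)) (T v))) ⟩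
          sum (λ c → ⟦ does (colour v ≟ᶠ c) ∧ T v ⟧) ∎
      decide : ∀ b → X apex ≡ b → j * s + (τ + α * ⟦ X apex ⟧) ≤ k * α
      decide false eq = begin
        j * s + (τ + α * ⟦ X apex ⟧)    ≡⟨ cong (λ b → j * s + (τ + α * ⟦ b ⟧)) eq ⟩
        j * s + (τ + α * 0)             ≡⟨ cong (j * s +_) (trans (cong (τ +_) (*-zeroʳ α)) (+-identityʳ τ)) ⟩
        j * s + τ                       ≤⟨ average ⟩
        k * α ∎
      -- With the apex the set has no shadows, so its weight is at most (k - 1) * α + α.
      decide true eq = begin
        j * s + (τ + α * ⟦ X apex ⟧)    ≤⟨ +-mono-≤ (*-monoʳ-≤ j s≤α) (+-mono-≤ no-shadow (≤-trans (*-monoʳ-≤ α (⟦⟧≤1 (X apex))) (≤-reflexive (*-identityʳ α)))) ⟩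
        j * α + (0 + α)                 ≡⟨ +-comm (j * α) α ⟩
        suc j * α                       ≡⟨ cong (_* α) (sym k≡) ⟩
        k * α ∎
        where
        T-empty : ∀ v → ⟦ T v ⟧ ≤ 0
        T-empty v with T v in e
        ... | false = z≤n
        ... | true = ⊥-elim (true≢false refl (ind apex (shadow v) eq e))
        no-shadow : τ ≤ 0
        no-shadow = ≤-trans (tally-mono T-empty sites) (≤-reflexive (trans (tally-const 0 sites) (*-zeroʳ (length sites))))

    mycielskian : Sparse
    mycielskian = record
      { V = Mycielskian V ; equal? = equal?′ ; A = A′ ; A-sym = A′-sym ; triangle-free = triangle-free′ ; k = suc k ; colour = colour′ ; proper = proper′
      ; sites = sites′ ; α = k * α ; independent = independent′ ; k≥1 = s≤s z≤n ; α≥1 = *-mono-≤ k≥1 α≥1 }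

    order : length sites′ ≡ k * length sites + α
    order = begin
      length sites′                                          ≡⟨ sym (trans (tally-const 1 sites′) (*-identityʳ _)) ⟩
      tally (λ _ → 1) sites′                                 ≡⟨ tally-sites′ (λ _ → 1) ⟩
      j * tally (λ _ → 1) sites + (tally (λ _ → 1) sites + α * 1) ≡⟨ cong (λ z → j * z + (z + α * 1)) (trans (tally-const 1 sites) (*-identityʳ _)) ⟩
      j * length sites + (length sites + α * 1)              ≡⟨ identity j (length sites) α ⟩
      suc j * length sites + α                               ≡⟨ cong (λ z → z * length sites + α) (sym k≡) ⟩
      k * length sites + α ∎
      where
      open ≡-Reasoning
      identity : ∀ j m a → j * m + (m + a * 1) ≡ suc j * m + a
      identity = solve-∀

  open Sparse using () renaming (sites to sitesOf; α to weightOf; k to coloursOf)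

  iterate : ℕ → Sparse → Sparse
  iterate zero H = H
  iterate (suc t) H = Step.mycielskian (iterate t H)

  iterate-k : ∀ t H → coloursOf (iterate t H) ≡ t + coloursOf H
  iterate-k zero H = refl
  iterate-k (suc t) H = cong suc (iterate-k t H)

  -- While k ≤ 2K, each step adds at least 1/(2K) to the ratio of m and α.
  iterate-ratio : ∀ K c t H → coloursOf H ≡ K → t ≤ K → c * K * weightOf H ≤ 2 * K * length (sitesOf H) →
    (c * K + t) * weightOf (iterate t H) ≤ 2 * K * length (sitesOf (iterate t H))
  iterate-ratio K c zero H eq t≤K h = subst (λ z → z * weightOf H ≤ 2 * K * length (sitesOf H)) (sym (+-identityʳ (c * K))) h
  iterate-ratio K c (suc t) H eq t<K h = begin
    (c * K + suc t) * (κ * a)                ≡⟨ id₁ (c * K + t) κ a (c * K + suc t) (+-suc (c * K) t) ⟩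
    κ * ((c * K + t) * a) + κ * a            ≤⟨ +-mono-≤ (*-monoʳ-≤ κ (iterate-ratio K c t H eq (≤-trans (n≤1+n t) t<K) h)) (*-monoˡ-≤ a κ≤) ⟩
    κ * (2 * K * m) + 2 * K * a              ≡⟨ id₂ κ K m a ⟩
    2 * K * (κ * m + a)                      ≡⟨ cong (2 * K *_) (sym (Step.order H′)) ⟩
    2 * K * length (sitesOf (iterate (suc t) H)) ∎
    where
    open ≤-Reasoning
    H′ : Sparse
    H′ = iterate t H
    κ a m : ℕ
    κ = coloursOf H′
    a = weightOf H′
    m = length (sitesOf H′)
    κ≤ : κ ≤ 2 * K
    κ≤ = ≤-trans (≤-reflexive (trans (iterate-k t H) (cong (t +_) eq))) (≤-trans (+-monoˡ-≤ K (≤-trans (n≤1+n t) t<K)) (≤-reflexive (cong (K +_) (sym (+-identityʳ K)))))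
    id₁ : ∀ x κ a y → y ≡ suc x → y * (κ * a) ≡ κ * (x * a) + κ * a
    id₁ x κ a .(suc x) refl = identity x κ a
      where
      identity : ∀ x κ a → suc x * (κ * a) ≡ κ * (x * a) + κ * a
      identity = solve-∀
    id₂ : ∀ κ K m a → κ * (2 * K * m) + 2 * K * a ≡ 2 * K * (κ * m + a)
    id₂ = solve-∀

  -- The increments 1/k of the ratio m/α form a harmonic series. Passing from K to 2 * K colours
  -- adds at least K * 1/(2K) = 1/2, so doubling the number of colours repeatedly makes the ratio as
  -- large as desired.
  sparse : ∀ c → Σ Sparse λ H → c * weightOf H ≤ 2 * length (sitesOf H)
  sparse zero = point , z≤n
  sparse (suc c) with sparse c
  ... | H , h = iterate K H , *-cancelˡ-≤ K {{>-nonZero (Sparse.k≥1 H)}} (begin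
    K * (suc c * weightOf (iterate K H))                ≡⟨ id₁ K c (weightOf (iterate K H)) ⟩
    (c * K + K) * weightOf (iterate K H)                ≤⟨ iterate-ratio K c K H refl ≤-refl (≤-trans (≤-reflexive (id₂ c K (weightOf H))) (≤-trans (*-monoʳ-≤ K h) (≤-reflexive (id₃ K (length (sitesOf H)))))) ⟩
    2 * K * length (sitesOf (iterate K H))         ≡⟨ sym (id₃ K (length (sitesOf (iterate K H)))) ⟩
    K * (2 * length (sitesOf (iterate K H))) ∎)
    where
    open ≤-Reasoning
    K : ℕ
    K = coloursOf H
    id₁ : ∀ K c a → K * (suc c * a) ≡ (c * K + K) * a
    id₁ = solve-∀
    id₂ : ∀ c K a → c * K * a ≡ K * (c * a)
    id₂ = solve-∀
    id₃ : ∀ K m → K * (2 * m) ≡ 2 * K * m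
    id₃ = solve-∀

  -- Colour of the edges between parts: the five parts 1, …, 5 form a red and a
  -- blue 5-cycle, part 0 is joined to them in blue; inside, part 0 is red and the
  -- other parts are blue.
  redParts : Fin 6 → Fin 6 → Bool
  redParts 0F 0F = true
  redParts 1F 2F = true
  redParts 2F 1F = true
  redParts 2F 3F = true
  redParts 3F 2F = true
  redParts 3F 4F = true
  redParts 4F 3F = true
  redParts 4F 5F = true
  redParts 5F 4F = true
  redParts 5F 1F = true
  redParts 1F 5F = true
  redParts _ _ = false

  redParts-sym : ∀ i j → redParts i j ≡ redParts j i
  redParts-sym i j = toWitness {a? = all? λ i → all? λ j → redParts i j ≟ redParts j i} _ i j

  -- Red triangles are thereby confined to a single part, where the graph is triangle-free. All
  -- triples of parts are checked by evaluation.
  red-triangle-parts : ∀ i j l → redParts i j ≡ true → redParts j l ≡ true → redParts i l ≡ true → (i ≡ j) × (j ≡ l)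
  red-triangle-parts i j l = λ p q r → sound (toWitness {a? = all? λ i → all? λ j → all? λ l → T? i j l ≟ true} _ i j l) p q r
    where
    T? : Fin 6 → Fin 6 → Fin 6 → Bool
    T? i j l = not (redParts i j ∧ redParts j l ∧ redParts i l) ∨ (does (i ≟ᶠ j) ∧ does (j ≟ᶠ l))
    sound : T? i j l ≡ true → redParts i j ≡ true → redParts j l ≡ true → redParts i l ≡ true → (i ≡ j) × (j ≡ l)
    sound t p q r with ∪-elim (not (redParts i j ∧ redParts j l ∧ redParts i l)) t
    ... | inj₁ h = ⊥-elim (true≢false (∧-intro p (∧-intro q r)) (not-true h))
    ... | inj₂ h = does-sound (∧-fst h) , does-sound (∧-snd {does (i ≟ᶠ j)} h)

  -- A part is triangle-free, so a clique uses it at most twice; a new vertex may find its part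
  -- occupied at most once.
  atMostOnce : Fin 6 → List (Fin 6) → Bool
  absent : Fin 6 → List (Fin 6) → Bool
  atMostOnce i [] = true
  atMostOnce i (j ∷ js) = if does (i ≟ᶠ j) then absent i js else atMostOnce i js
  absent i [] = true
  absent i (j ∷ js) = not (does (i ≟ᶠ j)) ∧ absent i js

  blueTo : Fin 6 → List (Fin 6) → Bool
  blueTo i [] = true
  blueTo i (j ∷ js) = not (redParts i j) ∧ blueTo i js

  -- No t further parts can be prepended to the list such that the parts are
  -- pairwise joined in blue and none is used three times.
  blocked : ℕ → List (Fin 6) → Bool
  blocked zero js = false
  blocked (suc t) js = does (all? λ i → (not (blueTo i js ∧ atMostOnce i js) ∨ blocked t (i ∷ js)) ≟ true)

  blocked-six : blocked 6 [] ≡ true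
  blocked-six = refl

  module Blowup (H : Sparse) where
    open Sparse H

    Vertex : Set
    Vertex = Fin 6 × V

    B : Vertex → Vertex → Bool
    B (i , u) (j , v) = if does (i ≟ᶠ j) then A u v else true

    B-same : ∀ i u v → B (i , u) (i , v) ≡ A u v
    B-same i u v with i ≟ᶠ i
    ... | yes _ = refl
    ... | no i≢i = ⊥-elim (i≢i refl)

    B-other : ∀ i j u v → i ≢ j → B (i , u) (j , v) ≡ true
    B-other i j u v i≢j with i ≟ᶠ j
    ... | yes e = ⊥-elim (i≢j e)
    ... | no _ = refl

    B-sym : ∀ x y → B x y ≡ B y x
    B-sym (i , u) (j , v) with i ≟ᶠ j
    ... | yes refl = trans (A-sym u v) (sym (B-same i v u))
    ... | no i≢j = sym (B-other j i v u (i≢j ∘ sym))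

    B-irr : ∀ x → B x x ≡ false
    B-irr (i , u) = trans (B-same i u u) (irreflexive u)

    copy : Fin 6 → List Vertex
    copy i = map (i ,_) sites

    vertices : List Vertex
    vertices = copy 0F ++ (copy 1F ++ (copy 2F ++ (copy 3F ++ (copy 4F ++ (copy 5F ++ [])))))

    tally-vertices : ∀ h → tally h vertices ≡ sum (λ i → tally (λ v → h (i , v)) sites)
    tally-vertices h = step 0F (step 1F (step 2F (step 3F (step 4F (step 5F refl)))))
      where
      step : ∀ i {xs z} → tally h xs ≡ z → tally h (copy i ++ xs) ≡ tally (λ v → h (i , v)) sites + z
      step i {xs} eq = trans (tally-++ h (copy i) xs) (cong₂ _+_ (tally-map h (i ,_) sites) eq)

    m : ℕ
    m = length sites

    length-vertices : length vertices ≡ 6 * m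
    length-vertices = trans (sym (trans (tally-const 1 vertices) (*-identityʳ _))) (trans (tally-vertices (λ _ → 1))
      (trans (sum-cong-≗ {6} λ i → trans (tally-const 1 sites) (*-identityʳ m)) (sum-const 6 m)))

    module OnList (xs : List Vertex) where

      n : ℕ
      n = length xs

      at : Fin n → Vertex
      at = lookup xs

      graph : Graph n
      graph = record { adj = λ x y → B (at x) (at y) ; sym = λ x y → B-sym (at x) (at y) ; irrefl = λ x → B-irr (at x) }

      colouring : Colouring graph
      colouring = record { col = λ x y → redParts (proj₁ (at x)) (proj₁ (at y)) ; colSym = λ x y → redParts-sym (proj₁ (at x)) (proj₁ (at y)) }

      same-part-triangle : ∀ x y z → proj₁ x ≡ proj₁ y → proj₁ y ≡ proj₁ z → B x y ≡ true → B y z ≡ true → B x z ≡ true → ⊥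
      same-part-triangle (i , u) (.i , v) (.i , w) refl refl p q r = triangle-free u v w
        (trans (sym (B-same i u v)) p) (trans (sym (B-same i v w)) q) (trans (sym (B-same i u w)) r)

      no-red : ¬ MonoClique graph colouring true 3
      no-red (f , _ , h) =
        let (xy , rxy) = h 0F 1F (λ ()) ; (yz , ryz) = h 1F 2F (λ ()) ; (xz , rxz) = h 0F 2F (λ ())
            (e , e′) = red-triangle-parts _ _ _ rxy ryz rxz
        in same-part-triangle (at (f 0F)) (at (f 1F)) (at (f 2F)) e e′ xy yz xz

      Blue : Vertex → Vertex → Set
      Blue x y = B x y ≡ true × redParts (proj₁ x) (proj₁ y) ≡ false

      blueTo-clique : ∀ {x ys} → All (Blue x) ys → blueTo (proj₁ x) (map proj₁ ys) ≡ true
      blueTo-clique [] = refl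
      blueTo-clique ((_ , b) ∷ bs) = ∧-intro (not-false b) (blueTo-clique bs)

      absent-clique : ∀ {x y zs} → proj₁ x ≡ proj₁ y → B x y ≡ true → All (Blue x) zs → All (Blue y) zs → absent (proj₁ x) (map proj₁ zs) ≡ true
      absent-clique e xy [] [] = refl
      absent-clique {x} {y} {z ∷ zs} e xy ((xz , _) ∷ xs) ((yz , _) ∷ ys) = ∧-intro
        (not-false (dec-false (proj₁ x ≟ᶠ proj₁ z) λ e′ → same-part-triangle x y z e (trans (sym e) e′) xy yz xz)) (absent-clique {x} {y} e xy xs ys)

      once-clique : ∀ {x ys} → All (Blue x) ys → AllPairs Blue ys → atMostOnce (proj₁ x) (map proj₁ ys) ≡ true
      once-clique [] [] = refl
      once-clique {x} {y ∷ ys} ((xy , _) ∷ xs) (py ∷ ps) = choose (does (proj₁ x ≟ᶠ proj₁ y)) refl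
        where
        choose : ∀ b → does (proj₁ x ≟ᶠ proj₁ y) ≡ b → (if b then absent (proj₁ x) (map proj₁ ys) else atMostOnce (proj₁ x) (map proj₁ ys)) ≡ true
        choose true e = absent-clique {x} {y} (does-sound e) xy xs py
        choose false _ = once-clique xs ps

      prepend-blocked : ∀ t z ys → AllPairs Blue ys → All (Blue z) ys → blocked (suc t) (map proj₁ ys) ≡ true → blocked t (map proj₁ (z ∷ ys)) ≡ true
      prepend-blocked t z ys ps bs h = [ (λ h′ → ⊥-elim (true≢false (∧-intro (blueTo-clique bs) (once-clique bs ps)) (not-true h′))) , id ]′
        (∪-elim (not (blueTo (proj₁ z) (map proj₁ ys) ∧ atMostOnce (proj₁ z) (map proj₁ ys))) (instantiate h (proj₁ z)))
        where
        instantiate : blocked (suc t) (map proj₁ ys) ≡ true → ∀ i → (not (blueTo i (map proj₁ ys) ∧ atMostOnce i (map proj₁ ys)) ∨ blocked t (i ∷ map proj₁ ys)) ≡ true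
        instantiate h = dec-sound (all? λ i → (not (blueTo i (map proj₁ ys) ∧ atMostOnce i (map proj₁ ys)) ∨ blocked t (i ∷ map proj₁ ys)) ≟ true) h

      -- The parts of a blue clique form an admissible list. Each of its vertices is one of the
      -- prepended parts that `blocked` has ruled out, so six of them contradict `blocked-six`.
      clique-blocked : ∀ ys t → AllPairs Blue ys → blocked (length ys + t) [] ≡ true → blocked t (map proj₁ ys) ≡ true
      clique-blocked [] t ps h = h
      clique-blocked (y ∷ ys) t (py ∷ ps) h = prepend-blocked t y ys ps py (clique-blocked ys (suc t) ps (subst (λ l → blocked l [] ≡ true) (sym (+-suc (length ys) t)) h))

      no-blue : ¬ MonoClique graph colouring false 6
      no-blue (f , _ , h) = true≢false (clique-blocked (map (λ a → at (f a)) (allFin 6)) 0 pairs blocked-six) refl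
        where
        b : ∀ i j → i ≢ j → Blue (at (f i)) (at (f j))
        b = h
        pairs : AllPairs Blue (map (λ a → at (f a)) (allFin 6))
        pairs =
          (b 0F 1F (λ ()) ∷ b 0F 2F (λ ()) ∷ b 0F 3F (λ ()) ∷ b 0F 4F (λ ()) ∷ b 0F 5F (λ ()) ∷ []) ∷
          (b 1F 2F (λ ()) ∷ b 1F 3F (λ ()) ∷ b 1F 4F (λ ()) ∷ b 1F 5F (λ ()) ∷ []) ∷
          (b 2F 3F (λ ()) ∷ b 2F 4F (λ ()) ∷ b 2F 5F (λ ()) ∷ []) ∷
          (b 3F 4F (λ ()) ∷ b 3F 5F (λ ()) ∷ []) ∷
          (b 4F 5F (λ ()) ∷ []) ∷ [] ∷ []

      free : KFree 3 6 graph
      free = colouring , no-red , no-blue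

    -- Every order is reached by repeating the vertex list and cutting it off. Repeated entries
    -- become pairwise non-adjacent copies of one vertex, and counts in the graph become tallies
    -- over the list.
    module Periodic (n′ : ℕ) (m≥1 : 1 ≤ m) where

      ℓ : ℕ
      ℓ = length vertices

      instance
        ℓ≢0 : NonZero ℓ
        ℓ≢0 = >-nonZero (subst (1 ≤_) (sym length-vertices) (≤-trans m≥1 (m≤m+n m _)))

      rounds : ℕ
      rounds = n′ / ℓ

      xs : List Vertex
      xs = concat (replicate rounds vertices) ++ take (n′ % ℓ) vertices

      length-xs : length xs ≡ n′
      length-xs = begin
        length xs                                   ≡⟨ sym (trans (tally-const 1 xs) (*-identityʳ _)) ⟩
        tally (λ _ → 1) xs                          ≡⟨ tally-++ (λ _ → 1) (concat (replicate rounds vertices)) _ ⟩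
        tally (λ _ → 1) (concat (replicate rounds vertices)) + tally (λ _ → 1) (take (n′ % ℓ) vertices) ≡⟨ cong₂ _+_
          (trans (tally-copies (λ _ → 1) rounds vertices) (cong (rounds *_) (trans (tally-const 1 vertices) (*-identityʳ ℓ))))
          (trans (trans (tally-const 1 (take (n′ % ℓ) vertices)) (*-identityʳ _)) (trans (length-take (n′ % ℓ) vertices) (m≤n⇒m⊓n≡m (<⇒≤ (m%n<n n′ ℓ))))) ⟩
        rounds * ℓ + n′ % ℓ                         ≡⟨ trans (+-comm (rounds * ℓ) _) (sym (m≡m%n+[m/n]*n n′ ℓ)) ⟩
        n′ ∎
        where open ≡-Reasoning

      tally-below : ∀ h → rounds * tally h vertices ≤ tally h xs
      tally-below h = ≤-trans (≤-reflexive (sym (tally-copies h rounds vertices))) (≤-trans (m≤m+n _ _) (≤-reflexive (sym (tally-++ h (concat (replicate rounds vertices)) _))))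

      tally-above : ∀ h → tally h xs ≤ suc rounds * tally h vertices
      tally-above h = begin
        tally h xs                                                          ≡⟨ tally-++ h (concat (replicate rounds vertices)) _ ⟩
        tally h (concat (replicate rounds vertices)) + tally h (take (n′ % ℓ) vertices) ≤⟨ +-mono-≤ (≤-reflexive (tally-copies h rounds vertices)) taken ⟩
        rounds * tally h vertices + tally h vertices                        ≡⟨ +-comm (rounds * tally h vertices) _ ⟩
        suc rounds * tally h vertices ∎
        where
        open ≤-Reasoning
        taken : tally h (take (n′ % ℓ) vertices) ≤ tally h vertices
        taken = ≤-trans (m≤m+n _ _) (≤-reflexive (trans (sym (tally-++ h (take (n′ % ℓ) vertices) _)) (cong (tally h) (take++drop≡id (n′ % ℓ) vertices))))

      open OnList xs

      -- Different parts are completely joined, so an independent set meets only one of them and the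
      -- bound `α` of a single part applies.
      independent-parts : ∀ (Y : Vertex → Bool) → Independent B Y → tally (λ y → ⟦ Y y ⟧) vertices ≤ α
      independent-parts Y ind = ≤-trans (≤-reflexive (tally-vertices (λ y → ⟦ Y y ⟧))) (one-part (λ i → tally (λ v → ⟦ Y (i , v) ⟧) sites)
        (λ i → independent (λ v → Y (i , v)) λ u v hu hv → trans (sym (B-same i u v)) (ind (i , u) (i , v) hu hv))
        λ i j i≢j hi hj → let (u , hu) = found sites hi ; (v , hv) = found sites hj in true≢false (B-other i j u v i≢j) (ind (i , u) (j , v) hu hv))
        where
        found : ∀ {f : V → Bool} vs → 1 ≤ tally (λ v → ⟦ f v ⟧) vs → ∃[ v ] f v ≡ true
        found {f} (v ∷ vs) h with f v in e
        ... | true = v , e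
        ... | false = found vs h
        one-part : ∀ {k} (c : Fin k → ℕ) → (∀ i → c i ≤ α) → (∀ i j → i ≢ j → 1 ≤ c i → 1 ≤ c j → ⊥) → sum c ≤ α
        one-part {zero} c small alone = z≤n
        one-part {suc k} c small alone with c zero in e
        ... | zero = one-part (c ∘ suc) (small ∘ suc) λ i j i≢j → alone (suc i) (suc j) (i≢j ∘ suc-injective)
        ... | suc x = ≤-trans (+-monoʳ-≤ (suc x) rest) (≤-trans (≤-reflexive (trans (+-identityʳ (suc x)) (sym e))) (small zero))
          where
          rest : sum (c ∘ suc) ≤ 0
          rest = ≮⇒≥ λ h → let (i , hi) = sum-positive (c ∘ suc) h in alone zero (suc i) (λ ()) (≤-trans (s≤s z≤n) (≤-reflexive (sym e))) hi

      injective-card : ∀ {s} (f : Fin s → Fin n) (X : Subset n) → Injective _≡_ _≡_ f → (∀ a → f a ∈ X) → s ≤ card X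
      injective-card {s} f X inj mem = begin
        s                                                    ≡⟨ sym (trans (sum-const s 1) (*-identityʳ s)) ⟩
        sum {s} (λ _ → 1)                                    ≡⟨ sum-cong-≗ (λ a → sym (trans (sum-cong-≗ λ i → sym (*-identityʳ ⟦ does (f a ≟ᶠ i) ⟧)) (sum-pick (f a) (λ _ → 1)))) ⟩
        sum (λ a → sum (λ i → ⟦ does (f a ≟ᶠ i) ⟧))          ≡⟨ ∑-comm (λ a i → ⟦ does (f a ≟ᶠ i) ⟧) ⟩
        sum (λ i → sum (λ a → ⟦ does (f a ≟ᶠ i) ⟧))          ≤⟨ sum-mono (λ i → fibre i (any? λ a → f a ≟ᶠ i)) ⟩
        card X ∎
        where
        open ≤-Reasoning
        fibre : ∀ i → Dec (∃[ a ] f a ≡ i) → sum (λ a → ⟦ does (f a ≟ᶠ i) ⟧) ≤ ⟦ X i ⟧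
        fibre i (yes (a , refl)) = begin
          sum (λ b → ⟦ does (f b ≟ᶠ f a) ⟧)          ≤⟨ sum-mono (λ b → ⟦⟧-mono {does (f b ≟ᶠ f a)} {does (a ≟ᶠ b)} λ h → dec-true (a ≟ᶠ b) (sym (inj (does-sound h)))) ⟩
          sum (λ b → ⟦ does (a ≟ᶠ b) ⟧)              ≡⟨ trans (sum-cong-≗ λ b → sym (*-identityʳ ⟦ does (a ≟ᶠ b) ⟧)) (sum-pick a (λ _ → 1)) ⟩
          1                                          ≡⟨ cong ⟦_⟧ (sym (mem a)) ⟩
          ⟦ X (f a) ⟧ ∎
        fibre i (no ∄) = ≤-trans (≤-reflexive (trans (sum-cong-≗ λ a → cong ⟦_⟧ (dec-false (f a ≟ᶠ i) λ e → ∄ (a , e))) (trans (sum-const s 0) (*-zeroʳ s)))) z≤n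

      vertex-equal : DecidableEquality Vertex
      vertex-equal (i , u) (j , v) with i ≟ᶠ j | equal? u v
      ... | yes refl | yes refl = yes refl
      ... | no i≢j | _ = no λ { refl → i≢j refl }
      ... | yes _ | no u≢v = no λ { refl → u≢v refl }

      -- The independent set is enlarged to `Y`, all copies of its vertices, which is still
      -- independent and thus has weight at most `α` per round. Rounding up to one extra round at
      -- most doubles the count. Since an independent set lives in one of six parts, the room
      -- between 2 * m and 6 * m per round absorbs this.
      alpha-small : ∀ d → α * suc d ≤ m → ℓ ≤ n′ → AlphaSmall graph d
      alpha-small d ratio ℓ≤n s (f , inj , ind) = begin-strict
        s * suc d                                     ≤⟨ *-monoˡ-≤ (suc d) (injective-card f (λ i → Y (at i)) inj image) ⟩
        card (λ i → Y (at i)) * suc d                 ≡⟨ cong (_* suc d) (tally-lookup (λ y → ⟦ Y y ⟧) xs) ⟩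
        tally (λ y → ⟦ Y y ⟧) xs * suc d              ≤⟨ *-monoˡ-≤ (suc d) (≤-trans (tally-above (λ y → ⟦ Y y ⟧)) (*-monoʳ-≤ (suc rounds) (independent-parts Y Y-independent))) ⟩
        suc rounds * α * suc d                        ≡⟨ *-assoc (suc rounds) α (suc d) ⟩
        suc rounds * (α * suc d)                      ≤⟨ *-monoʳ-≤ (suc rounds) ratio ⟩
        suc rounds * m                                ≤⟨ *-monoˡ-≤ m (+-monoˡ-≤ rounds rounds≥1) ⟩
        (rounds + rounds) * m                         <⟨ *-monoˡ-< m {{>-nonZero m≥1}} two<six ⟩
        rounds * 6 * m                                ≡⟨ trans (*-assoc rounds 6 m) (cong (rounds *_) (sym length-vertices)) ⟩
        rounds * ℓ                                    ≤⟨ m/n*n≤m n′ ℓ ⟩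
        n′                                            ≡⟨ sym length-xs ⟩
        n ∎
        where
        open ≤-Reasoning
        rounds≥1 : 1 ≤ rounds
        rounds≥1 = m≥n⇒m/n>0 ℓ≤n
        two<six : rounds + rounds < rounds * 6
        two<six = ≤-trans (≤-trans (+-monoˡ-≤ (rounds + rounds) rounds≥1) (m≤m+n (rounds + (rounds + rounds)) (rounds + (rounds + rounds)))) (≤-reflexive (identity rounds))
          where
          identity : ∀ x → x + (x + x) + (x + (x + x)) ≡ x * 6
          identity = solve-∀
        Y : Vertex → Bool
        Y y = does (any? λ a → vertex-equal (at (f a)) y)
        image : ∀ a → Y (at (f a)) ≡ true
        image a = dec-true (any? λ b → vertex-equal (at (f b)) (at (f a))) (a , refl)
        preimage : ∀ y → Y y ≡ true → ∃[ a ] at (f a) ≡ y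
        preimage y = dec-sound (any? λ a → vertex-equal (at (f a)) y)
        non-adjacent : ∀ a b → Dec (a ≡ b) → B (at (f a)) (at (f b)) ≡ false
        non-adjacent a b (yes refl) = B-irr (at (f a))
        non-adjacent a b (no a≢b) = ind a b a≢b
        Y-independent : Independent B Y
        Y-independent y z hy hz = let (a , p) = preimage y hy ; (b , q) = preimage z hz in
          subst₂ (λ y z → B y z ≡ false) p q (non-adjacent a b (a ≟ᶠ b))

      -- Each vertex is joined to all 5 * m vertices of the other parts in every complete round. The
      -- incomplete round costs at most 5 * ℓ for each vertex, which the error term covers once 5 *
      -- (k + 1) * ℓ ≤ n.
      edges-many : ∀ k → 5 * suc k * ℓ ≤ n′ → 5 * suc k * (n * n) ≤ 12 * suc k * edges graph + 12 * (n * n)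
      edges-many k large = begin
        5 * suc k * (n * n)                                          ≡⟨ id₁ (suc k) n ⟩
        suc k * (n * (5 * n))                                        ≤⟨ *-monoʳ-≤ (suc k) (*-monoʳ-≤ n across) ⟩
        suc k * (n * (rounds * (30 * m) + 5 * ℓ))                    ≡⟨ id₂ (suc k) n rounds m ℓ ⟩
        6 * suc k * (n * (rounds * (5 * m))) + 5 * suc k * ℓ * n     ≤⟨ +-mono-≤ (*-monoʳ-≤ (6 * suc k) degrees) (*-monoˡ-≤ n (≤-trans large (≤-reflexive (sym length-xs)))) ⟩
        6 * suc k * (2 * edges graph) + n * n                        ≤⟨ +-mono-≤ (≤-reflexive (id₃ (suc k) (edges graph))) (m≤m+n (n * n) _) ⟩
        12 * suc k * edges graph + 12 * (n * n) ∎
        where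
        open ≤-Reasoning
        id₁ : ∀ k n → 5 * k * (n * n) ≡ k * (n * (5 * n))
        id₁ = solve-∀
        id₂ : ∀ k n r m l → k * (n * (r * (30 * m) + 5 * l)) ≡ 6 * k * (n * (r * (5 * m))) + 5 * k * l * n
        id₂ = solve-∀
        id₃ : ∀ k e → 6 * k * (2 * e) ≡ 12 * k * e
        id₃ = solve-∀
        across : 5 * n ≤ rounds * (30 * m) + 5 * ℓ
        across = begin
          5 * n                              ≡⟨ cong (5 *_) (trans length-xs (m≡m%n+[m/n]*n n′ ℓ)) ⟩
          5 * (n′ % ℓ + rounds * ℓ)          ≤⟨ *-monoʳ-≤ 5 (+-monoˡ-≤ (rounds * ℓ) (<⇒≤ (m%n<n n′ ℓ))) ⟩
          5 * (ℓ + rounds * ℓ)               ≡⟨ cong (λ z → 5 * (ℓ + rounds * z)) length-vertices ⟩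
          5 * (ℓ + rounds * (6 * m))         ≡⟨ id₄ ℓ rounds m ⟩
          rounds * (30 * m) + 5 * ℓ ∎
          where
          id₄ : ∀ l r m → 5 * (l + r * (6 * m)) ≡ r * (30 * m) + 5 * l
          id₄ = solve-∀
        otherParts : Fin 6 → Vertex → ℕ
        otherParts i (j , _) = ⟦ not (does (i ≟ᶠ j)) ⟧
        five : ∀ i → tally (otherParts i) vertices ≡ 5 * m
        five i = trans (tally-vertices (otherParts i)) (trans (sum-cong-≗ λ j → trans (tally-const ⟦ not (does (i ≟ᶠ j)) ⟧ sites) (*-comm m _)) (count i))
          where
          count : ∀ (i : Fin 6) → sum (λ j → ⟦ not (does (i ≟ᶠ j)) ⟧ * m) ≡ 5 * m
          count 0F = identity m
            where
            identity : ∀ m → 0 * m + (1 * m + (1 * m + (1 * m + (1 * m + (1 * m + 0))))) ≡ 5 * m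
            identity = solve-∀
          count 1F = identity m
            where
            identity : ∀ m → 1 * m + (0 * m + (1 * m + (1 * m + (1 * m + (1 * m + 0))))) ≡ 5 * m
            identity = solve-∀
          count 2F = identity m
            where
            identity : ∀ m → 1 * m + (1 * m + (0 * m + (1 * m + (1 * m + (1 * m + 0))))) ≡ 5 * m
            identity = solve-∀
          count 3F = identity m
            where
            identity : ∀ m → 1 * m + (1 * m + (1 * m + (0 * m + (1 * m + (1 * m + 0))))) ≡ 5 * m
            identity = solve-∀
          count 4F = identity m
            where
            identity : ∀ m → 1 * m + (1 * m + (1 * m + (1 * m + (0 * m + (1 * m + 0))))) ≡ 5 * m
            identity = solve-∀
          count 5F = identity m
            where
            identity : ∀ m → 1 * m + (1 * m + (1 * m + (1 * m + (1 * m + (0 * m + 0))))) ≡ 5 * m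
            identity = solve-∀
        other-adjacent : ∀ x y → otherParts (proj₁ x) y ≤ ⟦ B x y ⟧
        other-adjacent (i , u) (j , v) with i ≟ᶠ j
        ... | yes _ = z≤n
        ... | no _ = ≤-refl
        degrees : n * (rounds * (5 * m)) ≤ 2 * edges graph
        degrees = begin
          n * (rounds * (5 * m))                                    ≡⟨ sym (sum-const n (rounds * (5 * m))) ⟩
          sum {n} (λ _ → rounds * (5 * m))                          ≤⟨ sum-mono (λ x → begin
            rounds * (5 * m)                                          ≡⟨ cong (rounds *_) (sym (five (proj₁ (at x)))) ⟩
            rounds * tally (otherParts (proj₁ (at x))) vertices       ≤⟨ tally-below (otherParts (proj₁ (at x))) ⟩
            tally (otherParts (proj₁ (at x))) xs                      ≤⟨ tally-mono (other-adjacent (at x)) xs ⟩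
            tally (λ y → ⟦ B (at x) y ⟧) xs                           ≡⟨ sym (tally-lookup (λ y → ⟦ B (at x) y ⟧) xs) ⟩
            sum (λ y → ⟦ B (at x) (at y) ⟧) ∎) ⟩
          degreeSum (adj graph)                                     ≡⟨ sym (countPairs-twice (adj graph) (adj-sym graph) (irrefl graph)) ⟩
          2 * edges graph ∎

  lower-bound : (k d : ℕ) → ∃[ N ] ((n : ℕ) → n ≥ N → Σ (Graph n) λ G → KFree 3 6 G × AlphaSmall G d ×
    (5 * suc k * (n * n) ≤ 12 * suc k * edges G + 12 * (n * n)))
  lower-bound k d = from (sparse (2 * suc d))
    where
    from : (Σ Sparse λ H → 2 * suc d * weightOf H ≤ 2 * length (sitesOf H)) → ∃[ N ] ((n : ℕ) → n ≥ N → Σ (Graph n) λ G → KFree 3 6 G × AlphaSmall G d ×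
      (5 * suc k * (n * n) ≤ 12 * suc k * edges G + 12 * (n * n)))
    from (H , h) = 5 * suc k * length vertices , λ n n≥ →
      let open Periodic n m≥1
          open OnList xs using (graph; free)
      in subst (λ n → Σ (Graph n) λ G → KFree 3 6 G × AlphaSmall G d × (5 * suc k * (n * n) ≤ 12 * suc k * edges G + 12 * (n * n))) length-xs
           (graph , free , alpha-small d ratio (≤-trans (m≤n*m (length vertices) (5 * suc k)) n≥) , edges-many k n≥)
      where
      open Blowup H
      ratio : weightOf H * suc d ≤ m
      ratio = *-cancelˡ-≤ 2 (≤-trans (≤-reflexive (identity (weightOf H) (suc d))) h)
        where
        identity : ∀ a d → 2 * (a * d) ≡ 2 * d * a
        identity = solve-∀
      m≥1 : 1 ≤ m
      m≥1 = ≤-trans (*-mono-≤ (Sparse.α≥1 H) (s≤s z≤n)) ratio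

open LowerBound using (lower-bound)
open import Defs
open import Data.Nat using (ℕ; suc; _+_; _*_; _≤_; _≥_)
open import Data.Product using (Σ; _×_; _,_; ∃; ∃-syntax)

theorem1p6 :
  -- upper bound: ∀ε ∃δ ∃N ∀n≥N, every (K3,K6)-free G on n vertices with α(G) < δn has e(G) ≤ (5/12+ε)n²
  ((k : ℕ) → ∃[ d ] ∃[ N ] ((n : ℕ) → n ≥ N → (G : Graph n) → KFree 3 6 G → AlphaSmall G d →
      12 * suc k * edges G ≤ (5 * suc k + 12) * (n * n)))
  ×
  -- lower bound: ∀ε ∀δ ∃N ∀n≥N, some (K3,K6)-free G on n vertices with α(G) < δn has e(G) ≥ (5/12-ε)n²
  ((k d : ℕ) → ∃[ N ] ((n : ℕ) → n ≥ N → Σ (Graph n) λ G → KFree 3 6 G × AlphaSmall G d ×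
      (5 * suc k * (n * n) ≤ 12 * suc k * edges G + 12 * (n * n))))
  ×
  -- weak stability: Δ(S_n,Z_n) = o(n²) for any two asymptotically extremal sequences
  ((S Z : GraphSeq) → AsympExtremal S → AsympExtremal Z →
    (k : ℕ) → ∃[ N ] ((n : ℕ) → n ≥ N → DeltaSmall (S n) (Z n) k))
theorem1p6 = upper-bound , lower-bound , weak-stability
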